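{- Let $k\in\mathbb{Z}_{\ge1}$ be even, $m\in\{0,1\}$, $p\ge3$ a prime and $r\in\mathbb{Z}_{\ge1}$. If $p^r\equiv2m-1\pmod4$, then \begin{multline*} \mathscr{H}_{k,m,2,1}(p^r)=\frac{C_{\frac k2}}{3\cdot2^k}\left(p^{r(\frac k2+1)}-2p^{\frac{rk}2}\right)-\delta_{2\mid r}\frac16p^{\frac{rk}2}(p-1)-2^{ -k}\sum_{\mu=0}^{\frac k2-1}T(k,\mu)p^{r\mu}\\ +\sum_{\mu=0}^{\frac k2-1}2^{ -2\mu}T(k,\mu)\left(\alpha_{k-2\mu,m,2,1}(p^r)-p^{k-2\mu+1}\alpha_{k-2\mu,m,2,1}(p^{r-2})\right)p^{r\mu}, \end{multline*} where $\alpha_{k-2\mu,m,2,1}(p^{r-2})$ is taken to be $0$ if $r=1$. If $p^r\equiv2m+1\pmod4$, then $\mathscr{H}_{k,m,2,1}(p^r)=0$.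
   Context: $\delta_{\mathcal S}=1$ if the statement $\mathcal S$ is true and $0$ otherwise. $T(k,\mu)=\frac{k-2\mu+1}{k-\mu+1}\binom{k}{\mu}$; $C_n=\frac1{n+1}\binom{2n}{n}$. Hurwitz class numbers: for a negative integer $D\equiv0,1\pmod4$, $H(|D|)=\sum_Q 1/\omega_Q$, the sum over $\mathrm{SL}_2(\mathbb{Z})$-classes of (not necessarily primitive) positive definite integral binary quadratic forms of discriminant $D$, with $\omega_Q=2$ if $Q$ is equivalent to $a(x^2+y^2)$, $\omega_Q=3$ if $Q$ is equivalent to $a(x^2+xy+y^2)$, $\omega_Q=1$ otherwise. $H(0):=-\frac1{12}$, and $H(x):=0$ for every other rational $x$. $\mathscr{H}_{k,m,M,b}(p^r):=\sum_{t\in\mathbb{Z},\,p\nmid t,\,t\equiv m\,(M)}H\left(\frac{p^r-t^2}{b}\right)t^k$. Let $q=e^{2\pi i\tau}$, $\mathcal{H}(\tau)=\sum_{n\ge0}H(n)q^n$, $(\mathcal{H}|V_b)(\tau)=\mathcal{H}(b\tau)$, and $\theta_{j,m,M}(\tau)=\sum_{n\in\mathbb{Z},\,n\equiv m\,(M)}n^jq^{n^2}$ (with $0^0=1$). Rankin–Cohen bracket, for functions $F_1,F_2$ with associated weights $\kappa_1,\kappa_2$: $[F_1,F_2]_k=\frac1{(2\pi i)^k}\sum_{i=0}^k(-1)^i\binom{\kappa_1+k-1}{k-i}\binom{\kappa_2+k-1}{i}\frac{\partial^iF_1}{\partial\tau^i}\frac{\partial^{k-i}F_2}{\partial\tau^{k-i}}$,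 with generalized binomials $\binom{\alpha}{i}=\frac{\Gamma(\alpha+1)}{i!\,\Gamma(\alpha-i+1)}$. In $[\mathcal{H}|V_b,\theta_{j,m,M}]$ the weights are $\kappa_1=\frac32$, $\kappa_2=\frac12+j$. For $\ell\ge0$, $n\ge1$: $\lambda_{\ell,m,M,b}(n)=\sum_{\varepsilon\in\{\pm1\}}\varepsilon^\ell\sum^*(t-\sqrt b\,s)^{\ell+1}$, where $\sum^*$ runs over integers $t\ge1,s\ge0$ with $t^2-bs^2=n$ and $t\equiv\varepsilon m\pmod M$, and terms with $s=0$ have weight $\frac12$. $\Lambda_{\ell,m,M,b}=\sum_{n\ge1}\lambda_{\ell,m,M,b}(n)q^n$. For $\ell\ge0$ and $j\in\{0,1\}$, $j\equiv\ell\pmod2$: $f_{\ell,m,M,b}=[\mathcal{H}|V_b,\theta_{j,m,M}]_{\lfloor\ell/2\rfloor}+b^{ -1/2}2^{ -1-\ell}\binom{\ell}{\lfloor\ell/2\rfloor}\Lambda_{\ell,m,M,b}=\sum_{n\ge0}\gamma_{\ell,m,M,b}(n)q^n$, and $\alpha_{\ell,m,M,b}(n)=\binom{\ell}{\lfloor\ell/2\rfloor}^{ -1}\gamma_{\ell,m,M,b}(n)$. -}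

module Defs where

open import Data.Bool.Base using (if_then_else_)
open import Data.Empty using (⊥-elim)
open import Data.Integer.Base as ℤ using (ℤ; +_; -[1+_]; ∣_∣; 0ℤ; 1ℤ; -1ℤ)
import Data.Integer.Divisibility.Signed as ℤ
import Data.Integer.DivMod as ℤ
import Data.Integer.Properties as ℤ
open import Data.Integer.Tactic.RingSolver using (solve-∀)
open import Data.List.Base
  using (List; []; _∷_; _++_; map; mapMaybe; foldr; filter; upTo; cartesianProduct; deduplicate)
open import Data.List.Membership.Propositional using (_∈_; find; lose)
open import Data.List.Membership.Propositional.Properties
  using (∈-++⁺ˡ; ∈-++⁺ʳ; ∈-map⁺; ∈-upTo⁺; ∈-cartesianProduct⁺)
import Data.List.Membership.Setoid.Properties as SetoidMembership
import Data.List.Relation.Unary.Any as Any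
import Data.List.Relation.Unary.Any.Properties as Any
open import Data.List.Relation.Unary.Any.Properties using (mapMaybe⁺)
open import Data.List.Relation.Unary.Any using (Any)
open import Data.List.Relation.Unary.AllPairs using (AllPairs)
import Data.List.Relation.Unary.Unique.DecSetoid.Properties as Unique
open import Data.Maybe.Base using (Maybe; just; nothing)
import Data.Maybe.Relation.Unary.Any as MAny
open import Data.Nat.Base as ℕ using (ℕ; zero; suc; NonZero; ⌊_/2⌋; _∸_; z≤n; s≤s)
import Data.Nat.Divisibility as ℕ
import Data.Nat.DivMod as ℕ
open import Data.Nat.Induction using (<-wellFounded)
import Data.Nat.Properties as ℕ
open import Data.Product.Base using (∃; ∃-syntax; _×_; _,_)
open import Data.Rational.Base as ℚ using (ℚ; mkℚ; 0ℚ; 1ℚ; ½; _/_; +-*-rawRing)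
open import Algebra.Bundles using (module RawRing)
open import Algebra.Definitions.RawSemiring (RawRing.rawSemiring +-*-rawRing) public using (_^_)
open import Data.Sum.Base using (_⊎_; inj₁; inj₂; [_,_]′)
open import Function.Base using (id)
open import Induction.WellFounded using (Acc; acc)
open import Level using (0ℓ)
open import Relation.Binary.Bundles using (DecSetoid)
open import Relation.Binary.PropositionalEquality
  using (_≡_; _≢_; refl; sym; trans; cong; cong₂; subst; module ≡-Reasoning)
open import Relation.Nullary using (¬_; Dec; yes; no; does; ¬?; map′; _×-dec_)

------------------------------------------------------------------------
-- Finite sums and congruences

∑ : ∀ {A : Set} → List A → (A → ℚ) → ℚ
∑ xs f = foldr (λ x s → f x ℚ.+ s) 0ℚ xs

infix 3 ∑
syntax ∑ xs (λ x → e) = ∑[ x ← xs ] e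

fromℤ : ℤ → ℚ
fromℤ z = z / 1

fromℕ : ℕ → ℚ
fromℕ n = fromℤ (+ n)

infix 4 _≋_[mod_] _≋?_[mod_]

_≋_[mod_] : ℤ → ℤ → ℕ → Set
a ≋ b [mod M ] = + M ℤ.∣ a ℤ.- b

_≋?_[mod_] : ∀ a b M → Dec (a ≋ b [mod M ])
a ≋? b [mod M ] = + M ℤ.∣? a ℤ.- b

δ : ∀ {P : Set} → Dec P → ℚ
δ P? = if does P? then 1ℚ else 0ℚ

-- All integers z with ∣ z ∣ ≤ B.
interval : ℕ → List ℤ
interval B = map +_ (upTo (suc B)) ++ map -[1+_] (upTo B)

interval-complete : ∀ B z → ∣ z ∣ ℕ.≤ B → z ∈ interval B
interval-complete B (+ n)    n≤B = ∈-++⁺ˡ (∈-map⁺ +_ (∈-upTo⁺ (s≤s n≤B)))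
interval-complete B -[1+ n ] n<B = ∈-++⁺ʳ (map +_ (upTo (suc B))) (∈-map⁺ -[1+_] (∈-upTo⁺ n<B))

bounded? : ∀ (B : ℕ) {P : ℤ → Set} → (∀ z → Dec (P z)) → (∀ {z} → P z → ∣ z ∣ ℕ.≤ B) → Dec (∃ P)
bounded? B P? bound = map′
  (λ w → let (z , _ , pz) = find w in z , pz)
  (λ (z , pz) → lose (interval-complete B z (bound pz)) pz)
  (Any.any? P? (interval B))

------------------------------------------------------------------------
-- Integral binary quadratic forms and the action of SL₂(ℤ)

module _ where

  open import Data.Integer.Base using (_+_; _*_; _-_; -_; _<_; _≤_)

  -- ⟨ a , b , c ⟩ is the form a x² + b x y + c y².
  record BQF : Set where
    constructor ⟨_,_,_⟩
    field
      a b c : ℤ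

  value : BQF → ℤ → ℤ → ℤ
  value ⟨ a , b , c ⟩ x y = a * (x * x) + b * (x * y) + c * (y * y)

  disc : BQF → ℤ
  disc ⟨ a , b , c ⟩ = b * b - + 4 * (a * c)

  PositiveDefinite : BQF → Set
  PositiveDefinite Q = ∀ x y → x ≢ 0ℤ ⊎ y ≢ 0ℤ → 0ℤ < value Q x y

  _≟ᶠ_ : (Q R : BQF) → Dec (Q ≡ R)
  ⟨ a , b , c ⟩ ≟ᶠ ⟨ a′ , b′ , c′ ⟩ = map′
    (λ { (refl , refl , refl) → refl })
    (λ { refl → refl , refl , refl })
    (a ℤ.≟ a′ ×-dec (b ℤ.≟ b′ ×-dec c ℤ.≟ c′))

  record SL₂ℤ : Set where
    constructor sl₂
    field
      α β γ δ′ : ℤ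
      det≡1    : α * δ′ - β * γ ≡ 1ℤ

  act : BQF → (α β γ δ′ : ℤ) → BQF
  act Q@(⟨ a , b , c ⟩) α β γ δ′ =
    ⟨ value Q α γ
    , + 2 * (a * (α * β)) + b * (α * δ′ + β * γ) + + 2 * (c * (γ * δ′))
    , value Q β δ′ ⟩

  _∙_ : BQF → SL₂ℤ → BQF
  Q ∙ sl₂ α β γ δ′ _ = act Q α β γ δ′

  -- The action is linear substitution of variables.
  value-∙ : ∀ Q M x y → let open SL₂ℤ M in
    value (Q ∙ M) x y ≡ value Q (α * x + β * y) (γ * x + δ′ * y)
  value-∙ ⟨ a , b , c ⟩ (sl₂ α β γ δ′ _) x y = identity a b c α β γ δ′ x y
    where
    identity : ∀ a b c α β γ δ′ x y →
      (a * (α * α) + b * (α * γ) + c * (γ * γ)) * (x * x)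
      + (+ 2 * (a * (α * β)) + b * (α * δ′ + β * γ) + + 2 * (c * (γ * δ′))) * (x * y)
      + (a * (β * β) + b * (β * δ′) + c * (δ′ * δ′)) * (y * y)
      ≡ a * ((α * x + β * y) * (α * x + β * y))
        + b * ((α * x + β * y) * (γ * x + δ′ * y))
        + c * ((γ * x + δ′ * y) * (γ * x + δ′ * y))
    identity = solve-∀

  infix 4 _~_
  infixr 4 _,_

  record _~_ (Q R : BQF) : Set where
    constructor _,_
    field
      matrix  : SL₂ℤ
      R≡Q∙M   : R ≡ Q ∙ matrix

  ⟨⟩-cong : ∀ {a a′ b b′ c c′} → a ≡ a′ → b ≡ b′ → c ≡ c′ → ⟨ a , b , c ⟩ ≡ ⟨ a′ , b′ , c′ ⟩
  ⟨⟩-cong refl refl refl = refl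

  ~-refl : ∀ {Q} → Q ~ Q
  ~-refl {⟨ a , b , c ⟩} = sl₂ 1ℤ 0ℤ 0ℤ 1ℤ refl , ⟨⟩-cong (e₁ a b c) (e₂ a b c) (e₃ a b c)
    where
    e₁ : ∀ a b c → a ≡ a * (1ℤ * 1ℤ) + b * (1ℤ * 0ℤ) + c * (0ℤ * 0ℤ)
    e₁ = solve-∀
    e₂ : ∀ a b c → b ≡ + 2 * (a * (1ℤ * 0ℤ)) + b * (1ℤ * 1ℤ + 0ℤ * 0ℤ) + + 2 * (c * (0ℤ * 1ℤ))
    e₂ = solve-∀
    e₃ : ∀ a b c → c ≡ a * (0ℤ * 0ℤ) + b * (0ℤ * 1ℤ) + c * (1ℤ * 1ℤ)
    e₃ = solve-∀

  ~-sym : ∀ {Q R} → Q ~ R → R ~ Q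
  ~-sym {⟨ a , b , c ⟩} (sl₂ α β γ δ′ det , refl) =
    sl₂ δ′ (- β) (- γ) α (trans (d α β γ δ′) det) ,
    ⟨⟩-cong (use a (e₁ a b c α β γ δ′)) (use b (e₂ a b c α β γ δ′)) (use c (e₃ a b c α β γ δ′))
    where
    d : ∀ α β γ δ′ → δ′ * α - (- β) * (- γ) ≡ α * δ′ - β * γ
    d = solve-∀
    use : ∀ x {y} → x * ((α * δ′ - β * γ) * (α * δ′ - β * γ)) ≡ y → x ≡ y
    use x eq = trans (sym (trans (cong (λ u → x * (u * u)) det) (ℤ.*-identityʳ x))) eq
    e₁ : ∀ a b c α β γ δ′ →
      a * ((α * δ′ - β * γ) * (α * δ′ - β * γ)) ≡
      (a * (α * α) + b * (α * γ) + c * (γ * γ)) * (δ′ * δ′)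
      + (+ 2 * (a * (α * β)) + b * (α * δ′ + β * γ) + + 2 * (c * (γ * δ′))) * (δ′ * (- γ))
      + (a * (β * β) + b * (β * δ′) + c * (δ′ * δ′)) * ((- γ) * (- γ))
    e₁ = solve-∀
    e₂ : ∀ a b c α β γ δ′ →
      b * ((α * δ′ - β * γ) * (α * δ′ - β * γ)) ≡
      + 2 * ((a * (α * α) + b * (α * γ) + c * (γ * γ)) * (δ′ * (- β)))
      + (+ 2 * (a * (α * β)) + b * (α * δ′ + β * γ) + + 2 * (c * (γ * δ′))) * (δ′ * α + (- β) * (- γ))
      + + 2 * ((a * (β * β) + b * (β * δ′) + c * (δ′ * δ′)) * ((- γ) * α))
    e₂ = solve-∀
    e₃ : ∀ a b c α β γ δ′ →
      c * ((α * δ′ - β * γ) * (α * δ′ - β * γ)) ≡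
      (a * (α * α) + b * (α * γ) + c * (γ * γ)) * ((- β) * (- β))
      + (+ 2 * (a * (α * β)) + b * (α * δ′ + β * γ) + + 2 * (c * (γ * δ′))) * ((- β) * α)
      + (a * (β * β) + b * (β * δ′) + c * (δ′ * δ′)) * (α * α)
    e₃ = solve-∀

  ~-trans : ∀ {Q R S} → Q ~ R → R ~ S → Q ~ S
  ~-trans {Q@(⟨ a , b , c ⟩)} (sl₂ α β γ δ′ det , refl) (sl₂ α′ β′ γ′ δ″ det′ , refl) =
    sl₂ (α * α′ + β * γ′) (α * β′ + β * δ″)
        (γ * α′ + δ′ * γ′) (γ * β′ + δ′ * δ″)
        (trans (d α β γ δ′ α′ β′ γ′ δ″) (cong₂ ℤ._*_ det det′)) ,
    ⟨⟩-cong (value-∙ Q (sl₂ α β γ δ′ det) α′ γ′)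
            (e₂ a b c α β γ δ′ α′ β′ γ′ δ″)
            (value-∙ Q (sl₂ α β γ δ′ det) β′ δ″)
    where
    d : ∀ α β γ δ′ α′ β′ γ′ δ″ →
      (α * α′ + β * γ′) * (γ * β′ + δ′ * δ″)
      - (α * β′ + β * δ″) * (γ * α′ + δ′ * γ′)
      ≡ (α * δ′ - β * γ) * (α′ * δ″ - β′ * γ′)
    d = solve-∀
    e₂ : ∀ a b c α β γ δ′ α′ β′ γ′ δ″ →
      + 2 * ((a * (α * α) + b * (α * γ) + c * (γ * γ)) * (α′ * β′))
      + (+ 2 * (a * (α * β)) + b * (α * δ′ + β * γ) + + 2 * (c * (γ * δ′))) * (α′ * δ″ + β′ * γ′)
      + + 2 * ((a * (β * β) + b * (β * δ′) + c * (δ′ * δ′)) * (γ′ * δ″))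
      ≡ + 2 * (a * ((α * α′ + β * γ′) * (α * β′ + β * δ″)))
        + b * ((α * α′ + β * γ′) * (γ * β′ + δ′ * δ″)
                   + (α * β′ + β * δ″) * (γ * α′ + δ′ * γ′))
        + + 2 * (c * ((γ * α′ + δ′ * γ′) * (γ * β′ + δ′ * δ″)))
    e₂ = solve-∀

  disc-~ : ∀ {Q R} → Q ~ R → disc R ≡ disc Q
  disc-~ {⟨ a , b , c ⟩} (sl₂ α β γ δ′ det , refl) =
    trans (e a b c α β γ δ′)
          (trans (cong (λ u → (b * b - + 4 * (a * c)) * (u * u)) det) (ℤ.*-identityʳ _))
    where
    e : ∀ a b c α β γ δ′ →
      (+ 2 * (a * (α * β)) + b * (α * δ′ + β * γ) + + 2 * (c * (γ * δ′)))
      * (+ 2 * (a * (α * β)) + b * (α * δ′ + β * γ) + + 2 * (c * (γ * δ′)))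
      - + 4 * ((a * (α * α) + b * (α * γ) + c * (γ * γ))
                   * (a * (β * β) + b * (β * δ′) + c * (δ′ * δ′)))
      ≡ (b * b - + 4 * (a * c)) * ((α * δ′ - β * γ) * (α * δ′ - β * γ))
    e = solve-∀

------------------------------------------------------------------------
-- Positive definite forms of given discriminant, up to SL₂(ℤ)

  -- Positive definite forms of discriminant - (n + 1).
  record PosForm (n : ℕ) : Set where
    constructor posForm
    field
      form     : BQF
      positive : PositiveDefinite form
      disc≡    : disc form ≡ -[1+ n ]

  open PosForm

  0≤z² : ∀ z → 0ℤ ≤ z * z
  0≤z² (+ zero)  = ℤ.+≤+ z≤n
  0≤z² (+ suc n) = ℤ.+≤+ z≤n
  0≤z² -[1+ n ]  = ℤ.+≤+ z≤n

  0<z² : ∀ {z} → z ≢ 0ℤ → 0ℤ < z * z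
  0<z² {+ zero}   z≢0 = ⊥-elim (z≢0 refl)
  0<z² {+ suc n}  _   = ℤ.+<+ (s≤s z≤n)
  0<z² { -[1+ n ]} _  = ℤ.+<+ (s≤s z≤n)

  0<u*v : ∀ {u v} → 0ℤ < u → 0ℤ < v → 0ℤ < u * v
  0<u*v (ℤ.+<+ (s≤s _)) (ℤ.+<+ (s≤s _)) = ℤ.+<+ (s≤s z≤n)

  ∣z∣≤∣z²∣ : ∀ z → ∣ z ∣ ℕ.≤ ∣ z * z ∣
  ∣z∣≤∣z²∣ (+ zero)  = z≤n
  ∣z∣≤∣z²∣ (+ suc n) = ℕ.m≤m*n (suc n) (suc n)
  ∣z∣≤∣z²∣ -[1+ n ]  = ℕ.m≤m*n (suc n) (suc n)

  ∣u∣≤∣u+v∣ : ∀ {u v} → 0ℤ ≤ u → 0ℤ ≤ v → ∣ u ∣ ℕ.≤ ∣ u + v ∣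
  ∣u∣≤∣u+v∣ {+ m} {+ k} _ _ = ℕ.m≤m+n m k

  complete-square : ∀ {n} a b c → disc ⟨ a , b , c ⟩ ≡ -[1+ n ] → ∀ x y →
    + 4 * (a * value ⟨ a , b , c ⟩ x y) ≡
    y * y + ((+ 2 * (a * x) + b * y) * (+ 2 * (a * x) + b * y) + + n * (y * y))
  complete-square {n} a b c D x y = begin
    + 4 * (a * value ⟨ a , b , c ⟩ x y)  ≡⟨ e₁ a b c x y ⟩
    t * t - (b * b - + 4 * (a * c)) * (y * y) ≡⟨ cong (λ d → t * t - d * (y * y)) D ⟩
    t * t - (- (1ℤ + + n)) * (y * y)     ≡⟨ e₂ t (+ n) y ⟩
    y * y + (t * t + + n * (y * y))      ∎
    where
    open ≡-Reasoning
    t = + 2 * (a * x) + b * y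
    e₁ : ∀ a b c x y →
      + 4 * (a * (a * (x * x) + b * (x * y) + c * (y * y))) ≡
      (+ 2 * (a * x) + b * y) * (+ 2 * (a * x) + b * y) - (b * b - + 4 * (a * c)) * (y * y)
    e₁ = solve-∀
    e₂ : ∀ t n y → t * t - (- (1ℤ + n)) * (y * y) ≡ y * y + (t * t + n * (y * y))
    e₂ = solve-∀

  0≤rest : ∀ n t y → 0ℤ ≤ t * t + + n * (y * y)
  0≤rest n t y = ℤ.+-mono-≤ (0≤z² t)
    (subst (_≤ + n * (y * y)) (ℤ.*-zeroʳ (+ n)) (ℤ.*-monoˡ-≤-nonNeg (+ n) (0≤z² y)))

  y-bound : ∀ {n} a b c → disc ⟨ a , b , c ⟩ ≡ -[1+ n ] → ∀ x y →
    ∣ y ∣ ℕ.≤ ∣ + 4 * (a * value ⟨ a , b , c ⟩ x y) ∣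
  y-bound {n} a b c D x y = ℕ.≤-trans (∣z∣≤∣z²∣ y)
    (subst (λ u → ∣ y * y ∣ ℕ.≤ ∣ u ∣) (sym (complete-square a b c D x y))
      (∣u∣≤∣u+v∣ (0≤z² y) (0≤rest n (+ 2 * (a * x) + b * y) y)))

  x-bound : ∀ {n} a b c → disc ⟨ a , b , c ⟩ ≡ -[1+ n ] → ∀ x y →
    ∣ x ∣ ℕ.≤ ∣ + 4 * (c * value ⟨ a , b , c ⟩ x y) ∣
  x-bound a b c D x y = subst (λ v → ∣ x ∣ ℕ.≤ ∣ + 4 * (c * v) ∣) (e₂ a b c x y)
    (y-bound c b a (trans (e₁ a b c) D) y x)
    where
    e₁ : ∀ a b c → b * b - + 4 * (c * a) ≡ b * b - + 4 * (a * c)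
    e₁ = solve-∀
    e₂ : ∀ a b c x y → c * (y * y) + b * (y * x) + a * (x * x) ≡ a * (x * x) + b * (x * y) + c * (y * y)
    e₂ = solve-∀

  -- An equivalence from Q to R has its entries bounded in terms of Q and R.
  _~?_ : ∀ {n} (Q : PosForm n) R → Dec (form Q ~ R)
  posForm Q@(⟨ a , b , c ⟩) _ D ~? R@(⟨ a′ , b′ , c′ ⟩) = map′
    (λ { (α , β , γ , δ′ , det , eq) → sl₂ α β γ δ′ det , eq })
    (λ { (sl₂ α β γ δ′ det , eq) → α , β , γ , δ′ , det , eq })
    (bounded? ∣ + 4 * (c * a′) ∣ (λ α →
     bounded? ∣ + 4 * (c * c′) ∣ (λ β →
     bounded? ∣ + 4 * (a * a′) ∣ (λ γ →
     bounded? ∣ + 4 * (a * c′) ∣ (λ δ′ →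
       (α * δ′ - β * γ ℤ.≟ 1ℤ) ×-dec (R ≟ᶠ act Q α β γ δ′))
       (λ { {δ′} (_ , refl) → y-bound a b c D β δ′ }))
       (λ { {γ} (_ , _ , refl) → y-bound a b c D α γ }))
       (λ { {β} (_ , δ′ , _ , refl) → x-bound a b c D β δ′ }))
       (λ { {α} (_ , γ , _ , _ , refl) → x-bound a b c D α γ }))

  formClasses : ℕ → DecSetoid 0ℓ 0ℓ
  formClasses n = record
    { Carrier = PosForm n
    ; _≈_ = λ Q R → form Q ~ form R
    ; isDecEquivalence = record
      { isEquivalence = record { refl = ~-refl ; sym = ~-sym ; trans = ~-trans }
      ; _≟_ = λ Q R → Q ~? form R
      }
    }

  positive-if : ∀ {n} Q → 0ℤ < BQF.a Q → disc Q ≡ -[1+ n ] → PositiveDefinite Q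
  positive-if {n} ⟨ a , b , c ⟩ 0<a D x y nonzero with y ℤ.≟ 0ℤ
  ... | yes refl = subst (0ℤ <_) (e a b c x) (0<u*v 0<a (0<z² ([ id , (λ 0≢0 → ⊥-elim (0≢0 refl)) ]′ nonzero)))
    where
    e : ∀ a b c x → a * (x * x) ≡ a * (x * x) + b * (x * 0ℤ) + c * (0ℤ * 0ℤ)
    e = solve-∀
  ... | no y≢0 = cancel 0<a (ℤ.*-cancelˡ-<-nonNeg (+ 4) (subst (0ℤ <_) (sym (complete-square a b c D x y))
      (ℤ.+-mono-<-≤ (0<z² y≢0) (0≤rest n (+ 2 * (a * x) + b * y) y))))
    where
    cancel : ∀ {a v} → 0ℤ < a → 0ℤ < a * v → 0ℤ < v
    cancel {+ suc m} {v} _ p = ℤ.*-cancelˡ-<-nonNeg (+ suc m) (subst (_< + suc m * v) (sym (ℤ.*-zeroʳ (+ suc m))) p)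
    cancel {+ zero} (ℤ.+<+ ()) _

  0<a : ∀ {n} (Q : PosForm n) → 0ℤ < BQF.a (form Q)
  0<a (posForm ⟨ a , b , c ⟩ pos _) = subst (0ℤ <_) (e a b c) (pos 1ℤ 0ℤ (inj₁ λ ()))
    where
    e : ∀ a b c → a * (1ℤ * 1ℤ) + b * (1ℤ * 0ℤ) + c * (0ℤ * 0ℤ) ≡ a
    e = solve-∀

  0<c : ∀ {n} (Q : PosForm n) → 0ℤ < BQF.c (form Q)
  0<c (posForm ⟨ a , b , c ⟩ pos _) = subst (0ℤ <_) (e a b c) (pos 0ℤ 1ℤ (inj₂ λ ()))
    where
    e : ∀ a b c → a * (0ℤ * 0ℤ) + b * (0ℤ * 1ℤ) + c * (1ℤ * 1ℤ) ≡ c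
    e = solve-∀

  actPos : ∀ {n} → PosForm n → SL₂ℤ → PosForm n
  actPos (posForm Q pos D) M@(sl₂ α β γ δ′ det) =
    posForm (Q ∙ M) (positive-if (Q ∙ M) (pos α γ nonzero) D′) D′
    where
    D′ = trans (disc-~ {Q} {Q ∙ M} (M , refl)) D
    e : ∀ β δ′ → 0ℤ * δ′ - β * 0ℤ ≡ 0ℤ
    e = solve-∀
    column≢0 : ∀ β δ′ → 0ℤ * δ′ - β * 0ℤ ≢ 1ℤ
    column≢0 β δ′ eq with () ← trans (sym (e β δ′)) eq
    nonzero : α ≢ 0ℤ ⊎ γ ≢ 0ℤ
    nonzero with α ℤ.≟ 0ℤ
    ... | no α≢0   = inj₁ α≢0
    ... | yes refl = inj₂ λ { refl → column≢0 β δ′ det }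

------------------------------------------------------------------------
  -- Every class contains a form with ∣ b ∣ ≤ ∣ a ∣ ≤ ∣ c ∣

  ∣r-n∣≤n : ∀ r n → r ℕ.≤ n ℕ.+ n → ∣ + r - + n ∣ ℕ.≤ n
  ∣r-n∣≤n r n r≤2n rewrite ℤ.[+m]-[+n]≡m⊖n r n with ℕ.≤-total r n
  ... | inj₁ r≤n rewrite ℤ.∣⊖∣-≤ r≤n = ℕ.m∸n≤m n r
  ... | inj₂ n≤r rewrite ℤ.⊖-≥ n≤r =
    ℕ.≤-trans (ℕ.∸-monoˡ-≤ n r≤2n) (ℕ.≤-reflexive (ℕ.m+n∸n≡m n n))

  translate : ℤ → SL₂ℤ
  translate k = sl₂ 1ℤ k 0ℤ 1ℤ (e k)
    where
    e : ∀ k → 1ℤ * 1ℤ - k * 0ℤ ≡ 1ℤ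
    e = solve-∀

  swap : SL₂ℤ
  swap = sl₂ 0ℤ -1ℤ 1ℤ 0ℤ refl

  centre : ∀ a b → 0ℤ < a → ∃[ k ] ∣ b + + 2 * (a * k) ∣ ℕ.≤ ∣ a ∣
  centre (+ zero)   b (ℤ.+<+ ())
  centre (+ suc m) b _ = - q , subst (λ u → ∣ u ∣ ℕ.≤ A) (sym eq) (∣r-n∣≤n r A (ℕ.<⇒≤ (ℤ.n%ℕd<d t (A ℕ.+ A))))
    where
    A = suc m
    t = b + + A
    r = t ℤ.%ℕ (A ℕ.+ A)
    q = t ℤ./ℕ (A ℕ.+ A)
    e₁ : ∀ b A q → b + + 2 * (A * - q) ≡ (b + A) - (q * (A + A) + A)
    e₁ = solve-∀
    e₂ : ∀ r A q → (r + q * (A + A)) - (q * (A + A) + A) ≡ r - A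
    e₂ = solve-∀
    eq : b + + 2 * (+ A * - q) ≡ + r - + A
    eq = trans (e₁ b (+ A) q)
      (trans (cong (_- (q * (+ A + + A) + + A)) (ℤ.a≡a%ℕn+[a/ℕn]*n t (A ℕ.+ A))) (e₂ (+ r) (+ A) q))

  Reduced : BQF → Set
  Reduced ⟨ a , b , c ⟩ = ∣ b ∣ ℕ.≤ ∣ a ∣ × ∣ a ∣ ℕ.≤ ∣ c ∣

  reduce : ∀ {n} (Q : PosForm n) → Acc ℕ._<_ ∣ BQF.a (form Q) ∣ →
           ∃ λ (R : PosForm n) → form Q ~ form R × Reduced (form R)
  reduce Q@(posForm ⟨ a , b , c ⟩ _ _) (acc rec) with centre a b (0<a Q)
  ... | k , small = result
    where
    R = actPos Q (translate k)
    open BQF (form R) renaming (a to a′; b to b′; c to c′)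
    e₁ : ∀ a b c → a * (1ℤ * 1ℤ) + b * (1ℤ * 0ℤ) + c * (0ℤ * 0ℤ) ≡ a
    e₁ = solve-∀
    e₂ : ∀ a b c k → b + + 2 * (a * k) ≡
         + 2 * (a * (1ℤ * k)) + b * (1ℤ * 1ℤ + k * 0ℤ) + + 2 * (c * (0ℤ * 1ℤ))
    e₂ = solve-∀
    e₃ : ∀ a b c → a * (0ℤ * 0ℤ) + b * (0ℤ * 1ℤ) + c * (1ℤ * 1ℤ) ≡ c
    e₃ = solve-∀
    a′≡a : a′ ≡ a
    a′≡a = e₁ a b c
    b′≤a′ : ∣ b′ ∣ ℕ.≤ ∣ a′ ∣
    b′≤a′ = subst (λ u → ∣ b′ ∣ ℕ.≤ ∣ u ∣) (sym a′≡a) (subst (λ u → ∣ u ∣ ℕ.≤ ∣ a ∣) (e₂ a b c k) small)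
    result : ∃ λ S → form Q ~ form S × Reduced (form S)
    result with ∣ a′ ∣ ℕ.≤? ∣ c′ ∣
    ... | yes a′≤c′ = R , (translate k , refl) , b′≤a′ , a′≤c′
    ... | no  a′≰c′ =
      let S , R~S , red = reduce (actPos R swap) (rec smaller)
      in S , ~-trans (~-trans (translate k , refl) (swap , refl)) R~S , red
      where
      smaller : ∣ value (form R) 0ℤ 1ℤ ∣ ℕ.< ∣ a ∣
      smaller = subst (λ u → ∣ u ∣ ℕ.< ∣ a ∣) (sym (e₃ a′ b′ c′))
        (subst (λ u → ∣ c′ ∣ ℕ.< ∣ u ∣) a′≡a (ℕ.≰⇒> a′≰c′))

  reduced-bounds : ∀ {n} (Q : PosForm n) → Reduced (form Q) → let open BQF (form Q) in
    ∣ a ∣ ℕ.≤ suc n × ∣ b ∣ ℕ.≤ suc n × ∣ c ∣ ℕ.≤ suc n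
  reduced-bounds {n} Q@(posForm ⟨ a , b , c ⟩ _ D) (b≤a , a≤c) =
    ℕ.≤-trans a≤c C≤N , ℕ.≤-trans b≤a (ℕ.≤-trans a≤c C≤N) , C≤N
    where
    A = ∣ a ∣
    B = ∣ b ∣
    C = ∣ c ∣
    +∣u∣ : ∀ {u} → 0ℤ < u → u ≡ + ∣ u ∣
    +∣u∣ (ℤ.+<+ _) = refl
    z²≡ : ∀ z → z * z ≡ + (∣ z ∣ ℕ.* ∣ z ∣)
    z²≡ (+ m)    = sym (ℤ.pos-* m m)
    z²≡ -[1+ m ] = refl
    rearrange : ∀ u v → v ≡ u - (u - v)
    rearrange = solve-∀
    4AC : 4 ℕ.* (A ℕ.* C) ≡ B ℕ.* B ℕ.+ suc n
    4AC = ℤ.+-injective (begin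
      + (4 ℕ.* (A ℕ.* C))    ≡⟨ ℤ.pos-* 4 (A ℕ.* C) ⟩
      + 4 * + (A ℕ.* C)      ≡⟨ cong (+ 4 *_) (ℤ.pos-* A C) ⟩
      + 4 * (+ A * + C)      ≡⟨ cong₂ (λ u v → + 4 * (u * v)) (sym (+∣u∣ (0<a Q))) (sym (+∣u∣ (0<c Q))) ⟩
      + 4 * (a * c)          ≡⟨ rearrange (b * b) (+ 4 * (a * c)) ⟩
      b * b - (b * b - + 4 * (a * c)) ≡⟨ cong₂ _-_ (z²≡ b) D ⟩
      + (B ℕ.* B ℕ.+ suc n)  ∎)
      where open ≡-Reasoning
    BB≤AC : B ℕ.* B ℕ.≤ A ℕ.* C
    BB≤AC = ℕ.*-mono-≤ b≤a (ℕ.≤-trans b≤a a≤c)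
    instance
      A≢0 : NonZero A
      A≢0 = positive⇒ (0<a Q)
        where
        positive⇒ : ∀ {u} → 0ℤ < u → NonZero ∣ u ∣
        positive⇒ (ℤ.+<+ (s≤s _)) = _
    3AC≤N : 3 ℕ.* (A ℕ.* C) ℕ.≤ suc n
    3AC≤N = ℕ.+-cancelˡ-≤ (A ℕ.* C) _ _
      (ℕ.≤-trans (ℕ.≤-reflexive 4AC) (ℕ.+-monoˡ-≤ (suc n) BB≤AC))
    C≤N : C ℕ.≤ suc n
    C≤N = ℕ.≤-trans (ℕ.m≤n*m C A) (ℕ.≤-trans (ℕ.m≤n*m (A ℕ.* C) 3) 3AC≤N)

------------------------------------------------------------------------
  -- Representatives of the classes of forms of discriminant - (n + 1)

  candidate : ∀ n → ℤ × ℤ × ℤ → Maybe (PosForm n)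
  candidate n (a , b , c) with 0ℤ ℤ.<? a | disc ⟨ a , b , c ⟩ ℤ.≟ -[1+ n ]
  ... | yes 0<a | yes D = just (posForm ⟨ a , b , c ⟩ (positive-if ⟨ a , b , c ⟩ 0<a D) D)
  ... | _       | _     = nothing

  box : ℕ → List (ℤ × ℤ × ℤ)
  box n = cartesianProduct I (cartesianProduct I I)
    where I = interval (suc n)

  -- One form from each class.
  classReps : ∀ n → List (PosForm n)
  classReps n = deduplicate (DecSetoid._≟_ (formClasses n)) (mapMaybe (candidate n) (box n))

  candidate-complete : ∀ {n} (R : PosForm n) → let open BQF (form R) in
    MAny.Any (λ S → form R ~ form S) (candidate n (a , b , c))
  candidate-complete {n} R with 0ℤ ℤ.<? BQF.a (form R) | disc (form R) ℤ.≟ -[1+ n ]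
  ... | yes _  | yes _ = MAny.just ~-refl
  ... | no 0≮a | _     = ⊥-elim (0≮a (0<a R))
  ... | yes _  | no ¬D = ⊥-elim (¬D (disc≡ R))

  box-complete : ∀ {n} (R : PosForm n) → Reduced (form R) → let open BQF (form R) in
    (a , b , c) ∈ box n
  box-complete {n} R red =
    let open BQF (form R)
        a≤ , b≤ , c≤ = reduced-bounds R red
    in ∈-cartesianProduct⁺ (interval-complete (suc n) a a≤)
         (∈-cartesianProduct⁺ (interval-complete (suc n) b b≤) (interval-complete (suc n) c c≤))

  candidates-complete : ∀ {n} xs (Q R : PosForm n) → form Q ~ form R → let open BQF (form R) in
    (a , b , c) ∈ xs → Any (λ S → form Q ~ form S) (mapMaybe (candidate n) xs)
  candidates-complete {n} xs Q R Q~R R∈xs = mapMaybe⁺ (candidate n) xs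
    (Any.map⁺ (lose R∈xs (MAny.map (λ {S} → ~-trans {form Q} {form R} {form S} Q~R) (candidate-complete R))))

  representatives-complete : ∀ {n} (Q : PosForm n) xs → Any (λ S → form Q ~ form S) xs →
    Any (λ S → form Q ~ form S) (deduplicate (DecSetoid._≟_ (formClasses n)) xs)
  representatives-complete {n} Q xs = Any.deduplicate⁺ (DecSetoid._≟_ (formClasses n))
    (λ {R} {S} S~R Q~R → ~-trans {form Q} {form R} {form S} Q~R (~-sym {form S} {form R} S~R))

  classReps-complete : ∀ {n} (Q : PosForm n) → Any (λ R → form Q ~ form R) (classReps n)
  classReps-complete {n} Q = from-reduced (reduce Q (<-wellFounded ∣ BQF.a (form Q) ∣))
    where
    from-reduced : (∃ λ R → form Q ~ form R × Reduced (form R)) → Any (λ R → form Q ~ form R) (classReps n)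
    from-reduced (R , Q~R , red) = representatives-complete Q (mapMaybe (candidate n) (box n))
      (candidates-complete (box n) Q R Q~R (box-complete R red))

  classReps-distinct : ∀ n → AllPairs (λ Q R → ¬ form Q ~ form R) (classReps n)
  classReps-distinct n = Unique.deduplicate-! (formClasses n) (mapMaybe (candidate n) (box n))

  similar? : ∀ {n} (Q : PosForm n) (g : ℤ → BQF) → (∀ e → disc (g e) ≡ -[1+ n ] → ∣ e ∣ ℕ.≤ suc n) →
             Dec (∃[ e ] form Q ~ g e)
  similar? {n} Q g bound = bounded? (suc n) (λ e → Q ~? g e)
    (λ {e} Q~ → bound e (trans (disc-~ Q~) (disc≡ Q)))

  ∼x²+y²? : ∀ {n} (Q : PosForm n) → Dec (∃[ e ] form Q ~ ⟨ e , 0ℤ , e ⟩)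
  ∼x²+y²? {n} Q = similar? Q (λ e → ⟨ e , 0ℤ , e ⟩) λ e D →
    subst (λ u → ∣ e ∣ ℕ.≤ ∣ u ∣) (trans (eq e) D) (bound e)
    where
    eq : ∀ e → - (+ 4 * (e * e)) ≡ 0ℤ * 0ℤ - + 4 * (e * e)
    eq = solve-∀
    bound : ∀ e → ∣ e ∣ ℕ.≤ ∣ - (+ 4 * (e * e)) ∣
    bound e rewrite ℤ.∣-i∣≡∣i∣ (+ 4 * (e * e)) | ℤ.abs-* (+ 4) (e * e) =
      ℕ.≤-trans (∣z∣≤∣z²∣ e) (ℕ.m≤n*m ∣ e * e ∣ 4)

  ∼x²+xy+y²? : ∀ {n} (Q : PosForm n) → Dec (∃[ e ] form Q ~ ⟨ e , e , e ⟩)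
  ∼x²+xy+y²? {n} Q = similar? Q (λ e → ⟨ e , e , e ⟩) λ e D →
    subst (λ u → ∣ e ∣ ℕ.≤ ∣ u ∣) (trans (eq e) D) (bound e)
    where
    eq : ∀ e → - (+ 3 * (e * e)) ≡ e * e - + 4 * (e * e)
    eq = solve-∀
    bound : ∀ e → ∣ e ∣ ℕ.≤ ∣ - (+ 3 * (e * e)) ∣
    bound e rewrite ℤ.∣-i∣≡∣i∣ (+ 3 * (e * e)) | ℤ.abs-* (+ 3) (e * e) =
      ℕ.≤-trans (∣z∣≤∣z²∣ e) (ℕ.m≤n*m ∣ e * e ∣ 3)

------------------------------------------------------------------------
-- Hurwitz class numbers

open import Data.Nat.Combinatorics using (_C_; nCk+nC[k+1]≡[n+1]C[k+1]; nCn≡1; nCk≡nC[n∸k])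
open import Data.Rational.Base using (_+_; _*_; _-_; -_)

1/ω : ∀ {n} → PosForm n → ℚ
1/ω Q = if does (∼x²+y²? Q) then + 1 / 2
        else if does (∼x²+xy+y²? Q) then + 1 / 3
        else 1ℚ

-- In the second clause the rational is the integer n + 1.  If - (n + 1) is
-- not 0 or 1 modulo 4, it is not the discriminant of a form and the sum is empty.
H : ℚ → ℚ
H (mkℚ (+ zero)  0 _) = - (+ 1 / 12)
H (mkℚ (+ suc n) 0 _) = ∑[ Q ← classReps n ] 1/ω Q
H _                   = 0ℚ

-- The sum over t ∈ ℤ is restricted to ∣ t ∣ ≤ pʳ: otherwise pʳ - t² < 0.
𝓗 : (k : ℕ) (m : ℤ) (M b : ℕ) .{{_ : NonZero b}} (p r : ℕ) → ℚ
𝓗 k m M b p r =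
  ∑[ t ← filter (λ t → ¬? (+ p ℤ.∣? t) ×-dec (t ≋? m [mod M ])) (interval (p ℕ.^ r)) ]
    H ((+ (p ℕ.^ r) ℤ.- t ℤ.* t) / b) * fromℤ t ^ k

------------------------------------------------------------------------
-- q-series

-- A power series ∑ₙ F n qⁿ is given by its coefficients.
QSeries : Set
QSeries = ℕ → ℚ

-- (2πi)⁻¹ ∂/∂τ = q d/dq, iterated i times.
D^ : ℕ → QSeries → QSeries
D^ i F n = fromℕ n ^ i * F n

_·_ : QSeries → QSeries → QSeries
(F · G) n = ∑[ i ← upTo (suc n) ] F i * G (n ∸ i)

_∣V_ : QSeries → ℕ → QSeries
(F ∣V b) n with b ℕ.∣? n
... | yes b∣n = F (ℕ.quotient b∣n)
... | no  _   = 0ℚ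

𝓗-series : QSeries
𝓗-series n = H (fromℕ n)

θ : (j : ℕ) (m : ℤ) (M : ℕ) → QSeries
θ j m M n =
  ∑[ s ← filter (λ s → (s ℤ.* s ℤ.≟ + n) ×-dec (s ≋? m [mod M ])) (interval n) ] fromℤ s ^ j

-- Γ(x + 1) / (i! Γ(x - i + 1)) = x (x - 1) ⋯ (x - i + 1) / i!
binomial : ℚ → ℕ → ℚ
binomial x zero    = 1ℚ
binomial x (suc i) = binomial x i * (x - fromℕ i) * (+ 1 / suc i)

-- The factor (2πi)⁻ᵏ is absorbed in the k derivatives D.
RankinCohen : (κ₁ κ₂ : ℚ) (k : ℕ) → QSeries → QSeries → QSeries
RankinCohen κ₁ κ₂ k F₁ F₂ n =
  ∑[ i ← upTo (suc k) ]
    (- 1ℚ) ^ i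
    * binomial (κ₁ + fromℕ k - 1ℚ) (k ∸ i)
    * binomial (κ₂ + fromℕ k - 1ℚ) i
    * (D^ i F₁ · D^ (k ∸ i) F₂) n

------------------------------------------------------------------------
-- λ, Λ, f, γ and α for b = β²
--
-- When b is the square of a natural number β > 0, √b = β is rational and the
-- sum ∑* is finite: t² - b s² = n forces t ≤ n and s ≤ n.

λ-weight : ℕ → ℚ
λ-weight zero    = ½
λ-weight (suc _) = 1ℚ

λ-coeff : (ℓ : ℕ) (m : ℤ) (M β : ℕ) .{{_ : NonZero β}} (n : ℕ) → ℚ
λ-coeff ℓ m M β n =
  ∑[ ε ← 1ℤ ∷ -1ℤ ∷ [] ]
    fromℤ ε ^ ℓ *
    (∑[ ts ← filter (solution? ε) (cartesianProduct (map suc (upTo n)) (upTo (suc n))) ]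
      (let t , s = ts in λ-weight s * fromℤ (+ t ℤ.- + (β ℕ.* s)) ^ suc ℓ))
  where
  solution? : ∀ ε (ts : ℕ × ℕ) → let t , s = ts in
    Dec (+ (t ℕ.^ 2) ℤ.- + (β ℕ.^ 2 ℕ.* s ℕ.^ 2) ≡ + n × + t ≋ ε ℤ.* m [mod M ])
  solution? ε (t , s) =
    (+ (t ℕ.^ 2) ℤ.- + (β ℕ.^ 2 ℕ.* s ℕ.^ 2) ℤ.≟ + n) ×-dec (+ t ≋? ε ℤ.* m [mod M ])

Λ : (ℓ : ℕ) (m : ℤ) (M β : ℕ) .{{_ : NonZero β}} → QSeries
Λ ℓ m M β zero      = 0ℚ
Λ ℓ m M β n@(suc _) = λ-coeff ℓ m M β n

f : (ℓ : ℕ) (m : ℤ) (M β : ℕ) .{{_ : NonZero β}} → QSeries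
f ℓ m M β n =
  RankinCohen (+ 3 / 2) (½ + fromℕ j) ⌊ ℓ /2⌋ (𝓗-series ∣V (β ℕ.^ 2)) (θ j m M) n
  + (+ 1 / β) * ½ ^ suc ℓ * fromℕ (ℓ C ⌊ ℓ /2⌋) * Λ ℓ m M β n
  where j = ℓ ℕ.% 2

C-nonZero : ∀ {n k} → k ℕ.≤ n → NonZero (n C k)
C-nonZero {n} {zero} _ = subst NonZero (sym (trans (nCk≡nC[n∸k] {0} {n} z≤n) (nCn≡1 n))) _
C-nonZero {suc n} {suc k} (s≤s k≤n) = subst NonZero (nCk+nC[k+1]≡[n+1]C[k+1] n k) (nonZero-+ (C-nonZero k≤n))
  where
  nonZero-+ : ∀ {x y} → NonZero x → NonZero (x ℕ.+ y)
  nonZero-+ {suc _} _ = _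

α : (ℓ : ℕ) (m : ℤ) (M β : ℕ) .{{_ : NonZero β}} → QSeries
α ℓ m M β n = (+ 1 / (ℓ C ⌊ ℓ /2⌋)) {{C-nonZero (ℕ.⌊n/2⌋≤n ℓ)}} * f ℓ m M β n

-- α(p^(r-2)), which is 0 when r = 1.
α[_^_-2] : (p r : ℕ) (ℓ : ℕ) (m : ℤ) (M β : ℕ) .{{_ : NonZero β}} → ℚ
α[ p ^ suc (suc r) -2] ℓ m M β = α ℓ m M β (p ℕ.^ r)
α[ p ^ _           -2] ℓ m M β = 0ℚ

------------------------------------------------------------------------
-- Ballot and Catalan numbers

T : ℕ → ℕ → ℚ
T k μ = (+ k ℤ.- + (2 ℕ.* μ) ℤ.+ 1ℤ) / suc (k ∸ μ) * fromℕ (k C μ)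

Catalan : ℕ → ℚ
Catalan n = (+ 1 / suc n) * fromℕ ((2 ℕ.* n) C n)

{-# OPTIONS --safe #-}

-- Up to the factor C(ℓ, ℓ/2), the coefficient of qⁿ in the Rankin–Cohen bracket is Σ_t H(n - t²) V(t),
-- where V is the coefficient of √(t² - n) in (t + √(t² - n))^(ℓ + 1).  The ballot numbers T(k, μ) expand
-- (2t)ᵏ in terms of these polynomials, so the sum of the α's is Σ_t H(n - t²) tᵏ up to a multiple of
-- Σ_t H(n - t²), and the part coming from Λ cancels Σ T(k, μ) p^(rμ).
--
-- The terms with p ∣ t are removed by the Hecke relation at p²: t² - pˢ is a square modulo p, so
-- H(p² (pˢ - t²)) = p H(pˢ - t²) for t ≠ 0, which leads to the α's at p^(r - 2).
--
-- Finally Σ_t H(n - t²) is evaluated for odd n without modular forms.  The sum of a suitable weight,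
-- supported on Selling-reduced forms, over an SL₂(ℤ)-class is 6 / ω, so the sum over t becomes a weighted
-- count of integer points on t² + 4ac - b² = n.  This quadric is n = pc + qy in suitable coordinates;
-- cutting the support into cones and exchanging these by symmetries of the quadric cancels everything
-- but the points with p = y, which are counted by the factorisations of n.

module Submission where

open import Data.Bool.Base using (if_then_else_; Bool; true; false; not; _∧_)
open import Data.Empty using (⊥-elim; ⊥)
open import Data.Integer.Base as ℤ using (ℤ; +_; -[1+_]; 0ℤ; 1ℤ; -1ℤ; +<+; +≤+; ∣_∣; -<+)
import Data.Integer.DivMod as ℤ
import Data.Integer.Divisibility.Signed as ℤ
import Data.Integer.Properties as ℤ
import Data.Integer.Tactic.RingSolver as ℤ
open import Data.List.Base using (List; []; _∷_; _++_; map; foldr; deduplicate; cartesianProduct; upTo; downFrom; applyUpTo; filter)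
open import Data.List.Membership.Propositional using (_∈_)
open import Data.List.Membership.Propositional.Properties using (∈-++⁺ˡ; ∈-++⁺ʳ; ∈-map⁺; ∈-cartesianProduct⁺; ∈-deduplicate⁺; ∈-upTo⁺; ∈-upTo⁻; ∈-downFrom⁻; ∈-downFrom⁺; ∈-map⁻)
import Data.List.Relation.Unary.All as All
import Data.List.Relation.Unary.Any as Any
import Data.List.Relation.Unary.Unique.DecPropositional as UniqueDec
import Data.List.Relation.Unary.Unique.DecPropositional.Properties as UniqueDec
import Data.List.Relation.Unary.Unique.Propositional.Properties as Unique
open import Data.Nat.Base as ℕ using (zero; suc; z≤n; s≤s; ℕ; NonZero; _∸_; ⌊_/2⌋)
import Data.Nat.Coprimality as Coprime
import Data.Nat.DivMod as ℕ
import Data.Nat.Divisibility as ℕ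
open import Data.Nat.Primality using (Prime; euclidsLemma; prime⇒irreducible; prime⇒nonZero; prime⇒nonTrivial; prime[2])
import Data.Nat.Properties as ℕ
open import Data.Product.Base using (_×_; _,_; proj₁; proj₂; ∃; ∃-syntax)
import Data.Product.Properties as Product
open import Data.Rational.Base as ℚ using (ℚ; mkℚ; 0ℚ; 1ℚ; ½)
import Data.Rational.Properties as ℚ
import Data.Rational.Unnormalised.Base as ℚᵘ
import Data.Rational.Unnormalised.Properties as ℚᵘ
import Data.Sum.Base as Sum⊎
open import Data.Sum.Base using (_⊎_; inj₁; inj₂; [_,_]′)
open import Function.Base using (id; _∘_)
open import Relation.Binary.Definitions using (DecidableEquality; tri<; tri≈; tri>)
open import Relation.Binary.PropositionalEquality hiding (J)
open import Relation.Nullary using (Dec; yes; no; does; ¬_; _×-dec_; ¬?)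
import Tactic.RingSolver.Core.AlmostCommutativeRing as ACR

-- Class numbers count forms with stabilisers; the weight makes these invisible. A positive definite
-- form is a point of the upper half-plane, and its Selling parameters locate it relative to the
-- sides of an ideal triangle of the Farey tessellation. Each of the three rotations of a triangle
-- carries weight 2, halved on a side shared by two triangles, and stabilisers show up as
-- coincidences among the representatives. Summed over matrices of determinant 1 instead of forms,
-- the total is 12 for every form. For the Hecke relation a pair (Q, M) with det M = p gets the
-- product of the weights of Q and of `Q ◂ M`. This is symmetric under passing to (`Q ◂ M`,
-- `adj M`), so it can be summed from either end. In the count on the quadric, oddness of n is
-- decisive: linear forms congruent to t + b modulo 2 are odd there, so their walls contain no
-- points, while the even forms p - q and p - y leave the wall terms that become the divisor sum.
-- H(0) = - 1 / 12 violates H(p² x) = p H(x). The defect (p - 1) / 12, at the two t with t² = p^(r -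
-- 2), produces the term with δ.

-- Finite sums and sums of finitely supported functions.

module FinSum where

  open import Data.List.Relation.Unary.Any using (here; there)
  open import Data.List.Relation.Unary.AllPairs using ([]; _∷_)
  open import Data.List.Relation.Unary.Unique.Propositional using (Unique)
  open import Algebra.Structures using (IsCommutativeMonoid)

  record DecEq (A : Set) : Set where
    constructor decEq
    field _≟_ : DecidableEquality A

  open DecEq {{...}} public

  instance
    ×-decEq : ∀ {A B : Set} {{_ : DecEq A}} {{_ : DecEq B}} → DecEq (A × B)
    ×-decEq = decEq (Product.≡-dec _≟_ _≟_)

  module Sum {V : Set} {_⊕_ : V → V → V} {ε : V} (isCM : IsCommutativeMonoid _≡_ _⊕_ ε) where

    open IsCommutativeMonoid isCM using (assoc; comm; identityˡ; identityʳ)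

    private variable
      A B I : Set

    sum : List A → (A → V) → V
    sum xs f = foldr (λ x s → f x ⊕ s) ε xs

    sum-cong-∈ : ∀ (xs : List A) {f g : A → V} → (∀ {x} → x ∈ xs → f x ≡ g x) → sum xs f ≡ sum xs g
    sum-cong-∈ []       f≗g = refl
    sum-cong-∈ (x ∷ xs) f≗g = cong₂ _⊕_ (f≗g (here refl)) (sum-cong-∈ xs (λ x∈ → f≗g (there x∈)))

    sum-cong : ∀ (xs : List A) {f g : A → V} → (∀ x → f x ≡ g x) → sum xs f ≡ sum xs g
    sum-cong xs f≗g = sum-cong-∈ xs (λ {x} _ → f≗g x)

    sum-ε : ∀ (xs : List A) {f : A → V} → (∀ {x} → x ∈ xs → f x ≡ ε) → sum xs f ≡ ε
    sum-ε []       f≗ε = refl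
    sum-ε (x ∷ xs) f≗ε = trans (cong₂ _⊕_ (f≗ε (here refl)) (sum-ε xs (λ x∈ → f≗ε (there x∈)))) (identityˡ ε)

    interchange : ∀ a b c d → (a ⊕ b) ⊕ (c ⊕ d) ≡ (a ⊕ c) ⊕ (b ⊕ d)
    interchange a b c d = begin
      (a ⊕ b) ⊕ (c ⊕ d) ≡⟨ assoc a b (c ⊕ d) ⟩
      a ⊕ (b ⊕ (c ⊕ d)) ≡⟨ cong (a ⊕_) (sym (assoc b c d)) ⟩
      a ⊕ ((b ⊕ c) ⊕ d) ≡⟨ cong (λ u → a ⊕ (u ⊕ d)) (comm b c) ⟩
      a ⊕ ((c ⊕ b) ⊕ d) ≡⟨ cong (a ⊕_) (assoc c b d) ⟩
      a ⊕ (c ⊕ (b ⊕ d)) ≡⟨ sym (assoc a c (b ⊕ d)) ⟩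
      (a ⊕ c) ⊕ (b ⊕ d) ∎
      where open ≡-Reasoning

    sum-⊕ : ∀ (xs : List A) (f g : A → V) → sum xs (λ x → f x ⊕ g x) ≡ sum xs f ⊕ sum xs g
    sum-⊕ []       f g = sym (identityˡ ε)
    sum-⊕ (x ∷ xs) f g = trans (cong ((f x ⊕ g x) ⊕_) (sum-⊕ xs f g)) (interchange (f x) (g x) _ _)

    sum-swap : ∀ (xs : List A) (ys : List B) (f : A → B → V) →
               sum xs (λ x → sum ys (f x)) ≡ sum ys (λ y → sum xs (λ x → f x y))
    sum-swap []       ys f = sym (sum-ε ys (λ _ → refl))
    sum-swap (x ∷ xs) ys f =
      trans (cong (sum ys (f x) ⊕_) (sum-swap xs ys f)) (sym (sum-⊕ ys (f x) _))

    sum-map : ∀ (h : I → A) (xs : List I) (f : A → V) → sum (map h xs) f ≡ sum xs (λ i → f (h i))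
    sum-map h []       f = refl
    sum-map h (x ∷ xs) f = cong (f (h x) ⊕_) (sum-map h xs f)

    sum-++ : ∀ (xs ys : List A) (f : A → V) → sum (xs ++ ys) f ≡ sum xs f ⊕ sum ys f
    sum-++ []       ys f = sym (identityˡ _)
    sum-++ (x ∷ xs) ys f = trans (cong (f x ⊕_) (sum-++ xs ys f)) (sym (assoc (f x) _ _))

    sum-× : ∀ (xs : List A) (ys : List B) (f : A × B → V) →
            sum (cartesianProduct xs ys) f ≡ sum xs (λ x → sum ys (λ y → f (x , y)))
    sum-× []       ys f = refl
    sum-× (x ∷ xs) ys f = trans (sum-++ (map (x ,_) ys) _ f)
      (cong₂ _⊕_ (sum-map (x ,_) ys f) (sum-× xs ys f))

    only : ∀ {P : Set} → Dec P → V → V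
    only P? v = if does P? then v else ε

    only-yes : ∀ {P : Set} (P? : Dec P) {v} → P → only P? v ≡ v
    only-yes (yes _) _ = refl
    only-yes (no ¬p) p = ⊥-elim (¬p p)

    only-no : ∀ {P : Set} (P? : Dec P) {v} → ¬ P → only P? v ≡ ε
    only-no (yes p) ¬p = ⊥-elim (¬p p)
    only-no (no _)  _  = refl

    only-⇔ : ∀ {P Q : Set} (P? : Dec P) (Q? : Dec Q) {v} → (P → Q) → (Q → P) → only P? v ≡ only Q? v
    only-⇔ (yes p) (yes q) f g = refl
    only-⇔ (yes p) (no ¬q) f g = ⊥-elim (¬q (f p))
    only-⇔ (no ¬p) (yes q) f g = ⊥-elim (¬p (g q))
    only-⇔ (no ¬p) (no ¬q) f g = refl

    module _ {{_ : DecEq A}} where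

      sum-only : ∀ {xs : List A} {a} → Unique xs → a ∈ xs → (f : A → V) →
                 sum xs (λ x → only (a ≟ x) (f x)) ≡ f a
      sum-only {x ∷ xs} (x∉ ∷ _) (here refl) f = trans
        (cong₂ _⊕_ (only-yes (x ≟ x) refl) (sum-ε xs (λ {y} y∈ → only-no (x ≟ y) (All.lookup x∉ y∈))))
        (identityʳ _)
      sum-only {x ∷ xs} {a} (x∉ ∷ u) (there a∈) f = trans
        (cong₂ _⊕_ (only-no (a ≟ x) (λ a≡x → All.lookup x∉ a∈ (sym a≡x))) (sum-only u a∈ f))
        (identityˡ _)

    -- The support condition in constructive form: every point is decided either to lie in the list
    -- or to have value `ε`. The list may be larger than the support.
    Covers : List A → (A → V) → Set
    Covers xs f = ∀ a → a ∈ xs ⊎ f a ≡ ε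

    module _ {{_ : DecEq A}} where

      sum-cover : ∀ {xs ys : List A} {f : A → V} → Unique xs → Unique ys → Covers xs f → Covers ys f →
                  sum xs f ≡ sum ys f
      sum-cover {xs} {ys} {f} ux uy cx cy = begin
        sum xs f                                       ≡⟨ sum-cong xs (λ x → sym (left x)) ⟩
        sum xs (λ x → sum ys (λ y → only (x ≟ y) (f y))) ≡⟨ sum-swap xs ys _ ⟩
        sum ys (λ y → sum xs (λ x → only (x ≟ y) (f y))) ≡⟨ sum-cong ys right ⟩
        sum ys f                                       ∎
        where
        open ≡-Reasoning
        left : ∀ x → sum ys (λ y → only (x ≟ y) (f y)) ≡ f x
        left x with cy x
        ... | inj₁ x∈ = sum-only uy x∈ f
        ... | inj₂ fx≡ε = trans (sum-ε ys (λ {y} _ → vanish y)) (sym fx≡ε)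
          where
          vanish : ∀ y → only (x ≟ y) (f y) ≡ ε
          vanish y with x ≟ y
          ... | yes refl = fx≡ε
          ... | no _     = refl
        flip : ∀ x y → only (x ≟ y) (f y) ≡ only (y ≟ x) (f x)
        flip x y with x ≟ y
        ... | yes refl = sym (only-yes (x ≟ x) refl)
        ... | no x≢y   = sym (only-no (y ≟ x) (λ y≡x → x≢y (sym y≡x)))
        right : ∀ y → sum xs (λ x → only (x ≟ y) (f y)) ≡ f y
        right y with cx y
        ... | inj₁ y∈ = trans (sum-cong xs (λ x → flip x y)) (sum-only ux y∈ f)
        ... | inj₂ fy≡ε = trans (sum-ε xs (λ {x} _ → vanish x)) (sym fy≡ε)
          where
          vanish : ∀ x → only (x ≟ y) (f y) ≡ ε
          vanish x with x ≟ y
          ... | yes _ = fy≡ε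
          ... | no _  = refl

    -- The sum of a finitely supported function on an arbitrary type.
    record HasSum {A : Set} (f : A → V) (s : V) : Set where
      constructor hasSum
      field
        supp   : List A
        unique : Unique supp
        covers : Covers supp f
        total  : sum supp f ≡ s

    open HasSum public

    module _ {{_ : DecEq A}} where

      HasSum-unique : ∀ {f : A → V} {s t} → HasSum f s → HasSum f t → s ≡ t
      HasSum-unique F G = trans (sym (total F))
        (trans (sum-cover (unique F) (unique G) (covers F) (covers G)) (total G))

      cover-sum : ∀ {f : A → V} (xs : List A) → Covers xs f → HasSum f (sum (deduplicate _≟_ xs) f)
      cover-sum xs c = hasSum (deduplicate _≟_ xs) (UniqueDec.deduplicate-! _≟_ xs)
        (λ a → [ (λ a∈ → inj₁ (∈-deduplicate⁺ _≟_ a∈)) , inj₂ ]′ (c a)) refl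

      HasSum-on : ∀ {f : A → V} {s} (F : HasSum f s) {xs} → Unique xs → Covers xs f → sum xs f ≡ s
      HasSum-on F u c = HasSum-unique (hasSum _ u c refl) F

      HasSum-⊕ : ∀ {f g : A → V} {s t} → HasSum f s → HasSum g t → HasSum (λ a → f a ⊕ g a) (s ⊕ t)
      HasSum-⊕ {f} {g} F G = hasSum xs (UniqueDec.deduplicate-! _≟_ _) cov
        (trans (sum-⊕ xs f g) (cong₂ _⊕_ (HasSum-on F (UniqueDec.deduplicate-! _≟_ _) cf)
                                         (HasSum-on G (UniqueDec.deduplicate-! _≟_ _) cg)))
        where
        xs = deduplicate _≟_ (supp F ++ supp G)
        cf : Covers xs f
        cf a = [ (λ a∈ → inj₁ (∈-deduplicate⁺ _≟_ (∈-++⁺ˡ a∈))) , inj₂ ]′ (covers F a)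
        cg : Covers xs g
        cg a = [ (λ a∈ → inj₁ (∈-deduplicate⁺ _≟_ (∈-++⁺ʳ (supp F) a∈))) , inj₂ ]′ (covers G a)
        cov : Covers xs (λ a → f a ⊕ g a)
        cov a with cf a | cg a
        ... | inj₁ a∈ | _       = inj₁ a∈
        ... | inj₂ _  | inj₁ a∈ = inj₁ a∈
        ... | inj₂ p  | inj₂ q  = inj₂ (trans (cong₂ _⊕_ p q) (identityˡ ε))

    HasSum-cong : ∀ {f g : A → V} {s} → (∀ a → f a ≡ g a) → HasSum f s → HasSum g s
    HasSum-cong f≗g F = hasSum (supp F) (unique F)
      (λ a → [ inj₁ , (λ p → inj₂ (trans (sym (f≗g a)) p)) ]′ (covers F a))
      (trans (sym (sum-cong (supp F) f≗g)) (total F))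

    HasSum-≡ : ∀ {f : A → V} {s t} → s ≡ t → HasSum f s → HasSum f t
    HasSum-≡ refl F = F

    HasSum-ε : ∀ {f : A → V} → (∀ a → f a ≡ ε) → HasSum f ε
    HasSum-ε f≗ε = hasSum [] [] (λ a → inj₂ (f≗ε a)) refl

    HasSum-single : ∀ {f : A → V} a → (∀ b → b ≡ a ⊎ f b ≡ ε) → HasSum f (f a)
    HasSum-single a c = hasSum (a ∷ []) (All.[] ∷ [])
      (λ b → [ (λ p → inj₁ (here p)) , inj₂ ]′ (c b)) (identityʳ _)

    HasSum-sum : {{_ : DecEq A}} → ∀ (is : List I) {f : I → A → V} {s : I → V} →
                 (∀ {i} → i ∈ is → HasSum (f i) (s i)) → HasSum (λ a → sum is (λ i → f i a)) (sum is s)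
    HasSum-sum []       F = HasSum-ε (λ _ → refl)
    HasSum-sum (i ∷ is) F = HasSum-⊕ (F (here refl)) (HasSum-sum is (λ i∈ → F (there i∈)))

    -- φ and ψ restrict to mutually inverse bijections between the supports of f and g.
    HasSum-bij : ∀ {f : A → V} {g : B → V} {s} → {{_ : DecEq A}} → {{_ : DecEq B}} → (φ : A → B) (ψ : B → A) →
                 (∀ a → ψ (φ a) ≡ a ⊎ f a ≡ ε) →
                 (∀ a → g (φ a) ≡ f a ⊎ f a ≡ ε) →
                 (∀ b → (φ (ψ b) ≡ b × f (ψ b) ≡ g b) ⊎ g b ≡ ε) →
                 HasSum f s → HasSum g s
    HasSum-bij {A} {B} {f} {g} {s} φ ψ ψφ gφ φψ F = HasSum-≡ eq (cover-sum ys cov)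
      where
      open ≡-Reasoning
      xs = supp F
      ys = map φ xs
      zs = deduplicate _≟_ ys
      cov : Covers ys g
      cov b with φψ b
      ... | inj₂ gb≡ε = inj₂ gb≡ε
      ... | inj₁ (φψb≡b , fψb≡gb) with covers F (ψ b)
      ...   | inj₁ ψb∈ = inj₁ (subst (_∈ ys) φψb≡b (∈-map⁺ φ ψb∈))
      ...   | inj₂ p   = inj₂ (trans (sym fψb≡gb) p)
      zs-u : Unique zs
      zs-u = UniqueDec.deduplicate-! _≟_ ys
      row : ∀ a → a ∈ xs → sum zs (λ b → only (φ a ≟ b) (f a)) ≡ f a
      row a a∈ = sum-only zs-u (∈-deduplicate⁺ _≟_ (∈-map⁺ φ a∈)) (λ _ → f a)
      rot : ∀ a b → g b ≡ f (ψ b) → φ (ψ b) ≡ b → only (φ a ≟ b) (f a) ≡ only (ψ b ≟ a) (f a)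
      rot a b _ φψb with φ a ≟ b | ψ b ≟ a
      ... | yes _    | yes _ = refl
      ... | no _     | no _  = refl
      ... | no φa≢b  | yes refl = ⊥-elim (φa≢b φψb)
      ... | yes refl | no ψb≢a with ψφ a
      ...   | inj₁ p = ⊥-elim (ψb≢a p)
      ...   | inj₂ p = p
      zero′ : ∀ a b → g b ≡ ε → only (φ a ≟ b) (f a) ≡ ε
      zero′ a b p with φ a ≟ b
      ... | no _ = refl
      ... | yes refl with gφ a
      ...   | inj₁ q = trans (sym q) p
      ...   | inj₂ q = q
      column : ∀ b → sum xs (λ a → only (φ a ≟ b) (f a)) ≡ g b
      column b with φψ b
      ... | inj₂ gb≡ε = trans (sum-ε xs (λ {a} _ → zero′ a b gb≡ε)) (sym gb≡ε)
      ... | inj₁ (φψb , fψb) with covers F (ψ b)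
      ...   | inj₁ ψb∈ = trans (sum-cong xs (λ a → rot a b (sym fψb) φψb)) (trans (sum-only (unique F) ψb∈ f) fψb)
      ...   | inj₂ p   = trans (sum-ε xs (λ {a} _ → zero′ a b (trans (sym fψb) p))) (trans (sym p) fψb)
      -- Double counting over the graph of `φ`: its rows sum to `f` and its columns to `g`.
      eq : sum zs g ≡ s
      eq = begin
        sum zs g ≡⟨ sum-cong zs (λ b → sym (column b)) ⟩
        sum zs (λ b → sum xs (λ a → only (φ a ≟ b) (f a))) ≡⟨ sum-swap zs xs _ ⟩
        sum xs (λ a → sum zs (λ b → only (φ a ≟ b) (f a))) ≡⟨ sum-cong-∈ xs (λ {a} a∈ → row a a∈) ⟩
        sum xs f ≡⟨ total F ⟩
        s ∎

    module _ {{_ : DecEq A}} {{_ : DecEq B}} where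

      -- The two projections of `supp F` serve all rows at once. A row over a point outside the
      -- first projection vanishes identically, so its sum is `ε` by uniqueness of sums.
      HasSum-fubini : ∀ {f : A × B → V} {g : A → V} {s} → HasSum f s →
                      (∀ a → HasSum (λ b → f (a , b)) (g a)) → HasSum g s
      HasSum-fubini {f} {g} F G = hasSum xs ux covg (begin
        sum xs g                                ≡⟨ sum-cong xs (λ x → sym (HasSum-on (G x) uy (covy x))) ⟩
        sum xs (λ x → sum ys (λ y → f (x , y))) ≡⟨ sum-× xs ys f ⟨
        sum (cartesianProduct xs ys) f          ≡⟨ HasSum-on F (Unique.cartesianProduct⁺ ux uy) covf ⟩
        _                                       ∎)
        where
        open ≡-Reasoning
        xs = deduplicate _≟_ (map proj₁ (supp F))
        ys = deduplicate _≟_ (map proj₂ (supp F))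
        ux : Unique xs
        ux = UniqueDec.deduplicate-! _≟_ _
        uy : Unique ys
        uy = UniqueDec.deduplicate-! _≟_ _
        covf : Covers (cartesianProduct xs ys) f
        covf p = [ (λ p∈ → inj₁ (∈-cartesianProduct⁺ (∈-deduplicate⁺ _≟_ (∈-map⁺ proj₁ p∈))
                                                     (∈-deduplicate⁺ _≟_ (∈-map⁺ proj₂ p∈)))) , inj₂ ]′ (covers F p)
        covy : ∀ x → Covers ys (λ y → f (x , y))
        covy x y = [ (λ p∈ → inj₁ (∈-deduplicate⁺ _≟_ (∈-map⁺ proj₂ p∈))) , inj₂ ]′ (covers F (x , y))
        covg : Covers xs g
        covg x with any? xs
          where
          any? : ∀ zs → (x ∈ zs) ⊎ (∀ {z} → z ∈ zs → z ≢ x)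
          any? []       = inj₂ λ ()
          any? (z ∷ zs) with z ≟ x | any? zs
          ... | yes refl | _        = inj₁ (here refl)
          ... | no _     | inj₁ x∈  = inj₁ (there x∈)
          ... | no z≢x   | inj₂ ∉zs = inj₂ λ { (here refl) → z≢x ; (there z∈) → ∉zs z∈ }
        ... | inj₁ x∈ = inj₁ x∈
        ... | inj₂ ∉xs = inj₂ (HasSum-unique (G x) (HasSum-ε vanish))
          where
          vanish : ∀ y → f (x , y) ≡ ε
          vanish y with covers F (x , y)
          ... | inj₁ p∈ = ⊥-elim (∉xs (∈-deduplicate⁺ _≟_ (∈-map⁺ proj₁ p∈)) refl)
          ... | inj₂ p  = p

      -- The last hypothesis does not follow from `G`: a row may have sum `ε` by cancellation
      -- without being zero, so the rows outside `supp G` are required to vanish entry by entry.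
      HasSum-Σ : ∀ {f : A × B → V} {g : A → V} {s} (G : HasSum g s) →
                 (∀ a → HasSum (λ b → f (a , b)) (g a)) →
                 (∀ a → a ∈ supp G ⊎ (∀ b → f (a , b) ≡ ε)) → HasSum f s
      HasSum-Σ {f} {g} G F c = HasSum-≡ (total G) (HasSum-cong collect (HasSum-sum xs {slice} (λ {a} _ → at a)))
        where
        xs = supp G
        slice : A → A × B → V
        slice a (x , y) = only (a ≟ x) (f (x , y))
        at : ∀ a → HasSum (slice a) (g a)
        at a = HasSum-bij (a ,_) proj₂ (λ _ → inj₁ refl) (λ _ → inj₁ (only-yes (a ≟ a) refl)) back (F a)
          where
          back : ∀ p → ((a , proj₂ p) ≡ p × f (a , proj₂ p) ≡ slice a p) ⊎ slice a p ≡ ε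
          back (x , y) with a ≟ x
          ... | yes refl = inj₁ (refl , refl)
          ... | no _     = inj₂ refl
        collect : ∀ p → sum xs (λ a → slice a p) ≡ f p
        collect (x , y) with c x
        ... | inj₁ x∈ = trans (sum-cong xs (λ a → flip a)) (sum-only (unique G) x∈ (λ a → f (x , y)))
          where
          flip : ∀ a → only (a ≟ x) (f (x , y)) ≡ only (x ≟ a) (f (x , y))
          flip a with a ≟ x
          ... | yes refl = sym (only-yes (x ≟ x) refl)
          ... | no a≢x   = sym (only-no (x ≟ a) (λ x≡a → a≢x (sym x≡a)))
        ... | inj₂ f≡ε = trans (sum-ε xs (λ {a} _ → vanish a)) (sym (f≡ε y))
          where
          vanish : ∀ a → only (a ≟ x) (f (x , y)) ≡ ε
          vanish a with a ≟ x
          ... | yes _ = f≡ε y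
          ... | no _  = refl

  module _ {V W : Set} {_⊕_ : V → V → V} {ε : V} {_⊞_ : W → W → W} {ε′ : W}
           (isV : IsCommutativeMonoid _≡_ _⊕_ ε) (isW : IsCommutativeMonoid _≡_ _⊞_ ε′)
           (h : V → W) (h-ε : h ε ≡ ε′) (h-⊕ : ∀ x y → h (x ⊕ y) ≡ h x ⊞ h y) where
    private
      module V = Sum isV
      module W = Sum isW

    sum-hom : ∀ {A : Set} (xs : List A) (f : A → V) → h (V.sum xs f) ≡ W.sum xs (λ a → h (f a))
    sum-hom []       f = h-ε
    sum-hom (x ∷ xs) f = trans (h-⊕ (f x) _) (cong (h (f x) ⊞_) (sum-hom xs f))

    HasSum-hom : ∀ {A : Set} {f : A → V} {s} → V.HasSum f s → W.HasSum (λ a → h (f a)) (h s)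
    HasSum-hom {f = f} F = W.hasSum (V.supp F) (V.unique F)
      (λ a → [ inj₁ , (λ p → inj₂ (trans (cong h p) h-ε)) ]′ (V.covers F a))
      (trans (sym (sum-hom (V.supp F) f)) (cong h (V.total F)))

-- Selling parameters of binary quadratic forms.

module Forms where

  open import Defs
  open FinSum
  open import Data.Integer.Base using (_+_; _*_; _-_; -_; _<_; _≤_)
  open import Data.Integer.Tactic.RingSolver using (solve-∀)

  instance
    ℤ-decEq : DecEq ℤ
    ℤ-decEq = decEq ℤ._≟_

    BQF-decEq : DecEq BQF
    BQF-decEq = decEq _≟ᶠ_

  module ℤΣ = Sum ℤ.+-0-isCommutativeMonoid

  Matrix : Set
  Matrix = ℤ × ℤ × ℤ × ℤ

  det : Matrix → ℤ
  det (α , β , γ , δ) = α * δ - β * γ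

  infixl 7 _◂_ _⊡_

  _◂_ : BQF → Matrix → BQF
  Q ◂ (α , β , γ , δ) = act Q α β γ δ

  _⊡_ : Matrix → Matrix → Matrix
  (α , β , γ , δ) ⊡ (α′ , β′ , γ′ , δ′) =
    α * α′ + β * γ′ , α * β′ + β * δ′ , γ * α′ + δ * γ′ , γ * β′ + δ * δ′

  adj : Matrix → Matrix
  adj (α , β , γ , δ) = δ , - β , - γ , α

  det-⊡ : ∀ M M′ → det (M ⊡ M′) ≡ det M * det M′
  det-⊡ (α , β , γ , δ) (α′ , β′ , γ′ , δ′) = e α β γ δ α′ β′ γ′ δ′
    where
    e : ∀ α β γ δ α′ β′ γ′ δ′ →
      (α * α′ + β * γ′) * (γ * β′ + δ * δ′) - (α * β′ + β * δ′) * (γ * α′ + δ * γ′)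
      ≡ (α * δ - β * γ) * (α′ * δ′ - β′ * γ′)
    e = solve-∀

  ◂-⊡ : ∀ Q M M′ → Q ◂ (M ⊡ M′) ≡ Q ◂ M ◂ M′
  ◂-⊡ ⟨ a , b , c ⟩ (α , β , γ , δ) (α′ , β′ , γ′ , δ′) =
    ⟨⟩-cong (v a b c α β γ δ α′ γ′) (e a b c α β γ δ α′ β′ γ′ δ′) (v a b c α β γ δ β′ δ′)
    where
    v : ∀ a b c α β γ δ x y →
      a * ((α * x + β * y) * (α * x + β * y)) + b * ((α * x + β * y) * (γ * x + δ * y))
        + c * ((γ * x + δ * y) * (γ * x + δ * y))
      ≡ (a * (α * α) + b * (α * γ) + c * (γ * γ)) * (x * x)
        + (+ 2 * (a * (α * β)) + b * (α * δ + β * γ) + + 2 * (c * (γ * δ))) * (x * y)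
        + (a * (β * β) + b * (β * δ) + c * (δ * δ)) * (y * y)
    v = solve-∀
    e : ∀ a b c α β γ δ α′ β′ γ′ δ′ →
      + 2 * (a * ((α * α′ + β * γ′) * (α * β′ + β * δ′)))
        + b * ((α * α′ + β * γ′) * (γ * β′ + δ * δ′) + (α * β′ + β * δ′) * (γ * α′ + δ * γ′))
        + + 2 * (c * ((γ * α′ + δ * γ′) * (γ * β′ + δ * δ′)))
      ≡ + 2 * ((a * (α * α) + b * (α * γ) + c * (γ * γ)) * (α′ * β′))
        + (+ 2 * (a * (α * β)) + b * (α * δ + β * γ) + + 2 * (c * (γ * δ))) * (α′ * δ′ + β′ * γ′)
        + + 2 * ((a * (β * β) + b * (β * δ) + c * (δ * δ)) * (γ′ * δ′))
    e = solve-∀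

  disc-◂ : ∀ Q M → disc (Q ◂ M) ≡ disc Q * (det M * det M)
  disc-◂ ⟨ a , b , c ⟩ (α , β , γ , δ) = e a b c α β γ δ
    where
    e : ∀ a b c α β γ δ →
      (+ 2 * (a * (α * β)) + b * (α * δ + β * γ) + + 2 * (c * (γ * δ)))
      * (+ 2 * (a * (α * β)) + b * (α * δ + β * γ) + + 2 * (c * (γ * δ)))
      - + 4 * ((a * (α * α) + b * (α * γ) + c * (γ * γ)) * (a * (β * β) + b * (β * δ) + c * (δ * δ)))
      ≡ (b * b - + 4 * (a * c)) * ((α * δ - β * γ) * (α * δ - β * γ))
    e = solve-∀

  -- The form ⟨ a , b , c ⟩ is half of s₁ (x - y)² + s₂ x² + s₃ y².
  s₁ s₂ s₃ : BQF → ℤ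
  s₁ ⟨ a , b , c ⟩ = - b
  s₂ ⟨ a , b , c ⟩ = + 2 * a + b
  s₃ ⟨ a , b , c ⟩ = + 2 * c + b

  pos zer : ℤ → ℤ
  pos (+ suc _) = 1ℤ
  pos _         = 0ℤ
  zer (+ 0)     = 1ℤ
  zer _         = 0ℤ

  -- Three times the fraction of an ideal triangle at an interior or a boundary point, doubled.
  weight₃ : ℤ → ℤ → ℤ → ℤ
  weight₃ x y z = + 2 * (pos x * pos y * pos z) + (zer x * pos y * pos z + pos x * zer y * pos z + pos x * pos y * zer z)

  weight : BQF → ℤ
  weight Q = weight₃ (s₁ Q) (s₂ Q) (s₃ Q)

  -- At most one parameter may vanish, which keeps degenerate forms out. These are exactly the
  -- triples of non-zero weight.
  record Selling (x y z : ℤ) : Set where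
    constructor selling
    field
      0≤x : 0ℤ ≤ x
      0≤y : 0ℤ ≤ y
      0≤z : 0ℤ ≤ z
      two : (0ℤ < y × 0ℤ < z) ⊎ (0ℤ < z × 0ℤ < x) ⊎ (0ℤ < x × 0ℤ < y)

  pattern 0<s = +<+ (s≤s z≤n)
  pattern 0≤+ = +≤+ z≤n

  selling? : ∀ x y z → Selling x y z ⊎ weight₃ x y z ≡ 0ℤ
  selling? (+ suc _) (+ suc _) (+ suc _) = inj₁ (selling 0≤+ 0≤+ 0≤+ (inj₁ (0<s , 0<s)))
  selling? (+ 0)     (+ suc _) (+ suc _) = inj₁ (selling 0≤+ 0≤+ 0≤+ (inj₁ (0<s , 0<s)))
  selling? (+ suc _) (+ 0)     (+ suc _) = inj₁ (selling 0≤+ 0≤+ 0≤+ (inj₂ (inj₁ (0<s , 0<s))))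
  selling? (+ suc _) (+ suc _) (+ 0)     = inj₁ (selling 0≤+ 0≤+ 0≤+ (inj₂ (inj₂ (0<s , 0<s))))
  selling? (+ 0) (+ 0) (+ 0) = inj₂ refl
  selling? (+ 0) (+ 0) (+ suc _) = inj₂ refl
  selling? (+ 0) (+ 0) -[1+ _ ] = inj₂ refl
  selling? (+ 0) (+ suc _) (+ 0) = inj₂ refl
  selling? (+ 0) (+ suc _) -[1+ _ ] = inj₂ refl
  selling? (+ 0) -[1+ _ ] (+ 0) = inj₂ refl
  selling? (+ 0) -[1+ _ ] (+ suc _) = inj₂ refl
  selling? (+ 0) -[1+ _ ] -[1+ _ ] = inj₂ refl
  selling? (+ suc _) (+ 0) (+ 0) = inj₂ refl
  selling? (+ suc _) (+ 0) -[1+ _ ] = inj₂ refl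
  selling? (+ suc _) (+ suc _) -[1+ _ ] = inj₂ refl
  selling? (+ suc _) -[1+ _ ] (+ 0) = inj₂ refl
  selling? (+ suc _) -[1+ _ ] (+ suc _) = inj₂ refl
  selling? (+ suc _) -[1+ _ ] -[1+ _ ] = inj₂ refl
  selling? -[1+ _ ] (+ 0) (+ 0) = inj₂ refl
  selling? -[1+ _ ] (+ 0) (+ suc _) = inj₂ refl
  selling? -[1+ _ ] (+ 0) -[1+ _ ] = inj₂ refl
  selling? -[1+ _ ] (+ suc _) (+ 0) = inj₂ refl
  selling? -[1+ _ ] (+ suc _) (+ suc _) = inj₂ refl
  selling? -[1+ _ ] (+ suc _) -[1+ _ ] = inj₂ refl
  selling? -[1+ _ ] -[1+ _ ] (+ 0) = inj₂ refl
  selling? -[1+ _ ] -[1+ _ ] (+ suc _) = inj₂ refl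
  selling? -[1+ _ ] -[1+ _ ] -[1+ _ ] = inj₂ refl

  IsSelling : BQF → Set
  IsSelling Q = Selling (s₁ Q) (s₂ Q) (s₃ Q)

  -- The norm of x + yζ for a primitive sixth root of unity ζ, that is, the hexagonal lattice with
  -- its six units.
  norm : ℤ → ℤ → ℤ
  norm x y = x * x + x * y + y * y

  4norm : ∀ x y → + 4 * norm x y ≡ (+ 2 * x + y) * (+ 2 * x + y) + + 3 * (y * y)
  4norm = e
    where
    e : ∀ x y → + 4 * (x * x + x * y + y * y) ≡ (+ 2 * x + y) * (+ 2 * x + y) + + 3 * (y * y)
    e = solve-∀

  0≤* : ∀ {x y} → 0ℤ ≤ x → 0ℤ ≤ y → 0ℤ ≤ x * y
  0≤* {+ m} {+ n} _ _ = subst (0ℤ ≤_) (ℤ.pos-* m n) 0≤+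

  0≤+′ : ∀ {x y} → 0ℤ ≤ x → 0ℤ ≤ y → 0ℤ ≤ x + y
  0≤+′ = ℤ.+-mono-≤

  0<+≤ : ∀ {x y} → 0ℤ < x → 0ℤ ≤ y → 0ℤ < x + y
  0<+≤ = ℤ.+-mono-<-≤

  0≤⇒≡0⊎0< : ∀ {x} → 0ℤ ≤ x → x ≡ 0ℤ ⊎ 0ℤ < x
  0≤⇒≡0⊎0< {+ zero}  _ = inj₁ refl
  0≤⇒≡0⊎0< {+ suc _} _ = inj₂ 0<s

  0≢1 : 0ℤ ≢ 1ℤ
  0≢1 ()

  square≡0 : ∀ {x} → x * x ≡ 0ℤ → x ≡ 0ℤ
  square≡0 {+ zero} _ = refl
  square≡0 {+ suc _} ()
  square≡0 { -[1+ _ ]} ()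

  sum≡0 : ∀ {x y} → 0ℤ ≤ x → 0ℤ ≤ y → x + y ≡ 0ℤ → x ≡ 0ℤ × y ≡ 0ℤ
  sum≡0 {+ zero} {+ zero} _ _ _ = refl , refl
  sum≡0 {+ suc m} {+ n} _ _ ()

  0≤norm : ∀ x y → 0ℤ ≤ norm x y
  0≤norm x y = ℤ.*-cancelˡ-≤-pos 0ℤ (norm x y) (+ 4) (subst (0ℤ ≤_) (sym (4norm x y))
    (0≤+′ (0≤z² (+ 2 * x + y)) (0≤* {+ 3} 0≤+ (0≤z² y))))

  norm≡0 : ∀ x y → norm x y ≡ 0ℤ → x ≡ 0ℤ × y ≡ 0ℤ
  norm≡0 x y n≡0 = x≡0 , y≡0
    where
    parts = sum≡0 (0≤z² (+ 2 * x + y)) (0≤* {+ 3} 0≤+ (0≤z² y))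
              (trans (sym (4norm x y)) (cong (+ 4 *_) n≡0))
    y≡0 : y ≡ 0ℤ
    y≡0 = square≡0 (ℤ.*-cancelˡ-≡ (+ 3) (y * y) 0ℤ (proj₂ parts))
    e : ∀ x → + 2 * x + 0ℤ ≡ + 2 * x
    e x = ℤ.+-identityʳ (+ 2 * x)
    x≡0 : x ≡ 0ℤ
    x≡0 = ℤ.*-cancelˡ-≡ (+ 2) x 0ℤ (trans (sym (e x)) (subst (λ u → + 2 * x + u ≡ 0ℤ) y≡0 (square≡0 (proj₁ parts))))

  0<norm : ∀ {x y} → ¬ (x ≡ 0ℤ × y ≡ 0ℤ) → 0ℤ < norm x y
  0<norm {x} {y} xy≢0 with 0≤⇒≡0⊎0< (0≤norm x y)
  ... | inj₁ n≡0 = ⊥-elim (xy≢0 (norm≡0 x y n≡0))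
  ... | inj₂ 0<n = 0<n

  0≤pred : ∀ {x} → 0ℤ < x → 0ℤ ≤ x - 1ℤ
  0≤pred {+ suc m} _ = 0≤+
  0≤pred {+ zero} (+<+ ())

  data Unit6 : ℤ → ℤ → Set where
    hex₀ : Unit6 1ℤ 0ℤ
    hex₁ : Unit6 0ℤ 1ℤ
    hex₂ : Unit6 -1ℤ 1ℤ
    hex₃ : Unit6 -1ℤ 0ℤ
    hex₄ : Unit6 0ℤ -1ℤ
    hex₅ : Unit6 1ℤ -1ℤ

  square≡1 : ∀ {x} → x * x ≡ 1ℤ → x ≡ 1ℤ ⊎ x ≡ -1ℤ
  square≡1 {+ 1} _ = inj₁ refl
  square≡1 { -[1+ 0 ]} _ = inj₂ refl
  square≡1 {+ 0} ()
  square≡1 {+ suc (suc m)} ()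
  square≡1 { -[1+ suc m ]} ()

  -- 4 = u² + 3y² forces ∣ y ∣ ≤ 1.
  y-small : ∀ u y → u * u + + 3 * (y * y) ≡ + 4 → y ≡ 0ℤ ⊎ y ≡ 1ℤ ⊎ y ≡ -1ℤ
  y-small u (+ 0) _ = inj₁ refl
  y-small u (+ 1) _ = inj₂ (inj₁ refl)
  y-small u -[1+ 0 ] _ = inj₂ (inj₂ refl)
  y-small u (+ suc (suc m)) eq = ⊥-elim (large (+ m) (u * u) 0≤+ (0≤z² u) eq)
    where
    large : ∀ m v → 0ℤ ≤ m → 0ℤ ≤ v → v + + 3 * ((+ 2 + m) * (+ 2 + m)) ≢ + 4
    large m v 0≤m 0≤v eq = 8≢0 (proj₁ (sum≡0 0≤+
        (0≤+′ 0≤v (0≤+′ (0≤* {+ 12} 0≤+ 0≤m) (0≤* {+ 3} 0≤+ (0≤z² m))))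
        (trans (e m v) (cong (_- + 4) eq))))
      where
      e : ∀ m v → + 8 + (v + (+ 12 * m + + 3 * (m * m))) ≡ v + + 3 * ((+ 2 + m) * (+ 2 + m)) - + 4
      e = solve-∀
      8≢0 : + 8 ≢ 0ℤ
      8≢0 ()
  y-small u -[1+ suc m ] eq = y-small′ (y-small u (+ suc (suc m)) eq)
    where
    y-small′ : + suc (suc m) ≡ 0ℤ ⊎ + suc (suc m) ≡ 1ℤ ⊎ + suc (suc m) ≡ -1ℤ → _
    y-small′ (inj₁ ())
    y-small′ (inj₂ (inj₁ ()))
    y-small′ (inj₂ (inj₂ ()))

  norm≡1 : ∀ x y → norm x y ≡ 1ℤ → Unit6 x y
  norm≡1 x y eq with y-small (+ 2 * x + y) y (trans (sym (4norm x y)) (cong (+ 4 *_) eq))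
  ... | inj₁ refl = case₀ x (square≡1 (trans (e x) eq))
    where
    e : ∀ x → x * x ≡ x * x + x * 0ℤ + 0ℤ * 0ℤ
    e = solve-∀
    case₀ : ∀ x → x ≡ 1ℤ ⊎ x ≡ -1ℤ → Unit6 x 0ℤ
    case₀ _ (inj₁ refl) = hex₀
    case₀ _ (inj₂ refl) = hex₃
  ... | inj₂ (inj₁ refl) = case₁ (ℤ.i*j≡0⇒i≡0∨j≡0 x (trans (e x) (cong (_- 1ℤ) eq)))
    where
    e : ∀ x → x * (x + 1ℤ) ≡ x * x + x * 1ℤ + 1ℤ * 1ℤ - 1ℤ
    e = solve-∀
    case₁ : x ≡ 0ℤ ⊎ x + 1ℤ ≡ 0ℤ → Unit6 x 1ℤ
    case₁ (inj₁ refl) = hex₁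
    case₁ (inj₂ p) = subst (λ u → Unit6 u 1ℤ) (sym (trans (shift x) (cong (_- 1ℤ) p))) hex₂
      where
      shift : ∀ x → x ≡ x + 1ℤ - 1ℤ
      shift = solve-∀
  ... | inj₂ (inj₂ refl) = case₂ (ℤ.i*j≡0⇒i≡0∨j≡0 x (trans (e x) (cong (_- 1ℤ) eq)))
    where
    e : ∀ x → x * (x - 1ℤ) ≡ x * x + x * -1ℤ + -1ℤ * -1ℤ - 1ℤ
    e = solve-∀
    case₂ : x ≡ 0ℤ ⊎ x - 1ℤ ≡ 0ℤ → Unit6 x -1ℤ
    case₂ (inj₁ refl) = hex₄
    case₂ (inj₂ p) = subst (λ u → Unit6 u -1ℤ) (sym (trans (shift x) (cong (_+ 1ℤ) p))) hex₅
      where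
      shift : ∀ x → x ≡ x - 1ℤ + 1ℤ
      shift = solve-∀

  -- A linear functional of the form, minimised on each orbit by the Selling-reduced forms. On half
  -- the square of the linear form with coefficients x, y its value is `norm x y`.
  size : BQF → ℤ
  size Q = s₁ Q + s₂ Q + s₃ Q

  -- The substitution turns the linear forms x - y, x and y into those whose coefficients appear
  -- here. Each of the three originals has norm 1.
  excess : BQF → Matrix → ℤ
  excess Q (α , β , γ , δ) =
    s₁ Q * (norm (α - γ) (β - δ) - 1ℤ) + s₂ Q * (norm α β - 1ℤ) + s₃ Q * (norm γ δ - 1ℤ)

  size-◂ : ∀ Q M → size (Q ◂ M) ≡ size Q + excess Q M
  size-◂ ⟨ a , b , c ⟩ (α , β , γ , δ) = e a b c α β γ δ
    where
    e : ∀ a b c α β γ δ →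
      - (+ 2 * (a * (α * β)) + b * (α * δ + β * γ) + + 2 * (c * (γ * δ)))
      + (+ 2 * (a * (α * α) + b * (α * γ) + c * (γ * γ)) + (+ 2 * (a * (α * β)) + b * (α * δ + β * γ) + + 2 * (c * (γ * δ))))
      + (+ 2 * (a * (β * β) + b * (β * δ) + c * (δ * δ)) + (+ 2 * (a * (α * β)) + b * (α * δ + β * γ) + + 2 * (c * (γ * δ))))
      ≡ (- b + (+ 2 * a + b) + (+ 2 * c + b))
        + (- b * ((α - γ) * (α - γ) + (α - γ) * (β - δ) + (β - δ) * (β - δ) - 1ℤ)
          + (+ 2 * a + b) * (α * α + α * β + β * β - 1ℤ)
          + (+ 2 * c + b) * (γ * γ + γ * δ + δ * δ - 1ℤ))
    e = solve-∀

  module Terms (Q : BQF) (α β γ δ : ℤ) (S : IsSelling Q) (det≡1 : α * δ - β * γ ≡ 1ℤ) where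
    open Selling S

    row₁≢0 : ¬ (α ≡ 0ℤ × β ≡ 0ℤ)
    row₁≢0 (refl , refl) = 0≢1 (trans (sym (e γ δ)) det≡1)
      where
      e : ∀ γ δ → 0ℤ * δ - 0ℤ * γ ≡ 0ℤ
      e = solve-∀

    row₂≢0 : ¬ (γ ≡ 0ℤ × δ ≡ 0ℤ)
    row₂≢0 (refl , refl) = 0≢1 (trans (sym (e α β)) det≡1)
      where
      e : ∀ α β → α * 0ℤ - β * 0ℤ ≡ 0ℤ
      e = solve-∀

    diff≢0 : ¬ (α - γ ≡ 0ℤ × β - δ ≡ 0ℤ)
    diff≢0 (p , q) = 0≢1 (trans (sym (trans (e α β γ δ) (trans (cong₂ (λ u v → u * δ - v * γ) p q) (z γ δ)))) det≡1)
      where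
      z : ∀ γ δ → 0ℤ * δ - 0ℤ * γ ≡ 0ℤ
      z = solve-∀
      e : ∀ α β γ δ → α * δ - β * γ ≡ (α - γ) * δ - (β - δ) * γ
      e = solve-∀

    t₁ : 0ℤ ≤ s₁ Q * (norm (α - γ) (β - δ) - 1ℤ)
    t₁ = 0≤* 0≤x (0≤pred (0<norm diff≢0))
    t₂ : 0ℤ ≤ s₂ Q * (norm α β - 1ℤ)
    t₂ = 0≤* 0≤y (0≤pred (0<norm row₁≢0))
    t₃ : 0ℤ ≤ s₃ Q * (norm γ δ - 1ℤ)
    t₃ = 0≤* 0≤z (0≤pred (0<norm row₂≢0))

    -- A matrix of determinant 1 sends none of the three linear forms to zero, so every new norm is
    -- at least 1 and every summand is non-negative.
    0≤excess : 0ℤ ≤ excess Q (α , β , γ , δ)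
    0≤excess = 0≤+′ (0≤+′ t₁ t₂) t₃

  adj-◂ : ∀ Q M → det M ≡ 1ℤ → Q ◂ M ◂ adj M ≡ Q
  adj-◂ Q (α , β , γ , δ) d = sym (_~_.R≡Q∙M (~-sym {Q} (sl₂ α β γ δ d , refl)))

  det-adj : ∀ M → det (adj M) ≡ det M
  det-adj (α , β , γ , δ) = e α β γ δ
    where
    e : ∀ α β γ δ → δ * α - (- β) * (- γ) ≡ α * δ - β * γ
    e = solve-∀

  -- Going by `M` and returning by `adj M` restores the size, so the two non-negative excesses add
  -- up to zero.
  excess≡0 : ∀ Q M → IsSelling Q → det M ≡ 1ℤ → IsSelling (Q ◂ M) → excess Q M ≡ 0ℤ
  excess≡0 Q M@(α , β , γ , δ) S d S′ = proj₁ (sum≡0 (Terms.0≤excess Q α β γ δ S d)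
      (Terms.0≤excess (Q ◂ M) δ (- β) (- γ) α S′ (trans (det-adj M) d)) (cancel (size Q) _ _
        (trans (sym (cong size (adj-◂ Q M d))) (trans (size-◂ (Q ◂ M) (adj M)) (cong (_+ excess (Q ◂ M) (adj M)) (size-◂ Q M))))))
    where
    cancel : ∀ x y z → x ≡ x + y + z → y + z ≡ 0ℤ
    cancel x y z p = trans (e x y z) (trans (cong (_- x) (sym p)) (ℤ.+-inverseʳ x))
      where
      e : ∀ x y z → y + z ≡ x + y + z - x
      e = solve-∀

  unit : ∀ {s} x y → 0ℤ < s → s * (norm x y - 1ℤ) ≡ 0ℤ → Unit6 x y
  unit {s} x y 0<s′ p with ℤ.i*j≡0⇒i≡0∨j≡0 s p
  ... | inj₁ refl = ⊥-elim (ℤ.<-irrefl refl 0<s′)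
  ... | inj₂ q = norm≡1 x y (trans (e (norm x y)) (cong (_+ 1ℤ) q))
    where
    e : ∀ n → n ≡ n - 1ℤ + 1ℤ
    e = solve-∀

  -- The first six matrices, up to sign, permute s₁, s₂, s₃ cyclically.
  data Twelve : Matrix → Set where
    r₀  : Twelve (1ℤ , 0ℤ , 0ℤ , 1ℤ)
    r₀′ : Twelve (-1ℤ , 0ℤ , 0ℤ , -1ℤ)
    r₁  : Twelve (0ℤ , 1ℤ , -1ℤ , 1ℤ)
    r₁′ : Twelve (0ℤ , -1ℤ , 1ℤ , -1ℤ)
    r₂  : Twelve (-1ℤ , 1ℤ , -1ℤ , 0ℤ)
    r₂′ : Twelve (1ℤ , -1ℤ , 1ℤ , 0ℤ)
    f₀  : Twelve (1ℤ , 0ℤ , -1ℤ , 1ℤ)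
    f₀′ : Twelve (-1ℤ , 0ℤ , 1ℤ , -1ℤ)
    f₁  : Twelve (0ℤ , 1ℤ , -1ℤ , 0ℤ)
    f₁′ : Twelve (0ℤ , -1ℤ , 1ℤ , 0ℤ)
    f₂  : Twelve (-1ℤ , 1ℤ , 0ℤ , -1ℤ)
    f₂′ : Twelve (1ℤ , -1ℤ , 0ℤ , 1ℤ)

  -- Two units of the hexagonal lattice have determinant 1 in this basis exactly when the angle
  -- between them is 60° or 120°. The first case gives the `r` matrices and the second the `f`
  -- matrices; the remaining pairs are refuted by computing the determinant.
  twelve : ∀ {α β γ δ} → Unit6 α β → Unit6 γ δ → α * δ - β * γ ≡ 1ℤ → Twelve (α , β , γ , δ)
  twelve hex₀ hex₁ refl = r₀
  twelve hex₀ hex₂ refl = f₀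
  twelve hex₁ hex₂ refl = r₁
  twelve hex₁ hex₃ refl = f₁
  twelve hex₂ hex₃ refl = r₂
  twelve hex₂ hex₄ refl = f₂
  twelve hex₃ hex₄ refl = r₀′
  twelve hex₃ hex₅ refl = f₀′
  twelve hex₄ hex₅ refl = r₁′
  twelve hex₄ hex₀ refl = f₁′
  twelve hex₅ hex₀ refl = r₂′
  twelve hex₅ hex₁ refl = f₂′

  -- With `s₂` and `s₃` positive, a vanishing excess forces both rows of `M` to have norm 1.
  selling-unique : ∀ Q M → IsSelling Q → 0ℤ < s₂ Q → 0ℤ < s₃ Q → det M ≡ 1ℤ → IsSelling (Q ◂ M) → Twelve M
  selling-unique Q M@(α , β , γ , δ) S 0<s₂ 0<s₃ d S′ =
    twelve (unit α β 0<s₂ (proj₂ inner)) (unit γ δ 0<s₃ (proj₂ outer)) d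
    where
    open Terms Q α β γ δ S d
    outer = sum≡0 (0≤+′ t₁ t₂) t₃ (excess≡0 Q M S d S′)
    inner = sum≡0 t₁ t₂ (proj₁ outer)

-- The total weight of an equivalence class.

module Classes where

  open import Defs
  open FinSum
  open Forms
  open import Data.Integer.Base using (_+_; _*_; _-_; -_; _<_; _≤_)
  open import Data.Integer.Tactic.RingSolver using (solve-∀)
  open import Data.Nat.Induction using (<-wellFounded)
  open import Data.List.Relation.Unary.Any using (here; there)
  open import Data.List.Relation.Unary.All using ([]; _∷_)
  open import Data.List.Relation.Unary.AllPairs using ([]; _∷_)

  open ℤΣ

  triple : BQF → ℤ × ℤ × ℤ
  triple Q = s₁ Q , s₂ Q , s₃ Q

  triple-injective : ∀ Q R → triple Q ≡ triple R → Q ≡ R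
  triple-injective ⟨ a , b , c ⟩ ⟨ a′ , b′ , c′ ⟩ eq =
    ⟨⟩-cong (half a a′ (cong (λ t → proj₁ (proj₂ t)) eq)) b≡b′ (half c c′ (cong (λ t → proj₂ (proj₂ t)) eq))
    where
    b≡b′ : b ≡ b′
    b≡b′ = ℤ.neg-injective (cong proj₁ eq)
    half : ∀ u v → + 2 * u + b ≡ + 2 * v + b′ → u ≡ v
    half u v p = ℤ.*-cancelˡ-≡ (+ 2) u v (trans (e u b) (trans (cong₂ _-_ p b≡b′) (sym (e v b′))))
      where
      e : ∀ u b → + 2 * u ≡ + 2 * u + b - b
      e = solve-∀

  weightᵗ : ℤ × ℤ × ℤ → ℤ
  weightᵗ (x , y , z) = weight₃ x y z

  -- The `r` matrices rotate the triangle. The `f` matrices cross the side x = 0 into the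
  -- neighbouring triangle: they produce the entry `- x`, so a Selling triple stays Selling under
  -- them only if x = 0.
  image : ℤ × ℤ × ℤ → ∀ {M} → Twelve M → ℤ × ℤ × ℤ
  image (x , y , z) r₀  = x , y , z
  image (x , y , z) r₀′ = x , y , z
  image (x , y , z) r₁  = z , x , y
  image (x , y , z) r₁′ = z , x , y
  image (x , y , z) r₂  = y , z , x
  image (x , y , z) r₂′ = y , z , x
  image (x , y , z) f₀  = x + x + z , x + x + y , - x
  image (x , y , z) f₀′ = x + x + z , x + x + y , - x
  image (x , y , z) f₁  = - x , x + x + z , x + x + y
  image (x , y , z) f₁′ = - x , x + x + z , x + x + y
  image (x , y , z) f₂  = x + x + y , - x , x + x + z
  image (x , y , z) f₂′ = x + x + y , - x , x + x + z

  triple-cong : ∀ {x x′ y y′ z z′ : ℤ} → x ≡ x′ → y ≡ y′ → z ≡ z′ → (x , y , z) ≡ (x′ , y′ , z′)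
  triple-cong refl refl refl = refl

  private module Images where
    r₁x : ∀ a b c → - (+ 2 * (a * (0ℤ * 1ℤ)) + b * (0ℤ * 1ℤ + 1ℤ * -1ℤ) + + 2 * (c * (-1ℤ * 1ℤ))) ≡ (+ 2 * c + b)
    r₁x = solve-∀
    r₁y : ∀ a b c → + 2 * (a * (0ℤ * 0ℤ) + b * (0ℤ * -1ℤ) + c * (-1ℤ * -1ℤ)) + (+ 2 * (a * (0ℤ * 1ℤ)) + b * (0ℤ * 1ℤ + 1ℤ * -1ℤ) + + 2 * (c * (-1ℤ * 1ℤ))) ≡ (- b)
    r₁y = solve-∀
    r₁z : ∀ a b c → + 2 * (a * (1ℤ * 1ℤ) + b * (1ℤ * 1ℤ) + c * (1ℤ * 1ℤ)) + (+ 2 * (a * (0ℤ * 1ℤ)) + b * (0ℤ * 1ℤ + 1ℤ * -1ℤ) + + 2 * (c * (-1ℤ * 1ℤ))) ≡ (+ 2 * a + b)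
    r₁z = solve-∀
    f₀x : ∀ a b c → - (+ 2 * (a * (1ℤ * 0ℤ)) + b * (1ℤ * 1ℤ + 0ℤ * -1ℤ) + + 2 * (c * (-1ℤ * 1ℤ))) ≡ (- b) + (- b) + (+ 2 * c + b)
    f₀x = solve-∀
    f₀y : ∀ a b c → + 2 * (a * (1ℤ * 1ℤ) + b * (1ℤ * -1ℤ) + c * (-1ℤ * -1ℤ)) + (+ 2 * (a * (1ℤ * 0ℤ)) + b * (1ℤ * 1ℤ + 0ℤ * -1ℤ) + + 2 * (c * (-1ℤ * 1ℤ))) ≡ (- b) + (- b) + (+ 2 * a + b)
    f₀y = solve-∀
    f₀z : ∀ a b c → + 2 * (a * (0ℤ * 0ℤ) + b * (0ℤ * 1ℤ) + c * (1ℤ * 1ℤ)) + (+ 2 * (a * (1ℤ * 0ℤ)) + b * (1ℤ * 1ℤ + 0ℤ * -1ℤ) + + 2 * (c * (-1ℤ * 1ℤ))) ≡ - (- b)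
    f₀z = solve-∀

  open Images

  triple-r₁ : ∀ Q → triple (Q ◂ (0ℤ , 1ℤ , -1ℤ , 1ℤ)) ≡ image (triple Q) r₁
  triple-r₁ ⟨ a , b , c ⟩ = triple-cong (r₁x a b c) (r₁y a b c) (r₁z a b c)

  triple-f₀ : ∀ Q → triple (Q ◂ (1ℤ , 0ℤ , -1ℤ , 1ℤ)) ≡ image (triple Q) f₀
  triple-f₀ ⟨ a , b , c ⟩ = triple-cong (f₀x a b c) (f₀y a b c) (f₀z a b c)

  triple-⊡r₁ : ∀ Q M → triple (Q ◂ (M ⊡ (0ℤ , 1ℤ , -1ℤ , 1ℤ))) ≡ image (triple (Q ◂ M)) r₁
  triple-⊡r₁ Q M = trans (cong triple (◂-⊡ Q M (0ℤ , 1ℤ , -1ℤ , 1ℤ))) (triple-r₁ (Q ◂ M))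

  triple-f₁ : ∀ Q → triple (Q ◂ (0ℤ , 1ℤ , -1ℤ , 0ℤ)) ≡ image (triple Q) f₁
  triple-f₁ Q = trans (triple-⊡r₁ Q (1ℤ , 0ℤ , -1ℤ , 1ℤ)) (cong (λ t → image t r₁) (triple-f₀ Q))

  -- Besides the identity only `r₁` and `f₀` need a computation: the others are products of these,
  -- and opposite matrices act alike.
  triple-◂ : ∀ Q {M} (m : Twelve M) → triple (Q ◂ M) ≡ image (triple Q) m
  triple-◂ Q r₀  = cong triple (sym (_~_.R≡Q∙M (~-refl {Q})))
  triple-◂ Q r₀′ = cong triple (sym (_~_.R≡Q∙M (~-refl {Q})))
  triple-◂ Q r₁  = triple-r₁ Q
  triple-◂ Q r₁′ = triple-r₁ Q
  triple-◂ Q r₂  = trans (triple-⊡r₁ Q (0ℤ , 1ℤ , -1ℤ , 1ℤ)) (cong (λ t → image t r₁) (triple-r₁ Q))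
  triple-◂ Q r₂′ = triple-◂ Q r₂
  triple-◂ Q f₀  = triple-f₀ Q
  triple-◂ Q f₀′ = triple-f₀ Q
  triple-◂ Q f₁  = triple-f₁ Q
  triple-◂ Q f₁′ = triple-f₁ Q
  triple-◂ Q f₂  = trans (triple-⊡r₁ Q (0ℤ , 1ℤ , -1ℤ , 0ℤ)) (cong (λ t → image t r₁) (triple-f₁ Q))
  triple-◂ Q f₂′ = triple-◂ Q f₂

  -- Stronger than being Selling: only `s₁` may vanish, which fixes the side on which a boundary
  -- form lies and supplies the positivity that `selling-unique` asks for.
  record Reduction (Q : BQF) : Set where
    field
      R    : BQF
      Q~R  : Q ~ R
      0≤s₁ : 0ℤ ≤ s₁ R
      0<s₂ : 0ℤ < s₂ R
      0<s₃ : 0ℤ < s₃ R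

  ≤-split : ∀ {b a} → b ℕ.≤ a → ∃[ d ] + a ≡ + b + + d
  ≤-split {b} {a} b≤a = a ℕ.∸ b , cong +_ (sym (ℕ.m+[n∸m]≡n b≤a))

  reduction : ∀ {n} (Q : PosForm n) → Reduction (PosForm.form Q)
  reduction Q = from (reduce Q (<-wellFounded ∣ BQF.a (PosForm.form Q) ∣))
    where
    open PosForm
    bound : ∀ {a b} → ∣ b ∣ ℕ.≤ ∣ a ∣ → 0ℤ < a → 0ℤ < + 2 * a - + ∣ b ∣
    bound {+ suc a} {b} b≤a _ with ≤-split b≤a
    ... | d , p = subst (0ℤ <_) (e (+ suc a) (+ ∣ b ∣) (+ d) p) (0<+≤ {+ suc a} {+ d} 0<s 0≤+)
      where
      e′ : ∀ b d → (b + d) + d ≡ + 2 * (b + d) - b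
      e′ = solve-∀
      e : ∀ a b d → a ≡ b + d → a + d ≡ + 2 * a - b
      e _ b d refl = e′ b d
    bound {+ zero} _ (+<+ ())
    from : (∃[ R ] form Q ~ form R × Reduced (form R)) → Reduction (form Q)
    from (R@(posForm ⟨ a , + zero , c ⟩ _ _) , Q~R , (b≤a , a≤c)) = record
      { R = form R ; Q~R = Q~R ; 0≤s₁ = 0≤+
      ; 0<s₂ = bound {a} {+ 0} b≤a (0<a R) ; 0<s₃ = bound {c} {+ 0} z≤n (0<c R) }
    from (R@(posForm ⟨ a , -[1+ b ] , c ⟩ _ _) , Q~R , (b≤a , a≤c)) = record
      { R = form R ; Q~R = Q~R ; 0≤s₁ = 0≤+
      ; 0<s₂ = bound {a} { -[1+ b ]} b≤a (0<a R) ; 0<s₃ = bound {c} { -[1+ b ]} (ℕ.≤-trans b≤a a≤c) (0<c R) }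
    -- A Gauss-reduced form with b > 0 has `s₁` negative. The translation by -1 replaces b by b - 2a
    -- and gives the parameters 2a - b, b and 2c - b.
    from (R@(posForm ⟨ a , + suc b , c ⟩ _ _) , Q~R , (b≤a , a≤c)) = record
      { R = form R ∙ translate -1ℤ
      ; Q~R = ~-trans {form Q} {form R} Q~R (translate -1ℤ , refl)
      ; 0≤s₁ = subst (0ℤ ≤_) (sym (e₁ a (+ suc b) c)) (ℤ.<⇒≤ (bound {a} {+ suc b} b≤a (0<a R)))
      ; 0<s₂ = subst (0ℤ <_) (sym (e₂ a (+ suc b) c)) 0<s
      ; 0<s₃ = subst (0ℤ <_) (sym (e₃ a (+ suc b) c)) (bound {c} {+ suc b} (ℕ.≤-trans b≤a a≤c) (0<c R)) }
      where
      e₁ : ∀ a b c → - (+ 2 * (a * (1ℤ * -1ℤ)) + b * (1ℤ * 1ℤ + -1ℤ * 0ℤ) + + 2 * (c * (0ℤ * 1ℤ))) ≡ + 2 * a - b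
      e₁ = solve-∀
      e₂ : ∀ a b c → + 2 * (a * (1ℤ * 1ℤ) + b * (1ℤ * 0ℤ) + c * (0ℤ * 0ℤ))
        + (+ 2 * (a * (1ℤ * -1ℤ)) + b * (1ℤ * 1ℤ + -1ℤ * 0ℤ) + + 2 * (c * (0ℤ * 1ℤ))) ≡ b
      e₂ = solve-∀
      e₃ : ∀ a b c → + 2 * (a * (-1ℤ * -1ℤ) + b * (-1ℤ * 1ℤ) + c * (1ℤ * 1ℤ))
        + (+ 2 * (a * (1ℤ * -1ℤ)) + b * (1ℤ * 1ℤ + -1ℤ * 0ℤ) + + 2 * (c * (0ℤ * 1ℤ))) ≡ + 2 * c - b
      e₃ = solve-∀

  ¬selling⇒weight≡0 : ∀ {x y z} → ¬ Selling x y z → weight₃ x y z ≡ 0ℤ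
  ¬selling⇒weight≡0 {x} {y} {z} ¬S = [ (λ S → ⊥-elim (¬S S)) , (λ p → p) ]′ (selling? x y z)

  m₀ m₁ m₂ n₀ n₁ n₂ : Matrix
  m₀ = 1ℤ , 0ℤ , 0ℤ , 1ℤ
  m₁ = 0ℤ , 1ℤ , -1ℤ , 1ℤ
  m₂ = -1ℤ , 1ℤ , -1ℤ , 0ℤ
  n₀ = 1ℤ , 0ℤ , -1ℤ , 1ℤ
  n₁ = 0ℤ , 1ℤ , -1ℤ , 0ℤ
  n₂ = -1ℤ , 1ℤ , 0ℤ , -1ℤ

  ~◂ : ∀ {Q R} → Q ~ R → ∀ M → det M ≡ 1ℤ → Q ~ R ◂ M
  ~◂ {Q} {R} Q~R (α , β , γ , δ′) d = ~-trans {Q} {R} Q~R (sl₂ α β γ δ′ d , refl)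

  -- 6 / ω
  massOf : ∀ {P P′ : Set} → Dec P → Dec P′ → ℤ
  massOf P? P′? = if does P? then + 3 else if does P′? then + 2 else + 6

  module _ {P P′ : Set} where

    mass-square : (P? : Dec P) (P′? : Dec P′) → P → massOf P? P′? ≡ + 3
    mass-square (yes _) _ _ = refl
    mass-square (no ¬p) _ p = ⊥-elim (¬p p)

    mass-hexagonal : (P? : Dec P) (P′? : Dec P′) → ¬ P → P′ → massOf P? P′? ≡ + 2
    mass-hexagonal (yes p) _        ¬p _  = ⊥-elim (¬p p)
    mass-hexagonal (no _)  (yes _)  _  _  = refl
    mass-hexagonal (no _)  (no ¬p′) _  p′ = ⊥-elim (¬p′ p′)

    mass-generic : (P? : Dec P) (P′? : Dec P′) → ¬ P → ¬ P′ → massOf P? P′? ≡ + 6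
    mass-generic (yes p) _        ¬p _   = ⊥-elim (¬p p)
    mass-generic (no _)  (yes p′) _  ¬p′ = ⊥-elim (¬p′ p′)
    mass-generic (no _)  (no _)   _  _   = refl

  only-cover : ∀ {P X : Set} (P? : Dec P) {v} → (P → X ⊎ v ≡ 0ℤ) → X ⊎ only P? v ≡ 0ℤ
  only-cover (yes p) k = k p
  only-cover (no _)  k = inj₂ refl

  module _ {n} (Q : PosForm n) where

    open PosForm Q renaming (form to q)

    -- Abstract, since the bounded searches behind these decisions should never be unfolded.
    abstract
      class? : ∀ R → Dec (q ~ R)
      class? R = Q ~? R

      square? : Dec (∃[ e ] q ~ ⟨ e , 0ℤ , e ⟩)
      square? = ∼x²+y²? Q

      hexagonal? : Dec (∃[ e ] q ~ ⟨ e , e , e ⟩)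
      hexagonal? = ∼x²+xy+y²? Q

      square?-does : does square? ≡ does (∼x²+y²? Q)
      square?-does = refl

      hexagonal?-does : does hexagonal? ≡ does (∼x²+xy+y²? Q)
      hexagonal?-does = refl

    mass : ℤ
    mass = massOf square? hexagonal?

    0<~ : ∀ {e b c} → q ~ ⟨ e , b , c ⟩ → 0ℤ < e
    0<~ (M , refl) = 0<a (actPos Q M)

    -- Makes the exceptional class recognisable by its parameters: x² + y² lies on a side, at the
    -- point where the other two parameters agree.
    square-triple : ∀ {e} → q ~ ⟨ e , 0ℤ , e ⟩ → ∃[ S ] ∃[ u ] q ~ S × triple S ≡ (0ℤ , + suc u , + suc u)
    square-triple {e} p = go e p (0<~ p)
      where
      go : ∀ e → q ~ ⟨ e , 0ℤ , e ⟩ → 0ℤ < e → ∃[ S ] ∃[ u ] q ~ S × triple S ≡ (0ℤ , + suc u , + suc u)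
      go (+ suc k) p _ = ⟨ + suc k , 0ℤ , + suc k ⟩ , k ℕ.+ 1 ℕ.* suc k ℕ.+ 0 , p , refl
      go (+ zero) p (+<+ ())

    -- The form x² + xy + y² has `s₁` negative; after a translation all three parameters agree,
    -- which is the centre of a triangle.
    hexagonal-triple : ∀ {e} → q ~ ⟨ e , e , e ⟩ → ∃[ S ] ∃[ u ] q ~ S × triple S ≡ (+ suc u , + suc u , + suc u)
    hexagonal-triple {e} p = go e p (0<~ p)
      where
      e₁ : ∀ e → e ≡ e * (1ℤ * 1ℤ) + e * (1ℤ * 0ℤ) + e * (0ℤ * 0ℤ)
      e₁ = solve-∀
      e₂ : ∀ e → - e ≡ + 2 * (e * (1ℤ * -1ℤ)) + e * (1ℤ * 1ℤ + -1ℤ * 0ℤ) + + 2 * (e * (0ℤ * 1ℤ))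
      e₂ = solve-∀
      e₃ : ∀ e → e ≡ e * (-1ℤ * -1ℤ) + e * (-1ℤ * 1ℤ) + e * (1ℤ * 1ℤ)
      e₃ = solve-∀
      e₄ : ∀ e → + 2 * e + - e ≡ e
      e₄ = solve-∀
      go : ∀ e → q ~ ⟨ e , e , e ⟩ → 0ℤ < e → ∃[ S ] ∃[ u ] q ~ S × triple S ≡ (+ suc u , + suc u , + suc u)
      go (+ zero) p (+<+ ())
      go (+ suc k) p _ = ⟨ + suc k , - + suc k , + suc k ⟩ , k ,
        ~-trans {q} {⟨ + suc k , + suc k , + suc k ⟩} p
          (translate -1ℤ , ⟨⟩-cong (e₁ (+ suc k)) (e₂ (+ suc k)) (e₃ (+ suc k))) ,
        triple-cong refl (e₄ (+ suc k)) (e₄ (+ suc k))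

    term : BQF → ℤ
    term S = only (class? S) (weight S)

    term-at : ∀ {R} → q ~ R → ∀ M → det M ≡ 1ℤ → (m : Twelve M) → term (R ◂ M) ≡ weightᵗ (image (triple R) m)
    term-at {R} q~R M d m = trans (only-yes (class? (R ◂ M)) (~◂ q~R M d)) (cong weightᵗ (triple-◂ R m))

    term-cover : ∀ {P : BQF → Set} → (∀ S → q ~ S → IsSelling S → P S) → ∀ S → P S ⊎ term S ≡ 0ℤ
    term-cover k S = only-cover (class? S) λ q~S →
      [ (λ SS → inj₁ (k S q~S SS)) , inj₂ ]′ (selling? (s₁ S) (s₂ S) (s₃ S))

    -- The forms of non-zero weight in the class of R are R ◂ M for M among the twelve.
    module Class {R : BQF} (q~R : q ~ R) (0≤s₁ : 0ℤ ≤ s₁ R) (0<s₂ : 0ℤ < s₂ R) (0<s₃ : 0ℤ < s₃ R) where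

      R-selling : IsSelling R
      R-selling = selling 0≤s₁ (ℤ.<⇒≤ 0<s₂) (ℤ.<⇒≤ 0<s₃) (inj₁ (0<s₂ , 0<s₃))

      member : ∀ {S} → q ~ S → IsSelling S → ∃[ M ] Twelve M × S ≡ R ◂ M
      member {S} q~S SS with ~-trans {R} {q} {S} (~-sym {q} {R} q~R) q~S
      ... | sl₂ α β γ δ′ d , refl = (α , β , γ , δ′) , selling-unique R (α , β , γ , δ′) R-selling 0<s₂ 0<s₃ d SS , refl

      member-triple : ∀ {S} → q ~ S → IsSelling S → ∃[ M ] ∃ λ (m : Twelve M) → triple S ≡ image (triple R) m
      member-triple q~S SS with member q~S SS
      ... | M , m , refl = M , m , triple-◂ R m

    at-triple : ∀ {S x y z} → triple S ≡ (x , y , z) → Selling x y z → IsSelling S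
    at-triple refl S = S

    module Interior {R x y z} (q~R : q ~ R) (t : triple R ≡ (+ suc x , + suc y , + suc z)) where

      open Class {R} q~R (subst (0ℤ ≤_) (sym (cong proj₁ t)) 0≤+)
        (subst (0ℤ <_) (sym (cong (λ t → proj₁ (proj₂ t)) t)) 0<s)
        (subst (0ℤ <_) (sym (cong (λ t → proj₂ (proj₂ t)) t)) 0<s)

      data Rotation (S : BQF) : Set where
        rot₀ : S ≡ R ◂ m₀ → triple S ≡ (+ suc x , + suc y , + suc z) → Rotation S
        rot₁ : S ≡ R ◂ m₁ → triple S ≡ (+ suc z , + suc x , + suc y) → Rotation S
        rot₂ : S ≡ R ◂ m₂ → triple S ≡ (+ suc y , + suc z , + suc x) → Rotation S

      image-t : ∀ {M} (m : Twelve M) → triple (R ◂ M) ≡ image (+ suc x , + suc y , + suc z) m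
      image-t m = trans (triple-◂ R m) (cong (λ t → image t m) t)

      rotation : ∀ S → q ~ S → IsSelling S → Rotation S
      rotation S q~S SS with member {S} q~S SS
      ... | _ , r₀  , refl = rot₀ refl (image-t r₀)
      ... | _ , r₀′ , refl = rot₀ refl (image-t r₀)
      ... | _ , r₁  , refl = rot₁ refl (image-t r₁)
      ... | _ , r₁′ , refl = rot₁ refl (image-t r₁)
      ... | _ , r₂  , refl = rot₂ refl (image-t r₂)
      ... | _ , r₂′ , refl = rot₂ refl (image-t r₂)
      -- In the interior x is positive, so every crossing matrix yields a negative parameter.
      ... | _ , f₀  , refl = ⊥-elim (negative (subst (0ℤ ≤_) (cong (λ t → proj₂ (proj₂ t)) (image-t f₀)) (Selling.0≤z SS)))
        where
        negative : ¬ (0ℤ ≤ -[1+ x ])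
        negative ()
      ... | _ , f₀′ , refl = ⊥-elim (negative (subst (0ℤ ≤_) (cong (λ t → proj₂ (proj₂ t)) (image-t f₀)) (Selling.0≤z SS)))
        where
        negative : ¬ (0ℤ ≤ -[1+ x ])
        negative ()
      ... | _ , f₁  , refl = ⊥-elim (negative (subst (0ℤ ≤_) (cong proj₁ (image-t f₁)) (Selling.0≤x SS)))
        where
        negative : ¬ (0ℤ ≤ -[1+ x ])
        negative ()
      ... | _ , f₁′ , refl = ⊥-elim (negative (subst (0ℤ ≤_) (cong proj₁ (image-t f₁)) (Selling.0≤x SS)))
        where
        negative : ¬ (0ℤ ≤ -[1+ x ])
        negative ()
      ... | _ , f₂  , refl = ⊥-elim (negative (subst (0ℤ ≤_) (cong (λ t → proj₁ (proj₂ t)) (image-t f₂)) (Selling.0≤y SS)))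
        where
        negative : ¬ (0ℤ ≤ -[1+ x ])
        negative ()
      ... | _ , f₂′ , refl = ⊥-elim (negative (subst (0ℤ ≤_) (cong (λ t → proj₁ (proj₂ t)) (image-t f₂)) (Selling.0≤y SS)))
        where
        negative : ¬ (0ℤ ≤ -[1+ x ])
        negative ()

      ¬square : ¬ (∃[ e ] q ~ ⟨ e , 0ℤ , e ⟩)
      ¬square (e , p) with square-triple p
      ... | S , u , q~S , tS with rotation S q~S (at-triple {S} tS (selling 0≤+ 0≤+ 0≤+ (inj₁ (0<s , 0<s))))
      ...   | rot₀ _ t′ with () ← trans (sym tS) t′
      ...   | rot₁ _ t′ with () ← trans (sym tS) t′
      ...   | rot₂ _ t′ with () ← trans (sym tS) t′

      coincide : x ≡ y → x ≡ z → ∀ S → Rotation S → S ≡ R ◂ m₀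
      coincide refl refl S (rot₀ p _) = p
      coincide refl refl S (rot₁ _ p) = triple-injective _ _ (trans p (sym (image-t r₀)))
      coincide refl refl S (rot₂ _ p) = triple-injective _ _ (trans p (sym (image-t r₀)))

      hexagonal : x ≡ y → x ≡ z → q ~ ⟨ + suc x , + suc x , + suc x ⟩
      hexagonal refl refl = ~-trans {q} {R} q~R (translate 1ℤ ,
          trans (⟨⟩-cong (e₁ (+ suc x)) (e₂ (+ suc x)) (e₃ (+ suc x))) (cong (_∙ translate 1ℤ) (sym R≡)))
        where
        e₁ : ∀ e → e ≡ e * (1ℤ * 1ℤ) + - e * (1ℤ * 0ℤ) + e * (0ℤ * 0ℤ)
        e₁ = solve-∀
        e₂ : ∀ e → e ≡ + 2 * (e * (1ℤ * 1ℤ)) + - e * (1ℤ * 1ℤ + 1ℤ * 0ℤ) + + 2 * (e * (0ℤ * 1ℤ))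
        e₂ = solve-∀
        e₃ : ∀ e → e ≡ e * (1ℤ * 1ℤ) + - e * (1ℤ * 1ℤ) + e * (1ℤ * 1ℤ)
        e₃ = solve-∀
        e₄ : ∀ e → + 2 * e + - e ≡ e
        e₄ = solve-∀
        R≡ : R ≡ ⟨ + suc x , - + suc x , + suc x ⟩
        R≡ = triple-injective _ _ (trans t (triple-cong refl (sym (e₄ (+ suc x))) (sym (e₄ (+ suc x)))))

      term-at′ : ∀ {M} → det M ≡ 1ℤ → (m : Twelve M) → term (R ◂ M) ≡ weightᵗ (image (+ suc x , + suc y , + suc z) m)
      term-at′ {M} d m = trans (term-at q~R M d m) (cong (λ t → weightᵗ (image t m)) t)

      separate : ∀ {S S′ u v} → triple S ≡ u → triple S′ ≡ v → u ≢ v → S ≢ S′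
      separate p p′ u≢v refl = u≢v (trans (sym p) p′)

      ¬hexagonal : ¬ (x ≡ y × x ≡ z) → ¬ (∃[ e ] q ~ ⟨ e , e , e ⟩)
      ¬hexagonal ne (e , p) with hexagonal-triple p
      ... | S , u , q~S , tS with rotation S q~S (at-triple {S} tS (selling 0≤+ 0≤+ 0≤+ (inj₁ (0<s , 0<s))))
      ...   | rot₀ _ t′ = ne (diag (trans (sym tS) t′))
        where
        diag : ∀ {u x y z : ℕ} → _≡_ {A = ℤ × ℤ × ℤ} (+ suc u , + suc u , + suc u) (+ suc x , + suc y , + suc z) → x ≡ y × x ≡ z
        diag refl = refl , refl
      ...   | rot₁ _ t′ = ne (diag (trans (sym tS) t′))
        where
        diag : ∀ {u x y z : ℕ} → _≡_ {A = ℤ × ℤ × ℤ} (+ suc u , + suc u , + suc u) (+ suc z , + suc x , + suc y) → x ≡ y × x ≡ z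
        diag refl = refl , refl
      ...   | rot₂ _ t′ = ne (diag (trans (sym tS) t′))
        where
        diag : ∀ {u x y z : ℕ} → _≡_ {A = ℤ × ℤ × ℤ} (+ suc u , + suc u , + suc u) (+ suc y , + suc z , + suc x) → x ≡ y × x ≡ z
        diag refl = refl , refl

      -- The three rotations have weight 2 each. They are distinct unless x = y = z, when a single
      -- form remains and the total 2 = 6 / 3 belongs to the hexagonal class.
      weight-class : HasSum term mass
      weight-class with (x ℕ.≟ y) ×-dec (x ℕ.≟ z)
      ... | yes (x≡y , x≡z) = HasSum-≡
        (trans (term-at′ refl r₀) (sym (mass-hexagonal square? hexagonal? ¬square (+ suc x , hexagonal x≡y x≡z))))
        (HasSum-single (R ◂ m₀) (term-cover λ S q~S SS → coincide x≡y x≡z S (rotation S q~S SS)))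
      ... | no ne = hasSum (R ◂ m₀ ∷ R ◂ m₁ ∷ R ◂ m₂ ∷ [])
        ( (separate (image-t r₀) (image-t r₁) (λ { refl → ne (refl , refl) })
           ∷ separate (image-t r₀) (image-t r₂) (λ { refl → ne (refl , refl) }) ∷ [])
        ∷ (separate (image-t r₁) (image-t r₂) (λ { refl → ne (refl , refl) }) ∷ [])
        ∷ [] ∷ [])
        (term-cover λ S q~S SS → place (rotation S q~S SS))
        (trans (cong₂ _+_ (term-at′ refl r₀) (cong₂ _+_ (term-at′ refl r₁) (cong (_+ 0ℤ) (term-at′ refl r₂))))
               (sym (mass-generic square? hexagonal? ¬square (¬hexagonal ne))))
        where
        place : ∀ {S} → Rotation S → S ∈ R ◂ m₀ ∷ R ◂ m₁ ∷ R ◂ m₂ ∷ []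
        place (rot₀ p _) = here p
        place (rot₁ p _) = there (here p)
        place (rot₂ p _) = there (there (here p))

    module Boundary {R y z} (q~R : q ~ R) (t : triple R ≡ (+ 0 , + suc y , + suc z)) where

      open Class {R} q~R (subst (0ℤ ≤_) (sym (cong proj₁ t)) 0≤+)
        (subst (0ℤ <_) (sym (cong (λ t → proj₁ (proj₂ t)) t)) 0<s)
        (subst (0ℤ <_) (sym (cong (λ t → proj₂ (proj₂ t)) t)) 0<s)

      image-t : ∀ {M} (m : Twelve M) → triple (R ◂ M) ≡ image (+ 0 , + suc y , + suc z) m
      image-t m = trans (triple-◂ R m) (cong (λ t → image t m) t)

      term-at′ : ∀ {M} → det M ≡ 1ℤ → (m : Twelve M) → term (R ◂ M) ≡ 1ℤ
      term-at′ {M} d m = trans (term-at q~R M d m) (trans (cong (λ t → weightᵗ (image t m)) t) (one m))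
        where
        one : ∀ {M} (m : Twelve M) → weightᵗ (image (+ 0 , + suc y , + suc z) m) ≡ 1ℤ
        one r₀ = refl
        one r₀′ = refl
        one r₁ = refl
        one r₁′ = refl
        one r₂ = refl
        one r₂′ = refl
        one f₀ = refl
        one f₀′ = refl
        one f₁ = refl
        one f₁′ = refl
        one f₂ = refl
        one f₂′ = refl

      separate : ∀ {S S′ u v} → triple S ≡ u → triple S′ ≡ v → u ≢ v → S ≢ S′
      separate p p′ u≢v refl = u≢v (trans (sym p) p′)

      six : List BQF
      six = R ◂ m₀ ∷ R ◂ m₁ ∷ R ◂ m₂ ∷ R ◂ n₀ ∷ R ◂ n₁ ∷ R ◂ n₂ ∷ []

      place : ∀ S → q ~ S → IsSelling S → S ∈ six
      place S q~S SS with member {S} q~S SS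
      ... | _ , r₀  , refl = here refl
      ... | _ , r₀′ , refl = here refl
      ... | _ , r₁  , refl = there (here refl)
      ... | _ , r₁′ , refl = there (here refl)
      ... | _ , r₂  , refl = there (there (here refl))
      ... | _ , r₂′ , refl = there (there (here refl))
      ... | _ , f₀  , refl = there (there (there (here refl)))
      ... | _ , f₀′ , refl = there (there (there (here refl)))
      ... | _ , f₁  , refl = there (there (there (there (here refl))))
      ... | _ , f₁′ , refl = there (there (there (there (here refl))))
      ... | _ , f₂  , refl = there (there (there (there (there (here refl)))))
      ... | _ , f₂′ , refl = there (there (there (there (there (here refl)))))

      triples : ∀ S → q ~ S → IsSelling S → ∃[ M ] ∃ λ (m : Twelve M) → triple S ≡ image (+ 0 , + suc y , + suc z) m
      triples S q~S SS with member-triple {S} q~S SS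
      ... | M , m , p = M , m , trans p (cong (λ t → image t m) t)

      ¬square : y ≢ z → ¬ (∃[ e ] q ~ ⟨ e , 0ℤ , e ⟩)
      ¬square y≢z (e , p) with square-triple p
      ... | S , u , q~S , tS with triples S q~S (at-triple {S} tS (selling 0≤+ 0≤+ 0≤+ (inj₁ (0<s , 0<s))))
      ...   | M , m , t′ = diag m (trans (sym tS) t′)
        where
        diag : ∀ {M} (m : Twelve M) → (+ 0 , + suc u , + suc u) ≢ image (+ 0 , + suc y , + suc z) m
        diag r₀ refl = y≢z refl
        diag r₀′ refl = y≢z refl
        diag r₁ ()
        diag r₁′ ()
        diag r₂ ()
        diag r₂′ ()
        diag f₀ ()
        diag f₀′ ()
        diag f₁ refl = y≢z refl
        diag f₁′ refl = y≢z refl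
        diag f₂ ()
        diag f₂′ ()

      ¬hexagonal : ¬ (∃[ e ] q ~ ⟨ e , e , e ⟩)
      ¬hexagonal (e , p) with hexagonal-triple p
      ... | S , u , q~S , tS with triples S q~S (at-triple {S} tS (selling 0≤+ 0≤+ 0≤+ (inj₁ (0<s , 0<s))))
      ...   | M , m , t′ = diag m (trans (sym tS) t′)
        where
        diag : ∀ {M} (m : Twelve M) → (+ suc u , + suc u , + suc u) ≢ image (+ 0 , + suc y , + suc z) m
        diag r₀ ()
        diag r₀′ ()
        diag r₁ ()
        diag r₁′ ()
        diag r₂ ()
        diag r₂′ ()
        diag f₀ ()
        diag f₀′ ()
        diag f₁ ()
        diag f₁′ ()
        diag f₂ ()
        diag f₂′ ()

      square : y ≡ z → ∃[ e ] q ~ ⟨ e , 0ℤ , e ⟩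
      square refl = BQF.a R , subst (q ~_) (shape R t) q~R
        where
        shape : ∀ R → triple R ≡ (+ 0 , + suc y , + suc y) → R ≡ ⟨ BQF.a R , 0ℤ , BQF.a R ⟩
        shape ⟨ a , b , c ⟩ p = triple-injective _ _ (trans p (triple-cong refl (sym p₂) (sym p₂)))
          where
          p₂ : + 2 * a + 0ℤ ≡ + suc y
          p₂ = trans (cong (λ u → + 2 * a + u) (sym (ℤ.neg-injective {b} {0ℤ} (cong proj₁ p)))) (cong (λ t → proj₁ (proj₂ t)) p)

      -- A boundary form belongs to two triangles, so there are six representatives, of weight 1
      -- each. For y = z they coincide in pairs, and the total 3 = 6 / 2 belongs to the square
      -- class.
      weight-class : HasSum term mass
      weight-class with y ℕ.≟ z
      ... | yes refl = hasSum (R ◂ m₀ ∷ R ◂ m₁ ∷ R ◂ m₂ ∷ [])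
        ( (separate (image-t r₀) (image-t r₁) (λ ()) ∷ separate (image-t r₀) (image-t r₂) (λ ()) ∷ [])
        ∷ (separate (image-t r₁) (image-t r₂) (λ ()) ∷ []) ∷ [] ∷ [])
        (term-cover λ S q~S SS → shrink (place S q~S SS))
        (trans (cong₂ _+_ (term-at′ refl r₀) (cong₂ _+_ (term-at′ refl r₁) (cong (_+ 0ℤ) (term-at′ refl r₂))))
               (sym (mass-square square? hexagonal? (square refl))))
        where
        shrink : ∀ {S} → S ∈ six → S ∈ R ◂ m₀ ∷ R ◂ m₁ ∷ R ◂ m₂ ∷ []
        shrink (here p) = here p
        shrink (there (here p)) = there (here p)
        shrink (there (there (here p))) = there (there (here p))
        shrink (there (there (there (here p)))) =
          there (there (here (trans p (triple-injective _ _ (trans (image-t f₀) (sym (image-t r₂)))))))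
        shrink (there (there (there (there (here p))))) =
          here (trans p (triple-injective _ _ (trans (image-t f₁) (sym (image-t r₀)))))
        shrink (there (there (there (there (there (here p)))))) =
          there (here (trans p (triple-injective _ _ (trans (image-t f₂) (sym (image-t r₁))))))
      ... | no y≢z = hasSum six
        ( (separate (image-t r₀) (image-t r₁) (λ ()) ∷ separate (image-t r₀) (image-t r₂) (λ ())
           ∷ separate (image-t r₀) (image-t f₀) (λ ()) ∷ separate (image-t r₀) (image-t f₁) (λ { refl → y≢z refl })
           ∷ separate (image-t r₀) (image-t f₂) (λ ()) ∷ [])
        ∷ (separate (image-t r₁) (image-t r₂) (λ ()) ∷ separate (image-t r₁) (image-t f₀) (λ ())
           ∷ separate (image-t r₁) (image-t f₁) (λ ()) ∷ separate (image-t r₁) (image-t f₂) (λ { refl → y≢z refl }) ∷ [])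
        ∷ (separate (image-t r₂) (image-t f₀) (λ { refl → y≢z refl }) ∷ separate (image-t r₂) (image-t f₁) (λ ())
           ∷ separate (image-t r₂) (image-t f₂) (λ ()) ∷ [])
        ∷ (separate (image-t f₀) (image-t f₁) (λ ()) ∷ separate (image-t f₀) (image-t f₂) (λ ()) ∷ [])
        ∷ (separate (image-t f₁) (image-t f₂) (λ ()) ∷ []) ∷ [] ∷ [])
        (term-cover place)
        (trans (cong₂ _+_ (term-at′ refl r₀) (cong₂ _+_ (term-at′ refl r₁) (cong₂ _+_ (term-at′ refl r₂)
                 (cong₂ _+_ (term-at′ refl f₀) (cong₂ _+_ (term-at′ refl f₁) (cong (_+ 0ℤ) (term-at′ refl f₂)))))))
               (sym (mass-generic square? hexagonal? (¬square y≢z) ¬hexagonal)))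

    weight-class : HasSum term mass
    weight-class = go (Reduction.R red) (Reduction.Q~R red) (Reduction.0≤s₁ red) (Reduction.0<s₂ red) (Reduction.0<s₃ red) refl
      where
      red = reduction Q
      go : ∀ R → q ~ R → 0ℤ ≤ s₁ R → 0ℤ < s₂ R → 0ℤ < s₃ R → ∀ {t} → triple R ≡ t → HasSum term mass
      go R q~R p₁ p₂ p₃ refl with s₁ R in e₁ | s₂ R in e₂ | s₃ R in e₃
      go R q~R _ _ _ refl | + suc x | + suc y | + suc z = Interior.weight-class {R} q~R (triple-cong e₁ e₂ e₃)
      go R q~R _ _ _ refl | + zero  | + suc y | + suc z = Boundary.weight-class {R} q~R (triple-cong e₁ e₂ e₃)
      go R q~R _ (+<+ ()) _ refl | _ | + zero | _
      go R q~R _ _ (+<+ ()) refl | _ | _ | + zero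

-- Total weight over a discriminant and over the matrices of determinant 1.

module Weights where

  open import Defs
  open FinSum
  open Forms
  open Classes
  open import Data.Integer.Base using (_+_; _*_; _-_; -_; _<_; _≤_)
  open import Data.Integer.Tactic.RingSolver using (solve-∀)
  open import Data.List.Relation.Unary.Any using (Any; here; there)
  open import Data.List.Relation.Unary.All using (All; []; _∷_)
  open import Data.List.Relation.Unary.AllPairs using (AllPairs; []; _∷_)
  open import Relation.Nullary.Decidable using (from-yes)

  open ℤΣ
  open PosForm

  selling⇒0<a : ∀ R → IsSelling R → 0ℤ < BQF.a R
  selling⇒0<a ⟨ a , b , c ⟩ S = ℤ.*-cancelˡ-<-nonNeg (+ 2) (subst (0ℤ <_) (e a b) (0<sum two))
    where
    open Selling S
    e : ∀ a b → - b + (+ 2 * a + b) ≡ + 2 * a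
    e = solve-∀
    0<sum : _ → 0ℤ < - b + (+ 2 * a + b)
    0<sum (inj₁ (0<y , _))        = ℤ.+-mono-≤-< 0≤x 0<y
    0<sum (inj₂ (inj₁ (_ , 0<x))) = ℤ.+-mono-<-≤ 0<x 0≤y
    0<sum (inj₂ (inj₂ (0<x , _))) = ℤ.+-mono-<-≤ 0<x 0≤y

  -- Abstract, so that comparing terms does not unfold the polynomials inside.
  abstract
    disc? : ∀ n R → Dec (disc R ≡ -[1+ n ])
    disc? n R = disc R ℤ.≟ -[1+ n ]

    det? : ∀ k M → Dec (det M ≡ k)
    det? k M = det M ℤ.≟ k

  weighted : ℕ → BQF → ℤ
  weighted n R = only (disc? n R) (weight R)

  only-elim : ∀ {P : Set} (P? : Dec P) {u v} → (P → u ≡ v) → (¬ P → u ≡ 0ℤ) → u ≡ only P? v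
  only-elim (yes p) y _ = y p
  only-elim (no ¬p) _ z = z ¬p

  -- After exchanging the sums: a form of non-zero weight is positive definite, hence equivalent to
  -- exactly one representative, by completeness and distinctness of `classReps`.
  total-weight : ∀ n → HasSum (weighted n) (sum (classReps n) mass)
  total-weight n = HasSum-cong collect (HasSum-sum (classReps n) {λ Q R → only (class? Q R) (weight R)} (λ {Q} _ → weight-class Q))
    where
    only-0 : ∀ {P : Set} (P? : Dec P) {v} → v ≡ 0ℤ → only P? v ≡ 0ℤ
    only-0 (yes _) p = p
    only-0 (no _)  _ = refl
    one : ∀ {R v} (Qs : List (PosForm n)) → AllPairs (λ Q Q′ → ¬ form Q ~ form Q′) Qs → Any (λ Q → form Q ~ R) Qs →
          sum Qs (λ Q → only (class? Q R) v) ≡ v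
    one {R} {v} (Q ∷ Qs) (Q≁ ∷ _) (here Q~R) = trans
      (cong₂ _+_ (only-yes (class? Q R) Q~R)
        (sum-ε Qs (λ {Q′} Q′∈ → only-no (class? Q′ R)
          (λ Q′~R → All.lookup Q≁ Q′∈ (~-trans {form Q} {R} {form Q′} Q~R (~-sym {form Q′} {R} Q′~R))))))
      (ℤ.+-identityʳ v)
    one {R} {v} (Q ∷ Qs) (Q≁ ∷ d) (there R∈) = trans
      (cong₂ _+_ (only-no (class? Q R) (λ Q~R → apart Q~R Q≁ R∈)) (one Qs d R∈))
      (ℤ.+-identityˡ v)
      where
      apart : form Q ~ R → ∀ {Qs} → All (λ Q′ → ¬ form Q ~ form Q′) Qs → Any (λ Q′ → form Q′ ~ R) Qs → ⊥
      apart Q~R (Q≁Q′ ∷ _) (here {Q′} Q′~R) = Q≁Q′ (~-trans {form Q} {R} {form Q′} Q~R (~-sym {form Q′} {R} Q′~R))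
      apart Q~R (_ ∷ a) (there R∈) = apart Q~R a R∈
    none : ∀ R → ¬ disc R ≡ -[1+ n ] → sum (classReps n) (λ Q → only (class? Q R) (weight R)) ≡ 0ℤ
    none R ¬D = sum-ε (classReps n) (λ {Q} _ → only-no (class? Q R) (λ Q~R → ¬D (trans (disc-~ {form Q} {R} Q~R) (disc≡ Q))))
    some : ∀ R → disc R ≡ -[1+ n ] → IsSelling R ⊎ weight R ≡ 0ℤ →
           sum (classReps n) (λ Q → only (class? Q R) (weight R)) ≡ weight R
    some R D (inj₂ w≡0) = trans (sum-ε (classReps n) (λ {Q} _ → only-0 (class? Q R) w≡0)) (sym w≡0)
    some R D (inj₁ S) = one (classReps n) (classReps-distinct n)
      (Any.map (λ {Q} R~Q → ~-sym {R} {form Q} R~Q) (classReps-complete (posForm R (positive-if R (selling⇒0<a R S) D) D)))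
    collect : ∀ R → sum (classReps n) (λ Q → only (class? Q R) (weight R)) ≡ weighted n R
    collect R = only-elim (disc? n R) (λ D → some R D (selling? (s₁ R) (s₂ R) (s₃ R))) (none R)

  the-twelve : List Matrix
  the-twelve =
    m₀ ∷ (-1ℤ , 0ℤ , 0ℤ , -1ℤ) ∷ m₁ ∷ (0ℤ , -1ℤ , 1ℤ , -1ℤ) ∷ m₂ ∷ (1ℤ , -1ℤ , 1ℤ , 0ℤ) ∷
    n₀ ∷ (-1ℤ , 0ℤ , 1ℤ , -1ℤ) ∷ n₁ ∷ (0ℤ , -1ℤ , 1ℤ , 0ℤ) ∷ n₂ ∷ (1ℤ , -1ℤ , 0ℤ , 1ℤ) ∷ []

  ∈-the-twelve : ∀ {M} → Twelve M → M ∈ the-twelve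
  ∈-the-twelve r₀  = here refl
  ∈-the-twelve r₀′ = there (here refl)
  ∈-the-twelve r₁  = there (there (here refl))
  ∈-the-twelve r₁′ = there (there (there (here refl)))
  ∈-the-twelve r₂  = there (there (there (there (here refl))))
  ∈-the-twelve r₂′ = there (there (there (there (there (here refl)))))
  ∈-the-twelve f₀  = there (there (there (there (there (there (here refl))))))
  ∈-the-twelve f₀′ = there (there (there (there (there (there (there (here refl)))))))
  ∈-the-twelve f₁  = there (there (there (there (there (there (there (there (here refl))))))))
  ∈-the-twelve f₁′ = there (there (there (there (there (there (there (there (there (here refl)))))))))
  ∈-the-twelve f₂  = there (there (there (there (there (there (there (there (there (there (here refl))))))))))
  ∈-the-twelve f₂′ = there (there (there (there (there (there (there (there (there (there (there (here refl)))))))))))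

  det-twelve : ∀ {M} → Twelve M → det M ≡ 1ℤ
  det-twelve r₀  = refl
  det-twelve r₀′ = refl
  det-twelve r₁  = refl
  det-twelve r₁′ = refl
  det-twelve r₂  = refl
  det-twelve r₂′ = refl
  det-twelve f₀  = refl
  det-twelve f₀′ = refl
  det-twelve f₁  = refl
  det-twelve f₁′ = refl
  det-twelve f₂  = refl
  det-twelve f₂′ = refl

  orbit : BQF → Matrix → ℤ
  orbit Q M = only (det? 1ℤ M) (weight (Q ◂ M))

  orbit-cong : ∀ Q R M M′ → det M ≡ det M′ → Q ◂ M ≡ R ◂ M′ → orbit Q M ≡ orbit R M′
  orbit-cong Q R M M′ eq eq′ = trans (only-⇔ (det? 1ℤ M) (det? 1ℤ M′) (λ d → trans (sym eq) d) (λ d → trans eq d))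
    (cong (λ S → only (det? 1ℤ M′) (weight S)) eq′)

  -- In the interior the six rotation matrices carry weight 2; on a side all twelve carry weight 1.
  -- Coincidences among the forms do not matter, because the sum runs over matrices.
  orbit-weight-selling : ∀ R → 0ℤ ≤ s₁ R → 0ℤ < s₂ R → 0ℤ < s₃ R → HasSum (orbit R) (+ 12)
  orbit-weight-selling R 0≤s₁ 0<s₂ 0<s₃ =
    hasSum the-twelve (from-yes (UniqueDec.unique? _≟_ the-twelve)) cover
      (trans (cong₂ _+_ (at r₀) (cong₂ _+_ (at r₀′) (cong₂ _+_ (at r₁) (cong₂ _+_ (at r₁′)
        (cong₂ _+_ (at r₂) (cong₂ _+_ (at r₂′) (cong₂ _+_ (at f₀) (cong₂ _+_ (at f₀′)
        (cong₂ _+_ (at f₁) (cong₂ _+_ (at f₁′) (cong₂ _+_ (at f₂) (cong (_+ 0ℤ) (at f₂′)))))))))))))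
        (twelve-sum (s₁ R) (s₂ R) (s₃ R) 0≤s₁ 0<s₂ 0<s₃))
    where
    cover : ∀ M → M ∈ the-twelve ⊎ orbit R M ≡ 0ℤ
    cover M = only-cover (det? 1ℤ M) λ d →
      [ (λ S → inj₁ (∈-the-twelve (selling-unique R M
          (selling 0≤s₁ (ℤ.<⇒≤ 0<s₂) (ℤ.<⇒≤ 0<s₃) (inj₁ (0<s₂ , 0<s₃))) 0<s₂ 0<s₃ d S))) , inj₂ ]′
      (selling? (s₁ (R ◂ M)) (s₂ (R ◂ M)) (s₃ (R ◂ M)))
    at : ∀ {M} (m : Twelve M) → orbit R M ≡ weightᵗ (image (triple R) m)
    at {M} m = trans (only-yes (det? 1ℤ M) (det-twelve m)) (cong weightᵗ (triple-◂ R m))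
    w : ∀ x y z {M} → Twelve M → ℤ
    w x y z m = weightᵗ (image (x , y , z) m)
    negative : ∀ {x} → ¬ (0ℤ ≤ -[1+ x ])
    negative ()
    twelve-sum : ∀ x y z → 0ℤ ≤ x → 0ℤ < y → 0ℤ < z →
      w x y z r₀ + (w x y z r₀′ + (w x y z r₁ + (w x y z r₁′ + (w x y z r₂ + (w x y z r₂′ +
      (w x y z f₀ + (w x y z f₀′ + (w x y z f₁ + (w x y z f₁′ + (w x y z f₂ + (w x y z f₂′ + 0ℤ))))))))))) ≡ + 12
    twelve-sum (+ zero)  (+ suc y) (+ suc z) _ _ _ = refl
    twelve-sum (+ suc x) (+ suc y) (+ suc z) _ _ _
      rewrite ¬selling⇒weight≡0 {+ suc x + + suc x + + suc z} {+ suc x + + suc x + + suc y} { -[1+ x ]} (λ S → negative (Selling.0≤z S))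
            | ¬selling⇒weight≡0 { -[1+ x ]} {+ suc x + + suc x + + suc z} {+ suc x + + suc x + + suc y} (λ S → negative (Selling.0≤x S))
            | ¬selling⇒weight≡0 {+ suc x + + suc x + + suc y} { -[1+ x ]} {+ suc x + + suc x + + suc z} (λ S → negative (Selling.0≤y S))
      = refl
    twelve-sum _ (+ zero) _ _ (+<+ ()) _
    twelve-sum _ _ (+ zero) _ _ (+<+ ())

  ⊡-cancelˡ : ∀ M M′ → det M ≡ 1ℤ → adj M ⊡ (M ⊡ M′) ≡ M′
  ⊡-cancelˡ (α , β , γ , δ) (α′ , β′ , γ′ , δ′) d =
    cong₂ _,_ (use α′ (e₁ α β γ δ α′ γ′)) (cong₂ _,_ (use β′ (e₁ α β γ δ β′ δ′))
      (cong₂ _,_ (use γ′ (e₂ α β γ δ α′ γ′)) (use δ′ (e₂ α β γ δ β′ δ′))))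
    where
    use : ∀ x {y} → y ≡ (α * δ - β * γ) * x → y ≡ x
    use x p = trans p (trans (cong (_* x) d) (ℤ.*-identityˡ x))
    e₁ : ∀ α β γ δ x y → δ * (α * x + β * y) + - β * (γ * x + δ * y) ≡ (α * δ - β * γ) * x
    e₁ = solve-∀
    e₂ : ∀ α β γ δ x y → - γ * (α * x + β * y) + α * (γ * x + δ * y) ≡ (α * δ - β * γ) * y
    e₂ = solve-∀

  adj-adj : ∀ M → adj (adj M) ≡ M
  adj-adj (α , β , γ , δ) = cong₂ (λ x y → α , x , y , δ) (ℤ.neg-involutive β) (ℤ.neg-involutive γ)

  orbit-⊡ : ∀ Q N M → det N ≡ 1ℤ → orbit Q (N ⊡ M) ≡ orbit (Q ◂ N) M
  orbit-⊡ Q N M d = orbit-cong Q (Q ◂ N) (N ⊡ M) M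
    (trans (det-⊡ N M) (trans (cong (_* det M) d) (ℤ.*-identityˡ (det M)))) (◂-⊡ Q N M)

  orbit-transport : ∀ Q N {s} → det N ≡ 1ℤ → HasSum (orbit (Q ◂ N)) s → HasSum (orbit Q) s
  orbit-transport Q N d F = HasSum-bij {f = orbit (Q ◂ N)} {g = orbit Q} (N ⊡_) (adj N ⊡_)
      (λ M → inj₁ (⊡-cancelˡ N M d)) (λ M → inj₁ (orbit-⊡ Q N M d))
      (λ M → inj₁ (back M , trans (sym (orbit-⊡ Q N (adj N ⊡ M) d)) (cong (orbit Q) (back M)))) F
    where
    back : ∀ M → N ⊡ (adj N ⊡ M) ≡ M
    back M = subst (λ N′ → N′ ⊡ (adj N ⊡ M) ≡ M) (adj-adj N) (⊡-cancelˡ (adj N) M (trans (det-adj N) d))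

  -- Left multiplication carries the sum for `Q` to that for its reduction. Stabilisers are absorbed
  -- by summing over matrices, so the value is the same for every class.
  orbit-weight : ∀ {n} (Q : PosForm n) → HasSum (orbit (form Q)) (+ 12)
  orbit-weight Q = transport (Reduction.Q~R red)
      (orbit-weight-selling R (Reduction.0≤s₁ red) (Reduction.0<s₂ red) (Reduction.0<s₃ red))
    where
    red = reduction Q
    R = Reduction.R red
    transport : form Q ~ R → HasSum (orbit R) (+ 12) → HasSum (orbit (form Q)) (+ 12)
    transport (sl₂ α β γ δ′ d , R≡) F =
      orbit-transport (form Q) (α , β , γ , δ′) d (subst (λ S → HasSum (orbit S) (+ 12)) R≡ F)

-- Congruences modulo a prime.

module Congruence where

  open FinSum
  open Forms
  open import Data.Integer.Base using (_+_; _*_; _-_; -_)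
  open import Data.Integer.Divisibility.Signed using (divides; ∣ᵤ⇒∣; ∣⇒∣ᵤ; ∣m∣n⇒∣m-n; ∣n⇒∣m*n) renaming (_∣_ to infix 4 _∥_; _∣?_ to infix 4 _∥?_)
  open import Data.Integer.Tactic.RingSolver using (solve-∀)
  open import Data.Nat.Coprimality using (Coprime; coprime-Bézout)
  open import Data.Nat.GCD using (module Bézout)

  instance
    ℕ-decEq : DecEq ℕ
    ℕ-decEq = decEq ℕ._≟_

  open ℤΣ

  by : ∀ {d x y : ℤ} → x ≡ y → d ∥ x → d ∥ y
  by {d} = subst (d ∥_)

  ∣-self : ∀ {d} x → d ∥ x * d
  ∣-self x = divides x refl

  module Modulo (p : ℕ) (p-prime : Prime p) where

    P : ℤ
    P = + p

    instance
      p≢0 : NonZero p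
      p≢0 = prime⇒nonZero p-prime

      P≢0 : ℤ.NonZero P
      P≢0 = p≢0

    euclid : ∀ x y → P ∥ x * y → P ∥ x ⊎ P ∥ y
    euclid x y d = Sum⊎.map ∣ᵤ⇒∣ ∣ᵤ⇒∣
      (euclidsLemma ∣ x ∣ ∣ y ∣ p-prime (subst (p ℕ.∣_) (ℤ.abs-* x y) (∣⇒∣ᵤ d)))

    euclid² : ∀ x → P ∥ x * x → P ∥ x
    euclid² x d = [ id , id ]′ (euclid x x d)

    P∤1 : ¬ P ∥ 1ℤ
    P∤1 d = ℕ.≤⇒≯ (ℕ.∣⇒≤ (∣⇒∣ᵤ d)) (ℕ.nonTrivial⇒n>1 p {{prime⇒nonTrivial p-prime}})

    inverse : ∀ u → ¬ P ∥ u → ∃[ w ] P ∥ u * w - 1ℤ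
    inverse u P∤u = from (coprime-Bézout coprime)
      where
      coprime : Coprime p ∣ u ∣
      coprime {d} (d∣p , d∣u) with prime⇒irreducible p-prime d∣p
      ... | inj₁ d≡1  = d≡1
      ... | inj₂ refl = ⊥-elim (P∤u (∣ᵤ⇒∣ d∣u))
      sign : ∀ u → ∃[ ε ] + ∣ u ∣ ≡ u * ε
      sign (+ n)    = 1ℤ , sym (ℤ.*-identityʳ (+ n))
      sign -[1+ n ] = -1ℤ , cong (λ m → + suc m) (sym (ℕ.*-identityʳ n))
      from : Bézout.Identity 1 p ∣ u ∣ → ∃[ w ] P ∥ u * w - 1ℤ
      from (Bézout.+- x y eq) with sign u
      ... | ε , s = - (ε * + y) , divides (- + x) (trans (e u ε (+ y)) (trans (cong (λ v → - (1ℤ + + y * v)) (sym s))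
        (trans (cong -_ (trans (cong (λ v → 1ℤ + v) (sym (ℤ.pos-* y ∣ u ∣))) (trans (cong +_ eq) (ℤ.pos-* x p)))) (ℤ.neg-distribˡ-* (+ x) P))))
        where
        e : ∀ u ε y → u * - (ε * y) - 1ℤ ≡ - (1ℤ + y * (u * ε))
        e = solve-∀
      from (Bézout.-+ x y eq) with sign u
      ... | ε , s = ε * + y , divides (+ x) (trans (e u ε (+ y)) (trans (cong (λ v → + y * v - 1ℤ) (sym s))
        (trans (cong (_- 1ℤ) (trans (sym (ℤ.pos-* y ∣ u ∣)) (trans (cong +_ (sym eq)) (cong (λ v → 1ℤ + v) (ℤ.pos-* x p))))) (e′ (+ x * P)))))
        where
        e : ∀ u ε y → u * (ε * y) - 1ℤ ≡ y * (u * ε) - 1ℤ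
        e = solve-∀
        e′ : ∀ v → 1ℤ + v - 1ℤ ≡ v
        e′ = solve-∀

    residues-distinct : ∀ {i j} → i ℕ.< p → j ℕ.< p → P ∥ + i - + j → i ≡ j
    residues-distinct {i} {j} i<p j<p d with ∣ + i - + j ∣ in eq
    ... | zero  = ℤ.+-injective (ℤ.i-j≡0⇒i≡j (+ i) (+ j) (ℤ.∣i∣≡0⇒i≡0 eq))
    ... | suc m = ⊥-elim (ℕ.<⇒≱ small (ℕ.≤-trans (ℕ.∣⇒≤ (subst (p ℕ.∣_) eq (∣⇒∣ᵤ d))) (ℕ.≤-reflexive (sym eq))))
      where
      small : ∣ + i - + j ∣ ℕ.< p
      small rewrite ℤ.[+m]-[+n]≡m⊖n i j = ℕ.≤-<-trans (ℤ.∣m⊝n∣≤m⊔n i j) (ℕ.⊔-lub i<p j<p)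

    -- The only root is the residue of v w, with w the inverse of u from Bézout's identity.
    linear-roots : ∀ u v → ¬ P ∥ u → sum (upTo p) (λ j → only (P ∥? u * + j - v) 1ℤ) ≡ 1ℤ
    linear-roots u v P∤u = trans (sum-cong-∈ (upTo p) (λ {j} j∈ → only-⇔ (P ∥? u * + j - v) (j₀ ≟ j)
        (λ d → residues-distinct j₀<p (∈-upTo⁻ j∈) (cancel (+ j) d)) (λ { refl → root })))
      (sum-only (Unique.upTo⁺ p) (∈-upTo⁺ j₀<p) (λ _ → 1ℤ))
      where
      w = proj₁ (inverse u P∤u)
      j₀ = (v * w) ℤ.%ℕ p
      q = (v * w) ℤ./ℕ p
      j₀<p : j₀ ℕ.< p
      j₀<p = ℤ.n%ℕd<d (v * w) p
      j₀≡ : v * w ≡ + j₀ + q * P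
      j₀≡ = ℤ.a≡a%ℕn+[a/ℕn]*n (v * w) p
      root : P ∥ u * + j₀ - v
      root = by (trans (e u v w q P) (cong (λ x → u * x - v) (trans (cong (_- q * P) j₀≡) (e′ (+ j₀) (q * P)))))
        (∣m∣n⇒∣m-n (∣n⇒∣m*n v (proj₂ (inverse u P∤u))) (∣-self (u * q)))
        where
        e : ∀ u v w q P → v * (u * w - 1ℤ) - u * q * P ≡ u * (v * w - q * P) - v
        e = solve-∀
        e′ : ∀ x y → x + y - y ≡ x
        e′ = solve-∀
      cancel : ∀ j → P ∥ u * j - v → P ∥ + j₀ - j
      cancel j d = [ (λ P∣u → ⊥-elim (P∤u P∣u)) , id ]′ (euclid u (+ j₀ - j) (by (e u v (+ j₀) j) (∣m∣n⇒∣m-n root d)))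
        where
        e : ∀ u v i j → (u * i - v) - (u * j - v) ≡ u * (i - j)
        e = solve-∀

-- Zeros of a form on the projective line modulo p.

module Roots where

  open import Defs using (BQF; ⟨_,_,_⟩; disc; ⟨⟩-cong)
  open FinSum
  open Forms
  open Congruence
  open import Data.Integer.Base using (_+_; _*_; _-_; -_)
  open import Data.Integer.Divisibility.Signed using (divides; ∣m∣n⇒∣m+n; ∣m∣n⇒∣m-n; ∣n⇒∣m*n; ∣m⇒∣m*n) renaming (_∣_ to infix 4 _∥_; _∣?_ to infix 4 _∥?_)
  open import Data.Integer.Tactic.RingSolver using (solve-∀)
  open import Data.List.Properties using (length-upTo)

  open ℤΣ

  infix 4 _∣ᶠ_ _∣ᶠ?_

  _∣ᶠ_ : ℤ → BQF → Set
  k ∣ᶠ ⟨ a , b , c ⟩ = k ∥ a × k ∥ b × k ∥ c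

  abstract
    _∣ᶠ?_ : ∀ k Q → Dec (k ∣ᶠ Q)
    k ∣ᶠ? ⟨ a , b , c ⟩ = (k ∥? a) ×-dec ((k ∥? b) ×-dec (k ∥? c))

  infixr 7 _·ᶠ_

  _·ᶠ_ : ℤ → BQF → BQF
  k ·ᶠ ⟨ a , b , c ⟩ = ⟨ k * a , k * b , k * c ⟩

  ∣ᶠ-quotient : ∀ {k} Q → k ∣ᶠ Q → ∃[ R ] Q ≡ k ·ᶠ R
  ∣ᶠ-quotient {k} _ (divides a refl , divides b refl , divides c refl) =
    ⟨ a , b , c ⟩ , ⟨⟩-cong (ℤ.*-comm a k) (ℤ.*-comm b k) (ℤ.*-comm c k)

  ∣ᶠ-·ᶠ : ∀ k R → k ∣ᶠ k ·ᶠ R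
  ∣ᶠ-·ᶠ k ⟨ a , b , c ⟩ = ∣m⇒∣m*n a (divides 1ℤ (sym (ℤ.*-identityˡ k))) ,
    ∣m⇒∣m*n b (divides 1ℤ (sym (ℤ.*-identityˡ k))) , ∣m⇒∣m*n c (divides 1ℤ (sym (ℤ.*-identityˡ k)))

  disc-·ᶠ : ∀ k R → disc (k ·ᶠ R) ≡ k * k * disc R
  disc-·ᶠ k ⟨ a , b , c ⟩ = e k a b c
    where
    e : ∀ k a b c → k * b * (k * b) - + 4 * (k * a * (k * c)) ≡ k * k * (b * b - + 4 * (a * c))
    e = solve-∀

  sum-1 : ∀ n → sum (upTo n) (λ _ → 1ℤ) ≡ + n
  sum-1 n = trans (count (upTo n)) (cong +_ (length-upTo n))
    where
    open import Data.List.Base using (length)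
    count : ∀ (xs : List ℕ) → sum xs (λ _ → 1ℤ) ≡ + length xs
    count []       = refl
    count (x ∷ xs) = cong (λ s → 1ℤ + s) (count xs)

  module Lines (p : ℕ) (p-prime : Prime p) (P∤2 : ¬ + p ∥ + 2) where

    open Modulo p p-prime public

    -- Right multiplication by SL₂(ℤ) has p + 1 orbits on the matrices of determinant p.
    g∞ : Matrix
    g∞ = 1ℤ , 0ℤ , 0ℤ , P

    g : ℕ → Matrix
    g j = P , + j , 0ℤ , 1ℤ

    -- Counts the cosets along which `R` descends: whenever p² divides `R ◂ h`, the quotient is a
    -- form of discriminant disc R / p².
    ρ : BQF → ℤ
    ρ R = only (P * P ∣ᶠ? R ◂ g∞) 1ℤ + sum (upTo p) (λ j → only (P * P ∣ᶠ? R ◂ g j) 1ℤ)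

    -- The zeros on the projective line over the field with p elements: the point (1 : 0) and the
    -- points (j : 1).
    roots : BQF → ℤ
    roots ⟨ a , b , c ⟩ = only (P ∥? a) 1ℤ + sum (upTo p) (λ j → only (P ∥? a * (+ j * + j) + b * + j + c) 1ℤ)

    P∤4* : ∀ {u} → ¬ P ∥ u → ¬ P ∥ + 4 * u
    P∤4* {u} P∤u d = [ (λ d → [ P∤2 , P∤2 ]′ (euclid (+ 2) (+ 2) d)) , P∤u ]′ (euclid (+ 4) u d)

    P∤2* : ∀ {u} → ¬ P ∥ u → ¬ P ∥ + 2 * u
    P∤2* {u} P∤u d = [ P∤2 , P∤u ]′ (euclid (+ 2) u d)

    drop : ∀ {x} → P * P ∥ P * x → P ∥ x
    drop {x} = ℤ.*-cancelˡ-∣ P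

    weaken : ∀ {x} → P * P ∥ x → P ∥ x
    weaken (divides q refl) = by (e q P) (∣-self (q * P))
      where
      e : ∀ q P → q * P * P ≡ q * (P * P)
      e = solve-∀

    cancel² : ∀ {u} x → ¬ P ∥ u → P * P ∥ u * x → P * P ∥ x
    cancel² {u} x P∤u d = from ([ (λ q → ⊥-elim (P∤u q)) , id ]′ (euclid u x (weaken d)))
      where
      e : ∀ u y P → u * (y * P) ≡ P * (u * y)
      e = solve-∀
      from : P ∥ x → P * P ∥ x
      from (divides y eq) = from′ ([ (λ q → ⊥-elim (P∤u q)) , id ]′ (euclid u y (drop (by (trans (cong (u *_) eq) (e u y P)) d))))
        where
        from′ : P ∥ y → P * P ∥ x
        from′ (divides z eq′) = divides z (trans eq (trans (cong (_* P) eq′) (ℤ.*-assoc z P P)))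

    g∞⇒ : ∀ {a b c} → P * P ∣ᶠ ⟨ a , b , c ⟩ ◂ g∞ → P * P ∥ a × P ∥ b
    g∞⇒ {a} {b} {c} (d₁ , d₂ , _) = by (e₁ a b c) d₁ , drop (by (e₂ a b c P) d₂)
      where
      e₁ : ∀ a b c → a * (1ℤ * 1ℤ) + b * (1ℤ * 0ℤ) + c * (0ℤ * 0ℤ) ≡ a
      e₁ = solve-∀
      e₂ : ∀ a b c P → + 2 * (a * (1ℤ * 0ℤ)) + b * (1ℤ * P + 0ℤ * 0ℤ) + + 2 * (c * (0ℤ * P)) ≡ P * b
      e₂ = solve-∀

    g∞⇐ : ∀ {a b c} → P * P ∥ a → P ∥ b → P * P ∣ᶠ ⟨ a , b , c ⟩ ◂ g∞
    g∞⇐ {a} {b} {c} d₁ (divides q refl) = by (e₁ a (q * P) c) d₁ , divides q (e₂ a q c P) , divides c (e₃ a (q * P) c P)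
      where
      e₁ : ∀ a b c → a ≡ a * (1ℤ * 1ℤ) + b * (1ℤ * 0ℤ) + c * (0ℤ * 0ℤ)
      e₁ = solve-∀
      e₂ : ∀ a q c P → + 2 * (a * (1ℤ * 0ℤ)) + q * P * (1ℤ * P + 0ℤ * 0ℤ) + + 2 * (c * (0ℤ * P)) ≡ q * (P * P)
      e₂ = solve-∀
      e₃ : ∀ a b c P → a * (0ℤ * 0ℤ) + b * (0ℤ * P) + c * (P * P) ≡ c * (P * P)
      e₃ = solve-∀

    g⇒ : ∀ {a b c} j → P * P ∣ᶠ ⟨ a , b , c ⟩ ◂ g j →
         P ∥ + 2 * a * + j - - b × P * P ∥ a * (+ j * + j) + b * + j + c
    g⇒ {a} {b} {c} j (_ , d₂ , d₃) = drop (by (e₂ a b c P (+ j)) d₂) , by (e₃ a b c (+ j)) d₃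
      where
      e₂ : ∀ a b c P j → + 2 * (a * (P * j)) + b * (P * 1ℤ + j * 0ℤ) + + 2 * (c * (0ℤ * 1ℤ)) ≡ P * (+ 2 * a * j - - b)
      e₂ = solve-∀
      e₃ : ∀ a b c j → a * (j * j) + b * (j * 1ℤ) + c * (1ℤ * 1ℤ) ≡ a * (j * j) + b * j + c
      e₃ = solve-∀

    g⇐ : ∀ {a b c} j → P ∥ + 2 * a * + j - - b → P * P ∥ a * (+ j * + j) + b * + j + c → P * P ∣ᶠ ⟨ a , b , c ⟩ ◂ g j
    g⇐ {a} {b} {c} j (divides q eq) d₃ = divides a (e₁ a b c P) ,
      divides q (trans (e₂ a b c P (+ j)) (trans (cong (P *_) eq) (e₄ q P))) , by (e₃ a b c (+ j)) d₃
      where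
      e₁ : ∀ a b c P → a * (P * P) + b * (P * 0ℤ) + c * (0ℤ * 0ℤ) ≡ a * (P * P)
      e₁ = solve-∀
      e₂ : ∀ a b c P j → + 2 * (a * (P * j)) + b * (P * 1ℤ + j * 0ℤ) + + 2 * (c * (0ℤ * 1ℤ)) ≡ P * (+ 2 * a * j - - b)
      e₂ = solve-∀
      e₃ : ∀ a b c j → a * (j * j) + b * j + c ≡ a * (j * j) + b * (j * 1ℤ) + c * (1ℤ * 1ℤ)
      e₃ = solve-∀
      e₄ : ∀ q P → P * (q * P) ≡ q * (P * P)
      e₄ = solve-∀

    -- Completing the square; it ties the zeros (j : 1) to a linear congruence in j.
    discriminant : ∀ a b c j → (+ 2 * a * j - - b) * (+ 2 * a * j - - b) - (b * b - + 4 * (a * c)) ≡ + 4 * a * (a * (j * j) + b * j + c)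
    discriminant = solve-∀

    0+1 : ∀ {x y} → x ≡ 0ℤ → y ≡ 1ℤ → x + y ≡ 1ℤ
    0+1 refl refl = refl

    1+0 : ∀ {x y} → x ≡ 1ℤ → y ≡ 0ℤ → x + y ≡ 1ℤ
    1+0 refl refl = refl

    c-from : ∀ {a b c} j → P ∥ a → P ∥ b → P ∥ a * (+ j * + j) + b * + j + c → P ∥ c
    c-from {a} {b} {c} j d₁ d₂ d₃ = by (e a b c (+ j)) (∣m∣n⇒∣m-n (∣m∣n⇒∣m-n d₃ (∣m⇒∣m*n (+ j * + j) d₁)) (∣m⇒∣m*n (+ j) d₂))
      where
      e : ∀ a b c j → a * (j * j) + b * j + c - a * (j * j) - b * j ≡ c
      e = solve-∀

    P∥b : ∀ {a b c} → P ∥ a → P ∥ b * b - + 4 * (a * c) → P ∥ b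
    P∥b {a} {b} {c} d₁ d = euclid² b (by (e a b c) (∣m∣n⇒∣m+n d (∣m⇒∣m*n (+ 4 * c) d₁)))
      where
      e : ∀ a b c → b * b - + 4 * (a * c) + a * (+ 4 * c) ≡ b * b
      e = solve-∀

    -- Modulo p the form is a non-zero multiple of the square of a linear form, so it has one zero,
    -- a double one. There the derivative vanishes modulo p, and completing the square makes the
    -- value divisible by p², because the discriminant is.
    ρ-primitive : ∀ R → ¬ P ∣ᶠ R → P * P ∥ disc R → ρ R ≡ 1ℤ
    ρ-primitive ⟨ a , b , c ⟩ ¬d D = go (P ∥? a)
      where
      go : Dec (P ∥ a) → ρ ⟨ a , b , c ⟩ ≡ 1ℤ
      go (no P∤a) = 0+1 (only-no (P * P ∣ᶠ? _) (λ d → P∤a (weaken (proj₁ (g∞⇒ {a} {b} {c} d)))))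
        (trans (sum-cong (upTo p) (λ j → only-⇔ (P * P ∣ᶠ? _) (P ∥? _) (λ d → proj₁ (g⇒ {a} {b} {c} j d)) (λ d → g⇐ {a} {b} {c} j d (lift j d))))
               (linear-roots (+ 2 * a) (- b) (P∤2* P∤a)))
        where
        lift : ∀ j → P ∥ + 2 * a * + j - - b → P * P ∥ a * (+ j * + j) + b * + j + c
        lift j (divides q eq) = cancel² _ (P∤4* P∤a) (by (discriminant a b c (+ j))
          (∣m∣n⇒∣m-n (divides (q * q) (trans (cong₂ _*_ eq eq) (e q P))) D))
          where
          e : ∀ q P → q * P * (q * P) ≡ q * q * (P * P)
          e = solve-∀
      go (yes P∣a) = 1+0 (only-yes (P * P ∣ᶠ? _) (g∞⇐ {a} {b} {c} P²∣a b∣))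
        (sum-ε (upTo p) (λ {j} _ → only-no (P * P ∣ᶠ? _) (λ d → P∤c (c-from {a} {b} {c} j P∣a b∣ (weaken (proj₂ (g⇒ {a} {b} {c} j d)))))))
        where
        b∣ : P ∥ b
        b∣ = P∥b {a} {b} {c} P∣a (weaken D)
        P∤c : ¬ P ∥ c
        P∤c c∣ = ¬d (P∣a , b∣ , c∣)
        b² : P * P ∥ b * b
        b² with b∣
        ... | divides q refl = divides (q * q) (e q P)
          where
          e : ∀ q P → q * P * (q * P) ≡ q * q * (P * P)
          e = solve-∀
        -- Here 4ac = b² - disc is divisible by p², and p does not divide c because it already
        -- divides a and b.
        P²∣a : P * P ∥ a
        P²∣a = cancel² a (P∤4* P∤c) (by (e a b c) (∣m∣n⇒∣m-n b² D))
          where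
          e : ∀ a b c → b * b - (b * b - + 4 * (a * c)) ≡ + 4 * c * a
          e = solve-∀

    -- One factor p is present already: the condition on the derivative holds automatically, and
    -- divisibility of the value by p² becomes vanishing of `R` modulo p.
    ρ-scaled : ∀ R → ρ (P ·ᶠ R) ≡ roots R
    ρ-scaled ⟨ a , b , c ⟩ = cong₂ _+_
      (only-⇔ (P * P ∣ᶠ? _) (P ∥? a) (λ d → drop (proj₁ (g∞⇒ {P * a} {P * b} {P * c} d)))
        (λ d → g∞⇐ {P * a} {P * b} {P * c} (ℤ.*-monoʳ-∣ P d) (∣m⇒∣m*n b ∥-refl)))
      (sum-cong (upTo p) (λ j → only-⇔ (P * P ∣ᶠ? _) (P ∥? _)
        (λ d → drop (by (e a b c P (+ j)) (proj₂ (g⇒ {P * a} {P * b} {P * c} j d))))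
        (λ d → g⇐ {P * a} {P * b} {P * c} j (divides (+ 2 * a * + j + b) (e′ a b P (+ j)))
          (by (sym (e a b c P (+ j))) (ℤ.*-monoʳ-∣ P d)))))
      where
      ∥-refl : P ∥ P
      ∥-refl = divides 1ℤ (sym (ℤ.*-identityˡ P))
      e : ∀ a b c P j → P * a * (j * j) + P * b * j + P * c ≡ P * (a * (j * j) + b * j + c)
      e = solve-∀
      e′ : ∀ a b P j → + 2 * (P * a) * j - - (P * b) ≡ (+ 2 * a * j + b) * P
      e′ = solve-∀

    -- The quadratic formula: the roots solve 2aj = - b ± t and are distinct because p does not
    -- divide 2t. If p divides a, one of the two zeros is (1 : 0).
    roots-split : ∀ R t → P ∥ t * t - disc R → ¬ P ∥ t → roots R ≡ + 2
    roots-split ⟨ a , b , c ⟩ t D P∤t = go (P ∥? a)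
      where
      go : Dec (P ∥ a) → roots ⟨ a , b , c ⟩ ≡ + 2
      go (no P∤a) = trans (cong₂ _+_ (only-no (P ∥? a) P∤a)
          (trans (sum-cong (upTo p) two) (trans (sum-⊕ (upTo p) (λ j → only (P ∥? + 2 * a * + j - (t - b)) 1ℤ) (λ j → only (P ∥? + 2 * a * + j - (- t - b)) 1ℤ))
            (cong₂ _+_ (linear-roots (+ 2 * a) (t - b) (P∤2* P∤a)) (linear-roots (+ 2 * a) (- t - b) (P∤2* P∤a))))))
        refl
        where
        product : ∀ j → (+ 2 * a * j - (t - b)) * (+ 2 * a * j - (- t - b)) ≡
                  + 4 * a * (a * (j * j) + b * j + c) - (t * t - (b * b - + 4 * (a * c)))
        product = e a b c t
          where
          e : ∀ a b c t j → (+ 2 * a * j - (t - b)) * (+ 2 * a * j - (- t - b)) ≡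
              + 4 * a * (a * (j * j) + b * j + c) - (t * t - (b * b - + 4 * (a * c)))
          e = solve-∀
        apart : ∀ j → P ∥ + 2 * a * j - (t - b) → P ∥ + 2 * a * j - (- t - b) → ⊥
        apart j d d′ = P∤2* P∤t (by (e a b t j) (∣m∣n⇒∣m-n d′ d))
          where
          e : ∀ a b t j → + 2 * a * j - (- t - b) - (+ 2 * a * j - (t - b)) ≡ + 2 * t
          e = solve-∀
        two : ∀ j → only (P ∥? a * (+ j * + j) + b * + j + c) 1ℤ ≡
              only (P ∥? + 2 * a * + j - (t - b)) 1ℤ + only (P ∥? + 2 * a * + j - (- t - b)) 1ℤ
        two j = cases (P ∥? _) (P ∥? _) (P ∥? _)
          (λ d → euclid (+ 2 * a * + j - (t - b)) (+ 2 * a * + j - (- t - b)) (by (sym (product (+ j))) (∣m∣n⇒∣m-n (∣n⇒∣m*n (+ 4 * a) d) D)))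
          (λ d → back (∣m⇒∣m*n (+ 2 * a * + j - (- t - b)) d)) (λ d → back (∣n⇒∣m*n (+ 2 * a * + j - (t - b)) d)) (apart (+ j))
          where
          back : P ∥ (+ 2 * a * + j - (t - b)) * (+ 2 * a * + j - (- t - b)) → P ∥ a * (+ j * + j) + b * + j + c
          back d = [ (λ q → ⊥-elim (P∤4* P∤a q)) , id ]′ (euclid (+ 4 * a) _
            (by (e (+ 4 * a * (a * (+ j * + j) + b * + j + c)) (t * t - (b * b - + 4 * (a * c))))
              (∣m∣n⇒∣m+n (by (product (+ j)) d) D)))
            where
            e : ∀ x y → x - y + y ≡ x
            e = solve-∀
          cases : ∀ {A B C : Set} (A? : Dec A) (B? : Dec B) (C? : Dec C) →
                  (A → B ⊎ C) → (B → A) → (C → A) → (B → C → ⊥) → only A? 1ℤ ≡ only B? 1ℤ + only C? 1ℤ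
          cases (yes a) (yes b) (yes c) _ _ _ ¬bc = ⊥-elim (¬bc b c)
          cases (yes a) (yes b) (no _) _ _ _ _ = refl
          cases (yes a) (no _) (yes c) _ _ _ _ = refl
          cases (yes a) (no ¬b) (no ¬c) f _ _ _ = ⊥-elim ([ ¬b , ¬c ]′ (f a))
          cases (no ¬a) (yes b) _ _ g _ _ = ⊥-elim (¬a (g b))
          cases (no ¬a) (no _) (yes c) _ _ h _ = ⊥-elim (¬a (h c))
          cases (no ¬a) (no _) (no _) _ _ _ _ = refl
      go (yes P∣a) = cong₂ _+_ (only-yes (P ∥? a) P∣a)
          (trans (sum-cong (upTo p) (λ j → only-⇔ (P ∥? _) (P ∥? _)
            (λ d → by (e a b c (+ j)) (∣m∣n⇒∣m-n d (∣m⇒∣m*n (+ j * + j) P∣a)))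
            (λ d → by (e′ a b c (+ j)) (∣m∣n⇒∣m+n d (∣m⇒∣m*n (+ j * + j) P∣a)))))
          (linear-roots b (- c) P∤b))
        where
        e : ∀ a b c j → a * (j * j) + b * j + c - a * (j * j) ≡ b * j - - c
        e = solve-∀
        e′ : ∀ a b c j → b * j - - c + a * (j * j) ≡ a * (j * j) + b * j + c
        e′ = solve-∀
        P∤b : ¬ P ∥ b
        P∤b d = P∤t (euclid² t (by (e″ a b c t) (∣m∣n⇒∣m+n D (∣m∣n⇒∣m-n (∣m⇒∣m*n b d) (∣m⇒∣m*n (+ 4 * c) P∣a)))))
          where
          e″ : ∀ a b c t → t * t - (b * b - + 4 * (a * c)) + (b * b - a * (+ 4 * c)) ≡ t * t
          e″ = solve-∀

    roots-double : ∀ R → ¬ P ∣ᶠ R → P ∥ disc R → roots R ≡ 1ℤ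
    roots-double ⟨ a , b , c ⟩ ¬d D = go (P ∥? a)
      where
      go : Dec (P ∥ a) → roots ⟨ a , b , c ⟩ ≡ 1ℤ
      go (no P∤a) = 0+1 (only-no (P ∥? a) P∤a)
        (trans (sum-cong (upTo p) (λ j → only-⇔ (P ∥? a * (+ j * + j) + b * + j + c) (P ∥? L j)
            (λ d → euclid² (L j) (by (e (L j * L j) (disc ⟨ a , b , c ⟩)) (∣m∣n⇒∣m+n (by (sym (discriminant a b c (+ j))) (∣n⇒∣m*n (+ 4 * a) d)) D)))
            (λ d → [ (λ q → ⊥-elim (P∤4* P∤a q)) , id ]′ (euclid (+ 4 * a) _ (by (discriminant a b c (+ j)) (∣m∣n⇒∣m-n (∣m⇒∣m*n (L j) d) D))))))
          (linear-roots (+ 2 * a) (- b) (P∤2* P∤a)))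
        where
        L : ℕ → ℤ
        L j = + 2 * a * + j - - b
        e : ∀ x y → x - y + y ≡ x
        e = solve-∀
      go (yes P∣a) = 1+0 (only-yes (P ∥? a) P∣a)
        (sum-ε (upTo p) (λ {j} _ → only-no (P ∥? _) (λ d → ¬d (P∣a , b∣ , c-from {a} {b} {c} j P∣a b∣ d))))
        where
        b∣ : P ∥ b
        b∣ = P∥b {a} {b} {c} P∣a D

    roots-zero : ∀ R → P ∣ᶠ R → roots R ≡ 1ℤ + P
    roots-zero ⟨ a , b , c ⟩ (d₁ , d₂ , d₃) = cong₂ _+_ (only-yes (P ∥? a) d₁)
      (trans (sum-cong (upTo p) (λ j → only-yes (P ∥? _) (∣m∣n⇒∣m+n (∣m∣n⇒∣m+n (∣m⇒∣m*n (+ j * + j) d₁) (∣m⇒∣m*n (+ j) d₂)) d₃)))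
        (sum-1 p))

    cancel-P² : ∀ {x y} → P * P * x ≡ P * P * y → x ≡ y
    cancel-P² {x} {y} eq = ℤ.*-cancelˡ-≡ P x y (ℤ.*-cancelˡ-≡ P (P * x) (P * y)
      (trans (sym (ℤ.*-assoc P P x)) (trans eq (ℤ.*-assoc P P y))))

    -- A form not divisible by p has its double zero only. For `R` = p R′ the discriminant of R′ is
    -- d, a non-zero square modulo p, and R′ has two zeros.
    ρ-split : ∀ R t d → disc R ≡ P * P * d → P ∥ t * t - d → ¬ P ∥ t → ρ R ≡ 1ℤ + only (P ∣ᶠ? R) 1ℤ
    ρ-split R t d D t² P∤t = go (P ∣ᶠ? R)
      where
      go : (P∣R? : Dec (P ∣ᶠ R)) → ρ R ≡ 1ℤ + only P∣R? 1ℤ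
      go (no ¬d) = ρ-primitive R ¬d (divides d (trans D (ℤ.*-comm (P * P) d)))
      go (yes q) with ∣ᶠ-quotient R q
      ... | R′ , refl = trans (ρ-scaled R′) (roots-split R′ t
            (by (cong (λ u → t * t - u) (sym (cancel-P² (trans (sym (disc-·ᶠ P R′)) D)))) t²) P∤t)

    -- For `R` = p R′ the discriminant of R′ is still divisible by p², so R′ has one zero modulo p,
    -- or all p + 1 points when p divides it.
    ρ-double : ∀ R d → disc R ≡ P * P * (P * P * d) → ρ R ≡ 1ℤ + only (P * P ∣ᶠ? R) P
    ρ-double R d D = go (P ∣ᶠ? R)
      where
      go : Dec (P ∣ᶠ R) → ρ R ≡ 1ℤ + only (P * P ∣ᶠ? R) P
      go (no ¬d) = trans (ρ-primitive R ¬d (divides (P * P * d) (trans D (ℤ.*-comm (P * P) _))))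
        (cong (λ u → 1ℤ + u) (sym (only-no (P * P ∣ᶠ? R) (λ (d₁ , d₂ , d₃) → ¬d (weaken d₁ , weaken d₂ , weaken d₃)))))
      go (yes q) with ∣ᶠ-quotient R q
      ... | R′@(⟨ a , b , c ⟩) , refl = trans (ρ-scaled R′) (inner (P ∣ᶠ? R′))
        where
        D′ : disc R′ ≡ P * P * d
        D′ = cancel-P² (trans (sym (disc-·ᶠ P R′)) D)
        inner : Dec (P ∣ᶠ R′) → roots R′ ≡ 1ℤ + only (P * P ∣ᶠ? P ·ᶠ R′) P
        inner (yes q′@(d₁ , d₂ , d₃)) = trans (roots-zero R′ q′) (cong (λ u → 1ℤ + u)
          (sym (only-yes (P * P ∣ᶠ? P ·ᶠ R′) (ℤ.*-monoʳ-∣ P d₁ , ℤ.*-monoʳ-∣ P d₂ , ℤ.*-monoʳ-∣ P d₃))))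
        inner (no ¬q) = trans (roots-double R′ ¬q (weaken (divides d (trans D′ (ℤ.*-comm (P * P) d)))))
          (cong (λ u → 1ℤ + u) (sym (only-no (P * P ∣ᶠ? P ·ᶠ R′) (λ (d₁ , d₂ , d₃) → ¬q (drop d₁ , drop d₂ , drop d₃)))))

-- The Hecke relation at p² for class numbers.

module Hecke where

  open import Defs using (BQF; ⟨_,_,_⟩; disc; ⟨⟩-cong; PosForm; posForm; positive-if; classReps)
  open FinSum
  open Forms
  open Classes
  open Weights
  open Congruence
  open Roots
  open import Data.Integer.Base using (_+_; _*_; _-_; -_)
  open import Data.Integer.Divisibility.Signed using (divides; ∣m∣n⇒∣m+n; ∣m∣n⇒∣m-n; ∣n⇒∣m*n; ∣m⇒∣m*n; ∣m⇒∣-m) renaming (_∣_ to infix 4 _∥_; _∣?_ to infix 4 _∥?_)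
  open import Data.Integer.Tactic.RingSolver using (solve-∀)

  open ℤΣ
  open PosForm

  -- Six times the Hurwitz class number of n + 1.
  abstract
    S : ℕ → ℤ
    S n = sum (classReps n) mass

    S-def : ∀ n → S n ≡ sum (classReps n) mass
    S-def n = refl

  S-sum : ∀ n → HasSum (weighted n) (S n)
  S-sum n = HasSum-≡ (sym (S-def n)) (total-weight n)

  scale : ∀ {A : Set} {f : A → ℤ} {s} c → HasSum f s → HasSum (λ a → f a * c) (s * c)
  scale c = HasSum-hom ℤ.+-0-isCommutativeMonoid ℤ.+-0-isCommutativeMonoid (_* c) (ℤ.*-zeroˡ c) (λ x y → ℤ.*-distribʳ-+ c x y)

  only-* : ∀ {P : Set} (P? : Dec P) v → only P? v ≡ only P? 1ℤ * v
  only-* (yes _) v = sym (ℤ.*-identityˡ v)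
  only-* (no _)  v = sym (ℤ.*-zeroˡ v)

  sum-*ʳ : ∀ {A : Set} (xs : List A) (f : A → ℤ) c → sum xs f * c ≡ sum xs (λ a → f a * c)
  sum-*ʳ xs f c = sum-hom ℤ.+-0-isCommutativeMonoid ℤ.+-0-isCommutativeMonoid (_* c) (ℤ.*-zeroˡ c) (λ x y → ℤ.*-distribʳ-+ c x y) xs f

  pos-* : ∀ k x → pos (+ suc k * x) ≡ pos x
  pos-* k (+ zero)  = cong pos (ℤ.*-zeroʳ (+ suc k))
  pos-* k (+ suc x) = refl
  pos-* k -[1+ x ]  = refl

  zer-* : ∀ k x → zer (+ suc k * x) ≡ zer x
  zer-* k (+ zero)  = cong zer (ℤ.*-zeroʳ (+ suc k))
  zer-* k (+ suc x) = refl
  zer-* k -[1+ x ]  = refl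

  weight₃-* : ∀ k x y z → weight₃ (+ suc k * x) (+ suc k * y) (+ suc k * z) ≡ weight₃ x y z
  weight₃-* k x y z rewrite pos-* k x | pos-* k y | pos-* k z | zer-* k x | zer-* k y | zer-* k z = refl

  weight-·ᶠ : ∀ k Q → weight (+ suc k ·ᶠ Q) ≡ weight Q
  weight-·ᶠ k ⟨ a , b , c ⟩ = trans (cong weightᵗ (triple-cong (e₁ (+ suc k) b) (e₂ (+ suc k) a b) (e₂ (+ suc k) c b)))
    (weight₃-* k (- b) (+ 2 * a + b) (+ 2 * c + b))
    where
    e₁ : ∀ k b → - (k * b) ≡ k * - b
    e₁ = solve-∀
    e₂ : ∀ k a b → + 2 * (k * a) + k * b ≡ k * (+ 2 * a + b)
    e₂ = solve-∀

  ·ᶠ-injective : ∀ k Q R → + suc k ·ᶠ Q ≡ + suc k ·ᶠ R → Q ≡ R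
  ·ᶠ-injective k ⟨ a , b , c ⟩ ⟨ a′ , b′ , c′ ⟩ eq = ⟨⟩-cong
    (ℤ.*-cancelˡ-≡ (+ suc k) a a′ (cong BQF.a eq)) (ℤ.*-cancelˡ-≡ (+ suc k) b b′ (cong BQF.b eq)) (ℤ.*-cancelˡ-≡ (+ suc k) c c′ (cong BQF.c eq))

  -- Exact quotients; the value on non-multiples is irrelevant.
  quot : ℤ → ℤ → ℤ
  quot k z with k ∥? z
  ... | yes (divides q _) = q
  ... | no _              = 0ℤ

  quot-∥ : ∀ {k z} → k ∥ z → k * quot k z ≡ z
  quot-∥ {k} {z} d with k ∥? z
  ... | yes (divides q eq) = trans (ℤ.*-comm k q) (sym eq)
  ... | no ¬d              = ⊥-elim (¬d d)

  quot-* : ∀ k x → quot (+ suc k) (+ suc k * x) ≡ x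
  quot-* k x = ℤ.*-cancelˡ-≡ (+ suc k) (quot (+ suc k) (+ suc k * x)) x
    (quot-∥ {+ suc k} {+ suc k * x} (∣m⇒∣m*n {+ suc k} x (divides 1ℤ (sym (ℤ.*-identityˡ (+ suc k))))))

  quotᶠ : ℤ → BQF → BQF
  quotᶠ k ⟨ a , b , c ⟩ = ⟨ quot k a , quot k b , quot k c ⟩

  quotᶠ-∣ᶠ : ∀ {k} Q → k ∣ᶠ Q → k ·ᶠ quotᶠ k Q ≡ Q
  quotᶠ-∣ᶠ ⟨ a , b , c ⟩ (d₁ , d₂ , d₃) = ⟨⟩-cong (quot-∥ d₁) (quot-∥ d₂) (quot-∥ d₃)

  quotᶠ-·ᶠ : ∀ k Q → quotᶠ (+ suc k) (+ suc k ·ᶠ Q) ≡ Q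
  quotᶠ-·ᶠ k ⟨ a , b , c ⟩ = ⟨⟩-cong (quot-* k a) (quot-* k b) (quot-* k c)

  -- Multiplication by k embeds the forms of discriminant d into those of discriminant k²d.
  multiples : ∀ k n n′ v → + suc k * + suc k * -[1+ n ] ≡ -[1+ n′ ] →
              HasSum (λ R → weighted n′ R * only (+ suc k ∣ᶠ? R) v) (S n * v)
  multiples k n n′ v eq = HasSum-bij {f = λ R → weighted n R * v} {g = g} (K ·ᶠ_) (quotᶠ K)
      (λ R → inj₁ (quotᶠ-·ᶠ k R)) (λ R → inj₁ (at R)) (λ R → back R (K ∣ᶠ? R) refl) (scale v (S-sum n))
    where
    K = + suc k
    g : BQF → ℤ
    g R = weighted n′ R * only (K ∣ᶠ? R) v
    at : ∀ R → g (K ·ᶠ R) ≡ weighted n R * v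
    at R = cong₂ _*_ (trans (cong (only (disc? n′ (K ·ᶠ R))) (weight-·ᶠ k R))
        (only-⇔ (disc? n′ (K ·ᶠ R)) (disc? n R)
          (λ D → ℤ.*-cancelˡ-≡ (K * K) (disc R) -[1+ n ] (trans (sym (disc-·ᶠ K R)) (trans D (sym eq))))
          (λ D → trans (disc-·ᶠ K R) (trans (cong (K * K *_) D) eq))))
      (only-yes (K ∣ᶠ? K ·ᶠ R) (∣ᶠ-·ᶠ K R))
    back : ∀ R (d : Dec (K ∣ᶠ R)) → (K ∣ᶠ? R) ≡ d →
           (K ·ᶠ quotᶠ K R ≡ R × weighted n (quotᶠ K R) * v ≡ g R) ⊎ g R ≡ 0ℤ
    back R (yes d) _ = inj₁ (quotᶠ-∣ᶠ R d , trans (sym (at (quotᶠ K R))) (cong g (quotᶠ-∣ᶠ R d)))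
    back R (no ¬d) _ = inj₂ (trans (cong (weighted n′ R *_) (only-no (K ∣ᶠ? R) ¬d)) (ℤ.*-zeroʳ (weighted n′ R)))

  ◂-adj : ∀ Q M → Q ◂ M ◂ adj M ≡ (det M * det M) ·ᶠ Q
  ◂-adj ⟨ a , b , c ⟩ (α , β , γ , δ) = ⟨⟩-cong (e₁ a b c α β γ δ) (e₂ a b c α β γ δ) (e₃ a b c α β γ δ)
    where
    e₁ : ∀ a b c α β γ δ →
      (a * (α * α) + b * (α * γ) + c * (γ * γ)) * (δ * δ)
      + (+ 2 * (a * (α * β)) + b * (α * δ + β * γ) + + 2 * (c * (γ * δ))) * (δ * (- γ))
      + (a * (β * β) + b * (β * δ) + c * (δ * δ)) * ((- γ) * (- γ))
      ≡ (α * δ - β * γ) * (α * δ - β * γ) * a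
    e₁ = solve-∀
    e₂ : ∀ a b c α β γ δ →
      + 2 * ((a * (α * α) + b * (α * γ) + c * (γ * γ)) * (δ * (- β)))
      + (+ 2 * (a * (α * β)) + b * (α * δ + β * γ) + + 2 * (c * (γ * δ))) * (δ * α + (- β) * (- γ))
      + + 2 * ((a * (β * β) + b * (β * δ) + c * (δ * δ)) * ((- γ) * α))
      ≡ (α * δ - β * γ) * (α * δ - β * γ) * b
    e₂ = solve-∀
    e₃ : ∀ a b c α β γ δ →
      (a * (α * α) + b * (α * γ) + c * (γ * γ)) * ((- β) * (- β))
      + (+ 2 * (a * (α * β)) + b * (α * δ + β * γ) + + 2 * (c * (γ * δ))) * ((- β) * α)
      + (a * (β * β) + b * (β * δ) + c * (δ * δ)) * (α * α)
      ≡ (α * δ - β * γ) * (α * δ - β * γ) * c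
    e₃ = solve-∀

  ·ᶠ-◂ : ∀ k Q M → (k ·ᶠ Q) ◂ M ≡ k ·ᶠ (Q ◂ M)
  ·ᶠ-◂ k ⟨ a , b , c ⟩ (α , β , γ , δ) = ⟨⟩-cong (v k a b c α γ) (e k a b c α β γ δ) (v k a b c β δ)
    where
    v : ∀ k a b c x y → k * a * (x * x) + k * b * (x * y) + k * c * (y * y) ≡ k * (a * (x * x) + b * (x * y) + c * (y * y))
    v = solve-∀
    e : ∀ k a b c α β γ δ → + 2 * (k * a * (α * β)) + k * b * (α * δ + β * γ) + + 2 * (k * c * (γ * δ))
      ≡ k * (+ 2 * (a * (α * β)) + b * (α * δ + β * γ) + + 2 * (c * (γ * δ)))
    e = solve-∀

  ∣ᶠ-◂ : ∀ k Q M → k ∣ᶠ Q → k ∣ᶠ Q ◂ M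
  ∣ᶠ-◂ k Q M d with ∣ᶠ-quotient Q d
  ... | R , refl = subst (k ∣ᶠ_) (sym (·ᶠ-◂ k R M)) (∣ᶠ-·ᶠ k (R ◂ M))

  -- Extends row sums known for positive definite forms to arbitrary forms: all others have weight
  -- zero.
  weighted-view : ∀ n Q → (∃[ F ] form {n} F ≡ Q) ⊎ weighted n Q ≡ 0ℤ
  weighted-view n Q = only-cover (disc? n Q) λ D →
    [ (λ S → inj₁ (posForm Q (positive-if Q (selling⇒0<a Q S) D) D , refl)) , inj₂ ]′ (selling? (s₁ Q) (s₂ Q) (s₃ Q))

  orbit-≡ : ∀ R X M → R ◂ M ≡ X → orbit R M ≡ only (det? 1ℤ M) (weight X)
  orbit-≡ R X M = cong (λ X → only (det? 1ℤ M) (weight X))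

  module Operator (p : ℕ) (p-prime : Prime p) (P∤2 : ¬ + p ∥ + 2) where

    open Lines p p-prime P∤2

    -- `In∞` and `In` express membership of a matrix of determinant p in the cosets of `g∞` and
    -- `g j` by its rows: the bottom row vanishes modulo p, or the top row is j times the bottom
    -- row.
    In∞ : Matrix → Set
    In∞ (α , β , γ , δ) = P ∥ γ × P ∥ δ

    In : ℕ → Matrix → Set
    In j (α , β , γ , δ) = P ∥ γ * + j - α × P ∥ δ * + j - β

    in∞? : ∀ M → Dec (In∞ M)
    in∞? (α , β , γ , δ) = (P ∥? γ) ×-dec (P ∥? δ)

    in? : ∀ j M → Dec (In j M)
    in? j (α , β , γ , δ) = (P ∥? γ * + j - α) ×-dec (P ∥? δ * + j - β)

    -- Modulo p the rows are dependent. A non-zero bottom row has the top row as a unique multiple.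
    -- If the bottom row is zero the top row is not, since otherwise p² would divide the determinant
    -- p.
    one-coset : ∀ M → det M ≡ P → only (in∞? M) 1ℤ + sum (upTo p) (λ j → only (in? j M) 1ℤ) ≡ 1ℤ
    one-coset (α , β , γ , δ) D = go (P ∥? γ) (P ∥? δ)
      where
      P∣det : P ∥ α * δ - β * γ
      P∣det = divides 1ℤ (trans D (sym (ℤ.*-identityˡ P)))
      go : Dec (P ∥ γ) → Dec (P ∥ δ) →
           only (in∞? (α , β , γ , δ)) 1ℤ + sum (upTo p) (λ j → only (in? j (α , β , γ , δ)) 1ℤ) ≡ 1ℤ
      go (no P∤γ) _ = 0+1 (only-no (in∞? (α , β , γ , δ)) (λ (d , _) → P∤γ d))
        (trans (sum-cong (upTo p) (λ j → only-⇔ (in? j (α , β , γ , δ)) (P ∥? _) proj₁ (λ d → d ,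
          [ (λ q → ⊥-elim (P∤γ q)) , id ]′ (euclid γ _ (by (e α β γ δ (+ j)) (∣m∣n⇒∣m+n (∣n⇒∣m*n δ d) P∣det))))))
          (linear-roots γ α P∤γ))
        where
        e : ∀ α β γ δ j → δ * (γ * j - α) + (α * δ - β * γ) ≡ γ * (δ * j - β)
        e = solve-∀
      go (yes γ∣) (no P∤δ) = 0+1 (only-no (in∞? (α , β , γ , δ)) (λ (_ , d) → P∤δ d))
        (trans (sum-cong (upTo p) (λ j → only-⇔ (in? j (α , β , γ , δ)) (P ∥? _) proj₂ (λ d →
          ∣m∣n⇒∣m-n (∣m⇒∣m*n (+ j) γ∣) α∣ , d)))
          (linear-roots δ β P∤δ))
        where
        e : ∀ α β γ δ → (α * δ - β * γ) + β * γ ≡ α * δ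
        e = solve-∀
        α∣ : P ∥ α
        α∣ = [ id , (λ q → ⊥-elim (P∤δ q)) ]′ (euclid α δ (by (e α β γ δ) (∣m∣n⇒∣m+n P∣det (∣n⇒∣m*n β γ∣))))
      go (yes γ∣) (yes δ∣) = 1+0 (only-yes (in∞? (α , β , γ , δ)) (γ∣ , δ∣))
        (sum-ε (upTo p) (λ {j} _ → only-no (in? j (α , β , γ , δ)) (λ (d , d′) → square
          (by (e α γ (+ j)) (∣m∣n⇒∣m-n (∣m⇒∣m*n (+ j) γ∣) d)) (by (e β δ (+ j)) (∣m∣n⇒∣m-n (∣m⇒∣m*n (+ j) δ∣) d′)) γ∣ δ∣)))
        where
        e : ∀ x y j → y * j - (y * j - x) ≡ x
        e = solve-∀
        square : P ∥ α → P ∥ β → P ∥ γ → P ∥ δ → ⊥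
        square (divides a refl) (divides b refl) (divides c refl) (divides d refl) =
          P∤1 (drop (divides (a * d - b * c) (trans (trans (ℤ.*-identityʳ P) (sym D)) (e′ a b c d P))))
          where
          e′ : ∀ a b c d P → a * P * (d * P) - b * P * (c * P) ≡ (a * d - b * c) * (P * P)
          e′ = solve-∀

    P-suc : ∃[ k ] P ≡ + suc k
    P-suc = go p p≢0
      where
      go : ∀ p → NonZero p → ∃[ k ] + p ≡ + suc k
      go (suc k) _ = k , refl

    quot-P : ∀ {z} x → z ≡ P * x → quot P z ≡ x
    quot-P x refl = ℤ.*-cancelˡ-≡ P (quot P (P * x)) x (quot-∥ {P} {P * x} (∣m⇒∣m*n x (divides 1ℤ (sym (ℤ.*-identityˡ P)))))

    module _ (Φ : Matrix → ℤ) where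

      ind : Matrix → ℤ
      ind M = only (det? P M) (Φ M)

      -- A function supported on the coset h SL₂(ℤ), where `φ M` is h M.
      coset : ∀ {c} {C : Matrix → Set} (C? : ∀ M → Dec (C M)) (φ ψ : Matrix → Matrix) →
              (∀ M → ψ (φ M) ≡ M) → (∀ M → det (φ M) ≡ P * det M) → (∀ M → C (φ M)) → (∀ M → C M → φ (ψ M) ≡ M) →
              HasSum (λ M → only (det? 1ℤ M) (Φ (φ M))) c →
              HasSum (λ M → only (C? M) (ind M)) c
      coset {C = C} C? φ ψ ψφ det-φ C-φ φψ = HasSum-bij {f = λ M → only (det? 1ℤ M) (Φ (φ M))} {g = supported} φ ψ
          (λ M → inj₁ (ψφ M)) (λ M → inj₁ (at M)) (λ M → back M (C? M))
        where
        supported : Matrix → ℤ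
        supported M = only (C? M) (ind M)
        at : ∀ M → supported (φ M) ≡ only (det? 1ℤ M) (Φ (φ M))
        at M = trans (only-yes (C? (φ M)) (C-φ M)) (only-⇔ (det? P (φ M)) (det? 1ℤ M)
          (λ D → ℤ.*-cancelˡ-≡ P (det M) 1ℤ (trans (sym (det-φ M)) (trans D (sym (ℤ.*-identityʳ P)))))
          (λ D → trans (det-φ M) (trans (cong (P *_) D) (ℤ.*-identityʳ P))))
        back : ∀ M → Dec (C M) → (φ (ψ M) ≡ M × only (det? 1ℤ (ψ M)) (Φ (φ (ψ M))) ≡ supported M) ⊎ supported M ≡ 0ℤ
        back M (yes i) = inj₁ (φψ M i , trans (sym (at (ψ M))) (cong supported (φψ M i)))
        back M (no ¬i) = inj₂ (only-no (C? M) ¬i)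

      cosets : ∀ {c∞} {c : ℕ → ℤ} →
               HasSum (λ M → only (det? 1ℤ M) (Φ (g∞ ⊡ M))) c∞ →
               (∀ j → HasSum (λ M → only (det? 1ℤ M) (Φ (g j ⊡ M))) (c j)) →
               HasSum ind (c∞ + sum (upTo p) c)
      cosets F∞ F = HasSum-cong collect (HasSum-⊕
          (coset in∞? (g∞ ⊡_) ψ∞ ψφ∞ (λ M → trans (det-⊡ g∞ M) (cong (_* det M) (e₀ P))) in∞-φ φψ∞ F∞)
          (HasSum-sum (upTo p) {λ j M → only (in? j M) (ind M)} (λ {j} _ →
            coset (in? j) (g j ⊡_) (ψ j) (ψφ j) (λ M → trans (det-⊡ (g j) M) (cong (_* det M) (e₁ P (+ j)))) (in-φ j) (φψ j) (F j))))
        where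
        e₀ : ∀ P → 1ℤ * P - 0ℤ * 0ℤ ≡ P
        e₀ = solve-∀
        e₁ : ∀ P j → P * 1ℤ - j * 0ℤ ≡ P
        e₁ = solve-∀
        ψ∞ : Matrix → Matrix
        ψ∞ (α , β , γ , δ) = α , β , quot P γ , quot P δ
        ψ : ℕ → Matrix → Matrix
        ψ j (α , β , γ , δ) = quot P (α - γ * + j) , quot P (β - δ * + j) , γ , δ
        first : ∀ x y → 1ℤ * x + 0ℤ * y ≡ x
        first = solve-∀
        second : ∀ P x y → 0ℤ * x + P * y ≡ P * y
        second = solve-∀
        third : ∀ P j x y → P * x + j * y - (0ℤ * x + 1ℤ * y) * j ≡ P * x
        third = solve-∀
        fourth : ∀ x y → 0ℤ * x + 1ℤ * y ≡ y
        fourth = solve-∀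
        quadruple : ∀ {x x′ y y′ z z′ w w′ : ℤ} → x ≡ x′ → y ≡ y′ → z ≡ z′ → w ≡ w′ → (x , y , z , w) ≡ (x′ , y′ , z′ , w′)
        quadruple refl refl refl refl = refl
        ψφ∞ : ∀ M → ψ∞ (g∞ ⊡ M) ≡ M
        ψφ∞ (α , β , γ , δ) = quadruple (first α γ) (first β δ) (quot-P γ (second P α γ)) (quot-P δ (second P β δ))
        in∞-φ : ∀ M → In∞ (g∞ ⊡ M)
        in∞-φ (α , β , γ , δ) = by (sym (second P α γ)) (∣m⇒∣m*n γ ∥-self) , by (sym (second P β δ)) (∣m⇒∣m*n δ ∥-self)
          where
          ∥-self : P ∥ P
          ∥-self = divides 1ℤ (sym (ℤ.*-identityˡ P))
        φψ∞ : ∀ M → In∞ M → g∞ ⊡ ψ∞ M ≡ M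
        φψ∞ (α , β , γ , δ) (d , d′) = quadruple (first α (quot P γ)) (first β (quot P δ))
          (trans (second P α _) (quot-∥ d)) (trans (second P β _) (quot-∥ d′))
        ψφ : ∀ j M → ψ j (g j ⊡ M) ≡ M
        ψφ j (α , β , γ , δ) = quadruple (quot-P α (third P (+ j) α γ)) (quot-P β (third P (+ j) β δ)) (fourth α γ) (fourth β δ)
        in-φ : ∀ j M → In j (g j ⊡ M)
        in-φ j (α , β , γ , δ) = divides (- α) (e P (+ j) α γ) , divides (- β) (e P (+ j) β δ)
          where
          e : ∀ P j x y → (0ℤ * x + 1ℤ * y) * j - (P * x + j * y) ≡ - x * P
          e = solve-∀
        flip : ∀ (x y : ℤ) → P ∥ y - x → P ∥ x - y
        flip x y d = by (e x y) (∣m⇒∣-m d)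
          where
          e : ∀ x y → - (y - x) ≡ x - y
          e = solve-∀
        φψ : ∀ j M → In j M → g j ⊡ ψ j M ≡ M
        φψ j (α , β , γ , δ) (d , d′) = quadruple
          (trans (cong (_+ + j * γ) (quot-∥ (flip α (γ * + j) d))) (e α γ (+ j))) (trans (cong (_+ + j * δ) (quot-∥ (flip β (δ * + j) d′))) (e β δ (+ j)))
          (fourth (quot P (α - γ * + j)) γ) (fourth (quot P (β - δ * + j)) δ)
          where
          e : ∀ x y j → x - y * j + j * y ≡ x
          e = solve-∀
        collect : ∀ M → only (in∞? M) (ind M) + sum (upTo p) (λ j → only (in? j M) (ind M)) ≡ ind M
        collect M = go (det? P M)
          where
          go : (D? : Dec (det M ≡ P)) →
               only (in∞? M) (only D? (Φ M)) + sum (upTo p) (λ j → only (in? j M) (only D? (Φ M))) ≡ only D? (Φ M)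
          go (no _) = trans (cong₂ _+_ (zero-only (in∞? M)) (sum-ε (upTo p) (λ {j} _ → zero-only (in? j M)))) refl
            where
            zero-only : ∀ {A : Set} (A? : Dec A) → only A? 0ℤ ≡ 0ℤ
            zero-only (yes _) = refl
            zero-only (no _)  = refl
          go (yes D) = begin
            only (in∞? M) (Φ M) + sum (upTo p) (λ j → only (in? j M) (Φ M))
              ≡⟨ cong₂ _+_ (only-* (in∞? M) (Φ M)) (trans (sum-cong (upTo p) (λ j → only-* (in? j M) (Φ M))) (sym (sum-*ʳ (upTo p) (λ j → only (in? j M) 1ℤ) (Φ M)))) ⟩
            only (in∞? M) 1ℤ * Φ M + sum (upTo p) (λ j → only (in? j M) 1ℤ) * Φ M
              ≡⟨ sym (ℤ.*-distribʳ-+ (Φ M) (only (in∞? M) 1ℤ) _) ⟩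
            (only (in∞? M) 1ℤ + sum (upTo p) (λ j → only (in? j M) 1ℤ)) * Φ M
              ≡⟨ cong (_* Φ M) (one-coset M D) ⟩
            1ℤ * Φ M ≡⟨ ℤ.*-identityˡ (Φ M) ⟩
            Φ M ∎
            where open ≡-Reasoning

    P²-suc : ∃[ k ] P * P ≡ + suc k
    P²-suc with P-suc
    ... | k , eq = _ , cong₂ _*_ eq eq

    actP : ∀ {n} (Q : PosForm n) M → det M ≡ P → ∃[ m ] ∃[ F ] form {m} F ≡ form Q ◂ M
    actP {n} (posForm Q Q>0 D) M@(α , β , γ , δ) d with P²-suc
    ... | k , P² = _ , posForm (Q ◂ M) (positive-if (Q ◂ M) (Q>0 α γ nonzero) D′) D′ , refl
      where
      D′ : disc (Q ◂ M) ≡ -[1+ n ] * + suc k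
      D′ = trans (disc-◂ Q M) (cong₂ _*_ D (trans (cong₂ _*_ d d) P²))
      e : ∀ β δ → 0ℤ * δ - β * 0ℤ ≡ 0ℤ
      e = solve-∀
      P≢0ℤ : P ≢ 0ℤ
      P≢0ℤ eq with P-suc
      ... | k , eq′ with () ← trans (sym eq′) eq
      nonzero : α ≢ 0ℤ ⊎ γ ≢ 0ℤ
      nonzero with α ℤ.≟ 0ℤ | γ ℤ.≟ 0ℤ
      ... | no α≢0 | _       = inj₁ α≢0
      ... | yes _  | no γ≢0  = inj₂ γ≢0
      ... | yes refl | yes refl = ⊥-elim (P≢0ℤ (trans (sym d) (e β δ)))

    orbit-◂ : ∀ {n} (Q : PosForm n) h → det h ≡ P → HasSum (orbit (form Q ◂ h)) (+ 12)
    orbit-◂ Q h d = from (actP Q h d)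
      where
      from : (∃[ m ] ∃[ F ] form {m} F ≡ form Q ◂ h) → HasSum (orbit (form Q ◂ h)) (+ 12)
      from (_ , F , eq) = subst (λ R → HasSum (orbit R) (+ 12)) eq (orbit-weight F)

    det-g∞ : det g∞ ≡ P
    det-g∞ = e P
      where
      e : ∀ P → 1ℤ * P - 0ℤ * 0ℤ ≡ P
      e = solve-∀

    det-g : ∀ j → det (g j) ≡ P
    det-g j = e P (+ j)
      where
      e : ∀ P j → P * 1ℤ - j * 0ℤ ≡ P
      e = solve-∀

    twelves : + 12 + sum (upTo p) (λ _ → + 12) ≡ + 12 * (1ℤ + P)
    twelves = trans (cong (λ u → + 12 + u) (trans (sym (sum-*ʳ (upTo p) (λ _ → 1ℤ) (+ 12))) (cong (_* + 12) (sum-1 p)))) (e P)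
      where
      e : ∀ P → + 12 + P * + 12 ≡ + 12 * (1ℤ + P)
      e = solve-∀

    -- Each of the p + 1 cosets contributes the orbit weight of the positive definite form
    -- `form Q ◂ h`.
    raising : ∀ {n} (Q : PosForm n) → HasSum (ind (λ M → weight (form Q ◂ M))) (+ 12 * (1ℤ + P))
    raising Q = HasSum-≡ twelves (cosets (λ M → weight (form Q ◂ M))
        (translated g∞ det-g∞) (λ j → translated (g j) (det-g j)))
      where
      translated : ∀ h → det h ≡ P → HasSum (λ M → only (det? 1ℤ M) (weight (form Q ◂ (h ⊡ M)))) (+ 12)
      translated h d = HasSum-cong {f = orbit (form Q ◂ h)}
        (λ M → orbit-≡ (form Q ◂ h) (form Q ◂ (h ⊡ M)) M (sym (◂-⊡ (form Q) h M)))
        (orbit-◂ Q h d)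

    -- The weight of R ◂ M after division by p², if possible.
    lowered : BQF → Matrix → ℤ
    lowered R M = only (P * P ∣ᶠ? R ◂ M) (weight (R ◂ M))

    lowered-yes : ∀ R M → P * P ∣ᶠ R ◂ M → lowered R M ≡ weight (R ◂ M)
    lowered-yes R M = only-yes (P * P ∣ᶠ? R ◂ M)

    lowered-no : ∀ R M → ¬ P * P ∣ᶠ R ◂ M → lowered R M ≡ 0ℤ
    lowered-no R M = only-no (P * P ∣ᶠ? R ◂ M)

    -- Divisibility by p² is invariant under SL₂(ℤ), so it is a condition on the coset; each coset
    -- satisfying it contributes 12.
    lowering : ∀ {n} (R : PosForm n) → HasSum (ind (lowered (form R))) (+ 12 * ρ (form R))
    lowering R = HasSum-≡ total-ρ (cosets (lowered (form R)) (translated g∞ det-g∞) (λ j → translated (g j) (det-g j)))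
      where
      r = form R
      c : Matrix → ℤ
      c h = + 12 * only (P * P ∣ᶠ? r ◂ h) 1ℤ
      total-ρ : c g∞ + sum (upTo p) (λ j → c (g j)) ≡ + 12 * ρ r
      total-ρ = trans (cong (λ u → c g∞ + u) (trans (sum-cong (upTo p) (λ j → ℤ.*-comm (+ 12) (only (P * P ∣ᶠ? r ◂ g j) 1ℤ)))
          (trans (sym (sum-*ʳ (upTo p) (λ j → only (P * P ∣ᶠ? r ◂ g j) 1ℤ) (+ 12))) (ℤ.*-comm _ (+ 12)))))
        (sym (ℤ.*-distribˡ-+ (+ 12) (only (P * P ∣ᶠ? r ◂ g∞) 1ℤ) _))
      translated : ∀ h → det h ≡ P → HasSum (λ M → only (det? 1ℤ M) (lowered r (h ⊡ M))) (c h)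
      translated h d = go (P * P ∣ᶠ? r ◂ h)
        where
        go : (d? : Dec (P * P ∣ᶠ r ◂ h)) → HasSum (λ M → only (det? 1ℤ M) (lowered r (h ⊡ M))) (+ 12 * only d? 1ℤ)
        go (no ¬d) = HasSum-ε (λ M → vanish M (det? 1ℤ M))
          where
          vanish : ∀ M → (D? : Dec (det M ≡ 1ℤ)) → only D? (lowered r (h ⊡ M)) ≡ 0ℤ
          vanish M (no _) = refl
          vanish M (yes D) = lowered-no r (h ⊡ M) (λ q → ¬d (subst (P * P ∣ᶠ_) (adj-◂ (r ◂ h) M D)
            (∣ᶠ-◂ (P * P) (r ◂ h ◂ M) (adj M) (subst (P * P ∣ᶠ_) (◂-⊡ r h M) q))))
        go (yes q) = HasSum-cong same (orbit-◂ R h d)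
          where
          same : ∀ M → orbit (r ◂ h) M ≡ only (det? 1ℤ M) (lowered r (h ⊡ M))
          same M = trans (orbit-≡ (r ◂ h) (r ◂ (h ⊡ M)) M (sym (◂-⊡ r h M)))
            (cong (only (det? 1ℤ M)) (sym (lowered-yes r (h ⊡ M)
              (subst (P * P ∣ᶠ_) (sym (◂-⊡ r h M)) (∣ᶠ-◂ (P * P) (r ◂ h) M q)))))

    module Level (n n′ : ℕ) (n→n′ : -[1+ n ] * (P * P) ≡ -[1+ n′ ]) where

      -- A pair carries the weights of both ends, which makes the correspondence symmetric without
      -- choosing class representatives.
      raised : BQF × Matrix → ℤ
      raised (Q , M) = weighted n Q * ind (λ M → weight (Q ◂ M)) M

      unraised : BQF × Matrix → ℤ
      unraised (R , M) = weighted n′ R * ind (lowered R) M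

      raised-sum : HasSum raised (S n * (+ 12 * (1ℤ + P)))
      raised-sum = HasSum-Σ (scale (+ 12 * (1ℤ + P)) (S-sum n)) (λ Q → row Q (weighted-view n Q))
          (λ Q → [ inj₁ , (λ w≡0 → inj₂ (λ M → zeroˡ (ind (λ M → weight (Q ◂ M)) M) w≡0)) ]′ (covers (S-sum n) Q))
        where
        zeroˡ : ∀ {x} y → x ≡ 0ℤ → x * y ≡ 0ℤ
        zeroˡ y refl = ℤ.*-zeroˡ y
        row : ∀ Q → (∃[ F ] form {n} F ≡ Q) ⊎ weighted n Q ≡ 0ℤ →
              HasSum (λ M → raised (Q , M)) (weighted n Q * (+ 12 * (1ℤ + P)))
        row _ (inj₁ (Q , refl)) = HasSum-≡ (ℤ.*-comm _ (weighted n (form Q)))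
          (HasSum-cong (λ M → ℤ.*-comm _ (weighted n (form Q))) (scale (weighted n (form Q)) (raising Q)))
        row Q (inj₂ w≡0) = HasSum-≡ (sym (zeroˡ _ w≡0)) (HasSum-ε (λ M → zeroˡ _ w≡0))

      -- The two ends exchange roles: `Q ◂ M ◂ adj M` is p² Q, whose weight is that of `Q`, and the
      -- product of the two weights is commutative.
      unraised-φ : ∀ Q M → det M ≡ P → unraised (Q ◂ M , adj M) ≡ raised (Q , M)
      unraised-φ Q M d = trans
          (cong₂ _*_ (only-⇔ (disc? n′ (Q ◂ M)) (disc? n Q) to from)
            (trans (only-yes (det? P (adj M)) (trans (det-adj M) d))
              (trans (only-yes (P * P ∣ᶠ? Q ◂ M ◂ adj M) (subst (P * P ∣ᶠ_) (sym P²Q) (∣ᶠ-·ᶠ (P * P) Q)))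
                (trans (cong weight P²Q) (weight-P² P²-suc)))))
          (trans (exchange (disc? n Q)) (cong (weighted n Q *_) (sym (only-yes (det? P M) d))))
        where
        P²Q : Q ◂ M ◂ adj M ≡ (P * P) ·ᶠ Q
        P²Q = trans (◂-adj Q M) (cong (λ u → (u * u) ·ᶠ Q) d)
        weight-P² : (∃[ k ] P * P ≡ + suc k) → weight ((P * P) ·ᶠ Q) ≡ weight Q
        weight-P² (k , eq) = trans (cong (λ u → weight (u ·ᶠ Q)) eq) (weight-·ᶠ k Q)
        disc-M : disc (Q ◂ M) ≡ disc Q * (P * P)
        disc-M = trans (disc-◂ Q M) (cong (λ u → disc Q * (u * u)) d)
        to : disc (Q ◂ M) ≡ -[1+ n′ ] → disc Q ≡ -[1+ n ]
        to D = cancel-P² (trans (ℤ.*-comm (P * P) (disc Q)) (trans (sym disc-M) (trans D (trans (sym n→n′) (ℤ.*-comm -[1+ n ] (P * P))))))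
        from : disc Q ≡ -[1+ n ] → disc (Q ◂ M) ≡ -[1+ n′ ]
        from D = trans disc-M (trans (cong (_* (P * P)) D) n→n′)
        exchange : ∀ {A : Set} (D? : Dec A) → only D? (weight (Q ◂ M)) * weight Q ≡ only D? (weight Q) * weight (Q ◂ M)
        exchange (yes _) = ℤ.*-comm (weight (Q ◂ M)) (weight Q)
        exchange (no _)  = trans (ℤ.*-zeroˡ (weight Q)) (sym (ℤ.*-zeroˡ (weight (Q ◂ M))))

      raise lower : BQF × Matrix → BQF × Matrix
      raise (Q , M) = Q ◂ M , adj M
      lower (R , M) = quotᶠ (P * P) (R ◂ M) , adj M

      raised-0 : ∀ Q M → det M ≢ P → raised (Q , M) ≡ 0ℤ
      raised-0 Q M d = trans (cong (weighted n Q *_) (only-no (det? P M) d)) (ℤ.*-zeroʳ (weighted n Q))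

      lower-raise : ∀ Q M → det M ≡ P → lower (raise (Q , M)) ≡ (Q , M)
      lower-raise Q M d with P²-suc
      ... | k , P² = cong₂ _,_ (trans (cong₂ quotᶠ P² (trans (◂-adj Q M) (cong (_·ᶠ Q) (trans (cong₂ _*_ d d) P²)))) (quotᶠ-·ᶠ k Q)) (adj-adj M)

      raise-lower : ∀ R M → det M ≡ P → P * P ∣ᶠ R ◂ M → raise (lower (R , M)) ≡ (R , M)
      raise-lower R M d q with P²-suc
      ... | k , P² = cong₂ _,_ Q◂ (adj-adj M)
        where
        Q = quotᶠ (P * P) (R ◂ M)
        Q◂ : Q ◂ adj M ≡ R
        Q◂ = ·ᶠ-injective k _ _ (subst (λ u → u ·ᶠ (Q ◂ adj M) ≡ u ·ᶠ R) P² (trans (sym (·ᶠ-◂ (P * P) Q (adj M)))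
          (trans (cong (_◂ adj M) (quotᶠ-∣ᶠ (R ◂ M) q)) (trans (◂-adj R M) (cong (λ u → (u * u) ·ᶠ R) d)))))

      unraised-0 : ∀ R M → lowered R M ≡ 0ℤ ⊎ det M ≢ P → unraised (R , M) ≡ 0ℤ
      unraised-0 R M z = trans (cong (weighted n′ R *_) (vanish (det? P M) z)) (ℤ.*-zeroʳ (weighted n′ R))
        where
        vanish : (d? : Dec (det M ≡ P)) → lowered R M ≡ 0ℤ ⊎ det M ≢ P → only d? (lowered R M) ≡ 0ℤ
        vanish (no _)  _        = refl
        vanish (yes _) (inj₁ p) = p
        vanish (yes d) (inj₂ ¬d) = ⊥-elim (¬d d)

      raised-lower : ∀ R M → det M ≡ P → P * P ∣ᶠ R ◂ M → raised (lower (R , M)) ≡ unraised (R , M)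
      raised-lower R M d q = trans (sym (unraised-φ (quotᶠ (P * P) (R ◂ M)) (adj M) (trans (det-adj M) d)))
        (cong unraised (raise-lower R M d q))

      unraised-sum : HasSum unraised (S n * (+ 12 * (1ℤ + P)))
      unraised-sum = HasSum-bij {f = raised} {g = unraised} raise lower
          (λ (Q , M) → retract Q M (det? P M)) (λ (Q , M) → agree Q M (det? P M))
          (λ (R , M) → section R M (det? P M) (P * P ∣ᶠ? R ◂ M)) raised-sum
        where
        retract : ∀ Q M → Dec (det M ≡ P) → lower (raise (Q , M)) ≡ (Q , M) ⊎ raised (Q , M) ≡ 0ℤ
        retract Q M (yes d) = inj₁ (lower-raise Q M d)
        retract Q M (no ¬d) = inj₂ (raised-0 Q M ¬d)
        agree : ∀ Q M → Dec (det M ≡ P) → unraised (raise (Q , M)) ≡ raised (Q , M) ⊎ raised (Q , M) ≡ 0ℤ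
        agree Q M (yes d) = inj₁ (unraised-φ Q M d)
        agree Q M (no ¬d) = inj₂ (raised-0 Q M ¬d)
        section : ∀ R M → Dec (det M ≡ P) → Dec (P * P ∣ᶠ R ◂ M) →
                  (raise (lower (R , M)) ≡ (R , M) × raised (lower (R , M)) ≡ unraised (R , M)) ⊎ unraised (R , M) ≡ 0ℤ
        section R M (no ¬d) _ = inj₂ (unraised-0 R M (inj₂ ¬d))
        section R M (yes d) (no ¬q) = inj₂ (unraised-0 R M (inj₁ (lowered-no R M ¬q)))
        section R M (yes d) (yes q) = inj₁ (raise-lower R M d q , raised-lower R M d q)

      -- The Hecke operator at p² in terms of the number of sublattices.
      hecke : HasSum (λ R → weighted n′ R * (+ 12 * ρ R)) (S n * (+ 12 * (1ℤ + P)))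
      hecke = HasSum-fubini unraised-sum (λ R → row R (weighted-view n′ R))
        where
        zeroˡ : ∀ {x} y → x ≡ 0ℤ → x * y ≡ 0ℤ
        zeroˡ y refl = ℤ.*-zeroˡ y
        row : ∀ R → (∃[ F ] form {n′} F ≡ R) ⊎ weighted n′ R ≡ 0ℤ →
              HasSum (λ M → unraised (R , M)) (weighted n′ R * (+ 12 * ρ R))
        row _ (inj₁ (R , refl)) = HasSum-≡ (ℤ.*-comm _ (weighted n′ (form R)))
          (HasSum-cong (λ M → ℤ.*-comm _ (weighted n′ (form R))) (scale (weighted n′ (form R)) (lowering R)))
        row R (inj₂ w≡0) = HasSum-≡ (sym (zeroˡ _ w≡0)) (HasSum-ε (λ M → zeroˡ _ w≡0))

      -- The constant part of `ρ` reproduces `S n′`. The conditional part counts forms divisible by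
      -- `suc k`, which by `multiples` are those of the smaller discriminant.
      hecke-relation : ∀ k v m → + suc k * + suc k * -[1+ m ] ≡ -[1+ n′ ] →
        (∀ R → disc R ≡ -[1+ n′ ] → ρ R ≡ 1ℤ + only (+ suc k ∣ᶠ? R) v) →
        S n * (1ℤ + P) ≡ S n′ + S m * v
      hecke-relation k v m eq ρ≡ = ℤ.*-cancelˡ-≡ (+ 12) _ _ (trans (e₁ (S n) P)
          (trans (HasSum-unique hecke (HasSum-cong pointwise
            (HasSum-⊕ (scale (+ 12) (S-sum n′)) (scale (+ 12) (multiples k m n′ v eq))))) (e₂ (S n′) (S m * v))))
        where
        e₁ : ∀ s P → + 12 * (s * (1ℤ + P)) ≡ s * (+ 12 * (1ℤ + P))
        e₁ = solve-∀
        e₂ : ∀ s u → s * + 12 + u * + 12 ≡ + 12 * (s + u)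
        e₂ = solve-∀
        e₃ : ∀ w u → w * + 12 + w * u * + 12 ≡ w * (+ 12 * (1ℤ + u))
        e₃ = solve-∀
        linear : ∀ {A : Set} (D? : Dec A) x u r → (A → r ≡ 1ℤ + u) →
                 only D? x * + 12 + only D? x * u * + 12 ≡ only D? x * (+ 12 * r)
        linear (yes D) x u r r≡ = trans (e₃ x u) (cong (λ u → x * (+ 12 * u)) (sym (r≡ D)))
        linear (no _)  x u r r≡ = sym (ℤ.*-zeroˡ (+ 12 * r))
        pointwise : ∀ R → weighted n′ R * + 12 + weighted n′ R * only (+ suc k ∣ᶠ? R) v * + 12 ≡ weighted n′ R * (+ 12 * ρ R)
        pointwise R = linear (disc? n′ R) (weight R) (only (+ suc k ∣ᶠ? R) v) (ρ R) (ρ≡ R)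

-- Class numbers of p² (pˢ - t²).

module HeckeTrace where

  open import Defs using (0<z²)
  open FinSum
  open Forms
  open Congruence
  open Roots
  open Hecke
  open import Data.Integer.Base using (_+_; _*_; _-_; -_; _≤_)
  open import Data.Integer.Divisibility.Signed using (divides) renaming (_∣_ to infix 4 _∥_; _∣?_ to infix 4 _∥?_)
  open import Data.Integer.Tactic.RingSolver using (solve-∀)

  -- 6 H, except for the value 0 at 0.
  6H⁺ : ℤ → ℤ
  6H⁺ (+ suc n) = S n
  6H⁺ _         = 0ℤ

  module Trace (p : ℕ) (p-prime : Prime p) (P∤2 : ¬ + p ∥ + 2) where

    open Operator p p-prime P∤2
    open Lines p p-prime P∤2

    N : ℕ → ℤ → ℤ
    N s t = + (p ℕ.^ s) - t * t

    6H⁺-≤0 : ∀ {x} → x ≤ 0ℤ → 6H⁺ x ≡ 0ℤ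
    6H⁺-≤0 {+ zero}   _ = refl
    6H⁺-≤0 { -[1+ _ ]} _ = refl
    6H⁺-≤0 {+ suc _} (+≤+ ())

    positive? : ∀ x → (∃[ n ] x ≡ + suc n) ⊎ x ≤ 0ℤ
    positive? (+ suc n) = inj₁ (n , refl)
    positive? (+ zero)  = inj₂ ℤ.≤-refl
    positive? -[1+ n ]  = inj₂ ℤ.-≤+

    P²*≤0 : ∀ {x} → x ≤ 0ℤ → P * P * x ≤ 0ℤ
    P²*≤0 {x} x≤0 = subst₂ _≤_ (sym (ℤ.*-assoc P P x)) refl (times (times x≤0))
      where
      times : ∀ {x} → x ≤ 0ℤ → P * x ≤ 0ℤ
      times {x} x≤0 = subst (P * x ≤_) (ℤ.*-zeroʳ P) (ℤ.*-monoˡ-≤-nonNeg P x≤0)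

    large : ∀ s t → s ℕ.≤ 2 → t ≢ 0ℤ → N s (t * P) ≤ 0ℤ
    large s t s≤2 t≢0 = ℤ.i≤j⇒i-j≤0 (ℤ.≤-trans (+≤+ (ℕ.^-monoʳ-≤ p s≤2)) (subst₂ _≤_ p² (e t P) bound))
      where
      p² : P * P * 1ℤ ≡ + (p ℕ.^ 2)
      p² = trans (ℤ.*-identityʳ (P * P)) (trans (cong (P *_) (cong +_ (sym (ℕ.*-identityʳ p)))) (sym (ℤ.pos-* p (p ℕ.* 1))))
      e : ∀ t P → P * P * (t * t) ≡ t * P * (t * P)
      e = solve-∀
      bound : P * P * 1ℤ ≤ P * P * (t * t)
      bound = subst₂ _≤_ (sym (ℤ.*-assoc P P 1ℤ)) (sym (ℤ.*-assoc P P (t * t)))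
        (ℤ.*-monoˡ-≤-nonNeg P (ℤ.*-monoˡ-≤-nonNeg P (ℤ.i<j⇒suc[i]≤j (0<z² t≢0))))

    N-step : ∀ s t → N (suc (suc s)) (t * P) ≡ P * P * N s t
    N-step s t = trans (cong (_- t * P * (t * P)) (trans (ℤ.pos-* p (p ℕ.* p ℕ.^ s)) (cong (P *_) (ℤ.pos-* p (p ℕ.^ s))))) (e P (+ (p ℕ.^ s)) t)
      where
      e : ∀ P x t → P * (P * x) - t * P * (t * P) ≡ P * P * (x - t * t)
      e = solve-∀

    lift-index : ∀ n → ∃[ n′ ] P * P * + suc n ≡ + suc n′
    lift-index n with P²-suc
    ... | k , eq = _ , cong (_* + suc n) eq

    -- For t ≠ 0 the discriminant t² - pˢ is a p-adic square up to an even power of p.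
    trace-lift : ∀ s t → t ≢ 0ℤ → 6H⁺ (P * P * N s t) ≡ P * 6H⁺ (N s t)

    trace-lift-positive : ∀ s t n n′ → t ≢ 0ℤ → N s t ≡ + suc n → P * P * + suc n ≡ + suc n′ → S n′ ≡ P * S n

    trace-lift s t t≢0 with positive? (N s t)
    ... | inj₂ N≤0 = trans (6H⁺-≤0 (P²*≤0 N≤0)) (sym (trans (cong (P *_) (6H⁺-≤0 N≤0)) (ℤ.*-zeroʳ P)))
    ... | inj₁ (n , eq) with lift-index n
    ...   | n′ , eq′ = trans (cong 6H⁺ (trans (cong (P * P *_) eq) eq′))
              (trans (trace-lift-positive s t n n′ t≢0 eq eq′) (cong (λ x → P * 6H⁺ x) (sym eq)))

    trace-lift-positive s t n n′ t≢0 eq eq′ = go s (P ∥? t) eq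
      where
      -eq′ : P * P * -[1+ n ] ≡ -[1+ n′ ]
      -eq′ = trans (sym (ℤ.neg-distribʳ-* (P * P) (+ suc n))) (cong -_ eq′)
      eq″ : -[1+ n ] * (P * P) ≡ -[1+ n′ ]
      eq″ = trans (ℤ.*-comm -[1+ n ] (P * P)) -eq′
      open Level n n′ eq″
      cancel : ∀ a b → a * (1ℤ + P) ≡ b + a → b ≡ P * a
      cancel a b h = trans (e₁ a b) (trans (cong (_- a) (sym h)) (e₂ a P))
        where
        e₁ : ∀ a b → b ≡ b + a - a
        e₁ = solve-∀
        e₂ : ∀ a P → a * (1ℤ + P) - a ≡ P * a
        e₂ = solve-∀
      impossible : ∀ {A : Set} {x} → x ≤ 0ℤ → x ≡ + suc n → A
      impossible (+≤+ ()) refl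
      go : ∀ s → Dec (P ∥ t) → N s t ≡ + suc n → S n′ ≡ P * S n
      go zero (no _) eq = impossible {x = N 0 t} (ℤ.i≤j⇒i-j≤0 (ℤ.i<j⇒suc[i]≤j (0<z² t≢0))) eq
      -- The discriminant is t² modulo p, a non-zero square, so the relation reads S n (1 + p) = S
      -- n′ + S n.
      go (suc s) (no P∤t) eq with P-suc
      ... | k , P≡ = cancel (S n) (S n′) (trans
            (hecke-relation k 1ℤ n (subst (λ u → u * u * -[1+ n ] ≡ -[1+ n′ ]) P≡ -eq′)
              (λ R D → trans (ρ-split R t -[1+ n ] (trans D (sym -eq′)) divisible P∤t)
                (cong (λ u → 1ℤ + only (u ∣ᶠ? R) 1ℤ) P≡)))
            (cong (λ u → S n′ + u) (ℤ.*-identityʳ (S n))))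
        where
        open FinSum.Sum ℤ.+-0-isCommutativeMonoid using (only)
        e : ∀ x t → t * t + (x - t * t) ≡ x
        e = solve-∀
        divisible : P ∥ t * t - -[1+ n ]
        divisible = divides (+ (p ℕ.^ s)) (trans (cong (λ u → t * t + u) (sym eq)) (trans (e (+ (p ℕ.^ suc s)) t)
          (trans (ℤ.pos-* p (p ℕ.^ s)) (ℤ.*-comm P _))))
      go 0 (yes (divides t′ refl)) eq = impossible (large 0 t′ z≤n (λ { refl → t≢0 refl })) eq
      go 1 (yes (divides t′ refl)) eq = impossible (large 1 t′ (s≤s z≤n) (λ { refl → t≢0 refl })) eq
      -- With t = p t′ the discriminant is p² times the one for t′ at exponent s. The relation reads
      -- S n (1 + p) = S n′ + p S m, and p S m = S n by recursion.
      go (suc (suc s)) (yes (divides t′ refl)) eq = from (positive? (N s t′))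
        where
        t′≢0 : t′ ≢ 0ℤ
        t′≢0 refl = t≢0 refl
        from : (∃[ m ] N s t′ ≡ + suc m) ⊎ N s t′ ≤ 0ℤ → S n′ ≡ P * S n
        from (inj₂ N≤0) = impossible (subst (_≤ 0ℤ) (sym (N-step s t′)) (P²*≤0 N≤0)) eq
        from (inj₁ (m , eqₘ)) with P²-suc
        ... | k , P²≡ = cancel (S n) (S n′) (trans
              (hecke-relation k P m (subst (λ u → u * u * -[1+ m ] ≡ -[1+ n′ ]) P²≡ P⁴m)
                (λ R D → trans (ρ-double R -[1+ m ] (trans D (sym (trans (sym (ℤ.*-assoc (P * P) (P * P) -[1+ m ])) P⁴m))))
                  (cong (λ u → 1ℤ + only (u ∣ᶠ? R) P) P²≡)))
              (cong (λ u → S n′ + u) (trans (ℤ.*-comm (S m) P) (sym (trace-lift-positive s t′ m n t′≢0 eqₘ P²m)))))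
          where
          open FinSum.Sum ℤ.+-0-isCommutativeMonoid using (only)
          P²m : P * P * + suc m ≡ + suc n
          P²m = trans (cong (P * P *_) (sym eqₘ)) (trans (sym (N-step s t′)) eq)
          P⁴m : P * P * (P * P) * -[1+ m ] ≡ -[1+ n′ ]
          P⁴m = trans (ℤ.*-assoc (P * P) (P * P) -[1+ m ])
            (trans (cong (P * P *_) (trans (sym (ℤ.neg-distribʳ-* (P * P) (+ suc m))) (cong -_ P²m))) -eq′)

-- A pointwise dissection of the weight by signs.

module Pointwise where

  open Forms
  open import Data.Integer.Base using (_+_; _*_; _-_; -_; _<_; _≤_)
  open import Data.Integer.Tactic.RingSolver using (solve-∀)

  posᴸ : List ℤ → ℤ
  posᴸ []       = 1ℤ
  posᴸ (x ∷ xs) = pos x * posᴸ xs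

  -- The cones below partition the quadruples (t , x , y , z), up to cancelling contributions,
  -- according to the positions of x, y, z and their pairwise sums relative to t and 0.
  N₁ F₁ Q₁ R₁ K⁺ K⁻ K G : ℤ → ℤ → ℤ → ℤ → ℤ
  N₁ t x y z = posᴸ (x + t ∷ x - t ∷ y + t ∷ y - t ∷ z + t ∷ z - t ∷ [])
  F₁ t x y z = posᴸ (t - x ∷ t + x ∷ y - t ∷ z - t ∷ [])
  Q₁ t x y z = posᴸ (x + y ∷ z + x ∷ t - x ∷ t - y ∷ t - z ∷ [])
  R₁ t x y z = posᴸ (x + y ∷ y + z ∷ z + x ∷ t - x ∷ t - y ∷ t - z ∷ [])
  K⁺ t x y z = posᴸ (x ∷ t - x ∷ t + x ∷ x + y ∷ z + x ∷ [])
  K⁻ t x y z = posᴸ (- x ∷ t - x ∷ t + x ∷ x + y ∷ z + x ∷ [])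
  K t x y z = K⁺ t x y z - K⁻ t x y z
  G t x y z = F₁ t x y z + F₁ t y z x + F₁ t z x y - (Q₁ t x y z + Q₁ t y z x + Q₁ t z x y) + + 2 * R₁ t x y z
              + (K t x y z + K t y z x + K t z x y)

  private

    data Sgn : Set where
      n o p : Sgn

    sgn : ℤ → Sgn
    sgn (+ zero)  = o
    sgn (+ suc _) = p
    sgn -[1+ _ ]  = n

    p? : Sgn → Bool
    p? p = true
    p? _ = false

    n? : Sgn → Bool
    n? n = true
    n? _ = false

    o? : Sgn → Bool
    o? o = true
    o? _ = false

    isPos : ℤ → Bool
    isPos (+ suc _) = true
    isPos _         = false

    ⟦_⟧ : Bool → ℤ
    ⟦ true ⟧  = 1ℤ
    ⟦ false ⟧ = 0ℤ

    pos≡ : ∀ x → pos x ≡ ⟦ isPos x ⟧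
    pos≡ (+ zero)  = refl
    pos≡ (+ suc _) = refl
    pos≡ -[1+ _ ]  = refl

    pos-sgn : ∀ x → pos x ≡ ⟦ p? (sgn x) ⟧
    pos-sgn (+ zero)  = refl
    pos-sgn (+ suc _) = refl
    pos-sgn -[1+ _ ]  = refl

    pos-neg-sgn : ∀ x → pos (- x) ≡ ⟦ n? (sgn x) ⟧
    pos-neg-sgn (+ zero)  = refl
    pos-neg-sgn (+ suc _) = refl
    pos-neg-sgn -[1+ _ ]  = refl

    zer-sgn : ∀ x → zer x ≡ ⟦ o? (sgn x) ⟧
    zer-sgn (+ zero)  = refl
    zer-sgn (+ suc _) = refl
    zer-sgn -[1+ _ ]  = refl

    pos-not : ∀ x → x ≢ 0ℤ → pos (- x) ≡ ⟦ not (isPos x) ⟧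
    pos-not (+ zero)  x≢0 = ⊥-elim (x≢0 refl)
    pos-not (+ suc _) _   = refl
    pos-not -[1+ _ ]  _   = refl

    all-B : (Bool → Bool) → Bool
    all-B f = f true ∧ f false

    all-S : (Sgn → Bool) → Bool
    all-S f = f n ∧ (f o ∧ f p)

    ∧-l : ∀ {a b} → a ∧ b ≡ true → a ≡ true
    ∧-l {true} _ = refl

    ∧-r : ∀ {a b} → a ∧ b ≡ true → b ≡ true
    ∧-r {true} e = e

    ∧-i : ∀ {a b} → a ≡ true → b ≡ true → a ∧ b ≡ true
    ∧-i refl refl = refl

    at-B : ∀ {f : Bool → Bool} → all-B f ≡ true → ∀ b → f b ≡ true
    at-B {f} e true  = ∧-l {f true} e
    at-B {f} e false = ∧-r {f true} e

    at-S : ∀ {f : Sgn → Bool} → all-S f ≡ true → ∀ s → f s ≡ true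
    at-S {f} e n = ∧-l {f n} e
    at-S {f} e o = ∧-l {f o} (∧-r {f n} e)
    at-S {f} e p = ∧-r {f o} (∧-r {f n} e)

    infixr 4 _⇒_
    _⇒_ : Bool → Bool → Bool
    true  ⇒ b = b
    false ⇒ _ = true

    mp : ∀ {a b} → (a ⇒ b) ≡ true → a ≡ true → b ≡ true
    mp e refl = e

    -- Which combinations of the signs of s, t - s, t + s occur.
    single : Sgn → Bool → Bool → Bool
    single n u w = w ⇒ u
    single o u w = (u ⇒ w) ∧ (w ⇒ u)
    single p u w = u ⇒ w

    sum-sign : Sgn → Sgn → Bool → Bool
    sum-sign p n e = true
    sum-sign n p e = true
    sum-sign p _ e = e
    sum-sign _ p e = e
    sum-sign _ _ e = not e

    diff-sign : Bool → Bool → Bool → Bool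
    diff-sign true  false e = e
    diff-sign false true  e = not e
    diff-sign _     _     _ = true

    -- The sum x + y is also (t + x) - (t - y) and (t + y) - (t - x), which constrains its sign
    -- beyond the signs of x and y.
    pair : Sgn → Bool → Bool → Sgn → Bool → Bool → Bool → Bool
    pair σ u w σ′ u′ w′ e = sum-sign σ σ′ e ∧ (diff-sign w u′ e ∧ diff-sign w′ u e)

    0<⇒isPos : ∀ {x} → 0ℤ < x → isPos x ≡ true
    0<⇒isPos {+ suc _} _ = refl
    0<⇒isPos {+ zero} (+<+ ())

    isPos⇒0< : ∀ {x} → isPos x ≡ true → 0ℤ < x
    isPos⇒0< {+ suc _} _ = 0<s

    ≤0⇒isPos : ∀ {x} → x ≤ 0ℤ → isPos x ≡ false
    ≤0⇒isPos {+ zero} _ = refl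
    ≤0⇒isPos { -[1+ _ ]} _ = refl
    ≤0⇒isPos {+ suc _} (ℤ.+≤+ ())

    isPos⇒≤0 : ∀ {x} → isPos x ≡ false → x ≤ 0ℤ
    isPos⇒≤0 {+ zero}   _ = ℤ.≤-refl
    isPos⇒≤0 { -[1+ _ ]} _ = ℤ.-≤+

    sum-sign-ok : ∀ x y → sum-sign (sgn x) (sgn y) (isPos (x + y)) ≡ true
    sum-sign-ok (+ zero)  (+ zero)  = refl
    sum-sign-ok (+ zero)  (+ suc _) = refl
    sum-sign-ok (+ zero)  -[1+ _ ]  = refl
    sum-sign-ok (+ suc _) (+ zero)  = refl
    sum-sign-ok (+ suc _) (+ suc _) = refl
    sum-sign-ok (+ suc _) -[1+ _ ]  = refl
    sum-sign-ok -[1+ _ ]  (+ zero)  = refl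
    sum-sign-ok -[1+ _ ]  (+ suc _) = refl
    sum-sign-ok -[1+ _ ]  -[1+ _ ]  = refl

    diff-sign-ok : ∀ x y z → x - y ≡ z → diff-sign (isPos x) (isPos y) (isPos z) ≡ true
    diff-sign-ok x y z refl with isPos x in ex | isPos y in ey
    ... | true  | true  = refl
    ... | false | false = refl
    ... | true  | false = 0<⇒isPos (ℤ.+-mono-<-≤ (isPos⇒0< ex) (ℤ.neg-mono-≤ (isPos⇒≤0 {y} ey)))
    ... | false | true  = cong not (≤0⇒isPos (ℤ.<⇒≤ (ℤ.+-mono-≤-< (isPos⇒≤0 {x} ex) (ℤ.neg-mono-< (isPos⇒0< {y} ey)))))

    single-ok : ∀ t s → single (sgn s) (isPos (t - s)) (isPos (t + s)) ≡ true
    single-ok t (+ zero) rewrite ℤ.+-identityʳ t = ∧-i (⇒-refl (isPos t)) (⇒-refl (isPos t))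
      where
      ⇒-refl : ∀ b → (b ⇒ b) ≡ true
      ⇒-refl true  = refl
      ⇒-refl false = refl
    single-ok t s@(+ suc k) with isPos (t - s) in eq
    ... | false = refl
    ... | true  = 0<⇒isPos (subst (0ℤ <_) (e t s) (ℤ.+-mono-< {0ℤ} {_} {0ℤ} (isPos⇒0< eq) (+<+ {0} {suc k ℕ.+ suc k} (s≤s z≤n))))
      where
      e : ∀ t s → t - s + (s + s) ≡ t + s
      e = solve-∀
    single-ok t s@(-[1+ k ]) with isPos (t + s) in eq
    ... | false = refl
    ... | true  = 0<⇒isPos (subst (0ℤ <_) (e t s) (ℤ.+-mono-< {0ℤ} {_} {0ℤ} (isPos⇒0< eq) (+<+ {0} {suc k ℕ.+ suc k} (s≤s z≤n))))
      where
      e : ∀ t s → t + s + (- s + - s) ≡ t - s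
      e = solve-∀

    pair-ok : ∀ t x y → pair (sgn x) (isPos (t - x)) (isPos (t + x)) (sgn y) (isPos (t - y)) (isPos (t + y)) (isPos (x + y)) ≡ true
    pair-ok t x y = ∧-i (sum-sign-ok x y) (∧-i (diff-sign-ok (t + x) (t - y) (x + y) (e₁ t x y)) (diff-sign-ok (t + y) (t - x) (x + y) (e₂ t x y)))
      where
      e₁ : ∀ t x y → t + x - (t - y) ≡ x + y
      e₁ = solve-∀
      e₂ : ∀ t x y → t + y - (t - x) ≡ x + y
      e₂ = solve-∀

    N′ : (u₁ w₁ u₂ w₂ u₃ w₃ : Bool) → ℤ
    N′ u₁ w₁ u₂ w₂ u₃ w₃ = ⟦ w₁ ⟧ * (⟦ not u₁ ⟧ * (⟦ w₂ ⟧ * (⟦ not u₂ ⟧ * (⟦ w₃ ⟧ * (⟦ not u₃ ⟧ * 1ℤ)))))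

    G′ : (σ₁ : Sgn) (u₁ w₁ : Bool) (σ₂ : Sgn) (u₂ w₂ : Bool) (σ₃ : Sgn) (u₃ w₃ : Bool) (e₁ e₂ e₃ : Bool) → ℤ
    G′ σ₁ u₁ w₁ σ₂ u₂ w₂ σ₃ u₃ w₃ e₁ e₂ e₃ =
      F′ u₁ w₁ u₂ u₃ + F′ u₂ w₂ u₃ u₁ + F′ u₃ w₃ u₁ u₂
      - (Q′ e₃ e₂ u₁ u₂ u₃ + Q′ e₁ e₃ u₂ u₃ u₁ + Q′ e₂ e₁ u₃ u₁ u₂)
      + + 2 * (⟦ e₃ ⟧ * (⟦ e₁ ⟧ * (⟦ e₂ ⟧ * (⟦ u₁ ⟧ * (⟦ u₂ ⟧ * (⟦ u₃ ⟧ * 1ℤ))))))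
      + (K′ σ₁ u₁ w₁ e₃ e₂ + K′ σ₂ u₂ w₂ e₁ e₃ + K′ σ₃ u₃ w₃ e₂ e₁)
      where
      F′ : Bool → Bool → Bool → Bool → ℤ
      F′ u w u′ u″ = ⟦ u ⟧ * (⟦ w ⟧ * (⟦ not u′ ⟧ * (⟦ not u″ ⟧ * 1ℤ)))
      Q′ : Bool → Bool → Bool → Bool → Bool → ℤ
      Q′ e e′ u u′ u″ = ⟦ e ⟧ * (⟦ e′ ⟧ * (⟦ u ⟧ * (⟦ u′ ⟧ * (⟦ u″ ⟧ * 1ℤ))))
      K′ : Sgn → Bool → Bool → Bool → Bool → ℤ
      K′ σ u w e e′ = ⟦ p? σ ⟧ * (⟦ u ⟧ * (⟦ w ⟧ * (⟦ e ⟧ * (⟦ e′ ⟧ * 1ℤ))))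
                      - ⟦ n? σ ⟧ * (⟦ u ⟧ * (⟦ w ⟧ * (⟦ e ⟧ * (⟦ e′ ⟧ * 1ℤ))))

    W′ : Sgn → Sgn → Sgn → ℤ
    W′ σ₁ σ₂ σ₃ = + 2 * (⟦ p? σ₁ ⟧ * ⟦ p? σ₂ ⟧ * ⟦ p? σ₃ ⟧)
      + (⟦ o? σ₁ ⟧ * ⟦ p? σ₂ ⟧ * ⟦ p? σ₃ ⟧ + ⟦ p? σ₁ ⟧ * ⟦ o? σ₂ ⟧ * ⟦ p? σ₃ ⟧ + ⟦ p? σ₁ ⟧ * ⟦ p? σ₂ ⟧ * ⟦ o? σ₃ ⟧)

    identity : ∀ (σ₁ : Sgn) (u₁ w₁ : Bool) (σ₂ : Sgn) (u₂ w₂ : Bool) (σ₃ : Sgn) (u₃ w₃ e₁ e₂ e₃ : Bool) → Bool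
    identity σ₁ u₁ w₁ σ₂ u₂ w₂ σ₃ u₃ w₃ e₁ e₂ e₃ = does (W′ σ₁ σ₂ σ₃ ℤ.≟
      + 2 * N′ u₁ w₁ u₂ w₂ u₃ w₃ + G′ σ₁ u₁ w₁ σ₂ u₂ w₂ σ₃ u₃ w₃ e₁ e₂ e₃
        -- Replacing t by - t turns t - x into - (t + x) and t + x into - (t - x), so u becomes
        -- `not w` and w becomes `not u`.
        + G′ σ₁ (not w₁) (not u₁) σ₂ (not w₂) (not u₂) σ₃ (not w₃) (not u₃) e₁ e₂ e₃)

    all-SBB : (Sgn → Bool → Bool → Bool) → Bool
    all-SBB f = all-S λ σ → all-B λ u → all-B (f σ u)

    at-SBB : ∀ f → all-SBB f ≡ true → ∀ σ u w → f σ u w ≡ true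
    at-SBB f h σ u w = at-B {f σ u} (at-B {λ u → all-B (f σ u)} (at-S {λ σ → all-B λ u → all-B (f σ u)} h σ) u) w

    -- The exhaustive check is staged: a sign pattern that violates a constraint is discarded before
    -- further variables are quantified, which limits the evaluation behind `table-true`.
    T₆ T₅ : (σ₁ : Sgn) (u₁ w₁ : Bool) (σ₂ : Sgn) (u₂ w₂ e₃ : Bool) (σ₃ : Sgn) (u₃ w₃ : Bool) → Bool → Bool
    T₆′ : (σ₁ : Sgn) (u₁ w₁ : Bool) (σ₂ : Sgn) (u₂ w₂ e₃ : Bool) (σ₃ : Sgn) (u₃ w₃ e₁ : Bool) → Bool → Bool
    T₆′ σ₁ u₁ w₁ σ₂ u₂ w₂ e₃ σ₃ u₃ w₃ e₁ e₂ = pair σ₃ u₃ w₃ σ₁ u₁ w₁ e₂ ⇒ identity σ₁ u₁ w₁ σ₂ u₂ w₂ σ₃ u₃ w₃ e₁ e₂ e₃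
    T₆ σ₁ u₁ w₁ σ₂ u₂ w₂ e₃ σ₃ u₃ w₃ e₁ = all-B (T₆′ σ₁ u₁ w₁ σ₂ u₂ w₂ e₃ σ₃ u₃ w₃ e₁)
    T₅ σ₁ u₁ w₁ σ₂ u₂ w₂ e₃ σ₃ u₃ w₃ e₁ = pair σ₂ u₂ w₂ σ₃ u₃ w₃ e₁ ⇒ T₆ σ₁ u₁ w₁ σ₂ u₂ w₂ e₃ σ₃ u₃ w₃ e₁

    T₄ : (σ₁ : Sgn) (u₁ w₁ : Bool) (σ₂ : Sgn) (u₂ w₂ e₃ : Bool) → Sgn → Bool → Bool → Bool
    T₄ σ₁ u₁ w₁ σ₂ u₂ w₂ e₃ σ₃ u₃ w₃ = single σ₃ u₃ w₃ ⇒ all-B (T₅ σ₁ u₁ w₁ σ₂ u₂ w₂ e₃ σ₃ u₃ w₃)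

    T₃ : (σ₁ : Sgn) (u₁ w₁ : Bool) (σ₂ : Sgn) (u₂ w₂ : Bool) → Bool → Bool
    T₃ σ₁ u₁ w₁ σ₂ u₂ w₂ e₃ = pair σ₁ u₁ w₁ σ₂ u₂ w₂ e₃ ⇒ all-SBB (T₄ σ₁ u₁ w₁ σ₂ u₂ w₂ e₃)

    T₂ : (σ₁ : Sgn) (u₁ w₁ : Bool) → Sgn → Bool → Bool → Bool
    T₂ σ₁ u₁ w₁ σ₂ u₂ w₂ = single σ₂ u₂ w₂ ⇒ all-B (T₃ σ₁ u₁ w₁ σ₂ u₂ w₂)

    T₁ : Sgn → Bool → Bool → Bool
    T₁ σ₁ u₁ w₁ = single σ₁ u₁ w₁ ⇒ all-SBB (T₂ σ₁ u₁ w₁)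

    table-true : all-SBB T₁ ≡ true
    table-true = refl

    lookup : ∀ σ₁ u₁ w₁ σ₂ u₂ w₂ σ₃ u₃ w₃ e₁ e₂ e₃ → single σ₁ u₁ w₁ ≡ true → single σ₂ u₂ w₂ ≡ true → single σ₃ u₃ w₃ ≡ true →
      pair σ₂ u₂ w₂ σ₃ u₃ w₃ e₁ ≡ true → pair σ₃ u₃ w₃ σ₁ u₁ w₁ e₂ ≡ true → pair σ₁ u₁ w₁ σ₂ u₂ w₂ e₃ ≡ true →
      identity σ₁ u₁ w₁ σ₂ u₂ w₂ σ₃ u₃ w₃ e₁ e₂ e₃ ≡ true
    lookup σ₁ u₁ w₁ σ₂ u₂ w₂ σ₃ u₃ w₃ e₁ e₂ e₃ s₁ s₂ s₃ p₁ p₂ p₃ =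
      mp (at-B {T₆′ σ₁ u₁ w₁ σ₂ u₂ w₂ e₃ σ₃ u₃ w₃ e₁}
        (mp (at-B {T₅ σ₁ u₁ w₁ σ₂ u₂ w₂ e₃ σ₃ u₃ w₃}
          (mp (at-SBB (T₄ σ₁ u₁ w₁ σ₂ u₂ w₂ e₃)
            (mp (at-B {T₃ σ₁ u₁ w₁ σ₂ u₂ w₂}
              (mp (at-SBB (T₂ σ₁ u₁ w₁) (mp (at-SBB T₁ table-true σ₁ u₁ w₁) s₁) σ₂ u₂ w₂) s₂) e₃) p₃)
            σ₃ u₃ w₃) s₃) e₁) p₁) e₂) p₂

    does-sound : ∀ {A : Set} (A? : Dec A) → does A? ≡ true → A
    does-sound (yes a) _ = a

  -- Because t ± x, t ± y and t ± z do not vanish, the sign of the negative of each is the Boolean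
  -- negation. Everything then depends on finitely many signs, and the claim is one entry of the
  -- table.
  pointwise : ∀ t x y z → t - x ≢ 0ℤ → t + x ≢ 0ℤ → t - y ≢ 0ℤ → t + y ≢ 0ℤ → t - z ≢ 0ℤ → t + z ≢ 0ℤ →
              weight₃ x y z ≡ + 2 * N₁ t x y z + G t x y z + G (- t) x y z
  pointwise t x y z x⁻ x⁺ y⁻ y⁺ z⁻ z⁺ = trans W (trans core (sym (cong₂ _+_ (cong₂ (λ a b → + 2 * a + b) N G⁺) G⁻)))
    where
    core = does-sound (_ ℤ.≟ _)
      (lookup (sgn x) (isPos (t - x)) (isPos (t + x)) (sgn y) (isPos (t - y)) (isPos (t + y)) (sgn z) (isPos (t - z)) (isPos (t + z))
        (isPos (y + z)) (isPos (z + x)) (isPos (x + y))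
        (single-ok t x) (single-ok t y) (single-ok t z) (pair-ok t y z) (pair-ok t z x) (pair-ok t x y))
    W : weight₃ x y z ≡ W′ (sgn x) (sgn y) (sgn z)
    W rewrite pos-sgn x | pos-sgn y | pos-sgn z | zer-sgn x | zer-sgn y | zer-sgn z = refl
    flip : ∀ s t → s - t ≡ - (t - s)
    flip = solve-∀
    minus : ∀ s → t - s ≢ 0ℤ → pos (s - t) ≡ ⟦ not (isPos (t - s)) ⟧
    minus s h = trans (cong pos (flip s t)) (pos-not (t - s) h)
    plus : ∀ s → pos (s + t) ≡ ⟦ isPos (t + s) ⟧
    plus s = trans (cong pos (ℤ.+-comm s t)) (pos≡ (t + s))
    N : N₁ t x y z ≡ N′ (isPos (t - x)) (isPos (t + x)) (isPos (t - y)) (isPos (t + y)) (isPos (t - z)) (isPos (t + z))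
    N rewrite plus x | minus x x⁻ | plus y | minus y y⁻ | plus z | minus z z⁻ = refl
    G⁺ : G t x y z ≡ G′ (sgn x) (isPos (t - x)) (isPos (t + x)) (sgn y) (isPos (t - y)) (isPos (t + y))
                        (sgn z) (isPos (t - z)) (isPos (t + z)) (isPos (y + z)) (isPos (z + x)) (isPos (x + y))
    G⁺ rewrite minus x x⁻ | minus y y⁻ | minus z z⁻
       | pos≡ (t - x) | pos≡ (t + x) | pos≡ (t - y) | pos≡ (t + y) | pos≡ (t - z) | pos≡ (t + z)
       | pos-sgn x | pos-sgn y | pos-sgn z | pos-neg-sgn x | pos-neg-sgn y | pos-neg-sgn z
       | pos≡ (x + y) | pos≡ (y + z) | pos≡ (z + x) = refl
    a₁ : ∀ s → t + s ≢ 0ℤ → pos (- t - s) ≡ ⟦ not (isPos (t + s)) ⟧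
    a₁ s h = trans (cong pos (e t s)) (pos-not (t + s) h)
      where
      e : ∀ t s → - t - s ≡ - (t + s)
      e = solve-∀
    a₂ : ∀ s → t - s ≢ 0ℤ → pos (- t + s) ≡ ⟦ not (isPos (t - s)) ⟧
    a₂ s h = trans (cong pos (e t s)) (pos-not (t - s) h)
      where
      e : ∀ t s → - t + s ≡ - (t - s)
      e = solve-∀
    not-not : ∀ b → not (not b) ≡ b
    not-not true  = refl
    not-not false = refl
    a₃ : ∀ s → pos (s - - t) ≡ ⟦ not (not (isPos (t + s))) ⟧
    a₃ s = trans (cong pos (e t s)) (trans (pos≡ (t + s)) (cong ⟦_⟧ (sym (not-not (isPos (t + s))))))
      where
      e : ∀ t s → s - - t ≡ t + s
      e = solve-∀
    G⁻ : G (- t) x y z ≡ G′ (sgn x) (not (isPos (t + x))) (not (isPos (t - x))) (sgn y) (not (isPos (t + y))) (not (isPos (t - y)))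
                            (sgn z) (not (isPos (t + z))) (not (isPos (t - z))) (isPos (y + z)) (isPos (z + x)) (isPos (x + y))
    G⁻ rewrite a₁ x x⁺ | a₁ y y⁺ | a₁ z z⁺ | a₂ x x⁻ | a₂ y y⁻ | a₂ z z⁻ | a₃ x | a₃ y | a₃ z
       | pos-sgn x | pos-sgn y | pos-sgn z | pos-neg-sgn x | pos-neg-sgn y | pos-neg-sgn z
       | pos≡ (x + y) | pos≡ (y + z) | pos≡ (z + x) = refl

-- Symmetries of the quadric and dissections of its cones.

module Eichler where

  open FinSum
  open Forms hiding (f₁; f₂)
  open Congruence
  open Pointwise
  open import Data.Integer.Base using (_+_; _*_; _-_; -_; _<_)
  open import Data.Integer.Tactic.RingSolver using (solve-∀)
  open import Data.List.Relation.Unary.All using (All; []; _∷_)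

  open ℤΣ

  Quad : Set
  Quad = ℤ × ℤ × ℤ × ℤ

  -- The fibre over t of the level set n is the set of forms of discriminant t² - n.
  quadratic : Quad → ℤ
  quadratic (t , a , b , g) = t * t - (b * b - + 4 * (a * g))

  quadruple : ∀ {x x′ y y′ z z′ w w′ : ℤ} → x ≡ x′ → y ≡ y′ → z ≡ z′ → w ≡ w′ → (x , y , z , w) ≡ (x′ , y′ , z′ , w′)
  quadruple refl refl refl refl = refl

  record Automorphism : Set where
    field
      φ ψ         : Quad → Quad
      φψ          : ∀ v → φ (ψ v) ≡ v
      ψφ          : ∀ v → ψ (φ v) ≡ v
      quadratic-φ : ∀ v → quadratic (φ v) ≡ quadratic v

  open Automorphism

  rotation : Automorphism
  rotation = record
    { φ = λ (t , a , b , g) → t , a + b + g , - (+ 2 * a) - b , a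
    ; ψ = λ (t , a , b , g) → t , g , - (+ 2 * g) - b , a + b + g
    ; φψ = λ (t , a , b , g) → quadruple refl (φψ-a t a b g) (φψ-b t a b g) refl
    ; ψφ = λ (t , a , b , g) → quadruple refl refl (ψφ-b t a b g) (ψφ-g t a b g)
    ; quadratic-φ = λ (t , a , b , g) → q-φ t a b g }
    where
    φψ-a : ∀ t a b g → (g) + (- (+ 2 * g) - b) + (a + b + g) ≡ a
    φψ-a = solve-∀
    φψ-b : ∀ t a b g → - (+ 2 * (g)) - (- (+ 2 * g) - b) ≡ b
    φψ-b = solve-∀
    ψφ-b : ∀ t a b g → - (+ 2 * (a)) - (- (+ 2 * a) - b) ≡ b
    ψφ-b = solve-∀
    ψφ-g : ∀ t a b g → (a + b + g) + (- (+ 2 * a) - b) + (a) ≡ g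
    ψφ-g = solve-∀
    q-φ : ∀ t a b g → (t) * (t) - ((- (+ 2 * a) - b) * (- (+ 2 * a) - b) - + 4 * ((a + b + g) * (a))) ≡ t * t - (b * b - + 4 * (a * g))
    q-φ = solve-∀

  swapping : Automorphism
  swapping = record
    { φ = λ (t , a , b , g) → t , a + b + g , - b - + 2 * g , g
    ; ψ = λ (t , a , b , g) → t , a + b + g , - b - + 2 * g , g
    ; φψ = λ (t , a , b , g) → quadruple refl (φψ-a t a b g) (φψ-b t a b g) refl
    ; ψφ = λ (t , a , b , g) → quadruple refl (φψ-a t a b g) (φψ-b t a b g) refl
    ; quadratic-φ = λ (t , a , b , g) → q-φ t a b g }
    where
    φψ-a : ∀ t a b g → (a + b + g) + (- b - + 2 * g) + (g) ≡ a
    φψ-a = solve-∀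
    φψ-b : ∀ t a b g → - (- b - + 2 * g) - + 2 * (g) ≡ b
    φψ-b = solve-∀
    q-φ : ∀ t a b g → (t) * (t) - ((- b - + 2 * g) * (- b - + 2 * g) - + 4 * ((a + b + g) * (g))) ≡ t * t - (b * b - + 4 * (a * g))
    q-φ = solve-∀

  negation : Automorphism
  negation = record
    { φ = λ (t , a , b , g) → - t , a , b , g
    ; ψ = λ (t , a , b , g) → - t , a , b , g
    ; φψ = λ (t , a , b , g) → quadruple (φψ-t t a b g) refl refl refl
    ; ψφ = λ (t , a , b , g) → quadruple (φψ-t t a b g) refl refl refl
    ; quadratic-φ = λ (t , a , b , g) → q-φ t a b g }
    where
    φψ-t : ∀ t a b g → - (- t) ≡ t
    φψ-t = solve-∀
    q-φ : ∀ t a b g → (- t) * (- t) - ((b) * (b) - + 4 * ((a) * (g))) ≡ t * t - (b * b - + 4 * (a * g))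
    q-φ = solve-∀

  reflection : Automorphism
  reflection = record
    { φ = λ (t , a , b , g) → t , a , - b , g
    ; ψ = λ (t , a , b , g) → t , a , - b , g
    ; φψ = λ (t , a , b , g) → quadruple refl refl (φψ-b t a b g) refl
    ; ψφ = λ (t , a , b , g) → quadruple refl refl (φψ-b t a b g) refl
    ; quadratic-φ = λ (t , a , b , g) → q-φ t a b g }
    where
    φψ-b : ∀ t a b g → - (- b) ≡ b
    φψ-b = solve-∀
    q-φ : ∀ t a b g → (t) * (t) - ((- b) * (- b) - + 4 * ((a) * (g))) ≡ t * t - (b * b - + 4 * (a * g))
    q-φ = solve-∀

  aut-N : Automorphism
  aut-N = record
    { φ = λ (t , a , b , g) → + 2 * a - t , g + b + t , - (+ 2 * a) - b , a
    ; ψ = λ (t , a , b , g) → + 2 * g - t , g , - (+ 2 * g) - b , a + b + t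
    ; φψ = λ (t , a , b , g) → quadruple (φψ-t t a b g) (φψ-a t a b g) (φψ-b t a b g) refl
    ; ψφ = λ (t , a , b , g) → quadruple (ψφ-t t a b g) refl (ψφ-b t a b g) (ψφ-g t a b g)
    ; quadratic-φ = λ (t , a , b , g) → q-φ t a b g }
    where
    φψ-t : ∀ t a b g → + 2 * (g) - (+ 2 * g - t) ≡ t
    φψ-t = solve-∀
    φψ-a : ∀ t a b g → (a + b + t) + (- (+ 2 * g) - b) + (+ 2 * g - t) ≡ a
    φψ-a = solve-∀
    φψ-b : ∀ t a b g → - (+ 2 * (g)) - (- (+ 2 * g) - b) ≡ b
    φψ-b = solve-∀
    ψφ-t : ∀ t a b g → + 2 * (a) - (+ 2 * a - t) ≡ t
    ψφ-t = solve-∀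
    ψφ-b : ∀ t a b g → - (+ 2 * (a)) - (- (+ 2 * a) - b) ≡ b
    ψφ-b = solve-∀
    ψφ-g : ∀ t a b g → (g + b + t) + (- (+ 2 * a) - b) + (+ 2 * a - t) ≡ g
    ψφ-g = solve-∀
    q-φ : ∀ t a b g → (+ 2 * a - t) * (+ 2 * a - t) - ((- (+ 2 * a) - b) * (- (+ 2 * a) - b) - + 4 * ((g + b + t) * (a))) ≡ t * t - (b * b - + 4 * (a * g))
    q-φ = solve-∀

  aut-F : Automorphism
  aut-F = record
    { φ = λ (t , a , b , g) → t + + 2 * g , a + b - t , - (+ 2 * g) - b , g
    ; ψ = λ (t , a , b , g) → t - + 2 * g , a + b + t , - (+ 2 * g) - b , g
    ; φψ = λ (t , a , b , g) → quadruple (φψ-t t a b g) (φψ-a t a b g) (φψ-b t a b g) refl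
    ; ψφ = λ (t , a , b , g) → quadruple (ψφ-t t a b g) (ψφ-a t a b g) (ψφ-b t a b g) refl
    ; quadratic-φ = λ (t , a , b , g) → q-φ t a b g }
    where
    φψ-t : ∀ t a b g → (t - + 2 * g) + + 2 * (g) ≡ t
    φψ-t = solve-∀
    φψ-a : ∀ t a b g → (a + b + t) + (- (+ 2 * g) - b) - (t - + 2 * g) ≡ a
    φψ-a = solve-∀
    φψ-b : ∀ t a b g → - (+ 2 * (g)) - (- (+ 2 * g) - b) ≡ b
    φψ-b = solve-∀
    ψφ-t : ∀ t a b g → (t + + 2 * g) - + 2 * (g) ≡ t
    ψφ-t = solve-∀
    ψφ-a : ∀ t a b g → (a + b - t) + (- (+ 2 * g) - b) + (t + + 2 * g) ≡ a
    ψφ-a = solve-∀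
    ψφ-b : ∀ t a b g → - (+ 2 * (g)) - (- (+ 2 * g) - b) ≡ b
    ψφ-b = solve-∀
    q-φ : ∀ t a b g → (t + + 2 * g) * (t + + 2 * g) - ((- (+ 2 * g) - b) * (- (+ 2 * g) - b) - + 4 * ((a + b - t) * (g))) ≡ t * t - (b * b - + 4 * (a * g))
    q-φ = solve-∀

  aut-1 : Automorphism
  aut-1 = record
    { φ = λ (t , a , b , g) → t + + 2 * a , - a , b , t + a - g
    ; ψ = λ (t , a , b , g) → t + + 2 * a , - a , b , t + a - g
    ; φψ = λ (t , a , b , g) → quadruple (φψ-t t a b g) (φψ-a t a b g) refl (φψ-g t a b g)
    ; ψφ = λ (t , a , b , g) → quadruple (φψ-t t a b g) (φψ-a t a b g) refl (φψ-g t a b g)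
    ; quadratic-φ = λ (t , a , b , g) → q-φ t a b g }
    where
    φψ-t : ∀ t a b g → (t + + 2 * a) + + 2 * (- a) ≡ t
    φψ-t = solve-∀
    φψ-a : ∀ t a b g → - (- a) ≡ a
    φψ-a = solve-∀
    φψ-g : ∀ t a b g → (t + + 2 * a) + (- a) - (t + a - g) ≡ g
    φψ-g = solve-∀
    q-φ : ∀ t a b g → (t + + 2 * a) * (t + + 2 * a) - ((b) * (b) - + 4 * ((- a) * (t + a - g))) ≡ t * t - (b * b - + 4 * (a * g))
    q-φ = solve-∀

  aut-2 : Automorphism
  aut-2 = record
    { φ = λ (t , a , b , g) → t + + 2 * g , a - g - t , b , g
    ; ψ = λ (t , a , b , g) → t - + 2 * g , a - g + t , b , g
    ; φψ = λ (t , a , b , g) → quadruple (φψ-t t a b g) (φψ-a t a b g) refl refl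
    ; ψφ = λ (t , a , b , g) → quadruple (ψφ-t t a b g) (ψφ-a t a b g) refl refl
    ; quadratic-φ = λ (t , a , b , g) → q-φ t a b g }
    where
    φψ-t : ∀ t a b g → (t - + 2 * g) + + 2 * (g) ≡ t
    φψ-t = solve-∀
    φψ-a : ∀ t a b g → (a - g + t) - (g) - (t - + 2 * g) ≡ a
    φψ-a = solve-∀
    ψφ-t : ∀ t a b g → (t + + 2 * g) - + 2 * (g) ≡ t
    ψφ-t = solve-∀
    ψφ-a : ∀ t a b g → (a - g - t) - (g) + (t + + 2 * g) ≡ a
    ψφ-a = solve-∀
    q-φ : ∀ t a b g → (t + + 2 * g) * (t + + 2 * g) - ((b) * (b) - + 4 * ((a - g - t) * (g))) ≡ t * t - (b * b - + 4 * (a * g))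
    q-φ = solve-∀

  aut-3 : Automorphism
  aut-3 = record
    { φ = λ (t , a , b , g) → t , - (a + b + g) , + 2 * a + b , - a
    ; ψ = λ (t , a , b , g) → t , - g , b + + 2 * g , - a - g - b
    ; φψ = λ (t , a , b , g) → quadruple refl (φψ-a t a b g) (φψ-b t a b g) (φψ-g t a b g)
    ; ψφ = λ (t , a , b , g) → quadruple refl (ψφ-a t a b g) (ψφ-b t a b g) (ψφ-g t a b g)
    ; quadratic-φ = λ (t , a , b , g) → q-φ t a b g }
    where
    φψ-a : ∀ t a b g → - ((- g) + (b + + 2 * g) + (- a - g - b)) ≡ a
    φψ-a = solve-∀
    φψ-b : ∀ t a b g → + 2 * (- g) + (b + + 2 * g) ≡ b
    φψ-b = solve-∀
    φψ-g : ∀ t a b g → - (- g) ≡ g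
    φψ-g = solve-∀
    ψφ-a : ∀ t a b g → - (- a) ≡ a
    ψφ-a = solve-∀
    ψφ-b : ∀ t a b g → (+ 2 * a + b) + + 2 * (- a) ≡ b
    ψφ-b = solve-∀
    ψφ-g : ∀ t a b g → - (- (a + b + g)) - (- a) - (+ 2 * a + b) ≡ g
    ψφ-g = solve-∀
    q-φ : ∀ t a b g → (t) * (t) - ((+ 2 * a + b) * (+ 2 * a + b) - + 4 * ((- (a + b + g)) * (- a))) ≡ t * t - (b * b - + 4 * (a * g))
    q-φ = solve-∀

  AllPos : List ℤ → Set
  AllPos = All (0ℤ <_)

  pos-0< : ∀ {x} → 0ℤ < x → pos x ≡ 1ℤ
  pos-0< {+ suc _} _ = refl
  pos-0< {+ zero} (+<+ ())

  posᴸ-yes : ∀ {xs} → AllPos xs → posᴸ xs ≡ 1ℤ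
  posᴸ-yes []       = refl
  posᴸ-yes (p ∷ ps) = cong₂ _*_ (pos-0< p) (posᴸ-yes ps)

  pos-view : ∀ x → 0ℤ < x ⊎ pos x ≡ 0ℤ
  pos-view (+ zero)  = inj₂ refl
  pos-view (+ suc _) = inj₁ 0<s
  pos-view -[1+ _ ]  = inj₂ refl

  posᴸ-view : ∀ xs → AllPos xs ⊎ posᴸ xs ≡ 0ℤ
  posᴸ-view [] = inj₁ []
  posᴸ-view (x ∷ xs) with pos-view x | posᴸ-view xs
  ... | inj₁ p | inj₁ ps = inj₁ (p ∷ ps)
  ... | inj₁ _ | inj₂ e  = inj₂ (trans (cong (pos x *_) e) (ℤ.*-zeroʳ (pos x)))
  ... | inj₂ e | _       = inj₂ (trans (cong (_* posᴸ xs) e) (ℤ.*-zeroˡ (posᴸ xs)))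

  1≢0ℤ : 1ℤ ≢ 0ℤ
  1≢0ℤ ()

  posᴸ-⇔ : ∀ xs ys → (AllPos xs → AllPos ys) → (AllPos ys → AllPos xs) → posᴸ xs ≡ posᴸ ys
  posᴸ-⇔ xs ys f g with posᴸ-view xs | posᴸ-view ys
  ... | inj₁ p | _      = trans (posᴸ-yes p) (sym (posᴸ-yes (f p)))
  ... | inj₂ e | inj₁ q = ⊥-elim (1≢0ℤ (trans (sym (posᴸ-yes (g q))) e))
  ... | inj₂ e | inj₂ e′ = trans e (sym e′)

  pos-trichotomy : ∀ x → pos x + (pos (- x) + zer x) ≡ 1ℤ
  pos-trichotomy (+ zero)  = refl
  pos-trichotomy (+ suc _) = refl
  pos-trichotomy -[1+ _ ]  = refl

  posᴸ-trichotomy : ∀ x xs → posᴸ xs ≡ posᴸ (x ∷ xs) + (posᴸ (- x ∷ xs) + zer x * posᴸ xs)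
  posᴸ-trichotomy x xs = trans (sym (ℤ.*-identityˡ (posᴸ xs)))
    (trans (cong (_* posᴸ xs) (sym (pos-trichotomy x))) (e (pos x) (pos (- x)) (zer x) (posᴸ xs)))
    where
    e : ∀ a b c d → (a + (b + c)) * d ≡ a * d + (b * d + c * d)
    e = solve-∀

  zer≢0 : ∀ {x} → x ≢ 0ℤ → zer x ≡ 0ℤ
  zer≢0 {+ zero}   x≢0 = ⊥-elim (x≢0 refl)
  zer≢0 {+ suc _}  _ = refl
  zer≢0 { -[1+ _ ]} _ = refl

  posᴸ-split : ∀ x xs → x ≢ 0ℤ → posᴸ xs ≡ posᴸ (x ∷ xs) + posᴸ (- x ∷ xs)
  posᴸ-split x xs x≢0 = trans (posᴸ-trichotomy x xs) (cong (λ u → posᴸ (x ∷ xs) + u)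
    (trans (cong (λ u → posᴸ (- x ∷ xs) + u * posᴸ xs) (zer≢0 x≢0)) (e (posᴸ (- x ∷ xs)) (posᴸ xs))))
    where
    e : ∀ a b → a + 0ℤ * b ≡ a
    e = solve-∀

  -- Cones in the coordinates with n = p c + q y, where c is even and p, q, y are odd.
  cB cC cD cE cF cX cN cQ cR cF′ cX′ cG cH : ℤ → ℤ → ℤ → ℤ → ℤ
  cB p c q y = posᴸ (p ∷ c ∷ q ∷ y ∷ [])
  cC p c q y = posᴸ (p ∷ q ∷ y ∷ c - q ∷ c - y ∷ [])
  cD p c q y = posᴸ (c ∷ q ∷ y ∷ p - q ∷ [])
  cE p c q y = posᴸ (c ∷ q ∷ y ∷ p - q ∷ p - y ∷ [])
  cF p c q y = posᴸ (y - c ∷ q ∷ p ∷ c - q ∷ [])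
  cX p c q y = posᴸ (p ∷ c ∷ q - c ∷ y - c ∷ [])
  cN p c q y = posᴸ (c - y ∷ q ∷ c - q ∷ y ∷ p ∷ p + q + y - c ∷ [])
  cQ p c q y = posᴸ (p - q ∷ c ∷ q ∷ c + q + y - p ∷ y ∷ [])
  cR p c q y = posᴸ (p - q ∷ p - y ∷ c ∷ q ∷ c + q + y - p ∷ y ∷ [])
  cF′ p c q y = posᴸ (c - p - q - y ∷ p ∷ q ∷ y ∷ [])
  cX′ p c q y = posᴸ (p - c - q - y ∷ c ∷ q ∷ y ∷ [])
  cG p c q y = posᴸ (p - q ∷ c ∷ q ∷ y - p ∷ [])
  cH p c q y = posᴸ (p ∷ c ∷ q - p ∷ y - p ∷ [])

  infixl 6 _⊕_
  _⊕_ : ∀ {x y} → 0ℤ < x → 0ℤ < y → 0ℤ < x + y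
  _⊕_ = ℤ.+-mono-<

  as : ∀ {x y} → x ≡ y → 0ℤ < x → 0ℤ < y
  as refl p = p

  -- Cut along the wall c = p + q + y. Beyond it c > q and c > y are implied, which leaves the
  -- simplicial cone `cF′`.
  C-split : ∀ p c q y → p + q + y - c ≢ 0ℤ → cC p c q y ≡ cN p c q y + cF′ p c q y
  C-split p c q y h = trans (posᴸ-split (p + q + y - c) (p ∷ q ∷ y ∷ c - q ∷ c - y ∷ []) h) (cong₂ _+_
    (posᴸ-⇔ (p + q + y - c ∷ p ∷ q ∷ y ∷ c - q ∷ c - y ∷ []) (c - y ∷ q ∷ c - q ∷ y ∷ p ∷ p + q + y - c ∷ [])
      (λ { (f₁ ∷ f₂ ∷ f₃ ∷ f₄ ∷ f₅ ∷ f₆ ∷ []) → f₆ ∷ f₃ ∷ f₅ ∷ f₄ ∷ f₂ ∷ f₁ ∷ [] })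
      (λ { (f₆ ∷ f₃ ∷ f₅ ∷ f₄ ∷ f₂ ∷ f₁ ∷ []) → f₁ ∷ f₂ ∷ f₃ ∷ f₄ ∷ f₅ ∷ f₆ ∷ [] }))
    (posᴸ-⇔ (- (p + q + y - c) ∷ p ∷ q ∷ y ∷ c - q ∷ c - y ∷ []) (c - p - q - y ∷ p ∷ q ∷ y ∷ [])
      (λ { (f₁ ∷ f₂ ∷ f₃ ∷ f₄ ∷ _ ∷ _ ∷ []) → as (e₁ p c q y) f₁ ∷ f₂ ∷ f₃ ∷ f₄ ∷ [] })
      (λ { (f₁ ∷ f₂ ∷ f₃ ∷ f₄ ∷ []) → as (sym (e₁ p c q y)) f₁ ∷ f₂ ∷ f₃ ∷ f₄ ∷ as (e₂ p c q y) (f₁ ⊕ f₂ ⊕ f₄) ∷ as (e₃ p c q y) (f₁ ⊕ f₂ ⊕ f₃) ∷ [] })))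
    where
    e₁ : ∀ p c q y → - (p + q + y - c) ≡ c - p - q - y
    e₁ = solve-∀
    e₂ : ∀ p c q y → c - p - q - y + p + y ≡ c - q
    e₂ = solve-∀
    e₃ : ∀ p c q y → c - p - q - y + p + q ≡ c - y
    e₃ = solve-∀

  -- Cut along the wall p = c + q + y, beyond which p > q is implied.
  D-split : ∀ p c q y → c + q + y - p ≢ 0ℤ → cD p c q y ≡ cQ p c q y + cX′ p c q y
  D-split p c q y h = trans (posᴸ-split (c + q + y - p) (c ∷ q ∷ y ∷ p - q ∷ []) h) (cong₂ _+_
    (posᴸ-⇔ (c + q + y - p ∷ c ∷ q ∷ y ∷ p - q ∷ []) (p - q ∷ c ∷ q ∷ c + q + y - p ∷ y ∷ [])
      (λ { (f₁ ∷ f₂ ∷ f₃ ∷ f₄ ∷ f₅ ∷ []) → f₅ ∷ f₂ ∷ f₃ ∷ f₁ ∷ f₄ ∷ [] })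
      (λ { (f₅ ∷ f₂ ∷ f₃ ∷ f₁ ∷ f₄ ∷ []) → f₁ ∷ f₂ ∷ f₃ ∷ f₄ ∷ f₅ ∷ [] }))
    (posᴸ-⇔ (- (c + q + y - p) ∷ c ∷ q ∷ y ∷ p - q ∷ []) (p - c - q - y ∷ c ∷ q ∷ y ∷ [])
      (λ { (f₁ ∷ f₂ ∷ f₃ ∷ f₄ ∷ _ ∷ []) → as (e₁ p c q y) f₁ ∷ f₂ ∷ f₃ ∷ f₄ ∷ [] })
      (λ { (f₁ ∷ f₂ ∷ f₃ ∷ f₄ ∷ []) → as (sym (e₁ p c q y)) f₁ ∷ f₂ ∷ f₃ ∷ f₄ ∷ as (e₂ p c q y) (f₁ ⊕ f₂ ⊕ f₄) ∷ [] })))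
    where
    e₁ : ∀ p c q y → - (c + q + y - p) ≡ p - c - q - y
    e₁ = solve-∀
    e₂ : ∀ p c q y → p - c - q - y + c + y ≡ p - q
    e₂ = solve-∀

  E-split : ∀ p c q y → c + q + y - p ≢ 0ℤ → cE p c q y ≡ cR p c q y + cX′ p c q y
  E-split p c q y h = trans (posᴸ-split (c + q + y - p) (c ∷ q ∷ y ∷ p - q ∷ p - y ∷ []) h) (cong₂ _+_
    (posᴸ-⇔ (c + q + y - p ∷ c ∷ q ∷ y ∷ p - q ∷ p - y ∷ []) (p - q ∷ p - y ∷ c ∷ q ∷ c + q + y - p ∷ y ∷ [])
      (λ { (f₁ ∷ f₂ ∷ f₃ ∷ f₄ ∷ f₅ ∷ f₆ ∷ []) → f₅ ∷ f₆ ∷ f₂ ∷ f₃ ∷ f₁ ∷ f₄ ∷ [] })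
      (λ { (f₅ ∷ f₆ ∷ f₂ ∷ f₃ ∷ f₁ ∷ f₄ ∷ []) → f₁ ∷ f₂ ∷ f₃ ∷ f₄ ∷ f₅ ∷ f₆ ∷ [] }))
    (posᴸ-⇔ (- (c + q + y - p) ∷ c ∷ q ∷ y ∷ p - q ∷ p - y ∷ []) (p - c - q - y ∷ c ∷ q ∷ y ∷ [])
      (λ { (f₁ ∷ f₂ ∷ f₃ ∷ f₄ ∷ _ ∷ _ ∷ []) → as (e₁ p c q y) f₁ ∷ f₂ ∷ f₃ ∷ f₄ ∷ [] })
      (λ { (f₁ ∷ f₂ ∷ f₃ ∷ f₄ ∷ []) → as (sym (e₁ p c q y)) f₁ ∷ f₂ ∷ f₃ ∷ f₄ ∷ as (e₂ p c q y) (f₁ ⊕ f₂ ⊕ f₄) ∷ as (e₃ p c q y) (f₁ ⊕ f₂ ⊕ f₃) ∷ [] })))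
    where
    e₁ : ∀ p c q y → - (c + q + y - p) ≡ p - c - q - y
    e₁ = solve-∀
    e₂ : ∀ p c q y → p - c - q - y + c + y ≡ p - q
    e₂ = solve-∀
    e₃ : ∀ p c q y → p - c - q - y + c + q ≡ p - y
    e₃ = solve-∀

  neg-diff : ∀ x y → - (x - y) ≡ y - x
  neg-diff = solve-∀

  back-diff : ∀ x y → x - y + y ≡ x
  back-diff = solve-∀

  -- The positive cone cut by the position of c relative to q and y. The two mixed positions differ
  -- by exchanging q and y.
  B-split : ∀ p c q y → c - q ≢ 0ℤ → c - y ≢ 0ℤ →
            cB p c q y ≡ cC p c q y + cF p c q y + (cF p c y q + cX p c q y)
  B-split p c q y h h′ = trans (posᴸ-split (c - q) (p ∷ c ∷ q ∷ y ∷ []) h) (cong₂ _+_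
    (trans (posᴸ-split (c - y) (c - q ∷ p ∷ c ∷ q ∷ y ∷ []) h′) (cong₂ _+_
      (posᴸ-⇔ (c - y ∷ c - q ∷ p ∷ c ∷ q ∷ y ∷ []) (p ∷ q ∷ y ∷ c - q ∷ c - y ∷ [])
        (λ { (f₁ ∷ f₂ ∷ f₃ ∷ f₄ ∷ f₅ ∷ f₆ ∷ []) → f₃ ∷ f₅ ∷ f₆ ∷ f₂ ∷ f₁ ∷ [] })
        (λ { (f₃ ∷ f₅ ∷ f₆ ∷ f₂ ∷ f₁ ∷ []) → f₁ ∷ f₂ ∷ f₃ ∷ as (back-diff c q) (f₂ ⊕ f₅) ∷ f₅ ∷ f₆ ∷ [] }))
      (posᴸ-⇔ (- (c - y) ∷ c - q ∷ p ∷ c ∷ q ∷ y ∷ []) (y - c ∷ q ∷ p ∷ c - q ∷ [])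
        (λ { (f₁ ∷ f₂ ∷ f₃ ∷ f₄ ∷ f₅ ∷ f₆ ∷ []) → as (neg-diff c y) f₁ ∷ f₅ ∷ f₃ ∷ f₂ ∷ [] })
        (λ { (f₁ ∷ f₅ ∷ f₃ ∷ f₂ ∷ []) → as (sym (neg-diff c y)) f₁ ∷ f₂ ∷ f₃ ∷ as (back-diff c q) (f₂ ⊕ f₅) ∷ f₅ ∷
          as (back-diff y c) (f₁ ⊕ as (back-diff c q) (f₂ ⊕ f₅)) ∷ [] }))))
    (trans (posᴸ-split (c - y) (- (c - q) ∷ p ∷ c ∷ q ∷ y ∷ []) h′) (cong₂ _+_
      (posᴸ-⇔ (c - y ∷ - (c - q) ∷ p ∷ c ∷ q ∷ y ∷ []) (q - c ∷ y ∷ p ∷ c - y ∷ [])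
        (λ { (f₁ ∷ f₂ ∷ f₃ ∷ f₄ ∷ f₅ ∷ f₆ ∷ []) → as (neg-diff c q) f₂ ∷ f₆ ∷ f₃ ∷ f₁ ∷ [] })
        (λ { (f₂ ∷ f₆ ∷ f₃ ∷ f₁ ∷ []) → f₁ ∷ as (sym (neg-diff c q)) f₂ ∷ f₃ ∷ as (back-diff c y) (f₁ ⊕ f₆) ∷
          as (back-diff q c) (f₂ ⊕ as (back-diff c y) (f₁ ⊕ f₆)) ∷ f₆ ∷ [] }))
      (posᴸ-⇔ (- (c - y) ∷ - (c - q) ∷ p ∷ c ∷ q ∷ y ∷ []) (p ∷ c ∷ q - c ∷ y - c ∷ [])
        (λ { (f₁ ∷ f₂ ∷ f₃ ∷ f₄ ∷ f₅ ∷ f₆ ∷ []) → f₃ ∷ f₄ ∷ as (neg-diff c q) f₂ ∷ as (neg-diff c y) f₁ ∷ [] })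
        (λ { (f₃ ∷ f₄ ∷ f₂ ∷ f₁ ∷ []) → as (sym (neg-diff c y)) f₁ ∷ as (sym (neg-diff c q)) f₂ ∷ f₃ ∷ f₄ ∷
          as (back-diff q c) (f₂ ⊕ f₄) ∷ as (back-diff y c) (f₁ ⊕ f₄) ∷ [] })))))

  -- z₁ : p = q;  z₂ : q < p = y;  z₃ : p = y < q.
  z₁ z₂ z₃ : ℤ → ℤ → ℤ → ℤ → ℤ
  z₁ p c q y = zer (p - q) * posᴸ (p ∷ c ∷ q ∷ y ∷ [])
  z₂ p c q y = zer (p - y) * posᴸ (p - q ∷ p ∷ c ∷ q ∷ y ∷ [])
  z₃ p c q y = zer (p - y) * posᴸ (- (p - q) ∷ p ∷ c ∷ q ∷ y ∷ [])

  -- The wall p = y is different in kind: p - y is even on the level sets considered, so the wall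
  -- may contain points and is kept as `z₂`.
  D-trichotomy : ∀ p c q y → cD p c q y ≡ cE p c q y + (cG p c q y + z₂ p c q y)
  D-trichotomy p c q y = trans (posᴸ-trichotomy (p - y) (c ∷ q ∷ y ∷ p - q ∷ [])) (cong₂ _+_
    (posᴸ-⇔ (p - y ∷ c ∷ q ∷ y ∷ p - q ∷ []) (c ∷ q ∷ y ∷ p - q ∷ p - y ∷ [])
      (λ { (f₁ ∷ f₂ ∷ f₃ ∷ f₄ ∷ f₅ ∷ []) → f₂ ∷ f₃ ∷ f₄ ∷ f₅ ∷ f₁ ∷ [] })
      (λ { (f₂ ∷ f₃ ∷ f₄ ∷ f₅ ∷ f₁ ∷ []) → f₁ ∷ f₂ ∷ f₃ ∷ f₄ ∷ f₅ ∷ [] }))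
    (cong₂ _+_
      (posᴸ-⇔ (- (p - y) ∷ c ∷ q ∷ y ∷ p - q ∷ []) (p - q ∷ c ∷ q ∷ y - p ∷ [])
        (λ { (f₁ ∷ f₂ ∷ f₃ ∷ f₄ ∷ f₅ ∷ []) → f₅ ∷ f₂ ∷ f₃ ∷ as (neg-diff p y) f₁ ∷ [] })
        (λ { (f₅ ∷ f₂ ∷ f₃ ∷ f₁ ∷ []) → as (sym (neg-diff p y)) f₁ ∷ f₂ ∷ f₃ ∷
          as (back-diff y p) (f₁ ⊕ as (back-diff p q) (f₅ ⊕ f₃)) ∷ f₅ ∷ [] }))
      (cong (zer (p - y) *_) (posᴸ-⇔ (c ∷ q ∷ y ∷ p - q ∷ []) (p - q ∷ p ∷ c ∷ q ∷ y ∷ [])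
        (λ { (f₂ ∷ f₃ ∷ f₄ ∷ f₅ ∷ []) → f₅ ∷ as (back-diff p q) (f₅ ⊕ f₃) ∷ f₂ ∷ f₃ ∷ f₄ ∷ [] })
        (λ { (f₅ ∷ _ ∷ f₂ ∷ f₃ ∷ f₄ ∷ []) → f₂ ∷ f₃ ∷ f₄ ∷ f₅ ∷ [] })))))

  -- The same positive cone cut by the position of p instead of c; comparing with `B-split` relates
  -- the two families of cones.
  B-trichotomy : ∀ p c q y → cB p c q y ≡
                 cD p c q y + (cG p c y q + (cH p c q y + z₃ p c q y) + z₁ p c q y)
  B-trichotomy p c q y = trans (posᴸ-trichotomy (p - q) (p ∷ c ∷ q ∷ y ∷ [])) (cong₂ _+_
    (posᴸ-⇔ (p - q ∷ p ∷ c ∷ q ∷ y ∷ []) (c ∷ q ∷ y ∷ p - q ∷ [])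
      (λ { (f₅ ∷ _ ∷ f₂ ∷ f₃ ∷ f₄ ∷ []) → f₂ ∷ f₃ ∷ f₄ ∷ f₅ ∷ [] })
      (λ { (f₂ ∷ f₃ ∷ f₄ ∷ f₅ ∷ []) → f₅ ∷ as (back-diff p q) (f₅ ⊕ f₃) ∷ f₂ ∷ f₃ ∷ f₄ ∷ [] }))
    (cong (_+ z₁ p c q y) (trans (posᴸ-trichotomy (p - y) (- (p - q) ∷ p ∷ c ∷ q ∷ y ∷ [])) (cong₂ _+_
      (posᴸ-⇔ (p - y ∷ - (p - q) ∷ p ∷ c ∷ q ∷ y ∷ []) (p - y ∷ c ∷ y ∷ q - p ∷ [])
        (λ { (f₁ ∷ f₂ ∷ f₃ ∷ f₄ ∷ f₅ ∷ f₆ ∷ []) → f₁ ∷ f₄ ∷ f₆ ∷ as (neg-diff p q) f₂ ∷ [] })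
        (λ { (f₁ ∷ f₄ ∷ f₆ ∷ f₂ ∷ []) → f₁ ∷ as (sym (neg-diff p q)) f₂ ∷ as (back-diff p y) (f₁ ⊕ f₆) ∷ f₄ ∷
          as (back-diff q p) (f₂ ⊕ as (back-diff p y) (f₁ ⊕ f₆)) ∷ f₆ ∷ [] }))
      (cong (_+ z₃ p c q y) (posᴸ-⇔ (- (p - y) ∷ - (p - q) ∷ p ∷ c ∷ q ∷ y ∷ []) (p ∷ c ∷ q - p ∷ y - p ∷ [])
        (λ { (f₁ ∷ f₂ ∷ f₃ ∷ f₄ ∷ f₅ ∷ f₆ ∷ []) → f₃ ∷ f₄ ∷ as (neg-diff p q) f₂ ∷ as (neg-diff p y) f₁ ∷ [] })
        (λ { (f₃ ∷ f₄ ∷ f₂ ∷ f₁ ∷ []) → as (sym (neg-diff p y)) f₁ ∷ as (sym (neg-diff p q)) f₂ ∷ f₃ ∷ f₄ ∷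
          as (back-diff q p) (f₂ ⊕ f₃) ∷ as (back-diff y p) (f₁ ⊕ f₃) ∷ [] })))))))

-- The weighted count of points on the quadric.

module EichlerSum where

  open FinSum
  open Forms hiding (f₁; f₂)
  open Congruence
  open Hecke using (quot; quot-*; scale)
  open Pointwise
  open Eichler
  open import Data.Integer.Base using (_+_; _*_; _-_; -_; _<_)
  open import Data.Integer.Divisibility.Signed using (divides; ∣m∣n⇒∣m+n; ∣m⇒∣m*n) renaming (_∣_ to infix 4 _∥_)
  open import Data.Integer.Tactic.RingSolver using (solve-∀)
  open import Data.List.Relation.Unary.All using ([]; _∷_)

  open ℤΣ
  open Automorphism

  -- The coordinates p, c, q, y of the cones, and the Selling parameters of the form ⟨ a , b , g ⟩.
  on-p on-s : (ℤ → ℤ → ℤ → ℤ → ℤ) → Quad → ℤ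
  on-p Φ (t , a , b , g) = Φ (t + (+ 2 * a + b)) (+ 2 * g) (t - - b) (t - (+ 2 * g + b))
  on-s Φ (t , a , b , g) = Φ t (- b) (+ 2 * a + b) (+ 2 * g + b)

  pairing : Quad → ℤ
  pairing (p , c , q , y) = p * c + q * y

  -- The automorphism is chosen so that the inequalities of `N₁` become, in the same order, those of
  -- `cN`. The other cones are matched in the same way.
  N₁-cone : ∀ v → on-s N₁ v ≡ on-p cN (φ aut-N v)
  N₁-cone (t , a , b , g) = cong posᴸ {(- b) + t ∷ (- b) - t ∷ (+ 2 * a + b) + t ∷ (+ 2 * a + b) - t ∷ (+ 2 * g + b) + t ∷ (+ 2 * g + b) - t ∷ []} {(+ 2 * (a)) - ((+ 2 * a - t) - (+ 2 * (a) + (- (+ 2 * a) - b))) ∷ ((+ 2 * a - t) - - (- (+ 2 * a) - b)) ∷ (+ 2 * (a)) - ((+ 2 * a - t) - - (- (+ 2 * a) - b)) ∷ ((+ 2 * a - t) - (+ 2 * (a) + (- (+ 2 * a) - b))) ∷ ((+ 2 * a - t) + (+ 2 * (g + b + t) + (- (+ 2 * a) - b))) ∷ ((+ 2 * a - t) + (+ 2 * (g + b + t) + (- (+ 2 * a) - b))) + ((+ 2 * a - t) - - (- (+ 2 * a) - b)) + ((+ 2 * a - t) - (+ 2 * (a) + (- (+ 2 * a) - b))) - (+ 2 * (a)) ∷ []}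
    (cong₂ _∷_ (e0 t a b g) (cong₂ _∷_ (e1 t a b g) (cong₂ _∷_ (e2 t a b g) (cong₂ _∷_ (e3 t a b g) (cong₂ _∷_ (e4 t a b g) (cong₂ _∷_ (e5 t a b g) refl))))))
    where
    e0 : ∀ t a b g → (- b) + t ≡ (+ 2 * (a)) - ((+ 2 * a - t) - (+ 2 * (a) + (- (+ 2 * a) - b)))
    e0 = solve-∀
    e1 : ∀ t a b g → (- b) - t ≡ ((+ 2 * a - t) - - (- (+ 2 * a) - b))
    e1 = solve-∀
    e2 : ∀ t a b g → (+ 2 * a + b) + t ≡ (+ 2 * (a)) - ((+ 2 * a - t) - - (- (+ 2 * a) - b))
    e2 = solve-∀
    e3 : ∀ t a b g → (+ 2 * a + b) - t ≡ ((+ 2 * a - t) - (+ 2 * (a) + (- (+ 2 * a) - b)))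
    e3 = solve-∀
    e4 : ∀ t a b g → (+ 2 * g + b) + t ≡ ((+ 2 * a - t) + (+ 2 * (g + b + t) + (- (+ 2 * a) - b)))
    e4 = solve-∀
    e5 : ∀ t a b g → (+ 2 * g + b) - t ≡ ((+ 2 * a - t) + (+ 2 * (g + b + t) + (- (+ 2 * a) - b))) + ((+ 2 * a - t) - - (- (+ 2 * a) - b)) + ((+ 2 * a - t) - (+ 2 * (a) + (- (+ 2 * a) - b))) - (+ 2 * (a))
    e5 = solve-∀

  F₁-cone : ∀ v → on-s F₁ v ≡ on-p cF (φ aut-F v)
  F₁-cone (t , a , b , g) = cong posᴸ {t - (- b) ∷ t + (- b) ∷ (+ 2 * a + b) - t ∷ (+ 2 * g + b) - t ∷ []} {((t + + 2 * g) - (+ 2 * (g) + (- (+ 2 * g) - b))) - (+ 2 * (g)) ∷ ((t + + 2 * g) - - (- (+ 2 * g) - b)) ∷ ((t + + 2 * g) + (+ 2 * (a + b - t) + (- (+ 2 * g) - b))) ∷ (+ 2 * (g)) - ((t + + 2 * g) - - (- (+ 2 * g) - b)) ∷ []}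
    (cong₂ _∷_ (e0 t a b g) (cong₂ _∷_ (e1 t a b g) (cong₂ _∷_ (e2 t a b g) (cong₂ _∷_ (e3 t a b g) refl))))
    where
    e0 : ∀ t a b g → t - (- b) ≡ ((t + + 2 * g) - (+ 2 * (g) + (- (+ 2 * g) - b))) - (+ 2 * (g))
    e0 = solve-∀
    e1 : ∀ t a b g → t + (- b) ≡ ((t + + 2 * g) - - (- (+ 2 * g) - b))
    e1 = solve-∀
    e2 : ∀ t a b g → (+ 2 * a + b) - t ≡ ((t + + 2 * g) + (+ 2 * (a + b - t) + (- (+ 2 * g) - b)))
    e2 = solve-∀
    e3 : ∀ t a b g → (+ 2 * g + b) - t ≡ (+ 2 * (g)) - ((t + + 2 * g) - - (- (+ 2 * g) - b))
    e3 = solve-∀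

  Q₁-cone : ∀ v → on-s Q₁ v ≡ on-p cQ v
  Q₁-cone (t , a , b , g) = cong posᴸ {(- b) + (+ 2 * a + b) ∷ (+ 2 * g + b) + (- b) ∷ t - (- b) ∷ t - (+ 2 * a + b) ∷ t - (+ 2 * g + b) ∷ []} {(t + (+ 2 * a + b)) - (t - - b) ∷ (+ 2 * g) ∷ (t - - b) ∷ (+ 2 * g) + (t - - b) + (t - (+ 2 * g + b)) - (t + (+ 2 * a + b)) ∷ (t - (+ 2 * g + b)) ∷ []}
    (cong₂ _∷_ (e0 t a b g) (cong₂ _∷_ (e1 t a b g) (cong₂ _∷_ (e2 t a b g) (cong₂ _∷_ (e3 t a b g) (cong₂ _∷_ (e4 t a b g) refl)))))
    where
    e0 : ∀ t a b g → (- b) + (+ 2 * a + b) ≡ (t + (+ 2 * a + b)) - (t - - b)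
    e0 = solve-∀
    e1 : ∀ t a b g → (+ 2 * g + b) + (- b) ≡ (+ 2 * g)
    e1 = solve-∀
    e2 : ∀ t a b g → t - (- b) ≡ (t - - b)
    e2 = solve-∀
    e3 : ∀ t a b g → t - (+ 2 * a + b) ≡ (+ 2 * g) + (t - - b) + (t - (+ 2 * g + b)) - (t + (+ 2 * a + b))
    e3 = solve-∀
    e4 : ∀ t a b g → t - (+ 2 * g + b) ≡ (t - (+ 2 * g + b))
    e4 = solve-∀

  R₁-cone : ∀ v → on-s R₁ v ≡ on-p cR v
  R₁-cone (t , a , b , g) = cong posᴸ {(- b) + (+ 2 * a + b) ∷ (+ 2 * a + b) + (+ 2 * g + b) ∷ (+ 2 * g + b) + (- b) ∷ t - (- b) ∷ t - (+ 2 * a + b) ∷ t - (+ 2 * g + b) ∷ []} {(t + (+ 2 * a + b)) - (t - - b) ∷ (t + (+ 2 * a + b)) - (t - (+ 2 * g + b)) ∷ (+ 2 * g) ∷ (t - - b) ∷ (+ 2 * g) + (t - - b) + (t - (+ 2 * g + b)) - (t + (+ 2 * a + b)) ∷ (t - (+ 2 * g + b)) ∷ []}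
    (cong₂ _∷_ (e0 t a b g) (cong₂ _∷_ (e1 t a b g) (cong₂ _∷_ (e2 t a b g) (cong₂ _∷_ (e3 t a b g) (cong₂ _∷_ (e4 t a b g) (cong₂ _∷_ (e5 t a b g) refl))))))
    where
    e0 : ∀ t a b g → (- b) + (+ 2 * a + b) ≡ (t + (+ 2 * a + b)) - (t - - b)
    e0 = solve-∀
    e1 : ∀ t a b g → (+ 2 * a + b) + (+ 2 * g + b) ≡ (t + (+ 2 * a + b)) - (t - (+ 2 * g + b))
    e1 = solve-∀
    e2 : ∀ t a b g → (+ 2 * g + b) + (- b) ≡ (+ 2 * g)
    e2 = solve-∀
    e3 : ∀ t a b g → t - (- b) ≡ (t - - b)
    e3 = solve-∀
    e4 : ∀ t a b g → t - (+ 2 * a + b) ≡ (+ 2 * g) + (t - - b) + (t - (+ 2 * g + b)) - (t + (+ 2 * a + b))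
    e4 = solve-∀
    e5 : ∀ t a b g → t - (+ 2 * g + b) ≡ (t - (+ 2 * g + b))
    e5 = solve-∀

  F′-cone : ∀ v → on-p cF′ v ≡ on-p cF (φ aut-1 v)
  F′-cone (t , a , b , g) = cong posᴸ {(+ 2 * g) - (t + (+ 2 * a + b)) - (t - - b) - (t - (+ 2 * g + b)) ∷ (t + (+ 2 * a + b)) ∷ (t - - b) ∷ (t - (+ 2 * g + b)) ∷ []} {((t + + 2 * a) - (+ 2 * (t + a - g) + (b))) - (+ 2 * (t + a - g)) ∷ ((t + + 2 * a) - - (b)) ∷ ((t + + 2 * a) + (+ 2 * (- a) + (b))) ∷ (+ 2 * (t + a - g)) - ((t + + 2 * a) - - (b)) ∷ []}
    (cong₂ _∷_ (e0 t a b g) (cong₂ _∷_ (e1 t a b g) (cong₂ _∷_ (e2 t a b g) (cong₂ _∷_ (e3 t a b g) refl))))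
    where
    e0 : ∀ t a b g → (+ 2 * g) - (t + (+ 2 * a + b)) - (t - - b) - (t - (+ 2 * g + b)) ≡ ((t + + 2 * a) - (+ 2 * (t + a - g) + (b))) - (+ 2 * (t + a - g))
    e0 = solve-∀
    e1 : ∀ t a b g → (t + (+ 2 * a + b)) ≡ ((t + + 2 * a) - - (b))
    e1 = solve-∀
    e2 : ∀ t a b g → (t - - b) ≡ ((t + + 2 * a) + (+ 2 * (- a) + (b)))
    e2 = solve-∀
    e3 : ∀ t a b g → (t - (+ 2 * g + b)) ≡ (+ 2 * (t + a - g)) - ((t + + 2 * a) - - (b))
    e3 = solve-∀

  X′-cone : ∀ v → on-p cX′ v ≡ on-p cX (φ aut-2 v)
  X′-cone (t , a , b , g) = cong posᴸ {(t + (+ 2 * a + b)) - (+ 2 * g) - (t - - b) - (t - (+ 2 * g + b)) ∷ (+ 2 * g) ∷ (t - - b) ∷ (t - (+ 2 * g + b)) ∷ []} {((t + + 2 * g) + (+ 2 * (a - g - t) + (b))) ∷ (+ 2 * (g)) ∷ ((t + + 2 * g) - - (b)) - (+ 2 * (g)) ∷ ((t + + 2 * g) - (+ 2 * (g) + (b))) - (+ 2 * (g)) ∷ []}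
    (cong₂ _∷_ (e0 t a b g) (cong₂ _∷_ (e1 t a b g) (cong₂ _∷_ (e2 t a b g) (cong₂ _∷_ (e3 t a b g) refl))))
    where
    e0 : ∀ t a b g → (t + (+ 2 * a + b)) - (+ 2 * g) - (t - - b) - (t - (+ 2 * g + b)) ≡ ((t + + 2 * g) + (+ 2 * (a - g - t) + (b)))
    e0 = solve-∀
    e1 : ∀ t a b g → (+ 2 * g) ≡ (+ 2 * (g))
    e1 = solve-∀
    e2 : ∀ t a b g → (t - - b) ≡ ((t + + 2 * g) - - (b)) - (+ 2 * (g))
    e2 = solve-∀
    e3 : ∀ t a b g → (t - (+ 2 * g + b)) ≡ ((t + + 2 * g) - (+ 2 * (g) + (b))) - (+ 2 * (g))
    e3 = solve-∀

  -- The cone where p is smaller than q and y is carried onto the mixed cone `cG`; this is what lets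
  -- the relations among the counts close up.
  H-cone : ∀ v → on-p (λ p c q y → posᴸ (y - p ∷ q - p ∷ p ∷ c ∷ [])) v ≡ on-p cG (φ aut-3 v)
  H-cone (t , a , b , g) = cong posᴸ {(t - (+ 2 * g + b)) - (t + (+ 2 * a + b)) ∷ (t - - b) - (t + (+ 2 * a + b)) ∷ (t + (+ 2 * a + b)) ∷ (+ 2 * g) ∷ []} {((t) + (+ 2 * (- (a + b + g)) + (+ 2 * a + b))) - ((t) - - (+ 2 * a + b)) ∷ (+ 2 * (- a)) ∷ ((t) - - (+ 2 * a + b)) ∷ ((t) - (+ 2 * (- a) + (+ 2 * a + b))) - ((t) + (+ 2 * (- (a + b + g)) + (+ 2 * a + b))) ∷ []}
    (cong₂ _∷_ (e0 t a b g) (cong₂ _∷_ (e1 t a b g) (cong₂ _∷_ (e2 t a b g) (cong₂ _∷_ (e3 t a b g) refl))))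
    where
    e0 : ∀ t a b g → (t - (+ 2 * g + b)) - (t + (+ 2 * a + b)) ≡ ((t) + (+ 2 * (- (a + b + g)) + (+ 2 * a + b))) - ((t) - - (+ 2 * a + b))
    e0 = solve-∀
    e1 : ∀ t a b g → (t - - b) - (t + (+ 2 * a + b)) ≡ (+ 2 * (- a))
    e1 = solve-∀
    e2 : ∀ t a b g → (t + (+ 2 * a + b)) ≡ ((t) - - (+ 2 * a + b))
    e2 = solve-∀
    e3 : ∀ t a b g → (+ 2 * g) ≡ ((t) - (+ 2 * (- a) + (+ 2 * a + b))) - ((t) + (+ 2 * (- (a + b + g)) + (+ 2 * a + b)))
    e3 = solve-∀

  F-swap : ∀ v → on-p (λ p c q y → cF p c y q) v ≡ on-p cF (φ swapping v)
  F-swap (t , a , b , g) = cong posᴸ {(t - - b) - (+ 2 * g) ∷ (t - (+ 2 * g + b)) ∷ (t + (+ 2 * a + b)) ∷ (+ 2 * g) - (t - (+ 2 * g + b)) ∷ []} {((t) - (+ 2 * (g) + (- b - + 2 * g))) - (+ 2 * (g)) ∷ ((t) - - (- b - + 2 * g)) ∷ ((t) + (+ 2 * (a + b + g) + (- b - + 2 * g))) ∷ (+ 2 * (g)) - ((t) - - (- b - + 2 * g)) ∷ []}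
    (cong₂ _∷_ (e0 t a b g) (cong₂ _∷_ (e1 t a b g) (cong₂ _∷_ (e2 t a b g) (cong₂ _∷_ (e3 t a b g) refl))))
    where
    e0 : ∀ t a b g → (t - - b) - (+ 2 * g) ≡ ((t) - (+ 2 * (g) + (- b - + 2 * g))) - (+ 2 * (g))
    e0 = solve-∀
    e1 : ∀ t a b g → (t - (+ 2 * g + b)) ≡ ((t) - - (- b - + 2 * g))
    e1 = solve-∀
    e2 : ∀ t a b g → (t + (+ 2 * a + b)) ≡ ((t) + (+ 2 * (a + b + g) + (- b - + 2 * g)))
    e2 = solve-∀
    e3 : ∀ t a b g → (+ 2 * g) - (t - (+ 2 * g + b)) ≡ (+ 2 * (g)) - ((t) - - (- b - + 2 * g))
    e3 = solve-∀

  G-swap : ∀ v → on-p (λ p c q y → cG p c y q) v ≡ on-p cG (φ swapping v)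
  G-swap (t , a , b , g) = cong posᴸ {(t + (+ 2 * a + b)) - (t - (+ 2 * g + b)) ∷ (+ 2 * g) ∷ (t - (+ 2 * g + b)) ∷ (t - - b) - (t + (+ 2 * a + b)) ∷ []} {((t) + (+ 2 * (a + b + g) + (- b - + 2 * g))) - ((t) - - (- b - + 2 * g)) ∷ (+ 2 * (g)) ∷ ((t) - - (- b - + 2 * g)) ∷ ((t) - (+ 2 * (g) + (- b - + 2 * g))) - ((t) + (+ 2 * (a + b + g) + (- b - + 2 * g))) ∷ []}
    (cong₂ _∷_ (e0 t a b g) (cong₂ _∷_ (e1 t a b g) (cong₂ _∷_ (e2 t a b g) (cong₂ _∷_ (e3 t a b g) refl))))
    where
    e0 : ∀ t a b g → (t + (+ 2 * a + b)) - (t - (+ 2 * g + b)) ≡ ((t) + (+ 2 * (a + b + g) + (- b - + 2 * g))) - ((t) - - (- b - + 2 * g))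
    e0 = solve-∀
    e1 : ∀ t a b g → (+ 2 * g) ≡ (+ 2 * (g))
    e1 = solve-∀
    e2 : ∀ t a b g → (t - (+ 2 * g + b)) ≡ ((t) - - (- b - + 2 * g))
    e2 = solve-∀
    e3 : ∀ t a b g → (t - - b) - (t + (+ 2 * a + b)) ≡ ((t) - (+ 2 * (g) + (- b - + 2 * g))) - ((t) + (+ 2 * (a + b + g) + (- b - + 2 * g)))
    e3 = solve-∀

  H-reorder : ∀ p c q y → cH p c q y ≡ posᴸ (y - p ∷ q - p ∷ p ∷ c ∷ [])
  H-reorder p c q y = posᴸ-⇔ (p ∷ c ∷ q - p ∷ y - p ∷ []) (y - p ∷ q - p ∷ p ∷ c ∷ [])
    (λ { (h₁ ∷ h₂ ∷ h₃ ∷ h₄ ∷ []) → h₄ ∷ h₃ ∷ h₁ ∷ h₂ ∷ [] }) (λ { (h₄ ∷ h₃ ∷ h₁ ∷ h₂ ∷ []) → h₁ ∷ h₂ ∷ h₃ ∷ h₄ ∷ [] })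

  -- The reflection of b exchanges `K⁺` and `K⁻`, so the correction `K`, which the pointwise
  -- identity needs, has total zero.
  K-reflect : ∀ v → on-s K⁻ v ≡ on-s K⁺ (φ reflection v)
  K-reflect (t , a , b , g) = posᴸ-⇔ (- - b ∷ t - - b ∷ t + - b ∷ - b + (+ 2 * a + b) ∷ (+ 2 * g + b) + - b ∷ [])
      (- - b ∷ t - - - b ∷ t + - - b ∷ - - b + (+ 2 * a + - b) ∷ (+ 2 * g + - b) + - - b ∷ [])
      (λ { (h₁ ∷ h₂ ∷ h₃ ∷ h₄ ∷ h₅ ∷ []) → h₁ ∷ as (e₁ t b) h₃ ∷ h₂ ∷ as (e₂ a b) h₄ ∷ as (e₃ g b) h₅ ∷ [] })
      (λ { (h₁ ∷ h₃ ∷ h₂ ∷ h₄ ∷ h₅ ∷ []) → h₁ ∷ h₂ ∷ as (sym (e₁ t b)) h₃ ∷ as (sym (e₂ a b)) h₄ ∷ as (sym (e₃ g b)) h₅ ∷ [] })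
    where
    e₁ : ∀ t b → t + - b ≡ t - - - b
    e₁ = solve-∀
    e₂ : ∀ a b → - b + (+ 2 * a + b) ≡ - - b + (+ 2 * a + - b)
    e₂ = solve-∀
    e₃ : ∀ g b → (+ 2 * g + b) + - b ≡ (+ 2 * g + - b) + - - b
    e₃ = solve-∀

  rotated : ∀ Φ v → on-s Φ (φ rotation v) ≡ on-s (λ t x y z → Φ t y z x) v
  rotated Φ (t , a , b , g) = cong₃ (e₁ a b) (e₂ a b g) (e₃ a b)
    where
    cong₃ : ∀ {x x′ y y′ z z′} → x ≡ x′ → y ≡ y′ → z ≡ z′ → Φ t x y z ≡ Φ t x′ y′ z′
    cong₃ refl refl refl = refl
    e₁ : ∀ a b → - (- (+ 2 * a) - b) ≡ + 2 * a + b
    e₁ = solve-∀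
    e₂ : ∀ a b g → + 2 * (a + b + g) + (- (+ 2 * a) - b) ≡ + 2 * g + b
    e₂ = solve-∀
    e₃ : ∀ a b → + 2 * a + (- (+ 2 * a) - b) ≡ - b
    e₃ = solve-∀

  module AtLevel (n : ℕ) (odd : ¬ + 2 ∥ + n) where

    abstract
      on? : ∀ v → Dec (quadratic v ≡ + n)
      on? v = quadratic v ℤ.≟ + n

    Sums : (Quad → ℤ) → ℤ → Set
    Sums Φ s = HasSum (λ v → only (on? v) (Φ v)) s

    on-cong : ∀ {Φ Ψ : Quad → ℤ} {s} → (∀ v → quadratic v ≡ + n → Φ v ≡ Ψ v) → Sums Φ s → Sums Ψ s
    on-cong {Φ} {Ψ} h = HasSum-cong (λ v → at (on? v) (h v))
      where
      at : ∀ {A : Set} {x y} (A? : Dec A) → (A → x ≡ y) → only A? x ≡ only A? y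
      at (yes p) h = h p
      at (no _)  h = refl

    on-≗ : ∀ {Φ Ψ : Quad → ℤ} {s} → (∀ v → Φ v ≡ Ψ v) → Sums Φ s → Sums Ψ s
    on-≗ h = on-cong (λ v _ → h v)

    on-⊕ : ∀ {Φ Ψ : Quad → ℤ} {s s′} → Sums Φ s → Sums Ψ s′ → Sums (λ v → Φ v + Ψ v) (s + s′)
    on-⊕ {Φ} {Ψ} F F′ = HasSum-cong (λ v → only-+ (on? v)) (HasSum-⊕ F F′)
      where
      only-+ : ∀ {A : Set} {x y} (A? : Dec A) → only A? x + only A? y ≡ only A? (x + y)
      only-+ (yes _) = refl
      only-+ (no _)  = refl

    on-scale : ∀ {Φ : Quad → ℤ} {s} k → Sums Φ s → Sums (λ v → Φ v * k) (s * k)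
    on-scale k F = HasSum-cong (λ v → only-*ʳ (on? v)) (scale k F)
      where
      only-*ʳ : ∀ {A : Set} {x} (A? : Dec A) → only A? x * k ≡ only A? (x * k)
      only-*ʳ (yes _) = refl
      only-*ʳ (no _)  = ℤ.*-zeroˡ k

    on-unique : ∀ {Φ : Quad → ℤ} {s s′} → Sums Φ s → Sums Φ s′ → s ≡ s′
    on-unique = HasSum-unique

    transport : ∀ (A : Automorphism) {Φ : Quad → ℤ} {s} → Sums Φ s → Sums (λ v → Φ (φ A v)) s
    transport A {Φ} F = HasSum-bij {f = λ v → only (on? v) (Φ v)} {g = λ v → only (on? v) (Φ (φ A v))} (ψ A) (φ A)
      (λ v → inj₁ (φψ A v))
      (λ v → inj₁ (trans (cong (λ w → only (on? (ψ A v)) (Φ w)) (φψ A v)) (moved v)))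
      (λ v → inj₁ (ψφ A v , only-⇔ (on? (φ A v)) (on? v) (trans (sym (quadratic-φ A v))) (trans (quadratic-φ A v)))) F
      where
      quadratic-ψ : ∀ v → quadratic (ψ A v) ≡ quadratic v
      quadratic-ψ v = trans (sym (quadratic-φ A (ψ A v))) (cong quadratic (φψ A v))
      moved : ∀ v → only (on? (ψ A v)) (Φ v) ≡ only (on? v) (Φ v)
      moved v = only-⇔ (on? (ψ A v)) (on? v) (trans (sym (quadratic-ψ v))) (trans (quadratic-ψ v))

    -- On the level set (t + b)(t - b) + 4ag is the odd number n.
    2∤t+b : ∀ t a b g → quadratic (t , a , b , g) ≡ + n → ¬ + 2 ∥ t + b
    2∤t+b t a b g e d = odd (by (trans (ring t a b g) e) (∣m∣n⇒∣m+n (∣m⇒∣m*n (t - b) d) (∣m⇒∣m*n (+ 2 * (a * g)) (divides 1ℤ refl))))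
      where
      ring : ∀ t a b g → (t + b) * (t - b) + + 2 * (+ 2 * (a * g)) ≡ t * t - (b * b - + 4 * (a * g))
      ring = solve-∀

    -- A linear form congruent to t + b modulo 2 is odd on the level set, so the wall where it
    -- vanishes contains no points.
    nonzero : ∀ {t a b g x} k → quadratic (t , a , b , g) ≡ + n → x ≡ t + b + + 2 * k → x ≢ 0ℤ
    nonzero {t} {a} {b} {g} k e eq refl = 2∤t+b t a b g e (divides (- k) (trans (ring (t + b) k) (trans (cong (_+ - k * + 2) (sym eq)) (ℤ.+-identityˡ (- k * + 2)))))
      where
      ring : ∀ x k → x ≡ x + + 2 * k + - k * + 2
      ring = solve-∀

    bounded : ∀ {x y z w} → 0ℤ < x → 0ℤ < y → 0ℤ < z → 0ℤ < w → x * y + z * w ≡ + n → x ∈ map +_ (upTo (suc n))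
    bounded {+ suc x} {+ suc y} {+ suc z} {+ suc w} _ _ _ _ e = ∈-map⁺ +_ (∈-upTo⁺ (s≤s (ℕ.≤-trans (ℕ.m≤m*n (suc x) (suc y))
      (ℕ.≤-trans (ℕ.m≤m+n (suc x ℕ.* suc y) (suc z ℕ.* suc w)) (ℕ.≤-reflexive (ℤ.+-injective e))))))
    bounded {+ zero} (+<+ ())
    bounded {_} {+ zero} _ (+<+ ())
    bounded {_} {_} {+ zero} _ _ (+<+ ())
    bounded {_} {_} {_} {+ zero} _ _ _ (+<+ ())

    module Finite (ℓ ℓ⁻¹ : Quad → Quad) (ℓ⁻¹ℓ : ∀ v → ℓ⁻¹ (ℓ v) ≡ v)
                  (ℓ-quadratic : ∀ v → pairing (ℓ v) ≡ quadratic v) where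

      -- In coordinates where the quadric is p c + q y = n, four positive coordinates are each at
      -- most n.
      finite : ∀ Φ → (∀ v → (let p , c , q , y = ℓ v in AllPos (p ∷ c ∷ q ∷ y ∷ [])) ⊎ Φ v ≡ 0ℤ) → ∃[ s ] Sums Φ s
      finite Φ support = _ , cover-sum (map ℓ⁻¹ box) cover
        where
        I = map +_ (upTo (suc n))
        box = cartesianProduct I (cartesianProduct I (cartesianProduct I I))
        inside : ∀ v → (let p , c , q , y = ℓ v in AllPos (p ∷ c ∷ q ∷ y ∷ [])) → quadratic v ≡ + n → ℓ v ∈ box
        inside v (0<p ∷ 0<c ∷ 0<q ∷ 0<y ∷ []) e = ∈-cartesianProduct⁺ (bounded 0<p 0<c 0<q 0<y e′)
            (∈-cartesianProduct⁺ (bounded 0<c 0<p 0<q 0<y (trans (cong (_+ q * y) (ℤ.*-comm c p)) e′))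
            (∈-cartesianProduct⁺ (bounded 0<q 0<y 0<p 0<c (trans (ℤ.+-comm (q * y) (p * c)) e′))
              (bounded 0<y 0<q 0<p 0<c (trans (cong (_+ p * c) (ℤ.*-comm y q)) (trans (ℤ.+-comm (q * y) (p * c)) e′)))))
          where
          p = proj₁ (ℓ v)
          c = proj₁ (proj₂ (ℓ v))
          q = proj₁ (proj₂ (proj₂ (ℓ v)))
          y = proj₂ (proj₂ (proj₂ (ℓ v)))
          e′ : p * c + q * y ≡ + n
          e′ = trans (ℓ-quadratic v) e
        cover : ∀ v → v ∈ map ℓ⁻¹ box ⊎ only (on? v) (Φ v) ≡ 0ℤ
        cover v = go (on? v) (support v)
          where
          go : (D? : Dec (quadratic v ≡ + n)) → (let p , c , q , y = ℓ v in AllPos (p ∷ c ∷ q ∷ y ∷ [])) ⊎ Φ v ≡ 0ℤ →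
               v ∈ map ℓ⁻¹ box ⊎ only D? (Φ v) ≡ 0ℤ
          go (no _)  _           = inj₂ refl
          go (yes e) (inj₂ z)    = inj₂ z
          go (yes e) (inj₁ ps)   = inj₁ (subst (_∈ map ℓ⁻¹ box) (ℓ⁻¹ℓ v) (∈-map⁺ ℓ⁻¹ (inside v ps e)))

    half : ∀ z x → z ≡ + 2 * x → quot (+ 2) z ≡ x
    half _ x refl = quot-* 1 x

    -- The system `xyca` is adapted to `K⁺`, whose last four inequalities say that its coordinates
    -- are positive. The inverses only have to be correct on images, where the halves are exact.
    pcqy pcqy⁻¹ xyca xyca⁻¹ : Quad → Quad
    pcqy (t , a , b , g) = t + (+ 2 * a + b) , + 2 * g , t - - b , t - (+ 2 * g + b)
    pcqy⁻¹ (p , c , q , y) = quot (+ 2) (q + y + c) , quot (+ 2) (p - q) , quot (+ 2) (q - y - c) , quot (+ 2) c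
    xyca (t , a , b , g) = t - - b , t + - b , - b + (+ 2 * a + b) , (+ 2 * g + b) + - b
    xyca⁻¹ (x , y , c , a) = quot (+ 2) (x + y) , quot (+ 2) c , quot (+ 2) (x - y) , quot (+ 2) a

    pcqy⁻¹-pcqy : ∀ v → pcqy⁻¹ (pcqy v) ≡ v
    pcqy⁻¹-pcqy (t , a , b , g) = quadruple
        (half (t - - b + (t - (+ 2 * g + b)) + + 2 * g) t (e₁ t b g)) (half (t + (+ 2 * a + b) - (t - - b)) a (e₂ t a b))
        (half (t - - b - (t - (+ 2 * g + b)) - + 2 * g) b (e₃ t b g)) (half (+ 2 * g) g refl)
      where
      e₁ : ∀ t b g → t - - b + (t - (+ 2 * g + b)) + + 2 * g ≡ + 2 * t
      e₁ = solve-∀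
      e₂ : ∀ t a b → t + (+ 2 * a + b) - (t - - b) ≡ + 2 * a
      e₂ = solve-∀
      e₃ : ∀ t b g → t - - b - (t - (+ 2 * g + b)) - + 2 * g ≡ + 2 * b
      e₃ = solve-∀

    xyca⁻¹-xyca : ∀ v → xyca⁻¹ (xyca v) ≡ v
    xyca⁻¹-xyca (t , a , b , g) = quadruple
        (half (t - - b + (t + - b)) t (e₁ t b)) (half (- b + (+ 2 * a + b)) a (e₂ a b))
        (half (t - - b - (t + - b)) b (e₃ t b)) (half ((+ 2 * g + b) + - b) g (e₅ g b))
      where
      e₁ : ∀ t b → t - - b + (t + - b) ≡ + 2 * t
      e₁ = solve-∀
      e₂ : ∀ a b → - b + (+ 2 * a + b) ≡ + 2 * a
      e₂ = solve-∀
      e₃ : ∀ t b → t - - b - (t + - b) ≡ + 2 * b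
      e₃ = solve-∀
      e₅ : ∀ g b → (+ 2 * g + b) + - b ≡ + 2 * g
      e₅ = solve-∀

    pcqy-quadratic : ∀ v → pairing (pcqy v) ≡ quadratic v
    pcqy-quadratic (t , a , b , g) = e t a b g
      where
      e : ∀ t a b g → (t + (+ 2 * a + b)) * (+ 2 * g) + (t - - b) * (t - (+ 2 * g + b)) ≡ t * t - (b * b - + 4 * (a * g))
      e = solve-∀

    xyca-quadratic : ∀ v → pairing (xyca v) ≡ quadratic v
    xyca-quadratic (t , a , b , g) = e t a b g
      where
      e : ∀ t a b g → (t - - b) * (t + - b) + (- b + (+ 2 * a + b)) * ((+ 2 * g + b) + - b) ≡ t * t - (b * b - + 4 * (a * g))
      e = solve-∀

    finite-pcqy : ∀ Φ → (∀ v → (let p , c , q , y = pcqy v in AllPos (p ∷ c ∷ q ∷ y ∷ [])) ⊎ Φ v ≡ 0ℤ) → ∃[ s ] Sums Φ s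
    finite-pcqy = Finite.finite pcqy pcqy⁻¹ pcqy⁻¹-pcqy pcqy-quadratic

    finite-xyca : ∀ Φ → (∀ v → (let p , c , q , y = xyca v in AllPos (p ∷ c ∷ q ∷ y ∷ [])) ⊎ Φ v ≡ 0ℤ) → ∃[ s ] Sums Φ s
    finite-xyca = Finite.finite xyca xyca⁻¹ xyca⁻¹-xyca xyca-quadratic

    cone-finite : ∀ (L : ℤ → ℤ → ℤ → ℤ → List ℤ) → (∀ p c q y → AllPos (L p c q y) → AllPos (p ∷ c ∷ q ∷ y ∷ [])) →
                  ∃[ s ] Sums (on-p (λ p c q y → posᴸ (L p c q y))) s
    cone-finite L h = finite-pcqy (on-p (λ p c q y → posᴸ (L p c q y))) λ (t , a , b , g) →
      [ (λ ps → inj₁ (h (t + (+ 2 * a + b)) (+ 2 * g) (t - - b) (t - (+ 2 * g + b)) ps)) , inj₂ ]′ (posᴸ-view (L (t + (+ 2 * a + b)) (+ 2 * g) (t - - b) (t - (+ 2 * g + b))))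

    zero-finite : ∀ (ζ : ℤ → ℤ → ℤ → ℤ → ℤ) (L : ℤ → ℤ → ℤ → ℤ → List ℤ) →
                  (∀ p c q y → AllPos (L p c q y) → AllPos (p ∷ c ∷ q ∷ y ∷ [])) →
                  ∃[ s ] Sums (on-p (λ p c q y → ζ p c q y * posᴸ (L p c q y))) s
    zero-finite ζ L h = finite-pcqy (on-p (λ p c q y → ζ p c q y * posᴸ (L p c q y))) λ (t , a , b , g) →
      [ (λ ps → inj₁ (h (t + (+ 2 * a + b)) (+ 2 * g) (t - - b) (t - (+ 2 * g + b)) ps)) ,
        (λ z → inj₂ (trans (cong (λ u → ζ (t + (+ 2 * a + b)) (+ 2 * g) (t - - b) (t - (+ 2 * g + b)) * u) z)
          (ℤ.*-zeroʳ (ζ (t + (+ 2 * a + b)) (+ 2 * g) (t - - b) (t - (+ 2 * g + b)))))) ]′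
      (posᴸ-view (L (t + (+ 2 * a + b)) (+ 2 * g) (t - - b) (t - (+ 2 * g + b))))

    F-finite : ∃[ s ] Sums (on-p cF) s
    F-finite = cone-finite (λ p c q y → y - c ∷ q ∷ p ∷ c - q ∷ []) λ { p c q y (h₁ ∷ h₂ ∷ h₃ ∷ h₄ ∷ []) →
      let 0<c = as (back-diff c q) (h₄ ⊕ h₂) in h₃ ∷ 0<c ∷ h₂ ∷ as (back-diff y c) (h₁ ⊕ 0<c) ∷ [] }

    X-finite : ∃[ s ] Sums (on-p cX) s
    X-finite = cone-finite (λ p c q y → p ∷ c ∷ q - c ∷ y - c ∷ []) λ { p c q y (h₁ ∷ h₂ ∷ h₃ ∷ h₄ ∷ []) →
      h₁ ∷ h₂ ∷ as (back-diff q c) (h₃ ⊕ h₂) ∷ as (back-diff y c) (h₄ ⊕ h₂) ∷ [] }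

    N-finite : ∃[ s ] Sums (on-p cN) s
    N-finite = cone-finite (λ p c q y → c - y ∷ q ∷ c - q ∷ y ∷ p ∷ p + q + y - c ∷ []) λ { p c q y (_ ∷ h₂ ∷ h₃ ∷ h₄ ∷ h₅ ∷ _ ∷ []) →
      h₅ ∷ as (back-diff c q) (h₃ ⊕ h₂) ∷ h₂ ∷ h₄ ∷ [] }

    Q-finite : ∃[ s ] Sums (on-p cQ) s
    Q-finite = cone-finite (λ p c q y → p - q ∷ c ∷ q ∷ c + q + y - p ∷ y ∷ []) λ { p c q y (h₁ ∷ h₂ ∷ h₃ ∷ _ ∷ h₅ ∷ []) →
      as (back-diff p q) (h₁ ⊕ h₃) ∷ h₂ ∷ h₃ ∷ h₅ ∷ [] }

    R-finite : ∃[ s ] Sums (on-p cR) s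
    R-finite = cone-finite (λ p c q y → p - q ∷ p - y ∷ c ∷ q ∷ c + q + y - p ∷ y ∷ []) λ { p c q y (h₁ ∷ _ ∷ h₂ ∷ h₃ ∷ _ ∷ h₅ ∷ []) →
      as (back-diff p q) (h₁ ⊕ h₃) ∷ h₂ ∷ h₃ ∷ h₅ ∷ [] }

    G-finite : ∃[ s ] Sums (on-p cG) s
    G-finite = cone-finite (λ p c q y → p - q ∷ c ∷ q ∷ y - p ∷ []) λ { p c q y (h₁ ∷ h₂ ∷ h₃ ∷ h₄ ∷ []) →
      let 0<p = as (back-diff p q) (h₁ ⊕ h₃) in 0<p ∷ h₂ ∷ h₃ ∷ as (back-diff y p) (h₄ ⊕ 0<p) ∷ [] }

    z₁-finite : ∃[ s ] Sums (on-p z₁) s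
    z₁-finite = zero-finite (λ p c q y → zer (p - q)) (λ p c q y → p ∷ c ∷ q ∷ y ∷ []) (λ p c q y h → h)

    z₂-finite : ∃[ s ] Sums (on-p z₂) s
    z₂-finite = zero-finite (λ p c q y → zer (p - y)) (λ p c q y → p - q ∷ p ∷ c ∷ q ∷ y ∷ []) λ { p c q y (_ ∷ h) → h }

    z₃-finite : ∃[ s ] Sums (on-p z₃) s
    z₃-finite = zero-finite (λ p c q y → zer (p - y)) (λ p c q y → - (p - q) ∷ p ∷ c ∷ q ∷ y ∷ []) λ { p c q y (_ ∷ h) → h }

    K-finite : ∃[ s ] Sums (on-s K⁺) s
    K-finite = finite-xyca (on-s K⁺) λ (t , a , b , g) →
      [ (λ { (_ ∷ h₂ ∷ h₃ ∷ h₄ ∷ h₅ ∷ []) → inj₁ (h₂ ∷ h₃ ∷ h₄ ∷ h₅ ∷ []) }) , inj₂ ]′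
      (posᴸ-view (- b ∷ t - - b ∷ t + - b ∷ - b + (+ 2 * a + b) ∷ (+ 2 * g + b) + - b ∷ []))

    on-∸ : ∀ {Φ Ψ : Quad → ℤ} {s s′} → Sums Φ s → Sums Ψ s′ → Sums (λ v → Φ v - Ψ v) (s - s′)
    on-∸ {Φ} {Ψ} {s} {s′} F F′ = HasSum-≡ (cong (λ u → s + u) (e s′)) (on-≗ (λ v → cong (λ u → Φ v + u) (e (Ψ v))) (on-⊕ F (on-scale -1ℤ F′)))
      where
      e : ∀ x → x * -1ℤ ≡ - x
      e = solve-∀

    on-double : ∀ {Φ : Quad → ℤ} {s} → Sums Φ s → Sums (λ v → + 2 * Φ v) (+ 2 * s)
    on-double {Φ} {s} F = HasSum-≡ (ℤ.*-comm s (+ 2)) (on-≗ (λ v → ℤ.*-comm (Φ v) (+ 2)) (on-scale (+ 2) F))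

    nF = proj₁ F-finite
    nX = proj₁ X-finite
    nN = proj₁ N-finite
    nQ = proj₁ Q-finite
    nR = proj₁ R-finite
    nG = proj₁ G-finite
    n₁ = proj₁ z₁-finite
    n₂ = proj₁ z₂-finite
    n₃ = proj₁ z₃-finite
    nK = proj₁ K-finite

    F-sum : Sums (on-p cF) nF
    F-sum = proj₂ F-finite

    F′-sum : Sums (on-p cF′) nF
    F′-sum = on-≗ (λ v → sym (F′-cone v)) (transport aut-1 F-sum)

    X′-sum : Sums (on-p cX′) nX
    X′-sum = on-≗ (λ v → sym (X′-cone v)) (transport aut-2 (proj₂ X-finite))

    H-sum : Sums (on-p cH) nG
    H-sum = on-≗ {λ v → on-p cG (φ aut-3 v)} {on-p cH}
      (λ v@(t , a , b , g) → trans (sym (H-cone v)) (sym (H-reorder (t + (+ 2 * a + b)) (+ 2 * g) (t - - b) (t - (+ 2 * g + b)))))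
      (transport aut-3 (proj₂ G-finite))

    E-sum : Sums (on-p cE) (nR + nX)
    E-sum = on-cong (λ (t , a , b , g) on → sym (E-split (t + (+ 2 * a + b)) (+ 2 * g) (t - - b) (t - (+ 2 * g + b))
        (nonzero {t} {a} {b} {g} (- b - a) on (e t a b g)))) (on-⊕ (proj₂ R-finite) X′-sum)
      where
      e : ∀ t a b g → + 2 * g + (t - - b) + (t - (+ 2 * g + b)) - (t + (+ 2 * a + b)) ≡ t + b + + 2 * (- b - a)
      e = solve-∀

    D-sum : Sums (on-p cD) (nQ + nX)
    D-sum = on-cong (λ (t , a , b , g) on → sym (D-split (t + (+ 2 * a + b)) (+ 2 * g) (t - - b) (t - (+ 2 * g + b))
        (nonzero {t} {a} {b} {g} (- b - a) on (e t a b g)))) (on-⊕ (proj₂ Q-finite) X′-sum)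
      where
      e : ∀ t a b g → + 2 * g + (t - - b) + (t - (+ 2 * g + b)) - (t + (+ 2 * a + b)) ≡ t + b + + 2 * (- b - a)
      e = solve-∀

    C-sum : Sums (on-p cC) (nN + nF)
    C-sum = on-cong (λ (t , a , b , g) on → sym (C-split (t + (+ 2 * a + b)) (+ 2 * g) (t - - b) (t - (+ 2 * g + b))
        (nonzero {t} {a} {b} {g} (t + a - + 2 * g) on (e t a b g)))) (on-⊕ (proj₂ N-finite) F′-sum)
      where
      e : ∀ t a b g → t + (+ 2 * a + b) + (t - - b) + (t - (+ 2 * g + b)) - + 2 * g ≡ t + b + + 2 * (t + a - + 2 * g)
      e = solve-∀

    B-sum : Sums (on-p cB) (nN + nF + nF + (nF + nX))
    B-sum = on-cong (λ (t , a , b , g) on → sym (B-split (t + (+ 2 * a + b)) (+ 2 * g) (t - - b) (t - (+ 2 * g + b))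
        (nonzero {t} {a} {b} {g} (g - t - b) on (e₁ t b g)) (nonzero {t} {a} {b} {g} (+ 2 * g - t) on (e₂ t b g))))
        (on-⊕ (on-⊕ C-sum F-sum) (on-⊕ (on-≗ (λ v → sym (F-swap v)) (transport swapping F-sum)) (proj₂ X-finite)))
      where
      e₁ : ∀ t b g → + 2 * g - (t - - b) ≡ t + b + + 2 * (g - t - b)
      e₁ = solve-∀
      e₂ : ∀ t b g → + 2 * g - (t - (+ 2 * g + b)) ≡ t + b + + 2 * (+ 2 * g - t)
      e₂ = solve-∀

    -- Two evaluations of the count for `cD`: along the wall p = c + q + y and along the wall p = y.
    D-relation : nQ + nX ≡ nR + nX + (nG + n₂)
    D-relation = on-unique D-sum (on-≗ (λ (t , a , b , g) → sym (D-trichotomy (t + (+ 2 * a + b)) (+ 2 * g) (t - - b) (t - (+ 2 * g + b))))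
      (on-⊕ E-sum (on-⊕ (proj₂ G-finite) (proj₂ z₂-finite))))

    -- Two evaluations of the count for `cB`: by the position of c and by the position of p, each
    -- relative to q and y.
    B-relation : nN + nF + nF + (nF + nX) ≡ nQ + nX + (nG + (nG + n₃) + n₁)
    B-relation = on-unique B-sum (on-≗ (λ (t , a , b , g) → sym (B-trichotomy (t + (+ 2 * a + b)) (+ 2 * g) (t - - b) (t - (+ 2 * g + b))))
      (on-⊕ D-sum (on-⊕ (on-⊕ (on-≗ (λ v → sym (G-swap v)) (transport swapping (proj₂ G-finite))) (on-⊕ H-sum (proj₂ z₃-finite))) (proj₂ z₁-finite))))

    -- The term `z₁` is moved from the wall p = q to the wall p = y by exchanging q and y, so that
    -- all three terms live on one wall.
    ζ : ℤ → ℤ → ℤ → ℤ → ℤ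
    ζ p c q y = zer (p - y) * posᴸ (p ∷ c ∷ y ∷ q ∷ []) + z₃ p c q y - + 2 * z₂ p c q y

    nζ = n₁ + n₃ - + 2 * n₂

    ζ-sum : Sums (on-p ζ) nζ
    ζ-sum = on-∸ (on-⊕ (on-≗ z₁-swap (transport swapping (proj₂ z₁-finite))) (proj₂ z₃-finite)) (on-double (proj₂ z₂-finite))
      where
      z₁-swap : ∀ v → on-p z₁ (φ swapping v) ≡ on-p (λ p c q y → zer (p - y) * posᴸ (p ∷ c ∷ y ∷ q ∷ [])) v
      z₁-swap (t , a , b , g) = cong₄ {c = + 2 * g} (e₁ t a b g) (e₂ t b g) (e₃ t b g)
        where
        cong₄ : ∀ {p p′ c q q′ y y′} → p ≡ p′ → q ≡ q′ → y ≡ y′ → z₁ p c q y ≡ zer (p′ - q′) * posᴸ (p′ ∷ c ∷ q′ ∷ y′ ∷ [])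
        cong₄ refl refl refl = refl
        e₁ : ∀ t a b g → t + (+ 2 * (a + b + g) + (- b - + 2 * g)) ≡ t + (+ 2 * a + b)
        e₁ = solve-∀
        e₂ : ∀ t b g → t - - (- b - + 2 * g) ≡ t - (+ 2 * g + b)
        e₂ = solve-∀
        e₃ : ∀ t b g → t - (+ 2 * g + (- b - + 2 * g)) ≡ t - - b
        e₃ = solve-∀

    rotate : ∀ {Φ : ℤ → ℤ → ℤ → ℤ → ℤ} {s} → Sums (on-s Φ) s → Sums (on-s (λ t x y z → Φ t y z x)) s
    rotate {Φ} F = on-≗ (rotated Φ) (transport rotation F)

    three : ∀ {Φ : ℤ → ℤ → ℤ → ℤ → ℤ} {s} → Sums (on-s Φ) s → Sums (on-s (λ t x y z → Φ t x y z + Φ t y z x + Φ t z x y)) (s + s + s)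
    three {Φ} F = on-⊕ (on-⊕ F (rotate {Φ} F)) (rotate {λ t x y z → Φ t y z x} (rotate {Φ} F))

    nΓ = nF + nF + nF - (nQ + nQ + nQ) + + 2 * nR + (nK - nK + (nK - nK) + (nK - nK))

    -- The terms `F₁`, `Q₁` and `K` enter with their three rotations, which have equal sums.
    G-sum : Sums (on-s G) nΓ
    G-sum = on-⊕ (on-⊕ (on-∸ (three {F₁} (on-≗ (λ v → sym (F₁-cone v)) (transport aut-F F-sum)))
                              (three {Q₁} (on-≗ (λ v → sym (Q₁-cone v)) (proj₂ Q-finite))))
                        (on-double (on-≗ (λ v → sym (R₁-cone v)) (proj₂ R-finite))))
        (three {K} (on-∸ (proj₂ K-finite) (on-≗ (λ v → sym (K-reflect v)) (transport reflection (proj₂ K-finite)))))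

    -- Six times the sum of H (n - t²), as a sum over divisors.
    weight-sum : Sums (on-s (λ _ → weight₃)) (+ 2 * nζ)
    weight-sum = HasSum-≡ (evaluate nN nF nX nQ nR nG nK n₁ n₂ n₃ D-relation B-relation)
      (on-cong (λ (t , a , b , g) on → sym (positions t a b g on))
        (on-⊕ (on-⊕ (on-double (on-≗ (λ v → sym (N₁-cone v)) (transport aut-N (proj₂ N-finite)))) G-sum) (transport negation G-sum)))
      where
      e₁ : ∀ t b → t - - b ≡ t + b + + 2 * 0ℤ
      e₁ = solve-∀
      e₂ : ∀ t b → t + - b ≡ t + b + + 2 * - b
      e₂ = solve-∀
      e₃ : ∀ t a b → t - (+ 2 * a + b) ≡ t + b + + 2 * (- a - b)
      e₃ = solve-∀
      e₄ : ∀ t a b → t + (+ 2 * a + b) ≡ t + b + + 2 * a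
      e₄ = solve-∀
      positions : ∀ t a b g → quadratic (t , a , b , g) ≡ + n →
        weight₃ (- b) (+ 2 * a + b) (+ 2 * g + b) ≡ + 2 * N₁ t (- b) (+ 2 * a + b) (+ 2 * g + b)
          + G t (- b) (+ 2 * a + b) (+ 2 * g + b) + G (- t) (- b) (+ 2 * a + b) (+ 2 * g + b)
      positions t a b g on = pointwise t (- b) (+ 2 * a + b) (+ 2 * g + b)
        (nonzero {t} {a} {b} {g} 0ℤ on (e₁ t b)) (nonzero {t} {a} {b} {g} (- b) on (e₂ t b))
        (nonzero {t} {a} {b} {g} (- a - b) on (e₃ t a b)) (nonzero {t} {a} {b} {g} a on (e₄ t a b))
        (nonzero {t} {a} {b} {g} (- g - b) on (e₃ t g b)) (nonzero {t} {a} {b} {g} g on (e₄ t g b))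
      -- The combination is twice the relation `B` minus four times the relation `D`: all cones
      -- cancel and the wall terms remain.
      evaluate : ∀ N F X Q R G K z₁ z₂ z₃ → Q + X ≡ R + X + (G + z₂) → N + F + F + (F + X) ≡ Q + X + (G + (G + z₃) + z₁) →
        + 2 * N + (F + F + F - (Q + Q + Q) + + 2 * R + (K - K + (K - K) + (K - K)))
              + (F + F + F - (Q + Q + Q) + + 2 * R + (K - K + (K - K) + (K - K)))
        ≡ + 2 * (z₁ + z₃ - + 2 * z₂)
      evaluate N F X Q R G K z₁ z₂ z₃ D B = trans (ring₁ N F X Q R G K z₁ z₂ z₃)
        (trans (cong₂ (λ u v → + 2 * (u - (Q + X + (G + (G + z₃) + z₁))) - + 4 * (v - (R + X + (G + z₂))) + + 2 * (z₁ + z₃ - + 2 * z₂)) B D)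
          (ring₂ Q X R G z₁ z₂ z₃))
        where
        ring₁ : ∀ N F X Q R G K z₁ z₂ z₃ →
          + 2 * N + (F + F + F - (Q + Q + Q) + + 2 * R + (K - K + (K - K) + (K - K)))
                + (F + F + F - (Q + Q + Q) + + 2 * R + (K - K + (K - K) + (K - K)))
          ≡ + 2 * (N + F + F + (F + X) - (Q + X + (G + (G + z₃) + z₁))) - + 4 * (Q + X - (R + X + (G + z₂))) + + 2 * (z₁ + z₃ - + 2 * z₂)
        ring₁ = solve-∀
        ring₂ : ∀ Q X R G z₁ z₂ z₃ → + 2 * (Q + X + (G + (G + z₃) + z₁) - (Q + X + (G + (G + z₃) + z₁)))
          - + 4 * (R + X + (G + z₂) - (R + X + (G + z₂))) + + 2 * (z₁ + z₃ - + 2 * z₂) ≡ + 2 * (z₁ + z₃ - + 2 * z₂)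
        ring₂ = solve-∀

-- Sums over the factorisations of a prime power.

module PrimePower where

  open FinSum
  open Forms hiding (f₁; f₂)
  open Congruence
  open import Data.Integer.Base using (_+_; _*_; _-_; -_)
  open import Data.Integer.Tactic.RingSolver using (solve-∀)

  open ℤΣ

  sum-downFrom : ∀ n f → sum (downFrom (suc n)) f ≡ sum (downFrom n) (λ i → f (suc i)) + f 0
  sum-downFrom zero    f = trans (ℤ.+-identityʳ (f 0)) (sym (ℤ.+-identityˡ (f 0)))
  sum-downFrom (suc n) f = trans (cong (λ u → f (suc n) + u) (sum-downFrom n f)) (sym (ℤ.+-assoc (f (suc n)) _ (f 0)))

  -- The number of j < m, counted with weight 1, 2 or - 1 according to j = l, j > l or j < l.
  count : ℕ → ℕ → ℤ
  count l m = sum (downFrom m) (λ j → 1ℤ + pos (+ j - + l) - + 2 * pos (+ l - + j))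

  pos-⊖ : ∀ {i j} → j ℕ.< i → pos (+ i - + j) ≡ 1ℤ
  pos-⊖ {i} {j} j<i with ℕ.m+[n∸m]≡n j<i
  ... | eq = subst (λ k → pos (+ k - + j) ≡ 1ℤ) eq (cong pos (e (+ j) (+ (i ∸ suc j))))
    where
    e : ∀ j d → 1ℤ + j + d - j ≡ 1ℤ + d
    e = solve-∀

  pos-⊖-≤ : ∀ {i j} → i ℕ.≤ j → pos (+ i - + j) ≡ 0ℤ
  pos-⊖-≤ {i} {j} i≤j with ℕ.m+[n∸m]≡n i≤j
  ... | eq = subst (λ k → pos (+ i - + k) ≡ 0ℤ) eq (trans (cong pos (e (+ i) (+ (j ∸ i)))) (nonpos (j ∸ i)))
    where
    e : ∀ i d → i - (i + d) ≡ - d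
    e = solve-∀
    nonpos : ∀ d → pos (- + d) ≡ 0ℤ
    nonpos zero    = refl
    nonpos (suc d) = refl

  count-≤ : ∀ l m → m ℕ.≤ l → count l m ≡ - + m
  count-≤ l zero    _   = refl
  count-≤ l (suc m) m<l = trans (cong₂ _+_ (cong₂ (λ u v → 1ℤ + u - + 2 * v) (pos-⊖-≤ (ℕ.<⇒≤ m<l)) (pos-⊖ m<l)) (count-≤ l m (ℕ.<⇒≤ m<l))) (e (+ m))
    where
    e : ∀ m → -1ℤ + - m ≡ - (1ℤ + m)
    e = solve-∀

  -- The l indices below l give - l, the index l gives 1, and the k indices above it give 2 each.
  count-> : ∀ l k → count l (suc (l ℕ.+ k)) ≡ + 2 * (1ℤ + (+ l + + k)) - + 3 * + l - 1ℤ
  count-> l zero = trans (cong (λ m → count l (suc m)) (ℕ.+-identityʳ l)) (trans (cong₂ _+_ (cong₂ (λ u v → 1ℤ + u - + 2 * v) (pos-⊖-≤ {l} {l} ℕ.≤-refl) (pos-⊖-≤ {l} {l} ℕ.≤-refl)) (count-≤ l l ℕ.≤-refl)) (e (+ l)))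
    where
    e : ∀ l → 1ℤ + - l ≡ + 2 * (1ℤ + (l + 0ℤ)) - + 3 * l - 1ℤ
    e = solve-∀
  count-> l (suc k) = trans (cong (λ m → count l (suc m)) (ℕ.+-suc l k)) (trans (cong₂ _+_ (cong₂ (λ u v → 1ℤ + u - + 2 * v)
      (pos-⊖ {suc (l ℕ.+ k)} {l} (s≤s (ℕ.m≤m+n l k))) (pos-⊖-≤ {l} {suc (l ℕ.+ k)} (ℕ.m≤n⇒m≤1+n (ℕ.m≤m+n l k)))) (count-> l k)) (e (+ l) (+ k)))
    where
    e : ∀ l k → + 2 + (+ 2 * (1ℤ + (l + k)) - + 3 * l - 1ℤ) ≡ + 2 * (1ℤ + (l + (1ℤ + k))) - + 3 * l - 1ℤ
    e = solve-∀

  module Powers (p : ℕ) (p-prime : Prime p) where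

    private instance
      p≢0 : NonZero p
      p≢0 = prime⇒nonZero p-prime

    1<p : 1 ℕ.< p
    1<p = ℕ.nonTrivial⇒n>1 p {{prime⇒nonTrivial p-prime}}

    P : ℤ
    P = + p

    -- Euclid's lemma strips one factor p at a time from d or from e.
    divisors : ∀ r d e → d ℕ.* e ≡ p ℕ.^ r → ∃[ i ] i ℕ.≤ r × d ≡ p ℕ.^ i × e ≡ p ℕ.^ (r ∸ i)
    divisors zero d e eq = 0 , z≤n , ℕ.m*n≡1⇒m≡1 d e eq , ℕ.m*n≡1⇒n≡1 d e eq
    divisors (suc r) d e eq with euclidsLemma d e p-prime (ℕ.divides (p ℕ.^ r) (trans eq (ℕ.*-comm p (p ℕ.^ r))))
    ... | inj₁ (ℕ.divides d′ refl) with divisors r d′ e (ℕ.*-cancelˡ-≡ (d′ ℕ.* e) (p ℕ.^ r) p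
            (trans (trans (sym (ℕ.*-assoc p d′ e)) (cong (ℕ._* e) (ℕ.*-comm p d′))) eq))
    ...   | i , i≤r , refl , e≡ = suc i , s≤s i≤r , ℕ.*-comm (p ℕ.^ i) p , e≡
    divisors (suc r) d e eq | inj₂ (ℕ.divides e′ refl) with divisors r d e′ (ℕ.*-cancelˡ-≡ (d ℕ.* e′) (p ℕ.^ r) p
            (trans (trans (ℕ.*-comm p (d ℕ.* e′)) (ℕ.*-assoc d e′ p)) eq))
    ...   | i , i≤r , d≡ , refl = i , ℕ.m≤n⇒m≤1+n i≤r , d≡ , trans (ℕ.*-comm (p ℕ.^ (r ∸ i)) p) (cong (p ℕ.^_) (sym (ℕ.+-∸-assoc 1 i≤r)))

    pw : ℕ → ℤ
    pw i = + (p ℕ.^ i)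

    pw-suc : ∀ i → pw (suc i) ≡ P * pw i
    pw-suc i = ℤ.pos-* p (p ℕ.^ i)

    -- The contribution of the factorisation pⁱ · pʲ, and the sign of i - j.
    contribution sign : ℕ → ℕ → ℤ
    contribution i j with j ℕ.≤? i
    ... | yes _ = 1ℤ - pw j
    ... | no _  = + 2 * pw j - + 3 * pw i - 1ℤ
    sign i j with j ℕ.≤? i
    ... | yes _ = 1ℤ
    ... | no _  = -1ℤ

    -- Both branches are homogeneous in the powers of p up to their constant terms 1 and - 1, which
    -- `sign` records.
    contribution-suc : ∀ i j → contribution (suc i) (suc j) ≡ P * contribution i j + (1ℤ - P) * sign i j
    contribution-suc i j with suc j ℕ.≤? suc i | j ℕ.≤? i
    ... | yes _ | yes _ = trans (cong (λ u → 1ℤ - u) (pw-suc j)) (e P (pw j))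
      where
      e : ∀ P x → 1ℤ - P * x ≡ P * (1ℤ - x) + (1ℤ - P) * 1ℤ
      e = solve-∀
    ... | no _  | no _ = trans (cong₂ (λ u v → + 2 * u - + 3 * v - 1ℤ) (pw-suc j) (pw-suc i)) (e P (pw j) (pw i))
      where
      e : ∀ P x y → + 2 * (P * x) - + 3 * (P * y) - 1ℤ ≡ P * (+ 2 * x - + 3 * y - 1ℤ) + (1ℤ - P) * -1ℤ
      e = solve-∀
    ... | yes (s≤s q) | no ¬q = ⊥-elim (¬q q)
    ... | no ¬q | yes q = ⊥-elim (¬q (s≤s q))

    sign-suc : ∀ i j → sign (suc i) (suc j) ≡ sign i j
    sign-suc i j with suc j ℕ.≤? suc i | j ℕ.≤? i
    ... | yes _ | yes _ = refl
    ... | no _  | no _ = refl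
    ... | yes (s≤s q) | no ¬q = ⊥-elim (¬q q)
    ... | no ¬q | yes q = ⊥-elim (¬q (s≤s q))

    B D : ℕ → ℤ
    B r = sum (downFrom (suc r)) (λ i → contribution i (r ∸ i))
    D r = sum (downFrom (suc r)) (λ i → sign i (r ∸ i))

    peel : ∀ (f : ℕ → ℕ → ℤ) r → sum (downFrom (suc (suc (suc r)))) (λ i → f i (suc (suc r) ∸ i)) ≡
           f (suc (suc r)) 0 + (sum (downFrom (suc r)) (λ i → f (suc i) (suc (r ∸ i))) + f 0 (suc (suc r)))
    peel f r = cong₂ _+_ (cong (f (suc (suc r))) (ℕ.n∸n≡0 r))
      (trans (sum-downFrom (suc r) (λ i → f i (suc (suc r) ∸ i)))
        (cong (_+ f 0 (suc (suc r))) (sum-cong-∈ (downFrom (suc r)) (λ {i} i∈ →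
          cong (f (suc i)) (ℕ.+-∸-assoc 1 (ℕ.≤-pred (∈-downFrom⁻ i∈)))))))

    -- The two outer terms, 1 and - 1, cancel.
    D-step : ∀ r → D (suc (suc r)) ≡ D r
    D-step r = trans (peel sign r) (trans (cong (λ u → 1ℤ + (u + -1ℤ)) (sum-cong (downFrom (suc r)) (λ i → sign-suc i (r ∸ i)))) (e (D r)))
      where
      e : ∀ x → 1ℤ + (x + -1ℤ) ≡ x
      e = solve-∀

    -- The outer factorisations contribute 0 and 2 p^(r + 2) - 4. The inner ones are the
    -- factorisations of p^r with a factor p added on both sides.
    B-step : ∀ r → B (suc (suc r)) ≡ P * B r + (1ℤ - P) * D r + + 2 * pw (suc (suc r)) - + 4
    B-step r = trans (peel contribution r) (trans (cong (λ u → 0ℤ + (u + (+ 2 * pw (suc (suc r)) - + 3 * 1ℤ - 1ℤ)))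
        (trans (sum-cong (downFrom (suc r)) (λ i → contribution-suc i (r ∸ i)))
          (trans (sum-⊕ (downFrom (suc r)) (λ i → P * contribution i (r ∸ i)) (λ i → (1ℤ - P) * sign i (r ∸ i)))
            (cong₂ _+_ (sum-*ˡ P (λ i → contribution i (r ∸ i))) (sum-*ˡ (1ℤ - P) (λ i → sign i (r ∸ i)))))))
        (e (P * B r + (1ℤ - P) * D r) (pw (suc (suc r)))))
      where
      e : ∀ x y → 0ℤ + (x + (+ 2 * y - + 3 * 1ℤ - 1ℤ)) ≡ x + + 2 * y - + 4
      e = solve-∀
      sum-*ˡ : ∀ k f → sum (downFrom (suc r)) (λ i → k * f i) ≡ k * sum (downFrom (suc r)) f
      sum-*ˡ k f = sym (sum-hom ℤ.+-0-isCommutativeMonoid ℤ.+-0-isCommutativeMonoid (k *_) (ℤ.*-zeroʳ k) (ℤ.*-distribˡ-+ k) (downFrom (suc r)) f)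

    B-1 : B 1 ≡ + 2 * P - + 4
    B-1 = trans (cong (λ u → 0ℤ + (+ 2 * u - + 3 * 1ℤ - 1ℤ + 0ℤ)) (cong +_ (ℕ.*-identityʳ p))) (e P)
      where
      e : ∀ P → 0ℤ + (+ 2 * P - + 3 * 1ℤ - 1ℤ + 0ℤ) ≡ + 2 * P - + 4
      e = solve-∀

-- Class number sums over t as divisor sums.

module ClassSum where

  open import Defs using (BQF; ⟨_,_,_⟩; disc)
  open FinSum
  open Forms hiding (r₀; r₁; r₂; f₀; f₁; f₂)
  open Weights
  open Congruence
  open Hecke using (S-sum; quot; pos-*)
  open HeckeTrace using (6H⁺)
  open Pointwise using (posᴸ)
  open Eichler
  open EichlerSum
  open PrimePower
  open import Data.Integer.Base using (_+_; _*_; _-_; -_; _<_; _≤_)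
  open import Data.Integer.Divisibility.Signed using (divides; ∣ᵤ⇒∣; ∣⇒∣ᵤ; ∣n⇒∣m*n; ∣m⇒∣m*n) renaming (_∣_ to infix 4 _∥_)
  open import Data.Integer.Tactic.RingSolver using (solve-∀)

  open ℤΣ

  halve : ∀ x → ¬ 2 ℕ.∣ x → x ≡ suc (2 ℕ.* ⌊ x /2⌋)
  halve zero          h = ⊥-elim (h (ℕ.divides 0 refl))
  halve (suc zero)    h = refl
  halve (suc (suc x)) h = trans (cong (suc ∘ suc) (halve x (λ { (ℕ.divides q e) → h (ℕ.divides (suc q) (cong (suc ∘ suc) e)) })))
    (cong suc (sym (ℕ.*-suc 2 ⌊ x /2⌋)))

  halveℤ : ∀ x → ¬ 2 ℕ.∣ x → + x ≡ 1ℤ + + 2 * + ⌊ x /2⌋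
  halveℤ x h = trans (cong +_ (halve x h)) (cong (λ u → 1ℤ + u) (ℤ.pos-* 2 ⌊ x /2⌋))

  even-sum : ∀ x y → ¬ + 2 ∥ x → ¬ + 2 ∥ y → + 2 ∥ x + y
  even-sum x y hx hy = [ (λ d → d) , (λ d → ⊥-elim (hx d)) ]′ (from (odd x hx) (odd y hy))
    where
    odd : ∀ x → ¬ + 2 ∥ x → ∃[ k ] x ≡ 1ℤ + + 2 * k
    odd (+ n)    h = + ⌊ n /2⌋ , halveℤ n (λ d → h (∣ᵤ⇒∣ d))
    odd -[1+ n ] h = - (1ℤ + + ⌊ suc n /2⌋) , trans (cong -_ (halveℤ (suc n) (λ d → h (∣ᵤ⇒∣ d)))) (e (+ ⌊ suc n /2⌋))
      where
      e : ∀ k → - (1ℤ + + 2 * k) ≡ 1ℤ + + 2 * - (1ℤ + k)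
      e = solve-∀
    from : ∀ {x y} → (∃[ k ] x ≡ 1ℤ + + 2 * k) → (∃[ k ] y ≡ 1ℤ + + 2 * k) → + 2 ∥ x + y ⊎ + 2 ∥ x
    from (k , refl) (l , refl) = inj₁ (divides (1ℤ + k + l) (e k l))
      where
      e : ∀ k l → 1ℤ + + 2 * k + (1ℤ + + 2 * l) ≡ (1ℤ + k + l) * + 2
      e = solve-∀

  module Evaluate (n : ℕ) (odd : ¬ + 2 ∥ + n) where

    open AtLevel n odd

    abstract
      factor? : ∀ d e → Dec (d * e ≡ + n)
      factor? d e = d * e ℤ.≟ + n

    odd-factors : ∀ d e → d * e ≡ + n → ¬ + 2 ∥ d × ¬ + 2 ∥ e
    odd-factors d e eq = (λ h → odd (by eq (∣m⇒∣m*n e h))) , (λ h → odd (by eq (∣n⇒∣m*n d h)))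

    Triples : Set
    Triples = (ℤ × ℤ) × ℤ

    solution : Triples → ℤ
    solution ((d , e) , γ) = only (factor? d e) (ζ d (+ 2 * γ) (e - + 2 * γ) d)

    -- On the wall p = y the equation n = p c + q y becomes n = d e with d = y and e = c + q; the
    -- third entry is half of c.
    toTriple : Quad → Triples
    toTriple (t , a , b , g) = (t - (+ 2 * g + b) , + 2 * g + (t - - b)) , g

    fromTriple : Triples → Quad
    fromTriple ((d , e) , γ) = t , t - e + γ , e - + 2 * γ - t , γ
      where t = quot (+ 2) (d + e)

    zer-≢0 : ∀ x → x ≡ 0ℤ ⊎ zer x ≡ 0ℤ
    zer-≢0 (+ zero)  = inj₁ refl
    zer-≢0 (+ suc _) = inj₂ refl
    zer-≢0 -[1+ _ ]  = inj₂ refl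

    ζ-diagonal : ∀ p c q y → p ≡ y ⊎ ζ p c q y ≡ 0ℤ
    ζ-diagonal p c q y with zer-≢0 (p - y)
    ... | inj₁ h = inj₁ (ℤ.i-j≡0⇒i≡j p y h)
    ... | inj₂ h = inj₂ (trans (cong (λ u → u * A + u * B′ - + 2 * (u * C)) h) (e A B′ C))
      where
      A = posᴸ (p ∷ c ∷ y ∷ q ∷ [])
      B′ = posᴸ (- (p - q) ∷ p ∷ c ∷ q ∷ y ∷ [])
      C = posᴸ (p - q ∷ p ∷ c ∷ q ∷ y ∷ [])
      e : ∀ a b c → 0ℤ * a + 0ℤ * b - + 2 * (0ℤ * c) ≡ 0ℤ
      e = solve-∀

    only-0 : ∀ {A : Set} (A? : Dec A) {v} → (A → v ≡ 0ℤ) → only A? v ≡ 0ℤ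
    only-0 (yes a) h = h a
    only-0 (no _)  _ = refl

    solution-sum : HasSum solution nζ
    solution-sum = HasSum-bij {f = λ v → only (on? v) (on-p ζ v)} {g = solution} toTriple fromTriple
        (λ (t , a , b , g) → retract t a b g (ζ-diagonal (t + (+ 2 * a + b)) (+ 2 * g) (t - - b) (t - (+ 2 * g + b))))
        (λ (t , a , b , g) → agree t a b g (ζ-diagonal (t + (+ 2 * a + b)) (+ 2 * g) (t - - b) (t - (+ 2 * g + b))))
        (λ ((d , e) , γ) → section d e γ (factor? d e)) ζ-sum
      where
      e₁ : ∀ t b g → t - (+ 2 * g + b) + (+ 2 * g + (t - - b)) ≡ + 2 * t
      e₁ = solve-∀
      t≡ : ∀ t b g → quot (+ 2) (t - (+ 2 * g + b) + (+ 2 * g + (t - - b))) ≡ t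
      t≡ t b g = half _ t (e₁ t b g)
      a≡ : ∀ t a b g → t + (+ 2 * a + b) ≡ t - (+ 2 * g + b) → t - (+ 2 * g + (t - - b)) + g ≡ a
      a≡ t a b g p≡y = ℤ.*-cancelˡ-≡ (+ 2) _ a (trans (e₂ t b g) (trans (cong (λ u → u - t - b) (sym p≡y)) (e₃ t a b)))
        where
        e₂ : ∀ t b g → + 2 * (t - (+ 2 * g + (t - - b)) + g) ≡ t - (+ 2 * g + b) - t - b
        e₂ = solve-∀
        e₃ : ∀ t a b → t + (+ 2 * a + b) - t - b ≡ + 2 * a
        e₃ = solve-∀
      retract : ∀ t a b g → t + (+ 2 * a + b) ≡ t - (+ 2 * g + b) ⊎ on-p ζ (t , a , b , g) ≡ 0ℤ →
                fromTriple (toTriple (t , a , b , g)) ≡ (t , a , b , g) ⊎ only (on? (t , a , b , g)) (on-p ζ (t , a , b , g)) ≡ 0ℤ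
      retract t a b g (inj₂ z) = inj₂ (only-0 (on? (t , a , b , g)) (λ _ → z))
      retract t a b g (inj₁ p≡y) = inj₁ (quadruple (t≡ t b g)
        (trans (cong (λ u → u - (+ 2 * g + (t - - b)) + g) (t≡ t b g)) (a≡ t a b g p≡y))
        (trans (cong (λ u → + 2 * g + (t - - b) - + 2 * g - u) (t≡ t b g)) (e₄ t b g)) refl)
        where
        e₄ : ∀ t b g → + 2 * g + (t - - b) - + 2 * g - t ≡ b
        e₄ = solve-∀
      agree : ∀ t a b g → t + (+ 2 * a + b) ≡ t - (+ 2 * g + b) ⊎ on-p ζ (t , a , b , g) ≡ 0ℤ →
              solution (toTriple (t , a , b , g)) ≡ only (on? (t , a , b , g)) (on-p ζ (t , a , b , g))
                ⊎ only (on? (t , a , b , g)) (on-p ζ (t , a , b , g)) ≡ 0ℤ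
      agree t a b g (inj₂ z) = inj₂ (only-0 (on? (t , a , b , g)) (λ _ → z))
      agree t a b g (inj₁ p≡y) = inj₁ (trans (only-⇔ (factor? (t - (+ 2 * g + b)) (+ 2 * g + (t - - b))) (on? (t , a , b , g))
          (trans (sym product)) (trans product))
          (cong (only (on? (t , a , b , g))) (cong₂ (λ p q → ζ p (+ 2 * g) q (t - (+ 2 * g + b))) (sym p≡y) (e₅ t b g))))
        where
        e₅ : ∀ t b g → + 2 * g + (t - - b) - + 2 * g ≡ t - - b
        e₅ = solve-∀
        product : (t - (+ 2 * g + b)) * (+ 2 * g + (t - - b)) ≡ quadratic (t , a , b , g)
        product = trans (e₆ t b g) (trans (cong (λ p → p * (+ 2 * g) + (t - - b) * (t - (+ 2 * g + b))) (sym p≡y)) (pcqy-quadratic (t , a , b , g)))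
          where
          e₆ : ∀ t b g → (t - (+ 2 * g + b)) * (+ 2 * g + (t - - b)) ≡ (t - (+ 2 * g + b)) * (+ 2 * g) + (t - - b) * (t - (+ 2 * g + b))
          e₆ = solve-∀
      section : ∀ d e γ → Dec (d * e ≡ + n) →
                (toTriple (fromTriple ((d , e) , γ)) ≡ ((d , e) , γ)
                  × only (on? (fromTriple ((d , e) , γ))) (on-p ζ (fromTriple ((d , e) , γ))) ≡ solution ((d , e) , γ))
                ⊎ solution ((d , e) , γ) ≡ 0ℤ
      section d e γ (no h) = inj₂ (only-no (factor? d e) h)
      -- Both factors of the odd number n are odd, so t = (d + e) / 2 is an integer.
      section d e γ (yes h) = inj₁ (section′ (even-sum d e (proj₁ (odd-factors d e h)) (proj₂ (odd-factors d e h))))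
        where
        section′ : + 2 ∥ d + e → _
        section′ (divides t d+e) = cong₂ _,_ (cong₂ _,_ y≡d (trans (cong (λ u → + 2 * γ + (u - - (e - + 2 * γ - u))) t-eq) (r₂ t e γ))) refl ,
            trans (only-⇔ (on? (fromTriple ((d , e) , γ))) (factor? d e) (trans (sym quad)) (trans quad))
              (cong (only (factor? d e)) (trans (cong₂ (λ p y → ζ p (+ 2 * γ) (u - - (e - + 2 * γ - u)) y) p≡d y≡d)
                (cong (λ q → ζ d (+ 2 * γ) q d) (trans (cong (λ u → u - - (e - + 2 * γ - u)) t-eq) (r₃ t e γ)))))
          where
          u = quot (+ 2) (d + e)
          t-eq : u ≡ t
          t-eq = half (d + e) t (trans d+e (ℤ.*-comm t (+ 2)))
          d≡ : d ≡ + 2 * t - e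
          d≡ = trans (r₀ d e) (cong (_- e) (trans d+e (ℤ.*-comm t (+ 2))))
            where
            r₀ : ∀ d e → d ≡ d + e - e
            r₀ = solve-∀
          r₁ : ∀ t e γ → t - (+ 2 * γ + (e - + 2 * γ - t)) ≡ + 2 * t - e
          r₁ = solve-∀
          r₂ : ∀ t e γ → + 2 * γ + (t - - (e - + 2 * γ - t)) ≡ e
          r₂ = solve-∀
          r₃ : ∀ t e γ → t - - (e - + 2 * γ - t) ≡ e - + 2 * γ
          r₃ = solve-∀
          r₄ : ∀ t e γ → t + (+ 2 * (t - e + γ) + (e - + 2 * γ - t)) ≡ + 2 * t - e
          r₄ = solve-∀
          y≡d : u - (+ 2 * γ + (e - + 2 * γ - u)) ≡ d
          y≡d = trans (cong (λ u → u - (+ 2 * γ + (e - + 2 * γ - u))) t-eq) (trans (r₁ t e γ) (sym d≡))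
          p≡d : u + (+ 2 * (u - e + γ) + (e - + 2 * γ - u)) ≡ d
          p≡d = trans (cong (λ u → u + (+ 2 * (u - e + γ) + (e - + 2 * γ - u))) t-eq) (trans (r₄ t e γ) (sym d≡))
          r₅ : ∀ t e γ → t * t - ((e - + 2 * γ - t) * (e - + 2 * γ - t) - + 4 * ((t - e + γ) * γ)) ≡ (+ 2 * t - e) * e
          r₅ = solve-∀
          quad : quadratic (fromTriple ((d , e) , γ)) ≡ d * e
          quad = trans (cong (λ u → u * u - ((e - + 2 * γ - u) * (e - + 2 * γ - u) - + 4 * ((u - e + γ) * γ))) t-eq)
            (trans (r₅ t e γ) (cong (_* e) (sym d≡)))

    ζ-factored : ∀ d c q → ζ d c q d ≡ pos d * pos c * pos q * (zer (d - d) * pos d * (1ℤ + pos (- (d - q)) - + 2 * pos (d - q)))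
    ζ-factored d c q = e (zer (d - d)) (pos d) (pos c) (pos q) (pos (- (d - q))) (pos (d - q))
      where
      e : ∀ Z D C Q U V → Z * (D * (C * (D * (Q * 1ℤ)))) + Z * (U * (D * (C * (Q * (D * 1ℤ))))) - + 2 * (Z * (V * (D * (C * (Q * (D * 1ℤ))))))
        ≡ D * C * Q * (Z * D * (1ℤ + U - + 2 * V))
      e = solve-∀

    -- For d e = n, the sum over γ of ζ counts the odd q = e - 2γ below e.
    inner : ∀ l m → HasSum (λ γ → ζ (1ℤ + + 2 * + l) (+ 2 * γ) (1ℤ + + 2 * + m - + 2 * γ) (1ℤ + + 2 * + l)) (count l m)
    inner l m = hasSum (map γ (downFrom m)) (Unique.map⁺ γ-injective (Unique.downFrom⁺ m)) covered
      (trans (sum-map γ (downFrom m) (λ γ → ζ d (+ 2 * γ) (e - + 2 * γ) d)) (sum-cong-∈ (downFrom m) (λ {j} j∈ → term j (∈-downFrom⁻ j∈))))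
      where
      d = 1ℤ + + 2 * + l
      e = 1ℤ + + 2 * + m
      -- With this parametrisation q = e - 2γ is 2j + 1, to be compared with d = 2l + 1.
      γ : ℕ → ℤ
      γ j = + m - + j
      γ-injective : ∀ {i j} → γ i ≡ γ j → i ≡ j
      γ-injective {i} {j} eq = ℤ.+-injective (trans (r (+ m) (+ i)) (trans (cong (λ u → + m - u) eq) (sym (r (+ m) (+ j)))))
        where
        r : ∀ m i → i ≡ m - (m - i)
        r = solve-∀
      pos-d : pos d ≡ 1ℤ
      pos-d = cong (λ u → pos (1ℤ + u)) (sym (ℤ.pos-* 2 l))
      zer-d : zer (d - d) ≡ 1ℤ
      zer-d = cong zer (ℤ.+-inverseʳ d)
      zero-at : ∀ γ → pos (+ 2 * γ) * pos (e - + 2 * γ) ≡ 0ℤ → ζ d (+ 2 * γ) (e - + 2 * γ) d ≡ 0ℤ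
      zero-at γ z = trans (ζ-factored d (+ 2 * γ) (e - + 2 * γ))
        (trans (r (pos d) (pos (+ 2 * γ)) (pos (e - + 2 * γ)) _) (trans (cong (λ u → pos d * u * X) z) (r′ (pos d) X)))
        where
        X = zer (d - d) * pos d * (1ℤ + pos (- (d - (e - + 2 * γ))) - + 2 * pos (d - (e - + 2 * γ)))
        r : ∀ D C Q X → D * C * Q * X ≡ D * (C * Q) * X
        r = solve-∀
        r′ : ∀ D X → D * 0ℤ * X ≡ 0ℤ
        r′ = solve-∀
      covered : ∀ γ′ → γ′ ∈ map γ (downFrom m) ⊎ ζ d (+ 2 * γ′) (e - + 2 * γ′) d ≡ 0ℤ
      covered (+ zero)  = inj₂ (zero-at 0ℤ refl)
      covered -[1+ k ]  = inj₂ (zero-at -[1+ k ] (ℤ.*-zeroˡ (pos (e - + 2 * -[1+ k ]))))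
      covered (+ suc k) with suc k ℕ.≤? m
      ... | yes k<m = inj₁ (subst (_∈ map γ (downFrom m)) γ-k (∈-map⁺ γ (∈-downFrom⁺ {m} {m ∸ suc k} (ℕ.∸-monoʳ-< {m} {suc k} {0} (s≤s z≤n) k<m))))
        where
        γ-k : γ (m ∸ suc k) ≡ + suc k
        γ-k = trans (cong (λ u → + m - u) (trans (sym (ℤ.⊖-≥ k<m)) (sym (ℤ.[+m]-[+n]≡m⊖n m (suc k))))) (r (+ m) (+ suc k))
          where
          r : ∀ m k → m - (m - k) ≡ k
          r = solve-∀
      ... | no k≮m = inj₂ (zero-at (+ suc k) (trans (cong (pos (+ 2 * + suc k) *_) (out (ℕ.≤-pred (ℕ.≰⇒> k≮m)))) (ℤ.*-zeroʳ (pos (+ 2 * + suc k)))))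
        where
        out : m ℕ.≤ k → pos (e - + 2 * + suc k) ≡ 0ℤ
        out m≤k = trans (cong pos (trans (cong (λ u → e - + 2 * (1ℤ + u)) (k≡ m≤k)) (r (+ m) (+ (k ∸ m))))) (neg (k ∸ m))
          where
          k≡ : m ℕ.≤ k → + k ≡ + m + + (k ∸ m)
          k≡ h = cong +_ (sym (ℕ.m+[n∸m]≡n h))
          r : ∀ m d → 1ℤ + + 2 * m - + 2 * (1ℤ + (m + d)) ≡ - (1ℤ + + 2 * d)
          r = solve-∀
          neg : ∀ d → pos (- (1ℤ + + 2 * + d)) ≡ 0ℤ
          neg zero    = refl
          neg (suc d) = refl
      term : ∀ j → j ℕ.< m → ζ d (+ 2 * γ j) (e - + 2 * γ j) d ≡ 1ℤ + pos (+ j - + l) - + 2 * pos (+ l - + j)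
      term j j<m = trans (ζ-factored d (+ 2 * γ j) (e - + 2 * γ j))
        (trans (cong₂ (λ x y → x * pos (+ 2 * γ j) * y * (zer (d - d) * x * (1ℤ + pos (- (d - (e - + 2 * γ j))) - + 2 * pos (d - (e - + 2 * γ j))))) pos-d pos-q)
          (trans (cong₂ (λ x y → 1ℤ * x * 1ℤ * (y * 1ℤ * (1ℤ + pos (- (d - (e - + 2 * γ j))) - + 2 * pos (d - (e - + 2 * γ j))))) pos-c zer-d)
            (trans (cong₂ (λ x y → 1ℤ * (1ℤ * (1ℤ + x - + 2 * y))) below above) (r (pos (+ j - + l)) (pos (+ l - + j))))))
        where
        r : ∀ x y → 1ℤ * (1ℤ * (1ℤ + x - + 2 * y)) ≡ 1ℤ + x - + 2 * y
        r = solve-∀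
        pos-c : pos (+ 2 * γ j) ≡ 1ℤ
        pos-c = trans (pos-* 1 (γ j)) (pos-⊖ j<m)
        pos-q : pos (e - + 2 * γ j) ≡ 1ℤ
        pos-q = trans (cong pos (r′ (+ m) (+ j))) (cong (λ u → pos (1ℤ + u)) (sym (ℤ.pos-* 2 j)))
          where
          r′ : ∀ m j → 1ℤ + + 2 * m - + 2 * (m - j) ≡ 1ℤ + + 2 * j
          r′ = solve-∀
        above : pos (d - (e - + 2 * γ j)) ≡ pos (+ l - + j)
        above = trans (cong pos (r′ (+ l) (+ m) (+ j))) (pos-* 1 (+ l - + j))
          where
          r′ : ∀ l m j → 1ℤ + + 2 * l - (1ℤ + + 2 * m - + 2 * (m - j)) ≡ + 2 * (l - j)
          r′ = solve-∀
        below : pos (- (d - (e - + 2 * γ j))) ≡ pos (+ j - + l)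
        below = trans (cong pos (r′ (+ l) (+ m) (+ j))) (pos-* 1 (+ j - + l))
          where
          r′ : ∀ l m j → - (1ℤ + + 2 * l - (1ℤ + + 2 * m - + 2 * (m - j))) ≡ + 2 * (j - l)
          r′ = solve-∀

    factor-count : ℤ × ℤ → ℤ
    factor-count (d , e) = only (factor? d e) (pos d * count ⌊ ∣ d ∣ /2⌋ ⌊ ∣ e ∣ /2⌋)

    factor-sum : HasSum factor-count nζ
    factor-sum = HasSum-fubini solution-sum (λ (d , e) → row d e (factor? d e))
      where
      0≢n : + 0 ≢ + n
      0≢n refl = odd (divides 0ℤ refl)
      row : ∀ d e (h? : Dec (d * e ≡ + n)) → HasSum (λ γ → only h? (ζ d (+ 2 * γ) (e - + 2 * γ) d)) (only h? (pos d * count ⌊ ∣ d ∣ /2⌋ ⌊ ∣ e ∣ /2⌋))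
      row d e (no _) = HasSum-ε (λ _ → refl)
      row (+ zero) e (yes h) = ⊥-elim (0≢n (trans (sym (ℤ.*-zeroˡ e)) h))
      row -[1+ d ] e (yes h) = HasSum-ε (λ γ → trans (ζ-factored -[1+ d ] (+ 2 * γ) (e - + 2 * γ)) refl)
      row (+ suc d) (+ e) (yes h) = HasSum-≡ (sym (ℤ.*-identityˡ (count ⌊ suc d /2⌋ ⌊ e /2⌋)))
        (HasSum-cong (λ γ → cong₂ (λ x y → ζ x (+ 2 * γ) (y - + 2 * γ) x) (sym (halveℤ (suc d) (λ k → proj₁ odds (∣ᵤ⇒∣ k)))) (sym (halveℤ e (λ k → proj₂ odds (∣ᵤ⇒∣ k)))))
          (inner ⌊ suc d /2⌋ ⌊ e /2⌋))
        where
        odds = odd-factors (+ suc d) (+ e) h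
      row (+ suc d) -[1+ e ] (yes ())

    -- In terms of the parameters, - disc is xy + yz + zx.
    selling⇒disc<0 : ∀ R → IsSelling R → disc R < 0ℤ
    selling⇒disc<0 ⟨ a , b , c ⟩ T = subst (_< 0ℤ) (e a b c) (ℤ.neg-mono-< (0<sum (two T)))
      where
      open Selling
      e : ∀ a b c → - (- b * (+ 2 * a + b) + ((+ 2 * a + b) * (+ 2 * c + b) + (+ 2 * c + b) * - b)) ≡ b * b - + 4 * (a * c)
      e = solve-∀
      x = - b
      y = + 2 * a + b
      z = + 2 * c + b
      xy = 0≤* (0≤x T) (0≤y T)
      yz = 0≤* (0≤y T) (0≤z T)
      zx = 0≤* (0≤z T) (0≤x T)
      0<* : ∀ {u v} → 0ℤ < u → 0ℤ < v → 0ℤ < u * v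
      0<* {+ suc _} {+ suc _} _ _ = 0<s
      0<* {+ zero} (+<+ ())
      0<* {_} {+ zero} _ (+<+ ())
      0<sum : _ → 0ℤ < x * y + (y * z + z * x)
      0<sum (inj₁ (0<y , 0<z))        = ℤ.+-mono-≤-< xy (ℤ.+-mono-<-≤ (0<* 0<y 0<z) zx)
      0<sum (inj₂ (inj₁ (0<z , 0<x))) = ℤ.+-mono-≤-< xy (ℤ.+-mono-≤-< yz (0<* 0<z 0<x))
      0<sum (inj₂ (inj₂ (0<x , 0<y))) = ℤ.+-mono-<-≤ (0<* 0<x 0<y) (0≤+′ yz zx)

    -- The quadric is fibred over t. For n - t² > 0 the fibre consists of the forms of discriminant
    -- t² - n, of total weight `6H⁺`; otherwise the fibre contains no Selling form, because those
    -- have negative discriminant.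
    trace-sum : HasSum (λ t → 6H⁺ (+ n - t * t)) (+ 2 * nζ)
    trace-sum = HasSum-fubini weight-sum (λ t → row t (+ n - t * t) refl)
      where
      toForm : ℤ × ℤ × ℤ → BQF
      toForm (a , b , g) = ⟨ a , b , g ⟩
      fromForm : BQF → ℤ × ℤ × ℤ
      fromForm ⟨ a , b , g ⟩ = a , b , g
      on-disc : ∀ t d → t * t - d ≡ + n → d ≡ - (+ n - t * t)
      on-disc t d h = trans (e₁ t d) (trans (cong (λ u → t * t - u) h) (e₂ t (+ n)))
        where
        e₁ : ∀ t d → d ≡ t * t - (t * t - d)
        e₁ = solve-∀
        e₂ : ∀ t n → t * t - n ≡ - (n - t * t)
        e₂ = solve-∀
      disc-on : ∀ t d → d ≡ - (+ n - t * t) → t * t - d ≡ + n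
      disc-on t d refl = e t (+ n)
        where
        e : ∀ t n → t * t - - (n - t * t) ≡ n
        e = solve-∀
      row : ∀ t N → N ≡ + n - t * t → HasSum (λ w → only (on? (t , w)) (on-s (λ _ → weight₃) (t , w))) (6H⁺ N)
      row t (+ suc m) N≡ = HasSum-bij {f = weighted m} {g = λ w → only (on? (t , w)) (on-s (λ _ → weight₃) (t , w))} fromForm toForm
        (λ _ → inj₁ refl) (λ Q → inj₁ (same Q)) (λ w → inj₁ (refl , sym (same (toForm w)))) (S-sum m)
        where
        same : ∀ Q → only (on? (t , fromForm Q)) (on-s (λ _ → weight₃) (t , fromForm Q)) ≡ weighted m Q
        same Q@(⟨ a , b , g ⟩) = only-⇔ (on? (t , a , b , g)) (disc? m Q)
          (λ h → trans (on-disc t (disc Q) h) (cong -_ (sym N≡)))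
          (λ h → disc-on t (disc Q) (trans h (cong -_ N≡)))
      row t N@(+ zero) N≡ = HasSum-ε (λ w → nonpositive t N N≡ ℤ.≤-refl w)
        where
        nonpositive : ∀ t N → N ≡ + n - t * t → N ≤ 0ℤ → ∀ w → only (on? (t , w)) (on-s (λ _ → weight₃) (t , w)) ≡ 0ℤ
        nonpositive t N N≡ N≤0 w@(a , b , g) = only-0 (on? (t , w)) (λ h → [ (λ T → ⊥-elim (ℤ.≤⇒≯ (subst (0ℤ ≤_)
          (sym (trans (on-disc t (disc ⟨ a , b , g ⟩) h) (cong -_ (sym N≡)))) (ℤ.neg-mono-≤ N≤0)) (selling⇒disc<0 ⟨ a , b , g ⟩ T))) , id ]′
          (selling? (- b) (+ 2 * a + b) (+ 2 * g + b)))
      row t N@(-[1+ m ]) N≡ = HasSum-ε (λ w → nonpositive t N N≡ ℤ.-≤+ w)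
        where
        nonpositive : ∀ t N → N ≡ + n - t * t → N ≤ 0ℤ → ∀ w → only (on? (t , w)) (on-s (λ _ → weight₃) (t , w)) ≡ 0ℤ
        nonpositive t N N≡ N≤0 w@(a , b , g) = only-0 (on? (t , w)) (λ h → [ (λ T → ⊥-elim (ℤ.≤⇒≯ (subst (0ℤ ≤_)
          (sym (trans (on-disc t (disc ⟨ a , b , g ⟩) h) (cong -_ (sym N≡)))) (ℤ.neg-mono-≤ N≤0)) (selling⇒disc<0 ⟨ a , b , g ⟩ T))) , id ]′
          (selling? (- b) (+ 2 * a + b) (+ 2 * g + b)))

  module EichlerPower (p : ℕ) (p-prime : Prime p) (2∤p : ¬ 2 ℕ.∣ p) where

    open Powers p p-prime

    2∤power : ∀ r → ¬ 2 ℕ.∣ p ℕ.^ r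
    2∤power zero    h = 1≢2* (ℕ.∣1⇒≡1 h)
      where
      1≢2* : 2 ≢ 1
      1≢2* ()
    2∤power (suc r) h = [ 2∤p , 2∤power r ]′ (euclidsLemma p (p ℕ.^ r) prime[2] h)

    -- All powers of p are odd, so their halves l and m satisfy 2l + 1 = pⁱ and 2m + 1 = pʲ, and the
    -- two branches are the two regimes of `count`.
    contribution-count : ∀ i j → + 2 * count ⌊ p ℕ.^ i /2⌋ ⌊ p ℕ.^ j /2⌋ ≡ contribution i j
    contribution-count i j with j ℕ.≤? i
    ... | yes j≤i = trans (cong (+ 2 *_) (count-≤ ⌊ p ℕ.^ i /2⌋ ⌊ p ℕ.^ j /2⌋ (ℕ.⌊n/2⌋-mono (powers-≤ j≤i))))
          (trans (e (+ ⌊ p ℕ.^ j /2⌋)) (cong (λ u → 1ℤ - u) (sym (halveℤ (p ℕ.^ j) (2∤power j)))))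
      where
      powers-≤ : j ℕ.≤ i → p ℕ.^ j ℕ.≤ p ℕ.^ i
      powers-≤ = ℕ.^-monoʳ-≤ p {{ℕ.>-nonZero (ℕ.<⇒≤ 1<p)}}
      e : ∀ m → + 2 * - m ≡ 1ℤ - (1ℤ + + 2 * m)
      e = solve-∀
    ... | no j≰i = trans (cong (λ m → + 2 * count l m) (sym m≡)) (trans (cong (+ 2 *_) (count-> l k))
          (trans (e (+ l) (+ k)) (trans (cong (λ u → + 2 * (1ℤ + + 2 * u) - + 3 * (1ℤ + + 2 * + l) - 1ℤ) (cong +_ m≡))
            (cong₂ (λ u v → + 2 * u - + 3 * v - 1ℤ) (sym (halveℤ (p ℕ.^ j) (2∤power j))) (sym (halveℤ (p ℕ.^ i) (2∤power i)))))))
      where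
      l = ⌊ p ℕ.^ i /2⌋
      m = ⌊ p ℕ.^ j /2⌋
      l<m : l ℕ.< m
      l<m = ℕ.*-cancelˡ-< 2 l m (ℕ.≤-pred (subst₂ ℕ._<_ (halve (p ℕ.^ i) (2∤power i)) (halve (p ℕ.^ j) (2∤power j)) (ℕ.^-monoʳ-< p 1<p (ℕ.≰⇒> j≰i))))
      k = m ∸ suc l
      m≡ : suc (l ℕ.+ k) ≡ m
      m≡ = ℕ.m+[n∸m]≡n l<m
      e : ∀ l k → + 2 * (+ 2 * (1ℤ + (l + k)) - + 3 * l - 1ℤ) ≡ + 2 * (1ℤ + + 2 * (1ℤ + (l + k))) - + 3 * (1ℤ + + 2 * l) - 1ℤ
      e = solve-∀

    -- Σ 6H(pʳ - t²) over t² < pʳ.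
    eichler : ∀ r → HasSum (λ t → 6H⁺ (+ (p ℕ.^ r) - t * t)) (B r)
    eichler r = HasSum-≡ total-B trace-sum
      where
      n = p ℕ.^ r
      odd : ¬ + 2 ∥ + n
      odd h = 2∤power r (∣⇒∣ᵤ h)
      open AtLevel n odd using (nζ)
      open Evaluate n odd
      pairs : List (ℤ × ℤ)
      pairs = map (λ i → pw i , pw (r ∸ i)) (downFrom (suc r))
      injective : ∀ {i j} → (pw i , pw (r ∸ i)) ≡ (pw j , pw (r ∸ j)) → i ≡ j
      injective {i} {j} eq with ℕ.<-cmp i j
      ... | tri≈ _ i≡j _ = i≡j
      ... | tri< i<j _ _ = ⊥-elim (ℕ.<⇒≢ (ℕ.^-monoʳ-< p 1<p i<j) (ℤ.+-injective (cong proj₁ eq)))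
      ... | tri> _ _ j<i = ⊥-elim (ℕ.<⇒≢ (ℕ.^-monoʳ-< p 1<p j<i) (sym (ℤ.+-injective (cong proj₁ eq))))
      covered : ∀ x → x ∈ pairs ⊎ factor-count x ≡ 0ℤ
      covered (+ d , + e) = go (factor? (+ d) (+ e))
        where
        go : (h? : Dec (+ d * + e ≡ + n)) → (+ d , + e) ∈ pairs ⊎ only h? (pos (+ d) * count ⌊ d /2⌋ ⌊ e /2⌋) ≡ 0ℤ
        go (no _) = inj₂ refl
        go (yes h) with divisors r d e (ℤ.+-injective (trans (ℤ.pos-* d e) h))
        ... | i , i≤r , refl , refl = inj₁ (∈-map⁺ (λ i → pw i , pw (r ∸ i)) (∈-downFrom⁺ (s≤s i≤r)))
      covered (-[1+ d ] , e) = inj₂ (only-0 (factor? -[1+ d ] e) (λ _ → ℤ.*-zeroˡ (count ⌊ suc d /2⌋ ⌊ ∣ e ∣ /2⌋)))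
      covered (+ d , -[1+ e ]) = inj₂ (only-0 (factor? (+ d) -[1+ e ]) (λ h → ⊥-elim (sign-clash d h)))
        where
        sign-clash : ∀ d → + d * -[1+ e ] ≢ + n
        sign-clash zero h = odd (divides 0ℤ (sym h))
        sign-clash (suc d) ()
      pairs-sum : sum pairs factor-count ≡ nζ
      pairs-sum = HasSum-on factor-sum (Unique.map⁺ injective (Unique.downFrom⁺ (suc r))) covered
      at : ∀ {i} → i ∈ downFrom (suc r) → + 2 * factor-count (pw i , pw (r ∸ i)) ≡ contribution i (r ∸ i)
      at {i} i∈ = trans (cong (+ 2 *_) (trans (only-yes (factor? (pw i) (pw (r ∸ i))) product)
          (trans (cong (_* count ⌊ p ℕ.^ i /2⌋ ⌊ p ℕ.^ (r ∸ i) /2⌋) positive) (ℤ.*-identityˡ _))))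
        (contribution-count i (r ∸ i))
        where
        product : pw i * pw (r ∸ i) ≡ + n
        product = trans (sym (ℤ.pos-* (p ℕ.^ i) (p ℕ.^ (r ∸ i)))) (cong +_ (trans (sym (ℕ.^-distribˡ-+-* p i (r ∸ i)))
          (cong (p ℕ.^_) (ℕ.m+[n∸m]≡n (ℕ.≤-pred (∈-downFrom⁻ i∈))))))
        positive : pos (pw i) ≡ 1ℤ
        positive = trans (cong (pos ∘ +_) (halve (p ℕ.^ i) (2∤power i))) refl
      total-B : + 2 * nζ ≡ B r
      total-B = trans (cong (+ 2 *_) (trans (sym pairs-sum) (sum-map (λ i → pw i , pw (r ∸ i)) (downFrom (suc r)) factor-count)))
        (trans (sum-hom ℤ.+-0-isCommutativeMonoid ℤ.+-0-isCommutativeMonoid (+ 2 *_) (ℤ.*-zeroʳ (+ 2)) (ℤ.*-distribˡ-+ (+ 2)) (downFrom (suc r)) (λ i → factor-count (pw i , pw (r ∸ i))))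
          (sum-cong-∈ (downFrom (suc r)) at))

-- Integers inside the rationals.

module Rational where

  open import Defs using (fromℤ; fromℕ; _^_)
  open FinSum
  open import Data.Rational.Base using (_+_; _*_; _-_; -_; _/_)
  open import Data.Rational.Unnormalised.Base using (mkℚᵘ; *≡*)
  open import Tactic.RingSolver using (solve-∀)
  open import Relation.Nullary.Decidable using (dec⇒maybe)
  open import Level using (0ℓ)

  ℚ-ring : ACR.AlmostCommutativeRing 0ℓ 0ℓ
  ℚ-ring = ACR.fromCommutativeRing ℚ.+-*-commutativeRing (λ x → dec⇒maybe (0ℚ ℚ.≟ x))

  module ℚΣ = Sum ℚ.+-0-isCommutativeMonoid

  -- Exposes the normal form of an integer, on which rational arithmetic and the clauses of `H`
  -- compute.
  fromℤ≡ : ∀ z → fromℤ z ≡ mkℚ z 0 (Coprime.sym (Coprime.1-coprimeTo ℤ.∣ z ∣))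
  fromℤ≡ z = ℚ.↥p/↧p≡p (mkℚ z 0 (Coprime.sym (Coprime.1-coprimeTo ℤ.∣ z ∣)))

  fromℤ-+ : ∀ x y → fromℤ (x ℤ.+ y) ≡ fromℤ x + fromℤ y
  fromℤ-+ x y rewrite fromℤ≡ x | fromℤ≡ y = cong fromℤ (cong₂ ℤ._+_ (sym (ℤ.*-identityʳ x)) (sym (ℤ.*-identityʳ y)))

  fromℤ-* : ∀ x y → fromℤ (x ℤ.* y) ≡ fromℤ x * fromℤ y
  fromℤ-* x y rewrite fromℤ≡ x | fromℤ≡ y = refl

  fromℤ-neg : ∀ x → fromℤ (ℤ.- x) ≡ - fromℤ x
  fromℤ-neg x = begin
    fromℤ (ℤ.- x)                        ≡⟨ e₁ (fromℤ x) (fromℤ (ℤ.- x)) ⟩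
    (fromℤ x + fromℤ (ℤ.- x)) - fromℤ x  ≡⟨ cong (_- fromℤ x) (trans (sym (fromℤ-+ x (ℤ.- x))) (cong fromℤ (ℤ.+-inverseʳ x))) ⟩
    0ℚ - fromℤ x                         ≡⟨ e₂ (fromℤ x) ⟩
    - fromℤ x                            ∎
    where
    open ≡-Reasoning
    e₁ : ∀ x y → y ≡ (x + y) - x
    e₁ = solve-∀ ℚ-ring
    e₂ : ∀ x → 0ℚ - x ≡ - x
    e₂ = solve-∀ ℚ-ring

  fromℤ-- : ∀ x y → fromℤ (x ℤ.- y) ≡ fromℤ x - fromℤ y
  fromℤ-- x y = trans (fromℤ-+ x (ℤ.- y)) (cong (λ u → fromℤ x + u) (fromℤ-neg y))

  fromℕ-suc : ∀ n → fromℕ (suc n) ≡ 1ℚ + fromℕ n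
  fromℕ-suc n = fromℤ-+ 1ℤ (+ n)

  fromℕ-+ : ∀ m n → fromℕ (m ℕ.+ n) ≡ fromℕ m + fromℕ n
  fromℕ-+ m n = fromℤ-+ (+ m) (+ n)

  fromℕ-* : ∀ m n → fromℕ (m ℕ.* n) ≡ fromℕ m * fromℕ n
  fromℕ-* m n = trans (cong fromℤ (ℤ.pos-* m n)) (fromℤ-* (+ m) (+ n))

  fromℕ-^ : ∀ m n → fromℕ (m ℕ.^ n) ≡ fromℕ m ^ n
  fromℕ-^ m zero    = refl
  fromℕ-^ m (suc n) = trans (fromℕ-* m (m ℕ.^ n)) (cong (fromℕ m *_) (fromℕ-^ m n))

  ^-+ : ∀ x m n → x ^ (m ℕ.+ n) ≡ x ^ m * x ^ n
  ^-+ x zero    n = sym (ℚ.*-identityˡ (x ^ n))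
  ^-+ x (suc m) n = trans (cong (x *_) (^-+ x m n)) (sym (ℚ.*-assoc x (x ^ m) (x ^ n)))

  ^-* : ∀ x y n → (x * y) ^ n ≡ x ^ n * y ^ n
  ^-* x y zero    = refl
  ^-* x y (suc n) = trans (cong (x * y *_) (^-* x y n)) (e x y (x ^ n) (y ^ n))
    where
    e : ∀ x y a b → x * y * (a * b) ≡ x * a * (y * b)
    e = solve-∀ ℚ-ring

  1^ : ∀ n → 1ℚ ^ n ≡ 1ℚ
  1^ zero    = refl
  1^ (suc n) = trans (ℚ.*-identityˡ (1ℚ ^ n)) (1^ n)

  0^ : ∀ n → 0ℚ ^ suc n ≡ 0ℚ
  0^ n = ℚ.*-zeroˡ (0ℚ ^ n)

  ^-double : ∀ x n → x ^ (n ℕ.* 2) ≡ (x * x) ^ n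
  ^-double x zero    = refl
  ^-double x (suc n) = trans (cong (λ u → x * (x * u)) (^-double x n)) (sym (ℚ.*-assoc x x ((x * x) ^ n)))

  fraction : ∀ x d → (x / suc d) * fromℕ (suc d) ≡ fromℤ x
  fraction x d = ℚ.toℚᵘ-injective (ℚᵘ.≃-trans (ℚ.toℚᵘ-homo-* (x / suc d) (fromℕ (suc d)))
    (ℚᵘ.≃-trans (ℚᵘ.*-cong (ℚ.toℚᵘ-fromℚᵘ (mkℚᵘ x d)) (ℚ.toℚᵘ-fromℚᵘ (mkℚᵘ (+ suc d) 0)))
      (ℚᵘ.≃-trans (*≡* (trans (ℤ.*-identityʳ (x ℤ.* + suc d)) (cong (λ k → x ℤ.* + suc k) (sym (ℕ.*-identityʳ d))))) (ℚᵘ.≃-sym (ℚ.toℚᵘ-fromℚᵘ (mkℚᵘ x 0))))))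

  *-cancel : ∀ {x y} c c⁻¹ → c⁻¹ * c ≡ 1ℚ → c * x ≡ c * y → x ≡ y
  *-cancel {x} {y} c c⁻¹ inv eq = trans (via x) (trans (cong (c⁻¹ *_) eq) (sym (via y)))
    where
    via : ∀ x → x ≡ c⁻¹ * (c * x)
    via x = trans (sym (ℚ.*-identityˡ x)) (trans (cong (_* x) (sym inv)) (ℚ.*-assoc c⁻¹ c x))

  suc-cancel : ∀ n {x y} → fromℕ (suc n) * x ≡ fromℕ (suc n) * y → x ≡ y
  suc-cancel n = *-cancel (fromℕ (suc n)) (+ 1 / suc n) (fraction (+ 1) n)

-- Binomial coefficients at half-integers.

module Binomials where

  open import Defs using (fromℕ; _^_; binomial)
  open FinSum
  open Rational
  open import Data.Nat.Combinatorics using (_C_; nCk+nC[k+1]≡[n+1]C[k+1]; k>n⇒nCk≡0)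
  open import Data.Rational.Base using (_+_; _*_; _-_; -_; _/_)
  open import Tactic.RingSolver using (solve-∀)

  fromℕ-*2 : ∀ n → fromℕ (n ℕ.* 2) ≡ fromℕ n + fromℕ n
  fromℕ-*2 n = trans (fromℕ-* n 2) (e (fromℕ n))
    where
    e : ∀ x → x * (1ℚ + 1ℚ) ≡ x + x
    e = solve-∀ ℚ-ring

  row : ℕ → ℕ → ℚ
  row n k = fromℕ (n C k)

  row-suc : ∀ n k → row (suc n) (suc k) ≡ row n k + row n (suc k)
  row-suc n k = trans (cong fromℕ (sym (nCk+nC[k+1]≡[n+1]C[k+1] n k))) (fromℕ-+ (n C k) (n C suc k))

  row-> : ∀ {n k} → n ℕ.< k → row n k ≡ 0ℚ
  row-> n<k = cong fromℕ (k>n⇒nCk≡0 n<k)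

  row-1 : ∀ n → row (2 ℕ.+ n) 1 ≡ row n 1 + (row n 0 + row n 0)
  row-1 n = trans (row-suc (suc n) 0) (trans (cong (λ u → 1ℚ + u) (row-suc n 0)) (e (row n 1)))
    where
    e : ∀ x → 1ℚ + (1ℚ + x) ≡ x + (1ℚ + 1ℚ)
    e = solve-∀ ℚ-ring

  row-2 : ∀ n k → row (2 ℕ.+ n) (2 ℕ.+ k) ≡ row n (2 ℕ.+ k) + (row n (1 ℕ.+ k) + row n (1 ℕ.+ k)) + row n k
  row-2 n k = trans (row-suc (suc n) (suc k)) (trans (cong₂ _+_ (row-suc n k) (row-suc n (suc k)))
      (e (row n k) (row n (suc k)) (row n (2 ℕ.+ k))))
    where
    e : ∀ x y z → x + y + (y + z) ≡ z + (y + y) + x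
    e = solve-∀ ℚ-ring

  absorb : ∀ n j → fromℕ (suc j) * row n (suc j) ≡ (fromℕ n - fromℕ j) * row n j
  absorb zero    zero    = refl
  absorb zero    (suc j) = trans (cong (fromℕ (2 ℕ.+ j) *_) (row-> {0} {2 ℕ.+ j} (s≤s z≤n)))
    (trans (e (fromℕ (2 ℕ.+ j)) (0ℚ - fromℕ (suc j))) (cong ((0ℚ - fromℕ (suc j)) *_) (sym (row-> {0} {suc j} (s≤s z≤n)))))
    where
    e : ∀ x y → x * 0ℚ ≡ y * 0ℚ
    e = solve-∀ ℚ-ring
  absorb (suc n) zero    = trans (cong (1ℚ *_) (row-suc n 0)) (trans (e₁ (row n 1))
    (trans (cong (λ u → 1ℚ + u) (absorb n 0)) (trans (e₂ (fromℕ n)) (cong (λ u → (u - 0ℚ) * 1ℚ) (sym (fromℕ-suc n))))))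
    where
    e₁ : ∀ x → 1ℚ * (1ℚ + x) ≡ 1ℚ + 1ℚ * x
    e₁ = solve-∀ ℚ-ring
    e₂ : ∀ x → 1ℚ + (x - 0ℚ) * 1ℚ ≡ (1ℚ + x - 0ℚ) * 1ℚ
    e₂ = solve-∀ ℚ-ring
  absorb (suc n) (suc j) = begin
    j₂ * row (suc n) (2 ℕ.+ j)        ≡⟨ cong (j₂ *_) (row-suc n (suc j)) ⟩
    j₂ * (b + c)                      ≡⟨ ℚ.*-distribˡ-+ j₂ b c ⟩
    j₂ * b + j₂ * c                   ≡⟨ cong (λ u → j₂ * b + u) (absorb n (suc j)) ⟩
    j₂ * b + (N - j₁) * b             ≡⟨ cong (λ u → u * b + (N - j₁) * b) (fromℕ-suc (suc j)) ⟩
    (1ℚ + j₁) * b + (N - j₁) * b      ≡⟨ e₁ N j₁ b ⟩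
    j₁ * b + (1ℚ + N - j₁) * b        ≡⟨ cong₂ (λ u v → u + (v - j₁) * b) (absorb n j) (sym (fromℕ-suc n)) ⟩
    (N - J) * a + (N₁ - j₁) * b       ≡⟨ cong (λ u → u * a + (N₁ - j₁) * b) (trans (e₂ N J) (sym (cong₂ _-_ (fromℕ-suc n) (fromℕ-suc j)))) ⟩
    (N₁ - j₁) * a + (N₁ - j₁) * b     ≡⟨ ℚ.*-distribˡ-+ (N₁ - j₁) a b ⟨
    (N₁ - j₁) * (a + b)               ≡⟨ cong ((N₁ - j₁) *_) (row-suc n j) ⟨
    (N₁ - j₁) * row (suc n) (suc j)   ∎
    where
    open ≡-Reasoning
    J = fromℕ j
    j₁ = fromℕ (suc j)
    j₂ = fromℕ (2 ℕ.+ j)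
    N = fromℕ n
    N₁ = fromℕ (suc n)
    a = row n j
    b = row n (suc j)
    c = row n (2 ℕ.+ j)
    e₁ : ∀ N j b → (1ℚ + j) * b + (N - j) * b ≡ j * b + (1ℚ + N - j) * b
    e₁ = solve-∀ ℚ-ring
    e₂ : ∀ N J → N - J ≡ 1ℚ + N - (1ℚ + J)
    e₂ = solve-∀ ℚ-ring

  absorb-suc : ∀ n j → fromℕ (suc j) * row (suc n) (suc j) ≡ fromℕ (suc n) * row n j
  absorb-suc n j = begin
    fromℕ (suc j) * row (suc n) (suc j)                   ≡⟨ cong (fromℕ (suc j) *_) (row-suc n j) ⟩
    fromℕ (suc j) * (row n j + row n (suc j))             ≡⟨ ℚ.*-distribˡ-+ (fromℕ (suc j)) (row n j) (row n (suc j)) ⟩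
    fromℕ (suc j) * row n j + fromℕ (suc j) * row n (suc j) ≡⟨ cong₂ (λ u v → u * row n j + v) (fromℕ-suc j) (absorb n j) ⟩
    (1ℚ + fromℕ j) * row n j + (fromℕ n - fromℕ j) * row n j ≡⟨ e (fromℕ n) (fromℕ j) (row n j) ⟩
    (1ℚ + fromℕ n) * row n j                              ≡⟨ cong (_* row n j) (fromℕ-suc n) ⟨
    fromℕ (suc n) * row n j                               ∎
    where
    open ≡-Reasoning
    e : ∀ N J a → (1ℚ + J) * a + (N - J) * a ≡ (1ℚ + N) * a
    e = solve-∀ ℚ-ring

  central : ℕ → ℚ
  central ν = row (ν ℕ.* 2) ν

  central-suc : ∀ ν → fromℕ (suc ν) * central (suc ν) ≡ (1ℚ + 1ℚ) * ((1ℚ + (fromℕ ν + fromℕ ν)) * central ν)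
  central-suc ν = begin
    fromℕ (suc ν) * central (suc ν)       ≡⟨ absorb-suc (suc (ν ℕ.* 2)) ν ⟩
    fromℕ (suc (suc (ν ℕ.* 2))) * b       ≡⟨ cong (_* b) (trans (fromℕ-suc (suc (ν ℕ.* 2))) (cong (λ u → 1ℚ + u) odd)) ⟩
    (1ℚ + (1ℚ + (Ν + Ν))) * b             ≡⟨ e₁ Ν b ⟩
    (1ℚ + 1ℚ) * ((1ℚ + (Ν + Ν) - Ν) * b)  ≡⟨ cong (λ u → (1ℚ + 1ℚ) * ((u - Ν) * b)) odd ⟨
    (1ℚ + 1ℚ) * ((fromℕ (suc (ν ℕ.* 2)) - Ν) * b) ≡⟨ cong ((1ℚ + 1ℚ) *_) (absorb (suc (ν ℕ.* 2)) ν) ⟨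
    (1ℚ + 1ℚ) * (fromℕ (suc ν) * row (suc (ν ℕ.* 2)) (suc ν)) ≡⟨ cong ((1ℚ + 1ℚ) *_) (absorb-suc (ν ℕ.* 2) ν) ⟩
    (1ℚ + 1ℚ) * (fromℕ (suc (ν ℕ.* 2)) * central ν) ≡⟨ cong (λ u → (1ℚ + 1ℚ) * (u * central ν)) odd ⟩
    (1ℚ + 1ℚ) * ((1ℚ + (Ν + Ν)) * central ν) ∎
    where
    open ≡-Reasoning
    Ν = fromℕ ν
    b = row (suc (ν ℕ.* 2)) ν
    odd : fromℕ (suc (ν ℕ.* 2)) ≡ 1ℚ + (Ν + Ν)
    odd = trans (fromℕ-suc (ν ℕ.* 2)) (cong (λ u → 1ℚ + u) (fromℕ-*2 ν))
    e₁ : ∀ n b → (1ℚ + (1ℚ + (n + n))) * b ≡ (1ℚ + 1ℚ) * ((1ℚ + (n + n) - n) * b)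
    e₁ = solve-∀ ℚ-ring

  binomial-suc : ∀ x i → binomial x (suc i) * fromℕ (suc i) ≡ binomial x i * (x - fromℕ i)
  binomial-suc x i = trans (ℚ.*-assoc (binomial x i * (x - fromℕ i)) (+ 1 / suc i) (fromℕ (suc i)))
    (trans (cong (binomial x i * (x - fromℕ i) *_) (fraction (+ 1) i)) (ℚ.*-identityʳ _))

  binomial-absorb : ∀ x i → binomial (x + 1ℚ) (suc i) * fromℕ (suc i) ≡ binomial x i * (x + 1ℚ)
  binomial-absorb x zero    = trans (binomial-suc (x + 1ℚ) 0) (e x)
    where
    e : ∀ x → 1ℚ * (x + 1ℚ - 0ℚ) ≡ 1ℚ * (x + 1ℚ)
    e = solve-∀ ℚ-ring
  binomial-absorb x (suc i) = suc-cancel i (begin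
    fromℕ (suc i) * (binomial (x + 1ℚ) (2 ℕ.+ i) * fromℕ (2 ℕ.+ i)) ≡⟨ cong (fromℕ (suc i) *_) (binomial-suc (x + 1ℚ) (suc i)) ⟩
    fromℕ (suc i) * (b * (x + 1ℚ - fromℕ (suc i))) ≡⟨ cong (λ u → fromℕ (suc i) * (b * (x + 1ℚ - u))) (fromℕ-suc i) ⟩
    fromℕ (suc i) * (b * (x + 1ℚ - (1ℚ + fromℕ i))) ≡⟨ e₁ (fromℕ (suc i)) b x (fromℕ i) ⟩
    b * fromℕ (suc i) * (x - fromℕ i) ≡⟨ cong (_* (x - fromℕ i)) (binomial-absorb x i) ⟩
    binomial x i * (x + 1ℚ) * (x - fromℕ i) ≡⟨ e₂ (binomial x i) x (fromℕ i) ⟩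
    binomial x i * (x - fromℕ i) * (x + 1ℚ) ≡⟨ cong (_* (x + 1ℚ)) (binomial-suc x i) ⟨
    binomial x (suc i) * fromℕ (suc i) * (x + 1ℚ) ≡⟨ e₃ (binomial x (suc i)) (fromℕ (suc i)) (x + 1ℚ) ⟩
    fromℕ (suc i) * (binomial x (suc i) * (x + 1ℚ)) ∎)
    where
    open ≡-Reasoning
    b = binomial (x + 1ℚ) (suc i)
    e₁ : ∀ s b x i → s * (b * (x + 1ℚ - (1ℚ + i))) ≡ b * s * (x - i)
    e₁ = solve-∀ ℚ-ring
    e₂ : ∀ b x i → b * (x + 1ℚ) * (x - i) ≡ b * (x - i) * (x + 1ℚ)
    e₂ = solve-∀ ℚ-ring
    e₃ : ∀ b s y → b * s * y ≡ s * (b * y)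
    e₃ = solve-∀ ℚ-ring

  4ℚ : ℚ
  4ℚ = 1ℚ + 1ℚ + (1ℚ + 1ℚ)

  -- Induction by absorption, matched with the recursion of the central binomial coefficients, (ν +
  -- 1) c(ν + 1) = 2 (2ν + 1) c(ν).
  half-integer-binomial : ∀ ν → 4ℚ ^ ν * binomial (fromℕ ν + ½) ν ≡ central ν * row (suc (ν ℕ.* 2)) 1
  half-integer-binomial ν = trans (go ν) (cong (central ν *_) (sym (row₁ (ν ℕ.* 2))))
    where
    open ≡-Reasoning
    row₁ : ∀ n → row (suc n) 1 ≡ fromℕ (suc n)
    row₁ n = trans (sym (ℚ.*-identityˡ (row (suc n) 1))) (trans (absorb-suc n 0) (ℚ.*-identityʳ (fromℕ (suc n))))
    go : ∀ ν → 4ℚ ^ ν * binomial (fromℕ ν + ½) ν ≡ central ν * fromℕ (suc (ν ℕ.* 2))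
    go zero    = refl
    go (suc ν) = suc-cancel ν (begin
      s * (4ℚ * q * binomial (s + ½) (suc ν)) ≡⟨ cong (λ u → s * (4ℚ * q * binomial u (suc ν))) (trans (cong (_+ ½) (fromℕ-suc ν)) (e₀ Ν)) ⟩
      s * (4ℚ * q * binomial (Ν + ½ + 1ℚ) (suc ν)) ≡⟨ e₁ s q (binomial (Ν + ½ + 1ℚ) (suc ν)) ⟩
      4ℚ * q * (binomial (Ν + ½ + 1ℚ) (suc ν) * s) ≡⟨ cong (4ℚ * q *_) (binomial-absorb (Ν + ½) ν) ⟩
      4ℚ * q * (binomial (Ν + ½) ν * (Ν + ½ + 1ℚ)) ≡⟨ e₂ q (binomial (Ν + ½) ν) Ν ⟩
      (q * binomial (Ν + ½) ν) * (4ℚ * (Ν + ½ + 1ℚ)) ≡⟨ cong (_* (4ℚ * (Ν + ½ + 1ℚ))) (go ν) ⟩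
      central ν * fromℕ (suc (ν ℕ.* 2)) * (4ℚ * (Ν + ½ + 1ℚ)) ≡⟨ cong (λ u → central ν * u * (4ℚ * (Ν + ½ + 1ℚ))) odd ⟩
      central ν * (1ℚ + (Ν + Ν)) * (4ℚ * (Ν + ½ + 1ℚ)) ≡⟨ e₃ (central ν) Ν ⟩
      (1ℚ + 1ℚ) * ((1ℚ + (Ν + Ν)) * central ν) * (1ℚ + (1ℚ + (1ℚ + (Ν + Ν)))) ≡⟨ cong₂ _*_ (sym (central-suc ν)) (sym odd₂) ⟩
      s * central (suc ν) * fromℕ (3 ℕ.+ ν ℕ.* 2) ≡⟨ ℚ.*-assoc s (central (suc ν)) (fromℕ (3 ℕ.+ ν ℕ.* 2)) ⟩
      s * (central (suc ν) * fromℕ (3 ℕ.+ ν ℕ.* 2)) ∎)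
      where
      s = fromℕ (suc ν)
      Ν = fromℕ ν
      q = 4ℚ ^ ν
      odd : fromℕ (suc (ν ℕ.* 2)) ≡ 1ℚ + (Ν + Ν)
      odd = trans (fromℕ-suc (ν ℕ.* 2)) (cong (λ u → 1ℚ + u) (fromℕ-*2 ν))
      odd₂ : fromℕ (3 ℕ.+ ν ℕ.* 2) ≡ 1ℚ + (1ℚ + (1ℚ + (Ν + Ν)))
      odd₂ = trans (fromℕ-suc (2 ℕ.+ ν ℕ.* 2)) (cong (λ u → 1ℚ + u) (trans (fromℕ-suc (1 ℕ.+ ν ℕ.* 2)) (cong (λ u → 1ℚ + u) odd)))
      e₀ : ∀ n → 1ℚ + n + ½ ≡ n + ½ + 1ℚ
      e₀ = solve-∀ ℚ-ring
      e₁ : ∀ s q b → s * ((1ℚ + 1ℚ + (1ℚ + 1ℚ)) * q * b) ≡ (1ℚ + 1ℚ + (1ℚ + 1ℚ)) * q * (b * s)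
      e₁ = solve-∀ ℚ-ring
      e₂ : ∀ q b n → (1ℚ + 1ℚ + (1ℚ + 1ℚ)) * q * (b * (n + ½ + 1ℚ)) ≡ (q * b) * ((1ℚ + 1ℚ + (1ℚ + 1ℚ)) * (n + ½ + 1ℚ))
      e₂ = solve-∀ ℚ-ring
      e₃ : ∀ c n → c * (1ℚ + (n + n)) * ((1ℚ + 1ℚ + (1ℚ + 1ℚ)) * (n + ½ + 1ℚ)) ≡ (1ℚ + 1ℚ) * ((1ℚ + (n + n)) * c) * (1ℚ + (1ℚ + (1ℚ + (n + n))))
      e₃ = solve-∀ ℚ-ring

  -- This turns the Rankin-Cohen coefficients into every second entry of row 2ν + 1 of Pascal's
  -- triangle. Passing from (i, j + 1) to (i + 1, j) multiplies both sides by (2j + 1)(2j + 2) /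
  -- ((2i + 2)(2i + 3)); the start is `half-integer-binomial`.
  bracket-coefficient : ∀ ν i j → i ℕ.+ j ≡ ν →
    4ℚ ^ ν * (binomial (fromℕ ν + ½) j * binomial (fromℕ ν - ½) i) ≡ central ν * row (suc (ν ℕ.* 2)) (suc (i ℕ.* 2))
  bracket-coefficient ν zero    j refl = trans (cong (4ℚ ^ ν *_) (ℚ.*-identityʳ (binomial (fromℕ ν + ½) ν))) (half-integer-binomial ν)
  bracket-coefficient ν (suc i) j eq =
    suc-cancel (2 ℕ.+ i ℕ.* 2) (suc-cancel (1 ℕ.+ i ℕ.* 2) (begin
      n₂ * (n₃ * (q * (b * binomial y′ (suc i))))           ≡⟨ e₁ n₂ n₃ q b (binomial y′ i) (y′ - I) (+ 1 / suc i) ⟩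
      n₂ * (+ 1 / suc i) * n₃ * (Z * (y′ - I))               ≡⟨ cong₂ (λ u v → u * v * (Z * (y′ - I))) n₂v n₃≡ ⟩
      (1ℚ + 1ℚ) * (1ℚ + (1ℚ + (1ℚ + (I + I)))) * (Z * (y′ - I)) ≡⟨ cong (λ u → (1ℚ + 1ℚ) * (1ℚ + (1ℚ + (1ℚ + (I + I)))) * (Z * u)) y′-I ⟩
      (1ℚ + 1ℚ) * (1ℚ + (1ℚ + (1ℚ + (I + I)))) * (Z * (J + ½)) ≡⟨ e₂ I J Z ⟩
      4ℚ * (J + ½) * (Z * (1ℚ + I + ½))                      ≡⟨ cong (λ u → 4ℚ * (J + ½) * (Z * u)) y-J ⟨
      4ℚ * (J + ½) * (Z * (y - J))                           ≡⟨ e₃ J q b (y - J) (binomial y′ i) ⟩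
      4ℚ * (J + ½) * (q * (b * (y - J) * binomial y′ i))     ≡⟨ cong (λ u → 4ℚ * (J + ½) * (q * (u * binomial y′ i))) (binomial-suc y j) ⟨
      4ℚ * (J + ½) * (q * (binomial y (suc j) * j₁ * binomial y′ i)) ≡⟨ e₄ J q (binomial y (suc j)) j₁ (binomial y′ i) ⟩
      4ℚ * (J + ½) * j₁ * (q * (binomial y (suc j) * binomial y′ i)) ≡⟨ cong (4ℚ * (J + ½) * j₁ *_) (bracket-coefficient ν i (suc j) (trans (ℕ.+-suc i j) eq)) ⟩
      4ℚ * (J + ½) * j₁ * (c * R)                            ≡⟨ cong (λ u → 4ℚ * (J + ½) * u * (c * R)) (fromℕ-suc j) ⟩
      4ℚ * (J + ½) * (1ℚ + J) * (c * R)                      ≡⟨ e₅ J c R ⟩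
      c * (1ℚ + (J + J)) * ((1ℚ + 1ℚ + (J + J)) * R)         ≡⟨ cong (c * (1ℚ + (J + J)) *_) h₁ ⟨
      c * (1ℚ + (J + J)) * (n₂ * M)                          ≡⟨ e₆ c (1ℚ + (J + J)) n₂ M ⟩
      c * n₂ * ((1ℚ + (J + J)) * M)                          ≡⟨ cong (c * n₂ *_) h₂ ⟨
      c * n₂ * (n₃ * R′)                                     ≡⟨ e₇ c n₂ n₃ R′ ⟩
      n₂ * (n₃ * (c * R′))                                   ∎))
    where
    open ≡-Reasoning
    n = suc (ν ℕ.* 2)
    I = fromℕ i
    J = fromℕ j
    j₁ = fromℕ (suc j)
    n₂ = fromℕ (2 ℕ.+ i ℕ.* 2)
    n₃ = fromℕ (3 ℕ.+ i ℕ.* 2)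
    q = 4ℚ ^ ν
    c = central ν
    y = fromℕ ν + ½
    y′ = fromℕ ν - ½
    b = binomial y j
    Z = q * (b * binomial y′ i)
    R = row n (suc (i ℕ.* 2))
    M = row n (2 ℕ.+ i ℕ.* 2)
    R′ = row n (3 ℕ.+ i ℕ.* 2)
    n₁≡ : fromℕ (suc (i ℕ.* 2)) ≡ 1ℚ + (I + I)
    n₁≡ = trans (fromℕ-suc (i ℕ.* 2)) (cong (λ u → 1ℚ + u) (fromℕ-*2 i))
    n₂≡ : n₂ ≡ 1ℚ + (1ℚ + (I + I))
    n₂≡ = trans (fromℕ-suc (1 ℕ.+ i ℕ.* 2)) (cong (λ u → 1ℚ + u) n₁≡)
    n₃≡ : n₃ ≡ 1ℚ + (1ℚ + (1ℚ + (I + I)))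
    n₃≡ = trans (fromℕ-suc (2 ℕ.+ i ℕ.* 2)) (cong (λ u → 1ℚ + u) n₂≡)
    ν≡ : fromℕ ν ≡ 1ℚ + I + J
    ν≡ = trans (cong fromℕ (sym eq)) (trans (fromℕ-+ (suc i) j) (cong (_+ J) (fromℕ-suc i)))
    n≡ : fromℕ n ≡ 1ℚ + (1ℚ + I + J + (1ℚ + I + J))
    n≡ = trans (fromℕ-suc (ν ℕ.* 2)) (cong (λ u → 1ℚ + u) (trans (fromℕ-*2 ν) (cong₂ _+_ ν≡ ν≡)))
    n₂v : n₂ * (+ 1 / suc i) ≡ 1ℚ + 1ℚ
    n₂v = trans (cong (_* (+ 1 / suc i)) (trans n₂≡ (trans (r I) (cong ((1ℚ + 1ℚ) *_) (sym (fromℕ-suc i))))))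
      (trans (r′ (fromℕ (suc i)) (+ 1 / suc i)) (trans (cong ((1ℚ + 1ℚ) *_) (fraction (+ 1) i)) refl))
      where
      r : ∀ I → 1ℚ + (1ℚ + (I + I)) ≡ (1ℚ + 1ℚ) * (1ℚ + I)
      r = solve-∀ ℚ-ring
      r′ : ∀ s v → (1ℚ + 1ℚ) * s * v ≡ (1ℚ + 1ℚ) * (v * s)
      r′ = solve-∀ ℚ-ring
    y′-I : y′ - I ≡ J + ½
    y′-I = trans (cong (λ u → u - ½ - I) ν≡) (r I J)
      where
      r : ∀ I J → 1ℚ + I + J - ½ - I ≡ J + ½
      r = solve-∀ ℚ-ring
    y-J : y - J ≡ 1ℚ + I + ½
    y-J = trans (cong (λ u → u + ½ - J) ν≡) (r I J)
      where
      r : ∀ I J → 1ℚ + I + J + ½ - J ≡ 1ℚ + I + ½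
      r = solve-∀ ℚ-ring
    h₁ : n₂ * M ≡ (1ℚ + 1ℚ + (J + J)) * R
    h₁ = trans (absorb n (suc (i ℕ.* 2))) (cong (_* R) (trans (cong₂ _-_ n≡ n₁≡) (r I J)))
      where
      r : ∀ I J → 1ℚ + (1ℚ + I + J + (1ℚ + I + J)) - (1ℚ + (I + I)) ≡ 1ℚ + 1ℚ + (J + J)
      r = solve-∀ ℚ-ring
    h₂ : n₃ * R′ ≡ (1ℚ + (J + J)) * M
    h₂ = trans (absorb n (2 ℕ.+ i ℕ.* 2)) (cong (_* M) (trans (cong₂ _-_ n≡ n₂≡) (r I J)))
      where
      r : ∀ I J → 1ℚ + (1ℚ + I + J + (1ℚ + I + J)) - (1ℚ + (1ℚ + (I + I))) ≡ 1ℚ + (J + J)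
      r = solve-∀ ℚ-ring
    e₁ : ∀ n₂ n₃ q b b′ d v → n₂ * (n₃ * (q * (b * (b′ * d * v)))) ≡ n₂ * v * n₃ * (q * (b * b′) * d)
    e₁ = solve-∀ ℚ-ring
    e₂ : ∀ I J Z → (1ℚ + 1ℚ) * (1ℚ + (1ℚ + (1ℚ + (I + I)))) * (Z * (J + ½)) ≡ (1ℚ + 1ℚ + (1ℚ + 1ℚ)) * (J + ½) * (Z * (1ℚ + I + ½))
    e₂ = solve-∀ ℚ-ring
    e₃ : ∀ J q b d b′ → (1ℚ + 1ℚ + (1ℚ + 1ℚ)) * (J + ½) * (q * (b * b′) * d) ≡ (1ℚ + 1ℚ + (1ℚ + 1ℚ)) * (J + ½) * (q * (b * d * b′))
    e₃ = solve-∀ ℚ-ring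
    e₄ : ∀ J q b j b′ → (1ℚ + 1ℚ + (1ℚ + 1ℚ)) * (J + ½) * (q * (b * j * b′)) ≡ (1ℚ + 1ℚ + (1ℚ + 1ℚ)) * (J + ½) * j * (q * (b * b′))
    e₄ = solve-∀ ℚ-ring
    e₅ : ∀ J c R → (1ℚ + 1ℚ + (1ℚ + 1ℚ)) * (J + ½) * (1ℚ + J) * (c * R) ≡ c * (1ℚ + (J + J)) * ((1ℚ + 1ℚ + (J + J)) * R)
    e₅ = solve-∀ ℚ-ring
    e₆ : ∀ c d n M → c * d * (n * M) ≡ c * n * (d * M)
    e₆ = solve-∀ ℚ-ring
    e₇ : ∀ c n₂ n₃ R → c * n₂ * (n₃ * R) ≡ n₂ * (n₃ * (c * R))
    e₇ = solve-∀ ℚ-ring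

-- Ballot numbers and the expansion of powers of 2t.

module Chebyshev where

  open import Defs using (fromℤ; fromℕ; _^_; ∑; T; Catalan)
  open FinSum
  open Rational
  open Binomials
  open import Data.Nat.Combinatorics using (_C_; nCk≡nC[n∸k])
  open import Data.Rational.Base using (_+_; _*_; _-_; -_; _/_)
  open import Tactic.RingSolver using (solve-∀)

  ∑-applyUpTo : ∀ {A : Set} (g : ℕ → A) n (f : A → ℚ) → ∑ (applyUpTo g n) f ≡ ∑ (upTo n) (f ∘ g)
  ∑-applyUpTo g zero    f = refl
  ∑-applyUpTo g (suc n) f = cong (λ u → f (g 0) + u)
    (trans (∑-applyUpTo (g ∘ suc) n f) (sym (∑-applyUpTo suc n (f ∘ g))))

  ∑-first : ∀ n (f : ℕ → ℚ) → ∑ (upTo (suc n)) f ≡ f 0 + ∑ (upTo n) (f ∘ suc)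
  ∑-first n f = cong (λ u → f 0 + u) (∑-applyUpTo suc n f)

  ∑-last : ∀ n (f : ℕ → ℚ) → ∑ (upTo (suc n)) f ≡ ∑ (upTo n) f + f n
  ∑-last zero    f = trans (ℚ.+-identityʳ (f 0)) (sym (ℚ.+-identityˡ (f 0)))
  ∑-last (suc n) f = begin
    ∑ (upTo (2 ℕ.+ n)) f                          ≡⟨ ∑-first (suc n) f ⟩
    f 0 + ∑ (upTo (suc n)) (f ∘ suc)              ≡⟨ cong (λ u → f 0 + u) (∑-last n (f ∘ suc)) ⟩
    f 0 + (∑ (upTo n) (f ∘ suc) + f (suc n))      ≡⟨ ℚ.+-assoc (f 0) (∑ (upTo n) (f ∘ suc)) (f (suc n)) ⟨
    f 0 + ∑ (upTo n) (f ∘ suc) + f (suc n)        ≡⟨ cong (_+ f (suc n)) (∑-first n f) ⟨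
    ∑ (upTo (suc n)) f + f (suc n)                ∎
    where open ≡-Reasoning

  ∑-* : ∀ {A : Set} c (xs : List A) f → ∑ xs (λ x → c * f x) ≡ c * ∑ xs f
  ∑-* c xs f = sym (sum-hom ℚ.+-0-isCommutativeMonoid ℚ.+-0-isCommutativeMonoid (c *_) (ℚ.*-zeroʳ c) (ℚ.*-distribˡ-+ c) xs f)

  -- The convolution Σ_{μ + ν = K} a μ n^μ W ν.
  G : ℚ → (ℕ → ℚ) → ℕ → (ℕ → ℚ) → ℚ
  G n a zero    W = a 0 * W 0
  G n a (suc K) W = a 0 * W (suc K) + n * G n (a ∘ suc) K W

  G-∑ : ∀ n a K W → ∑ (upTo (suc K)) (λ μ → a μ * n ^ μ * W (K ∸ μ)) ≡ G n a K W
  G-∑ n a zero    W = trans (ℚ.+-identityʳ (a 0 * 1ℚ * W 0)) (cong (_* W 0) (ℚ.*-identityʳ (a 0)))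
  G-∑ n a (suc K) W = trans (∑-first (suc K) (λ μ → a μ * n ^ μ * W (suc K ∸ μ)))
    (cong₂ _+_ (cong (_* W (suc K)) (ℚ.*-identityʳ (a 0)))
      (trans (ℚΣ.sum-cong (upTo (suc K)) (λ μ → e (a (suc μ)) n (n ^ μ) (W (K ∸ μ))))
        (trans (∑-* n (upTo (suc K)) (λ μ → a (suc μ) * n ^ μ * W (K ∸ μ))) (cong (n *_) (G-∑ n (a ∘ suc) K W)))))
    where
    e : ∀ a n m w → a * (n * m) * w ≡ n * (a * m * w)
    e = solve-∀ ℚ-ring

  shift : (ℕ → ℚ) → ℕ → ℚ
  shift a zero    = 0ℚ
  shift a (suc μ) = a μ

  module _ (n : ℚ) where

    G-cong : ∀ {a b} K W → (∀ μ → a μ ≡ b μ) → G n a K W ≡ G n b K W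
    G-cong zero    W h = cong (_* W 0) (h 0)
    G-cong (suc K) W h = cong₂ _+_ (cong (_* W (suc K)) (h 0)) (cong (n *_) (G-cong K W (h ∘ suc)))

    G-congʳ : ∀ a K {V W} → (∀ ν → V ν ≡ W ν) → G n a K V ≡ G n a K W
    G-congʳ a zero    h = cong (a 0 *_) (h 0)
    G-congʳ a (suc K) h = cong₂ _+_ (cong (a 0 *_) (h (suc K))) (cong (n *_) (G-congʳ (a ∘ suc) K h))

    G-+ : ∀ a b K W → G n (λ μ → a μ + b μ) K W ≡ G n a K W + G n b K W
    G-+ a b zero    W = ℚ.*-distribʳ-+ (W 0) (a 0) (b 0)
    G-+ a b (suc K) W = trans (cong (λ u → (a 0 + b 0) * W (suc K) + n * u) (G-+ (a ∘ suc) (b ∘ suc) K W))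
      (e (a 0) (b 0) (W (suc K)) n (G n (a ∘ suc) K W) (G n (b ∘ suc) K W))
      where
      e : ∀ a b w n x y → (a + b) * w + n * (x + y) ≡ a * w + n * x + (b * w + n * y)
      e = solve-∀ ℚ-ring

    G-+ʳ : ∀ a K V W → G n a K (λ ν → V ν + W ν) ≡ G n a K V + G n a K W
    G-+ʳ a zero    V W = ℚ.*-distribˡ-+ (a 0) (V 0) (W 0)
    G-+ʳ a (suc K) V W = trans (cong (λ u → a 0 * (V (suc K) + W (suc K)) + n * u) (G-+ʳ (a ∘ suc) K V W))
      (e (a 0) (V (suc K)) (W (suc K)) n (G n (a ∘ suc) K V) (G n (a ∘ suc) K W))
      where
      e : ∀ a v w n x y → a * (v + w) + n * (x + y) ≡ a * v + n * x + (a * w + n * y)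
      e = solve-∀ ℚ-ring

    G-*ʳ : ∀ a K c W → G n a K (λ ν → c * W ν) ≡ c * G n a K W
    G-*ʳ a zero    c W = e (a 0) c (W 0)
      where
      e : ∀ a c w → a * (c * w) ≡ c * (a * w)
      e = solve-∀ ℚ-ring
    G-*ʳ a (suc K) c W = trans (cong (λ u → a 0 * (c * W (suc K)) + n * u) (G-*ʳ (a ∘ suc) K c W))
      (e (a 0) c (W (suc K)) n (G n (a ∘ suc) K W))
      where
      e : ∀ a c w n x → a * (c * w) + n * (c * x) ≡ c * (a * w + n * x)
      e = solve-∀ ℚ-ring

    G-last : ∀ a K W → G n a (suc K) W ≡ G n a K (W ∘ suc) + a (suc K) * n ^ suc K * W 0
    G-last a zero    W = e (a 0) (W 1) n (a 1) (W 0)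
      where
      e : ∀ a w n b v → a * w + n * (b * v) ≡ a * w + b * (n * 1ℚ) * v
      e = solve-∀ ℚ-ring
    G-last a (suc K) W = trans (cong (λ u → a 0 * W (2 ℕ.+ K) + n * u) (G-last (a ∘ suc) K W))
      (e (a 0 * W (2 ℕ.+ K)) n (G n (a ∘ suc) K (W ∘ suc)) (a (2 ℕ.+ K)) (n ^ suc K) (W 0))
      where
      e : ∀ z n g b m v → z + n * (g + b * m * v) ≡ z + n * g + b * (n * m) * v
      e = solve-∀ ℚ-ring

    G-shift : ∀ a K W → G n (shift a) (suc K) W ≡ n * G n a K W
    G-shift a K W = e (W (suc K)) (n * G n a K W)
      where
      e : ∀ w y → 0ℚ * w + y ≡ y
      e = solve-∀ ℚ-ring

  -- (√x + √-N)^(2ν + 1) = X ν √x + V ν √-N.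
  module Powers√ (N x : ℚ) where

    odd even : ℕ → ℕ → ℚ
    odd  ν i = row (suc (ν ℕ.* 2)) (suc (i ℕ.* 2))
    even ν i = row (suc (ν ℕ.* 2)) (i ℕ.* 2)

    V X : ℕ → ℚ
    V ν = G (- N) (odd ν) ν (x ^_)
    X ν = G (- N) (even ν) ν (x ^_)

    -- Two steps in Pascal's triangle, that is, multiplication by (1 + X)².
    odd-suc : ∀ ν i → odd (suc ν) i ≡ odd ν i + (even ν i + even ν i) + shift (odd ν) i
    odd-suc ν zero    = trans (row-1 (suc (ν ℕ.* 2))) (sym (ℚ.+-identityʳ _))
    odd-suc ν (suc i) = row-2 (suc (ν ℕ.* 2)) (suc (i ℕ.* 2))

    even-suc : ∀ ν i → even (suc ν) i ≡ even ν i + (shift (odd ν) i + shift (odd ν) i) + shift (even ν) i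
    even-suc ν zero    = refl
    even-suc ν (suc i) = row-2 (suc (ν ℕ.* 2)) (i ℕ.* 2)

    raise : ∀ a K → a (suc K) ≡ 0ℚ → G (- N) a (suc K) (x ^_) ≡ x * G (- N) a K (x ^_)
    raise a K a≡0 = begin
      G (- N) a (suc K) (x ^_)                                     ≡⟨ G-last (- N) a K (x ^_) ⟩
      G (- N) a K (λ ν → x * x ^ ν) + a (suc K) * (- N) ^ suc K * 1ℚ ≡⟨ cong₂ (λ u v → u + v * (- N) ^ suc K * 1ℚ) (G-*ʳ (- N) a K x (x ^_)) a≡0 ⟩
      x * G (- N) a K (x ^_) + 0ℚ * (- N) ^ suc K * 1ℚ             ≡⟨ e (x * G (- N) a K (x ^_)) ((- N) ^ suc K) ⟩
      x * G (- N) a K (x ^_)                                       ∎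
      where
      open ≡-Reasoning
      e : ∀ y m → y + 0ℚ * m * 1ℚ ≡ y
      e = solve-∀ ℚ-ring

    combine : ∀ a b c K → a (suc K) ≡ 0ℚ →
      G (- N) (λ i → a i + (b i + b i) + shift c i) (suc K) (x ^_)
        ≡ x * G (- N) a K (x ^_) + (G (- N) b (suc K) (x ^_) + G (- N) b (suc K) (x ^_)) + - N * G (- N) c K (x ^_)
    combine a b c K a≡0 = trans (G-+ (- N) (λ i → a i + (b i + b i)) (shift c) (suc K) (x ^_))
      (cong₂ _+_ (trans (G-+ (- N) a (λ i → b i + b i) (suc K) (x ^_)) (cong₂ _+_ (raise a K a≡0) (G-+ (- N) b b (suc K) (x ^_))))
        (G-shift (- N) c K (x ^_)))

    odd-0 : ∀ ν → odd ν (suc ν) ≡ 0ℚ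
    odd-0 ν = row-> {suc (ν ℕ.* 2)} (s≤s (s≤s (ℕ.n≤1+n (ν ℕ.* 2))))

    even-0 : ∀ ν → even ν (suc ν) ≡ 0ℚ
    even-0 ν = row-> {suc (ν ℕ.* 2)} ℕ.≤-refl

    -- Multiplication by (√x + √-N)² = x - N + 2 √x √-N.
    V-suc : ∀ ν → V (suc ν) ≡ (x - N) * V ν + (1ℚ + 1ℚ) * x * X ν
    V-suc ν = trans (G-cong (- N) (suc ν) (x ^_) (odd-suc ν)) (trans (combine (odd ν) (even ν) (odd ν) ν (odd-0 ν))
      (trans (cong (λ u → x * V ν + (u + u) + - N * V ν) (raise (even ν) ν (even-0 ν))) (e N x (V ν) (X ν))))
      where
      e : ∀ N x V X → x * V + (x * X + x * X) + - N * V ≡ (x - N) * V + (1ℚ + 1ℚ) * x * X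
      e = solve-∀ ℚ-ring

    X-suc : ∀ ν → X (suc ν) ≡ (x - N) * X ν - (1ℚ + 1ℚ) * N * V ν
    X-suc ν = trans (G-cong (- N) (suc ν) (x ^_) (even-suc ν)) (trans (combine (even ν) (shift (odd ν)) (even ν) ν (even-0 ν))
      (trans (cong (λ u → x * X ν + (u + u) + - N * X ν) (G-shift (- N) (odd ν) ν (x ^_))) (e N x (V ν) (X ν))))
      where
      e : ∀ N x V X → x * X + (- N * V + - N * V) + - N * X ≡ (x - N) * X - (1ℚ + 1ℚ) * N * V
      e = solve-∀ ℚ-ring

    n : ℚ
    n = N + x

    -- This is n² V (ν - 1). At ν = 0 the power is the inverse (√x - √-N) / n of √x + √-N, so V (-1)
    -- is - 1 / n.
    U : ℕ → ℚ
    U zero    = - (n * V 0)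
    U (suc ν) = n * (n * V ν)

    -- The Chebyshev recursion: (√x + √-N)² and its conjugate have sum 2 (x - N) = 4x - 2n and
    -- product n².
    three-term : ∀ ν → 4ℚ * x * V ν ≡ V (suc ν) + (1ℚ + 1ℚ) * n * V ν + U ν
    three-term zero    = sym (trans (cong (λ u → u + (1ℚ + 1ℚ) * n * V 0 - n * V 0) (V-suc 0)) (e N x))
      where
      e : ∀ N x → (x - N) * (1ℚ * 1ℚ) + (1ℚ + 1ℚ) * x * (1ℚ * 1ℚ) + (1ℚ + 1ℚ) * (N + x) * (1ℚ * 1ℚ) - (N + x) * (1ℚ * 1ℚ)
        ≡ (1ℚ + 1ℚ + (1ℚ + 1ℚ)) * x * (1ℚ * 1ℚ)
      e = solve-∀ ℚ-ring
    three-term (suc ν) = sym (trans (cong (λ u → u + (1ℚ + 1ℚ) * n * V (suc ν) + n * (n * V ν)) (V-suc (suc ν)))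
      (trans (cong₂ (λ u v → (x - N) * u + (1ℚ + 1ℚ) * x * v + (1ℚ + 1ℚ) * n * u + n * (n * V ν)) (V-suc ν) (X-suc ν))
        (trans (e N x (V ν) (X ν)) (cong (4ℚ * x *_) (sym (V-suc ν))))))
      where
      e : ∀ N x V X →
        (x - N) * ((x - N) * V + (1ℚ + 1ℚ) * x * X) + (1ℚ + 1ℚ) * x * ((x - N) * X - (1ℚ + 1ℚ) * N * V)
          + (1ℚ + 1ℚ) * (N + x) * ((x - N) * V + (1ℚ + 1ℚ) * x * X) + (N + x) * ((N + x) * V)
        ≡ (1ℚ + 1ℚ + (1ℚ + 1ℚ)) * x * ((x - N) * V + (1ℚ + 1ℚ) * x * X)
      e = solve-∀ ℚ-ring

  -- The coefficients of (1 - X)(1 + X)^(2K).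
  ballot : ℕ → ℕ → ℚ
  ballot K μ = row (K ℕ.* 2) μ - shift (row (K ℕ.* 2)) μ

  -- Multiplication of the generating polynomial by (1 + X)².
  ballot-step : ∀ K μ → ballot (suc K) μ ≡ ballot K μ + (shift (ballot K) μ + shift (ballot K) μ) + shift (shift (ballot K)) μ
  ballot-step K zero    = refl
  ballot-step K (suc zero) = trans (cong (_- 1ℚ) (row-1 (K ℕ.* 2))) (e (row (K ℕ.* 2) 1))
    where
    e : ∀ x → x + (1ℚ + 1ℚ) - 1ℚ ≡ x - 1ℚ + (1ℚ - 0ℚ + (1ℚ - 0ℚ)) + 0ℚ
    e = solve-∀ ℚ-ring
  ballot-step K (suc (suc zero)) = trans (cong₂ _-_ (row-2 (K ℕ.* 2) 0) (row-1 (K ℕ.* 2))) (e (row (K ℕ.* 2) 1) (row (K ℕ.* 2) 2))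
    where
    e : ∀ x y → y + (x + x) + 1ℚ - (x + (1ℚ + 1ℚ)) ≡ y - x + (x - 1ℚ + (x - 1ℚ)) + (1ℚ - 0ℚ)
    e = solve-∀ ℚ-ring
  ballot-step K (suc (suc (suc μ))) = trans (cong₂ _-_ (row-2 (K ℕ.* 2) (suc μ)) (row-2 (K ℕ.* 2) μ))
    (e (row (K ℕ.* 2) μ) (row (K ℕ.* 2) (1 ℕ.+ μ)) (row (K ℕ.* 2) (2 ℕ.+ μ)) (row (K ℕ.* 2) (3 ℕ.+ μ)))
    where
    e : ∀ x y z w → w + (z + z) + y - (z + (y + y) + x) ≡ w - z + (z - y + (z - y)) + (y - x)
    e = solve-∀ ℚ-ring

  double∸ : ∀ K → K ℕ.* 2 ∸ K ≡ K
  double∸ K = trans (cong (_∸ K) (trans (ℕ.*-comm K 2) (cong (λ u → K ℕ.+ u) (ℕ.+-identityʳ K)))) (ℕ.m+n∸n≡m K K)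

  -- The generating polynomial has degree 2K + 1 and changes sign when its coefficients are
  -- reversed; K and K + 1 are the two middle exponents.
  ballot-antisymmetric : ∀ K → ballot K (suc K) ≡ - ballot K K
  ballot-antisymmetric zero    = refl
  ballot-antisymmetric (suc K) = trans (cong (_- row m (suc K)) (cong fromℕ (trans (nCk≡nC[n∸k] {2 ℕ.+ K} {m} (s≤s (s≤s (ℕ.m≤m*n K 2)))) (cong (m C_) (double∸ K)))))
    (e (row m K) (row m (suc K)))
    where
    m = suc K ℕ.* 2
    e : ∀ x y → x - y ≡ - (y - x)
    e = solve-∀ ℚ-ring

  -- (4x)^K = Σ_{μ ≤ K} ballot K μ n^μ V (K - μ): after division by √x this is the expansion of
  -- (2√x)^(2K + 1) = ((√x + √-N) + (√x - √-N))^(2K + 1).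
  module _ (N x : ℚ) where

    open Powers√ N x

    ballot-expansion : ∀ K → G n (ballot K) K V ≡ (4ℚ * x) ^ K
    ballot-expansion zero    = refl
    ballot-expansion (suc K) = sym (begin
      4ℚ * x * (4ℚ * x) ^ K       ≡⟨ cong (4ℚ * x *_) (ballot-expansion K) ⟨
      4ℚ * x * G n a K V          ≡⟨ G-*ʳ n a K (4ℚ * x) V ⟨
      G n a K (λ ν → 4ℚ * x * V ν) ≡⟨ G-congʳ n a K three-term ⟩
      G n a K (λ ν → V (suc ν) + (1ℚ + 1ℚ) * n * V ν + U ν)
        ≡⟨ trans (G-+ʳ n a K (λ ν → V (suc ν) + (1ℚ + 1ℚ) * n * V ν) U)
             (cong (_+ G n a K U) (trans (G-+ʳ n a K (V ∘ suc) (λ ν → (1ℚ + 1ℚ) * n * V ν))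
               (cong (λ u → G n a K (V ∘ suc) + u) (G-*ʳ n a K ((1ℚ + 1ℚ) * n) V)))) ⟩
      G n a K (V ∘ suc) + (1ℚ + 1ℚ) * n * g + G n a K U ≡⟨ cong₂ (λ u v → u + (1ℚ + 1ℚ) * n * g + v) first (third K) ⟩
      G n a (suc K) V + a K * n ^ suc K * V 0 + (1ℚ + 1ℚ) * n * g + (G n (shift (shift a)) (suc K) V - a K * n ^ suc K * V 0)
        ≡⟨ e (G n a (suc K) V) (a K * n ^ suc K * V 0) n g (G n (shift (shift a)) (suc K) V) ⟩
      G n a (suc K) V + (n * g + n * g) + G n (shift (shift a)) (suc K) V
        ≡⟨ cong (λ u → G n a (suc K) V + (u + u) + G n (shift (shift a)) (suc K) V) (G-shift n a K V) ⟨
      G n a (suc K) V + (G n (shift a) (suc K) V + G n (shift a) (suc K) V) + G n (shift (shift a)) (suc K) V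
        ≡⟨ trans (G-+ n (λ μ → a μ + (shift a μ + shift a μ)) (shift (shift a)) (suc K) V)
             (cong (_+ G n (shift (shift a)) (suc K) V) (trans (G-+ n a (λ μ → shift a μ + shift a μ) (suc K) V)
               (cong (λ u → G n a (suc K) V + u) (G-+ n (shift a) (shift a) (suc K) V)))) ⟨
      G n (λ μ → a μ + (shift a μ + shift a μ) + shift (shift a) μ) (suc K) V
        ≡⟨ G-cong n (suc K) V (λ μ → sym (ballot-step K μ)) ⟩
      G n (ballot (suc K)) (suc K) V ∎)
      where
      open ≡-Reasoning
      a = ballot K
      g = G n a K V
      first : G n a K (V ∘ suc) ≡ G n a (suc K) V + a K * n ^ suc K * V 0
      first = sym (trans (cong (_+ a K * n ^ suc K * V 0) (trans (G-last n a K V)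
          (cong (λ u → G n a K (V ∘ suc) + u * n ^ suc K * V 0) (ballot-antisymmetric K))))
        (r (G n a K (V ∘ suc)) (a K) (n ^ suc K) (V 0)))
        where
        r : ∀ g a m v → g + - a * m * v + a * m * v ≡ g
        r = solve-∀ ℚ-ring
      -- The boundary term created by `U 0` is the negative of the one in `first`, which comes from
      -- the antisymmetry of `ballot`.
      third : ∀ J → G n (ballot J) J U ≡ G n (shift (shift (ballot J))) (suc J) V - ballot J J * n ^ suc J * V 0
      third zero    = r n (V 0) (V 1)
        where
        r : ∀ n v w → (1ℚ - 0ℚ) * - (n * v) ≡ 0ℚ * w + n * (0ℚ * v) - (1ℚ - 0ℚ) * (n * 1ℚ) * v
        r = solve-∀ ℚ-ring
      third (suc J) = trans (G-last n b J U) (trans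
        (cong (_+ b (suc J) * n ^ suc J * - (n * V 0)) (trans (G-*ʳ n b J n (λ ν → n * V ν)) (cong (n *_) (G-*ʳ n b J n V))))
        (trans (r n (G n b J V) (b (suc J)) (n ^ suc J) (V 0))
          (cong (_- b (suc J) * n ^ (2 ℕ.+ J) * V 0) (sym (trans (G-shift n (shift b) (suc J) V) (cong (n *_) (G-shift n b J V)))))))
        where
        b = ballot (suc J)
        r : ∀ n g a m v → n * (n * g) + a * m * - (n * v) ≡ n * (n * g) - a * (n * m) * v
        r = solve-∀ ℚ-ring
      e : ∀ y z n g w → y + z + (1ℚ + 1ℚ) * n * g + (w - z) ≡ y + (n * g + n * g) + w
      e = solve-∀ ℚ-ring

  ballot-absorb : ∀ K μ → μ ℕ.≤ K →
    ballot K μ * fromℕ (suc (K ℕ.* 2 ∸ μ)) ≡ fromℤ (+ (K ℕ.* 2) ℤ.- + (2 ℕ.* μ) ℤ.+ 1ℤ) * row (K ℕ.* 2) μ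
  ballot-absorb K μ μ≤K = trans (cong (ballot K μ *_) denominator) (trans (go μ) (cong (_* row (K ℕ.* 2) μ) (sym numerator)))
    where
    k = K ℕ.* 2
    go : ∀ μ → ballot K μ * (1ℚ + (fromℕ k - fromℕ μ)) ≡ (fromℕ k - (fromℕ μ + fromℕ μ) + 1ℚ) * row k μ
    go zero    = e (fromℕ k)
      where
      e : ∀ k → (1ℚ - 0ℚ) * (1ℚ + (k - 0ℚ)) ≡ (k - (0ℚ + 0ℚ) + 1ℚ) * 1ℚ
      e = solve-∀ ℚ-ring
    go (suc μ) = begin
      (y - x) * (1ℚ + (κ - m₁))              ≡⟨ cong (λ u → (y - x) * (1ℚ + (κ - u))) (fromℕ-suc μ) ⟩
      (y - x) * (1ℚ + (κ - (1ℚ + m)))        ≡⟨ e₁ x y κ m ⟩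
      y * (κ - m) - (κ - m) * x              ≡⟨ cong (λ u → y * (κ - m) - u) (absorb k μ) ⟨
      y * (κ - m) - m₁ * y                   ≡⟨ cong (λ u → y * (κ - m) - u * y) (fromℕ-suc μ) ⟩
      y * (κ - m) - (1ℚ + m) * y             ≡⟨ e₂ y κ m ⟩
      (κ - (1ℚ + m + (1ℚ + m)) + 1ℚ) * y     ≡⟨ cong (λ u → (κ - (u + u) + 1ℚ) * y) (fromℕ-suc μ) ⟨
      (κ - (m₁ + m₁) + 1ℚ) * y               ∎
      where
      open ≡-Reasoning
      x = row k μ
      y = row k (suc μ)
      κ = fromℕ k
      m = fromℕ μ
      m₁ = fromℕ (suc μ)
      e₁ : ∀ x y κ m → (y - x) * (1ℚ + (κ - (1ℚ + m))) ≡ y * (κ - m) - (κ - m) * x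
      e₁ = solve-∀ ℚ-ring
      e₂ : ∀ y κ m → y * (κ - m) - (1ℚ + m) * y ≡ (κ - (1ℚ + m + (1ℚ + m)) + 1ℚ) * y
      e₂ = solve-∀ ℚ-ring
    denominator : fromℕ (suc (k ∸ μ)) ≡ 1ℚ + (fromℕ k - fromℕ μ)
    denominator = trans (fromℕ-suc (k ∸ μ)) (cong (λ u → 1ℚ + u)
      (trans (e (fromℕ (k ∸ μ)) (fromℕ μ)) (cong (_- fromℕ μ) (trans (sym (fromℕ-+ (k ∸ μ) μ))
        (cong fromℕ (ℕ.m∸n+n≡m (ℕ.≤-trans μ≤K (ℕ.m≤m*n K 2))))))))
      where
      e : ∀ d m → d ≡ d + m - m
      e = solve-∀ ℚ-ring
    numerator : fromℤ (+ k ℤ.- + (2 ℕ.* μ) ℤ.+ 1ℤ) ≡ fromℕ k - (fromℕ μ + fromℕ μ) + 1ℚ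
    numerator = trans (fromℤ-+ (+ k ℤ.- + (2 ℕ.* μ)) 1ℤ) (cong (_+ 1ℚ) (trans (fromℤ-- (+ k) (+ (2 ℕ.* μ)))
      (cong (λ u → fromℕ k - u) (trans (cong fromℕ (ℕ.*-comm 2 μ)) (fromℕ-*2 μ)))))

  T-ballot : ∀ K μ → μ ℕ.≤ K → T (K ℕ.* 2) μ ≡ ballot K μ
  T-ballot K μ μ≤K = suc-cancel d (trans (e (fromℕ (suc d)) (z / suc d) (row k μ)) (trans (cong (_* row k μ) (fraction z d))
      (trans (sym (ballot-absorb K μ μ≤K)) (ℚ.*-comm (ballot K μ) (fromℕ (suc d))))))
    where
    k = K ℕ.* 2
    d = k ∸ μ
    z = + k ℤ.- + (2 ℕ.* μ) ℤ.+ 1ℤ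
    e : ∀ s t r → s * (t * r) ≡ t * s * r
    e = solve-∀ ℚ-ring

  Catalan-ballot : ∀ K → Catalan K ≡ ballot K K
  Catalan-ballot K = suc-cancel K (begin
    s * ((+ 1 / suc K) * row (2 ℕ.* K) K)      ≡⟨ e s (+ 1 / suc K) (row (2 ℕ.* K) K) ⟩
    (+ 1 / suc K) * s * row (2 ℕ.* K) K        ≡⟨ cong₂ _*_ (fraction 1ℤ K) (cong (λ j → row j K) (ℕ.*-comm 2 K)) ⟩
    1ℚ * row k K                               ≡⟨ cong (λ z → fromℤ z * row k K) one ⟨
    fromℤ (+ k ℤ.- + (2 ℕ.* K) ℤ.+ 1ℤ) * row k K ≡⟨ ballot-absorb K K ℕ.≤-refl ⟨
    ballot K K * fromℕ (suc (k ∸ K))           ≡⟨ cong (λ d → ballot K K * fromℕ (suc d)) half ⟩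
    ballot K K * s                             ≡⟨ ℚ.*-comm (ballot K K) s ⟩
    s * ballot K K                             ∎)
    where
    open ≡-Reasoning
    k = K ℕ.* 2
    s = fromℕ (suc K)
    one : + k ℤ.- + (2 ℕ.* K) ℤ.+ 1ℤ ≡ 1ℤ
    one = cong (ℤ._+ 1ℤ) (trans (cong (λ j → + k ℤ.- + j) (ℕ.*-comm 2 K)) (ℤ.+-inverseʳ (+ k)))
    half : k ∸ K ≡ K
    half = double∸ K
    e : ∀ s t r → s * (t * r) ≡ t * s * r
    e = solve-∀ ℚ-ring

-- Hurwitz class numbers, their moments, and the plain sum over t.

module ClassNumber where

  open import Defs using (⟨_,_,_⟩; PosForm; posForm; classReps; 1/ω; H; fromℤ; fromℕ; _^_; δ; ∑; _≋?_[mod_]; ∼x²+y²?; ∼x²+xy+y²?; interval; interval-complete; ∣z∣≤∣z²∣)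
  open FinSum
  open Classes using (mass; square?-does; hexagonal?-does)
  open Hecke using (S; S-def)
  open HeckeTrace using (6H⁺)
  open Rational
  open PrimePower using (module Powers)
  open ClassSum using (module EichlerPower)
  open import Data.Integer.Divisibility.Signed using (divides; ∣⇒∣ᵤ) renaming (_∣_ to infix 4 _∥_)
  open import Data.List.Relation.Unary.Any using (here; there)
  open import Data.List.Relation.Unary.AllPairs using ([]; _∷_)
  open import Data.List.Relation.Unary.Unique.Propositional using (Unique)
  open import Data.Rational.Base using (_+_; _*_; _-_; -_; _/_)
  open import Tactic.RingSolver using (solve-∀)

  open ℚΣ

  abstract
    -- Opaque, so that comparing terms never unfolds the enumeration of classes behind `H`.
    h : ℤ → ℚ
    h x = H (fromℤ x)

    h-def : ∀ x → h x ≡ H (fromℤ x)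
    h-def x = refl

  zero# : ℤ → ℚ
  zero# (+ zero) = 1ℚ
  zero# _        = 0ℚ

  zero#≢0 : ∀ {x} → x ≢ 0ℤ → zero# x ≡ 0ℚ
  zero#≢0 {+ zero}   x≢0 = ⊥-elim (x≢0 refl)
  zero#≢0 {+ suc _}  _   = refl
  zero#≢0 { -[1+ _ ]} _   = refl

  mass-1/ω : ∀ {n} (Q : PosForm n) → fromℤ (mass Q) ≡ fromℕ 6 * 1/ω Q
  mass-1/ω Q = trans (cong₂ (λ a b → fromℤ (if a then + 3 else if b then + 2 else + 6)) (square?-does Q) (hexagonal?-does Q))
    (cases (does (∼x²+y²? Q)) (does (∼x²+xy+y²? Q)))
    where
    cases : ∀ a b → fromℤ (if a then + 3 else if b then + 2 else + 6) ≡ fromℕ 6 * (if a then + 1 / 2 else if b then + 1 / 3 else 1ℚ)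
    cases true  b     = refl
    cases false true  = refl
    cases false false = refl

  h-suc : ∀ n → h (+ suc n) ≡ ∑ (classReps n) 1/ω
  h-suc n = trans (h-def (+ suc n)) (cong H (fromℤ≡ (+ suc n)))

  h-neg : ∀ {x} → x ℤ.< 0ℤ → h x ≡ 0ℚ
  h-neg { -[1+ n ]} _ = trans (h-def -[1+ n ]) (cong H (fromℤ≡ -[1+ n ]))
  h-neg {+ _} (+<+ ())

  -- The masses 6 / ω account for positive x; at 0 the value - 1 / 12 has to be put in separately.
  h-formula : ∀ x → h x ≡ (+ 1 / 6) * fromℤ (6H⁺ x) - (+ 1 / 12) * zero# x
  h-formula (+ zero)  = h-def (+ zero)
  h-formula -[1+ n ]  = h-neg { -[1+ n ]} -<+
  h-formula (+ suc n) = trans (h-suc n) (sym (trans (cong (λ u → (+ 1 / 6) * u - (+ 1 / 12) * 0ℚ) six) (e (∑ (classReps n) 1/ω))))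
    where
    six : fromℤ (S n) ≡ fromℕ 6 * ∑ (classReps n) 1/ω
    six = trans (cong fromℤ (S-def n)) (trans (sum-hom ℤ.+-0-isCommutativeMonoid ℚ.+-0-isCommutativeMonoid fromℤ refl fromℤ-+ (classReps n) mass)
      (trans (sum-cong (classReps n) mass-1/ω)
        (sym (sum-hom ℚ.+-0-isCommutativeMonoid ℚ.+-0-isCommutativeMonoid (fromℕ 6 *_) (ℚ.*-zeroʳ (fromℕ 6)) (ℚ.*-distribˡ-+ (fromℕ 6)) (classReps n) 1/ω))))
    e : ∀ x → (+ 1 / 6) * ((+ 6 / 1) * x) - (+ 1 / 12) * 0ℚ ≡ x
    e = solve-∀ ℚ-ring

  -- A form of discriminant - x satisfies b² + x = 4ac.
  h-vanish : ∀ x → (∀ b → ¬ + 4 ∥ b ℤ.* b ℤ.+ x) → h x ≡ 0ℚ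
  h-vanish (+ zero)  no-disc = ⊥-elim (no-disc 0ℤ (divides 0ℤ refl))
  h-vanish -[1+ n ]  _       = h-neg { -[1+ n ]} -<+
  h-vanish (+ suc n) no-disc = trans (h-suc n) (sum-ε (classReps n) (λ {Q} _ → impossible Q))
    where
    impossible : ∀ Q → 1/ω Q ≡ 0ℚ
    impossible (posForm ⟨ a , b , c ⟩ _ D) = ⊥-elim (no-disc b (divides (a ℤ.* c)
      (trans (cong (λ u → b ℤ.* b ℤ.- u) (sym D)) (e a b c))))
      where
      e : ∀ a b c → b ℤ.* b ℤ.- (b ℤ.* b ℤ.- + 4 ℤ.* (a ℤ.* c)) ≡ a ℤ.* c ℤ.* + 4
      e = ℤ.solve-∀

  parity : ∀ d → (∃[ e ] d ≡ + 2 ℤ.* e) ⊎ (∃[ e ] d ≡ 1ℤ ℤ.+ + 2 ℤ.* e)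
  parity d with d ℤ.%ℕ 2 | ℤ.n%ℕd<d d 2 | ℤ.a≡a%ℕn+[a/ℕn]*n d 2
  ... | 0 | _ | eq = inj₁ (d ℤ./ℕ 2 , trans eq (trans (ℤ.+-identityˡ _) (ℤ.*-comm (d ℤ./ℕ 2) (+ 2))))
  ... | 1 | _ | eq = inj₂ (d ℤ./ℕ 2 , trans eq (cong (λ u → 1ℤ ℤ.+ u) (ℤ.*-comm (d ℤ./ℕ 2) (+ 2))))
  ... | suc (suc _) | s≤s (s≤s ()) | _

  2∤1+2e : ∀ e → ¬ + 2 ∥ 1ℤ ℤ.+ + 2 ℤ.* e
  2∤1+2e e (divides q eq) = no-one (∣⇒∣ᵤ (divides (q ℤ.- e) (trans (e₁ e) (trans (cong (λ u → u ℤ.- + 2 ℤ.* e) eq) (e₂ q e)))))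
    where
    e₁ : ∀ e → 1ℤ ≡ 1ℤ ℤ.+ + 2 ℤ.* e ℤ.- + 2 ℤ.* e
    e₁ = ℤ.solve-∀
    e₂ : ∀ q e → q ℤ.* + 2 ℤ.- + 2 ℤ.* e ≡ (q ℤ.- e) ℤ.* + 2
    e₂ = ℤ.solve-∀
    no-one : ¬ 2 ℕ.∣ 1
    no-one d with ℕ.∣1⇒≡1 d
    ... | ()

  -- Modulo 4 the odd number 2μ - 1 equals t² - b². Hence b - t is odd, and t² - b² is - 1 or 1
  -- according to whether t is even or odd.
  trace-parity : ∀ μ n t b → + 4 ∥ n ℤ.- (+ 2 ℤ.* μ ℤ.- 1ℤ) → + 4 ∥ b ℤ.* b ℤ.+ (n ℤ.- t ℤ.* t) → + 2 ∥ t ℤ.- μ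
  trace-parity μ n t b (divides u hu) (divides v hv) with parity (b ℤ.- t)
  ... | inj₁ (e , eq) = ⊥-elim (2∤1+2e (u ℤ.* + 2 ℤ.+ (μ ℤ.- 1ℤ) ℤ.+ + 2 ℤ.* (t ℤ.* e ℤ.+ e ℤ.* e)) (divides (+ 2 ℤ.* v)
      (trans (r₁ u μ t e) (trans (cong₂ (λ x d → x ℤ.+ (+ 2 ℤ.* t ℤ.* d ℤ.+ d ℤ.* d)) (cong (λ x → x ℤ.+ (+ 2 ℤ.* μ ℤ.- 1ℤ)) (sym hu)) (sym eq))
        (trans (r₂ n μ t b) (trans hv (r₃ v)))))))
    where
    r₁ : ∀ u μ t e → 1ℤ ℤ.+ + 2 ℤ.* (u ℤ.* + 2 ℤ.+ (μ ℤ.- 1ℤ) ℤ.+ + 2 ℤ.* (t ℤ.* e ℤ.+ e ℤ.* e))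
       ≡ u ℤ.* + 4 ℤ.+ (+ 2 ℤ.* μ ℤ.- 1ℤ) ℤ.+ (+ 2 ℤ.* t ℤ.* (+ 2 ℤ.* e) ℤ.+ + 2 ℤ.* e ℤ.* (+ 2 ℤ.* e))
    r₁ = ℤ.solve-∀
    r₂ : ∀ n μ t b → n ℤ.- (+ 2 ℤ.* μ ℤ.- 1ℤ) ℤ.+ (+ 2 ℤ.* μ ℤ.- 1ℤ) ℤ.+ (+ 2 ℤ.* t ℤ.* (b ℤ.- t) ℤ.+ (b ℤ.- t) ℤ.* (b ℤ.- t))
       ≡ b ℤ.* b ℤ.+ (n ℤ.- t ℤ.* t)
    r₂ = ℤ.solve-∀
    r₃ : ∀ v → v ℤ.* + 4 ≡ + 2 ℤ.* v ℤ.* + 2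
    r₃ = ℤ.solve-∀
  ... | inj₂ (e , eq) = divides (v ℤ.- u ℤ.- t ℤ.* e ℤ.- e ℤ.* e ℤ.- e ℤ.- μ) (ℤ.*-cancelˡ-≡ (+ 2) _ _
      (trans (r₁ n μ t (1ℤ ℤ.+ + 2 ℤ.* e) u v e) (trans (cong₂ (λ x y → x ℤ.- y ℤ.+ _) (trans (cong (λ d → (t ℤ.+ d) ℤ.* (t ℤ.+ d) ℤ.+ (n ℤ.- t ℤ.* t)) (sym eq)) (trans (r₄ n t b) hv)) hu) (r₃ u v μ t e))))
    where
    r₁ : ∀ n μ t d u v e → + 2 ℤ.* (t ℤ.- μ)
       ≡ (t ℤ.+ d) ℤ.* (t ℤ.+ d) ℤ.+ (n ℤ.- t ℤ.* t) ℤ.- (n ℤ.- (+ 2 ℤ.* μ ℤ.- 1ℤ)) ℤ.+ (+ 2 ℤ.* (t ℤ.- μ) ℤ.- (+ 2 ℤ.* t ℤ.* d ℤ.+ d ℤ.* d ℤ.+ (+ 2 ℤ.* μ ℤ.- 1ℤ)))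
    r₁ = ℤ.solve-∀
    r₃ : ∀ u v μ t e → v ℤ.* + 4 ℤ.- u ℤ.* + 4 ℤ.+ (+ 2 ℤ.* (t ℤ.- μ) ℤ.- (+ 2 ℤ.* t ℤ.* (1ℤ ℤ.+ + 2 ℤ.* e) ℤ.+ (1ℤ ℤ.+ + 2 ℤ.* e) ℤ.* (1ℤ ℤ.+ + 2 ℤ.* e) ℤ.+ (+ 2 ℤ.* μ ℤ.- 1ℤ)))
       ≡ + 2 ℤ.* ((v ℤ.- u ℤ.- t ℤ.* e ℤ.- e ℤ.* e ℤ.- e ℤ.- μ) ℤ.* + 2)
    r₃ = ℤ.solve-∀
    r₄ : ∀ n t b → (t ℤ.+ (b ℤ.- t)) ℤ.* (t ℤ.+ (b ℤ.- t)) ℤ.+ (n ℤ.- t ℤ.* t) ≡ b ℤ.* b ℤ.+ (n ℤ.- t ℤ.* t)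
    r₄ = ℤ.solve-∀

  interval-unique : ∀ B → Unique (interval B)
  interval-unique B = Unique.++⁺ (Unique.map⁺ ℤ.+-injective (Unique.upTo⁺ (suc B))) (Unique.map⁺ ℤ.-[1+-injective (Unique.upTo⁺ B)) disjoint
    where
    disjoint : ∀ {x} → x ∈ map +_ (upTo (suc B)) × x ∈ map -[1+_] (upTo B) → ⊥
    disjoint (p , q) with ∈-map⁻ +_ p | ∈-map⁻ -[1+_] q
    ... | _ , _ , refl | _ , _ , ()

  ∑-filter : ∀ {A : Set} {P : A → Set} (P? : ∀ x → Dec (P x)) xs (f : A → ℚ) → ∑ (filter P? xs) f ≡ ∑ xs (λ x → only (P? x) (f x))
  ∑-filter P? []       f = refl
  ∑-filter P? (x ∷ xs) f with does (P? x)
  ... | true  = cong (λ u → f x + u) (∑-filter P? xs f)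
  ... | false = trans (∑-filter P? xs f) (sym (ℚ.+-identityˡ _))

  only-× : ∀ {P Q : Set} (P? : Dec P) (Q? : Dec Q) x → only (P? ×-dec Q?) x ≡ only P? (only Q? x)
  only-× (yes _) (yes _) x = refl
  only-× (yes _) (no _)  x = refl
  only-× (no _)  _       x = refl

  only-* : ∀ {P : Set} (P? : Dec P) c x → only P? (c * x) ≡ c * only P? x
  only-* (yes _) c x = refl
  only-* (no _)  c x = sym (ℚ.*-zeroʳ c)

  only-+ : ∀ {P : Set} (P? : Dec P) x y → only P? (x + y) ≡ only P? x + only P? y
  only-+ (yes _) x y = refl
  only-+ (no _)  x y = refl

  only-zero : ∀ {P : Set} (P? : Dec P) → only P? 0ℚ ≡ 0ℚ
  only-zero (yes _) = refl
  only-zero (no _)  = refl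

  n-t²<0 : ∀ n t → n ℕ.< ∣ t ∣ → + n ℤ.- t ℤ.* t ℤ.< 0ℤ
  n-t²<0 n t n<t = subst (+ n ℤ.- t ℤ.* t ℤ.<_) (ℤ.+-inverseʳ (t ℤ.* t))
    (ℤ.+-monoˡ-< (ℤ.- (t ℤ.* t)) (subst (+ n ℤ.<_) (square t) (+<+ (ℕ.<-≤-trans n<t (∣z∣≤∣z²∣ t)))))
    where
    square : ∀ t → + ∣ t ℤ.* t ∣ ≡ t ℤ.* t
    square (+ zero)  = refl
    square (+ suc n) = refl
    square -[1+ n ]  = refl

  module Moment (m : ℤ) where

    term : ℕ → (ℤ → ℚ) → ℤ → ℚ
    term n g t = only (t ≋? m [mod 2 ]) (h (+ n ℤ.- t ℤ.* t) * g t)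

    moment : ℕ → (ℤ → ℚ) → ℚ
    moment n g = ∑ (interval n) (term n g)

    moment-hasSum : ∀ n g → HasSum (term n g) (moment n g)
    moment-hasSum n g = hasSum (interval n) (interval-unique n) covered refl
      where
      covered : Covers (interval n) (term n g)
      covered t with ∣ t ∣ ℕ.≤? n
      ... | yes t≤n = inj₁ (interval-complete n t t≤n)
      ... | no t≰n  = inj₂ (trans (cong (only (t ≋? m [mod 2 ])) (trans (cong (_* g t) (h-neg (n-t²<0 n t (ℕ.≰⇒> t≰n)))) (ℚ.*-zeroˡ (g t)))) (only-zero (t ≋? m [mod 2 ])))

    term-+ : ∀ n f g t → term n (λ t → f t + g t) t ≡ term n f t + term n g t
    term-+ n f g t = trans (cong (only (t ≋? m [mod 2 ])) (ℚ.*-distribˡ-+ (h (+ n ℤ.- t ℤ.* t)) (f t) (g t)))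
      (only-+ (t ≋? m [mod 2 ]) (h (+ n ℤ.- t ℤ.* t) * f t) (h (+ n ℤ.- t ℤ.* t) * g t))

    moment-+ : ∀ n f g → moment n (λ t → f t + g t) ≡ moment n f + moment n g
    moment-+ n f g = trans (sum-cong (interval n) (term-+ n f g)) (sum-⊕ (interval n) (term n f) (term n g))

    moment-cong : ∀ n {f g} → (∀ t → f t ≡ g t) → moment n f ≡ moment n g
    moment-cong n f≗g = sum-cong (interval n) (λ t → cong (λ u → only (t ≋? m [mod 2 ]) (h (+ n ℤ.- t ℤ.* t) * u)) (f≗g t))

    moment-* : ∀ n c g → moment n (λ t → c * g t) ≡ c * moment n g
    moment-* n c g = trans (sum-cong (interval n) (λ t → trans (cong (only (t ≋? m [mod 2 ])) (e (h (+ n ℤ.- t ℤ.* t)) c (g t))) (only-* (t ≋? m [mod 2 ]) c _)))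
      (sym (sum-hom ℚ.+-0-isCommutativeMonoid ℚ.+-0-isCommutativeMonoid (c *_) (ℚ.*-zeroʳ c) (ℚ.*-distribˡ-+ c) (interval n) (term n g)))
      where
      e : ∀ h c g → h * (c * g) ≡ c * (h * g)
      e = solve-∀ ℚ-ring

  module Total (p : ℕ) (p-prime : Prime p) (2∤p : ¬ 2 ℕ.∣ p) where

    open Powers p p-prime using (B; D; B-step; D-step; B-1; divisors; 1<p)
    open EichlerPower p p-prime 2∤p using (eichler)

    not-square : ∀ r → ¬ 2 ℕ.∣ r → ∀ t → + (p ℕ.^ r) ≢ t ℤ.* t
    not-square r 2∤r t eq with divisors r ∣ t ∣ ∣ t ∣ (sym (trans (cong ∣_∣ eq) (ℤ.abs-* t t)))
    ... | i , i≤r , d≡ , e≡ = 2∤r (ℕ.divides i (trans (sym (ℕ.m+[n∸m]≡n i≤r)) (trans (cong (λ u → i ℕ.+ u) (sym i≡)) (trans (cong (λ u → i ℕ.+ u) (sym (ℕ.+-identityʳ i))) (ℕ.*-comm 2 i)))))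
      where
      i≡ : i ≡ r ℕ.∸ i
      i≡ = [ (λ i<j → ⊥-elim (ℕ.<⇒≢ (ℕ.^-monoʳ-< p 1<p i<j) (trans (sym d≡) e≡))) , [ (λ q → q) , (λ j<i → ⊥-elim (ℕ.<⇒≢ (ℕ.^-monoʳ-< p 1<p j<i) (trans (sym e≡) d≡))) ]′ ]′ (compare i (r ℕ.∸ i))
        where
        compare : ∀ i j → i ℕ.< j ⊎ (i ≡ j ⊎ j ℕ.< i)
        compare i j with ℕ.m≤n⇒m<n∨m≡n {i} {j}
        ... | split with ℕ.≤-<-connex i j
        ...   | inj₂ j<i = inj₂ (inj₂ j<i)
        ...   | inj₁ i≤j = [ inj₁ , (λ q → inj₂ (inj₁ q)) ]′ (split i≤j)

    squares : ∀ r (even? : Dec (2 ℕ.∣ r)) → HasSum (λ t → zero# (+ (p ℕ.^ r) ℤ.- t ℤ.* t)) ((1ℚ + 1ℚ) * δ even?)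
    squares r (no 2∤r) = HasSum-ε (λ t → zero#≢0 (λ eq → not-square r 2∤r t (ℤ.i-j≡0⇒i≡j _ _ eq)))
    squares r (yes (ℕ.divides q refl)) = hasSum (a ∷ ℤ.- a ∷ []) ((a≢-a All.∷ All.[]) ∷ (All.[] ∷ [])) covered
        (cong₂ (λ x y → x + (y + 0ℚ)) (at a refl) (at (ℤ.- a) (e₁ a)))
      where
      a = + (p ℕ.^ q)
      aa : + (p ℕ.^ (q ℕ.* 2)) ≡ a ℤ.* a
      aa = trans (cong (λ e → + (p ℕ.^ e)) (trans (ℕ.*-comm q 2) (cong (λ u → q ℕ.+ u) (ℕ.+-identityʳ q)))) (trans (cong +_ (ℕ.^-distribˡ-+-* p q q)) (ℤ.pos-* (p ℕ.^ q) (p ℕ.^ q)))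
      e₁ : ∀ a → ℤ.- a ℤ.* ℤ.- a ≡ a ℤ.* a
      e₁ = ℤ.solve-∀
      at : ∀ t → t ℤ.* t ≡ a ℤ.* a → zero# (+ (p ℕ.^ (q ℕ.* 2)) ℤ.- t ℤ.* t) ≡ 1ℚ
      at t eq = cong zero# (trans (cong₂ ℤ._-_ aa eq) (ℤ.+-inverseʳ (a ℤ.* a)))
      positive : 0 ℕ.< p ℕ.^ q
      positive = ℕ.m^n>0 p {{ℕ.>-nonZero (ℕ.<⇒≤ 1<p)}} q
      a≢-a : a ≢ ℤ.- a
      a≢-a eq = clash positive eq
        where
        clash : ∀ {x} → 0 ℕ.< x → + x ≢ ℤ.- + x
        clash (s≤s _) ()
      covered : ∀ t → t ∈ a ∷ ℤ.- a ∷ [] ⊎ zero# (+ (p ℕ.^ (q ℕ.* 2)) ℤ.- t ℤ.* t) ≡ 0ℚ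
      covered t with t ℤ.≟ a | t ℤ.≟ ℤ.- a
      ... | yes t≡ | _      = inj₁ (here t≡)
      ... | no _   | yes t≡ = inj₁ (there (here t≡))
      ... | no t≢a | no t≢-a = inj₂ (zero#≢0 (λ eq → [ (λ u → t≢a (sym (ℤ.i-j≡0⇒i≡j _ _ u))) , (λ u → t≢-a (from-sum t u)) ]′
            (ℤ.i*j≡0⇒i≡0∨j≡0 (a ℤ.- t) (trans (e a t) (trans (cong (λ x → x ℤ.- t ℤ.* t) (sym aa)) eq)))))
        where
        e : ∀ a t → (a ℤ.- t) ℤ.* (a ℤ.+ t) ≡ a ℤ.* a ℤ.- t ℤ.* t
        e = ℤ.solve-∀
        from-sum : ∀ t → a ℤ.+ t ≡ 0ℤ → t ≡ ℤ.- a
        from-sum t u = trans (e′ a t) (trans (cong (λ x → x ℤ.- a) u) (ℤ.+-identityˡ (ℤ.- a)))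
          where
          e′ : ∀ a t → t ≡ a ℤ.+ t ℤ.- a
          e′ = ℤ.solve-∀

    δ-step : ∀ r → δ (2 ℕ.∣? (2 ℕ.+ r)) ≡ δ (2 ℕ.∣? r)
    δ-step r = only-⇔ (2 ℕ.∣? (2 ℕ.+ r)) (2 ℕ.∣? r) (λ d → ℕ.∣m+n∣m⇒∣n d (ℕ.divides 1 refl)) (ℕ.∣m∣n⇒∣m+n (ℕ.divides 1 refl))

    D-δ : ∀ r → fromℤ (D r) ≡ δ (2 ℕ.∣? r)
    D-δ zero          = refl
    D-δ (suc zero)    = refl
    D-δ (suc (suc r)) = trans (cong fromℤ (D-step r)) (trans (D-δ r) (sym (δ-step r)))

    -- The δ comes from the two t with t² = p^r: each contributes H(0) = - 1 / 12, where `6H⁺` is 0.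
    total-h : ℕ → ℚ
    total-h r = (+ 1 / 6) * (fromℤ (B r) - δ (2 ℕ.∣? r))

    class-number-sum : ∀ r → HasSum (λ t → h (+ (p ℕ.^ r) ℤ.- t ℤ.* t)) (total-h r)
    class-number-sum r = HasSum-≡ (e (fromℤ (B r)) (δ (2 ℕ.∣? r)))
      (HasSum-cong (λ t → trans (r₁ (fromℤ (6H⁺ (N t))) (zero# (N t))) (sym (h-formula (N t))))
        (HasSum-⊕ {f = λ t → (+ 1 / 6) * fromℤ (6H⁺ (N t))} {g = λ t → - (+ 1 / 12) * zero# (N t)}
          (HasSum-hom ℤ.+-0-isCommutativeMonoid ℚ.+-0-isCommutativeMonoid (λ x → (+ 1 / 6) * fromℤ x) refl (λ x y → trans (cong ((+ 1 / 6) *_) (fromℤ-+ x y)) (ℚ.*-distribˡ-+ (+ 1 / 6) (fromℤ x) (fromℤ y))) (eichler r))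
          (HasSum-hom ℚ.+-0-isCommutativeMonoid ℚ.+-0-isCommutativeMonoid (- (+ 1 / 12) *_) refl (ℚ.*-distribˡ-+ (- (+ 1 / 12))) (squares r (2 ℕ.∣? r)))))
      where
      N : ℤ → ℤ
      N t = + (p ℕ.^ r) ℤ.- t ℤ.* t
      r₁ : ∀ x z → (+ 1 / 6) * x + - (+ 1 / 12) * z ≡ (+ 1 / 6) * x - (+ 1 / 12) * z
      r₁ = solve-∀ ℚ-ring
      e : ∀ b d → (+ 1 / 6) * b + - (+ 1 / 12) * ((1ℚ + 1ℚ) * d) ≡ (+ 1 / 6) * (b - d)
      e = solve-∀ ℚ-ring

    total-1 : total-h 1 ≡ (+ 1 / 3) * (fromℕ p - (1ℚ + 1ℚ))
    total-1 = trans (cong (λ u → (+ 1 / 6) * (u - 0ℚ)) (trans (cong fromℤ B-1) (trans (fromℤ-- (+ 2 ℤ.* + p) (+ 4)) (cong (_- fromℕ 4) (fromℤ-* (+ 2) (+ p)))))) (e (fromℕ p))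
      where
      e : ∀ p → (+ 1 / 6) * ((+ 2 / 1) * p - (+ 4 / 1) - 0ℚ) ≡ (+ 1 / 3) * (p - (1ℚ + 1ℚ))
      e = solve-∀ ℚ-ring

    -- Subtracting δ from `B` makes the recursion clean: the term (1 - p) δ of `B-step` is absorbed.
    total-step : ∀ r → total-h (2 ℕ.+ r) ≡ fromℕ p * total-h r + (+ 1 / 3) * (fromℕ (p ℕ.^ (2 ℕ.+ r)) - (1ℚ + 1ℚ))
    total-step r = trans (cong₂ (λ x y → (+ 1 / 6) * (x - y)) B≡ (δ-step r)) (e (fromℕ p) (fromℤ (B r)) (δ (2 ℕ.∣? r)) n)
      where
      n = fromℕ (p ℕ.^ (2 ℕ.+ r))
      B≡ : fromℤ (B (2 ℕ.+ r)) ≡ fromℕ p * fromℤ (B r) + (1ℚ - fromℕ p) * δ (2 ℕ.∣? r) + fromℕ 2 * n - fromℕ 4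
      B≡ = trans (cong fromℤ (B-step r)) (trans (fromℤ-- (+ p ℤ.* B r ℤ.+ (1ℤ ℤ.- + p) ℤ.* D r ℤ.+ + 2 ℤ.* + (p ℕ.^ (2 ℕ.+ r))) (+ 4)) (cong (_- fromℕ 4)
        (trans (fromℤ-+ (+ p ℤ.* B r ℤ.+ (1ℤ ℤ.- + p) ℤ.* D r) (+ 2 ℤ.* + (p ℕ.^ (2 ℕ.+ r)))) (cong₂ _+_
          (trans (fromℤ-+ (+ p ℤ.* B r) ((1ℤ ℤ.- + p) ℤ.* D r)) (cong₂ _+_ (fromℤ-* (+ p) (B r))
            (trans (fromℤ-* (1ℤ ℤ.- + p) (D r)) (cong₂ _*_ (fromℤ-- 1ℤ (+ p)) (D-δ r)))))
          (fromℤ-* (+ 2) (+ (p ℕ.^ (2 ℕ.+ r))))))))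
      e : ∀ p b d n → (+ 1 / 6) * (p * b + (1ℚ - p) * d + (+ 2 / 1) * n - (+ 4 / 1) - d) ≡ p * ((+ 1 / 6) * (b - d)) + (+ 1 / 3) * (n - (1ℚ + 1ℚ))
      e = solve-∀ ℚ-ring

-- Coefficients of the Rankin-Cohen bracket.

module Series where

  open import Defs using (fromℤ; fromℕ; _^_; ∑; _≋?_[mod_]; interval; interval-complete; ∣z∣≤∣z²∣; binomial; D^; _·_; _∣V_; 𝓗-series; θ; RankinCohen; Λ; λ-coeff; f; C-nonZero; α)
  open FinSum
  open Rational
  open Binomials
  open Chebyshev
  open ClassNumber
  open import Data.Nat.Combinatorics using (_C_)
  open import Data.Rational.Base using (_+_; _*_; _-_; -_; _/_)
  open import Tactic.RingSolver using (solve-∀)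

  open ℚΣ

  ∣V1 : ∀ F a → (F ∣V 1) a ≡ F a
  ∣V1 F a with 1 ℕ.∣? a
  ... | yes (ℕ.divides q eq) = cong F (sym (trans eq (ℕ.*-identityʳ q)))
  ... | no 1∤a = ⊥-elim (1∤a (ℕ.divides a (sym (ℕ.*-identityʳ a))))

  +∣²∣ : ∀ s → + ∣ s ℤ.* s ∣ ≡ s ℤ.* s
  +∣²∣ (+ zero)  = refl
  +∣²∣ (+ suc n) = refl
  +∣²∣ -[1+ n ]  = refl

  only-cong : ∀ {P : Set} (P? : Dec P) {x y} → (P → x ≡ y) → only P? x ≡ only P? y
  only-cong (yes p) eq = eq p
  only-cong (no _)  eq = refl

  module Coefficients (m : ℤ) where

    open Moment m

    -- A range independent of b allows the sums in `convolution` to be exchanged.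
    θ-interval : ∀ {b n} → b ℕ.≤ n →
      θ 0 m 2 b ≡ ∑ (interval n) (λ s → only (s ℤ.* s ℤ.≟ + b) (only (s ≋? m [mod 2 ]) 1ℚ))
    θ-interval {b} {n} b≤n = trans (∑-filter (λ s → (s ℤ.* s ℤ.≟ + b) ×-dec (s ≋? m [mod 2 ])) (interval b) (λ s → 1ℚ))
      (trans (sum-cong (interval b) (λ s → only-× (s ℤ.* s ℤ.≟ + b) (s ≋? m [mod 2 ]) 1ℚ))
        (sum-cover (interval-unique b) (interval-unique n) (covered ℕ.≤-refl) (covered b≤n)))
      where
      covered : ∀ {c} → b ℕ.≤ c → Covers (interval c) (λ s → only (s ℤ.* s ℤ.≟ + b) (only (s ≋? m [mod 2 ]) 1ℚ))
      covered {c} b≤c s with ∣ s ∣ ℕ.≤? c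
      ... | yes s≤c = inj₁ (interval-complete c s s≤c)
      ... | no s≰c  = inj₂ (only-no (s ℤ.* s ℤ.≟ + b) (λ eq → s≰c (ℕ.≤-trans (∣z∣≤∣z²∣ s) (ℕ.≤-trans (ℕ.≤-reflexive (cong ∣_∣ eq)) b≤c))))

    -- For each s only the index a = n - s² contributes, and the derivatives multiply by powers of
    -- the two exponents.
    convolution : ∀ n i e →
      (D^ i (𝓗-series ∣V 1) · D^ e (θ 0 m 2)) n ≡ moment n (λ s → fromℤ (+ n ℤ.- s ℤ.* s) ^ i * fromℤ (s ℤ.* s) ^ e)
    convolution n i e = begin
      ∑ (upTo (suc n)) (λ a → fromℕ a ^ i * (𝓗-series ∣V 1) a * (fromℕ (n ∸ a) ^ e * θ 0 m 2 (n ∸ a)))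
        ≡⟨ sum-cong (upTo (suc n)) expand ⟩
      ∑ (upTo (suc n)) (λ a → ∑ (interval n) (λ s → cell s a))
        ≡⟨ sum-swap (upTo (suc n)) (interval n) (λ a s → cell s a) ⟩
      ∑ (interval n) (λ s → ∑ (upTo (suc n)) (cell s))
        ≡⟨ sum-cong (interval n) (λ s → collect s (∣ s ℤ.* s ∣ ℕ.≤? n)) ⟩
      moment n (λ s → fromℤ (+ n ℤ.- s ℤ.* s) ^ i * fromℤ (s ℤ.* s) ^ e) ∎
      where
      open ≡-Reasoning
      w : ℕ → ℚ
      w a = h (+ a) * (fromℕ a ^ i * fromℕ (n ∸ a) ^ e)
      cell : ℤ → ℕ → ℚ
      cell s a = only (s ℤ.* s ℤ.≟ + (n ∸ a)) (only (s ≋? m [mod 2 ]) (w a))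
      expand : ∀ a → fromℕ a ^ i * (𝓗-series ∣V 1) a * (fromℕ (n ∸ a) ^ e * θ 0 m 2 (n ∸ a)) ≡ ∑ (interval n) (λ s → cell s a)
      expand a = trans (cong₂ (λ u v → fromℕ a ^ i * u * (fromℕ (n ∸ a) ^ e * v)) (trans (∣V1 𝓗-series a) (sym (h-def (+ a)))) (θ-interval (ℕ.m∸n≤m n a)))
        (trans (r (fromℕ a ^ i) (h (+ a)) (fromℕ (n ∸ a) ^ e) _)
          (trans (sym (∑-* (w a) (interval n) (λ s → only (s ℤ.* s ℤ.≟ + (n ∸ a)) (only (s ≋? m [mod 2 ]) 1ℚ))))
            (sum-cong (interval n) (λ s → pull (s ℤ.* s ℤ.≟ + (n ∸ a)) (s ≋? m [mod 2 ]) (w a)))))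
        where
        r : ∀ a h b t → a * h * (b * t) ≡ h * (a * b) * t
        r = solve-∀ ℚ-ring
        pull : ∀ {P Q : Set} (P? : Dec P) (Q? : Dec Q) w → w * only P? (only Q? 1ℚ) ≡ only P? (only Q? w)
        pull (yes _) (yes _) w = ℚ.*-identityʳ w
        pull (yes _) (no _)  w = ℚ.*-zeroʳ w
        pull (no _)  _       w = ℚ.*-zeroʳ w
      collect : ∀ s → Dec (∣ s ℤ.* s ∣ ℕ.≤ n) → ∑ (upTo (suc n)) (cell s) ≡ term n (λ s → fromℤ (+ n ℤ.- s ℤ.* s) ^ i * fromℤ (s ℤ.* s) ^ e) s
      collect s (no q≰n) = trans (sum-ε (upTo (suc n)) (λ {a} _ → only-no (s ℤ.* s ℤ.≟ + (n ∸ a)) (λ eq → q≰n (ℕ.≤-trans (ℕ.≤-reflexive (cong ∣_∣ eq)) (ℕ.m∸n≤m n a)))))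
        (sym (trans (cong (only (s ≋? m [mod 2 ])) (trans (cong (_* g) (h-neg negative)) (ℚ.*-zeroˡ g))) (only-zero (s ≋? m [mod 2 ]))))
        where
        g = fromℤ (+ n ℤ.- s ℤ.* s) ^ i * fromℤ (s ℤ.* s) ^ e
        negative : + n ℤ.- s ℤ.* s ℤ.< 0ℤ
        negative = subst (+ n ℤ.- s ℤ.* s ℤ.<_) (ℤ.+-inverseʳ (s ℤ.* s))
          (ℤ.+-monoˡ-< (ℤ.- (s ℤ.* s)) (subst (+ n ℤ.<_) (+∣²∣ s) (ℤ.+<+ (ℕ.≰⇒> q≰n))))
      collect s (yes q≤n) = trans (sum-cong-∈ (upTo (suc n)) (λ {a} a∈ →
          only-⇔ (s ℤ.* s ℤ.≟ + (n ∸ a)) (a₀ ≟ a) {only (s ≋? m [mod 2 ]) (w a)}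
            (λ eq → trans (cong (λ z → n ∸ ∣ z ∣) eq) (ℕ.m∸[m∸n]≡n (ℕ.≤-pred (∈-upTo⁻ a∈))))
            (λ { refl → trans (sym (+∣²∣ s)) (cong +_ (sym (ℕ.m∸[m∸n]≡n q≤n))) })))
        (trans (sum-only (Unique.upTo⁺ (suc n)) (∈-upTo⁺ (s≤s (ℕ.m∸n≤m n q))) (λ a → only (s ≋? m [mod 2 ]) (w a)))
          (cong (only (s ≋? m [mod 2 ])) (cong₂ (λ y x → h y * (fromℤ y ^ i * fromℤ x ^ e)) a₀≡
            (trans (cong +_ (ℕ.m∸[m∸n]≡n q≤n)) (+∣²∣ s)))))
        where
        q = ∣ s ℤ.* s ∣
        a₀ = n ∸ q
        a₀≡ : + a₀ ≡ + n ℤ.- s ℤ.* s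
        a₀≡ = trans (sym (ℤ.⊖-≥ q≤n)) (trans (sym (ℤ.[+m]-[+n]≡m⊖n n q)) (cong (λ u → + n ℤ.- u) (+∣²∣ s)))

    moment-∑ : ∀ n (xs : List ℕ) (g : ℕ → ℤ → ℚ) → ∑ xs (λ i → moment n (g i)) ≡ moment n (λ t → ∑ xs (λ i → g i t))
    moment-∑ n []       g = sym (sum-ε (interval n) (λ {t} _ → trans (cong (only (t ≋? m [mod 2 ])) (ℚ.*-zeroʳ (h (+ n ℤ.- t ℤ.* t)))) (only-zero (t ≋? m [mod 2 ]))))
    moment-∑ n (x ∷ xs) g = trans (cong (λ u → moment n (g x) + u) (moment-∑ n xs g)) (sym (moment-+ n (g x) (λ t → ∑ xs (λ i → g i t))))

    chebyshev : ℕ → ℕ → ℤ → ℚ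
    chebyshev n ν t = Powers√.V (fromℤ (+ n ℤ.- t ℤ.* t)) (fromℤ (t ℤ.* t)) ν

    -- The coefficients are supplied by `bracket-coefficient`; the signs combine with the powers of
    -- n - t² into powers of its negative, which gives the polynomial `V` term by term.
    bracket : ∀ n ν → 4ℚ ^ ν * RankinCohen (+ 3 / 2) (½ + fromℕ 0) ν (𝓗-series ∣V 1) (θ 0 m 2) n ≡ central ν * moment n (chebyshev n ν)
    bracket n ν = begin
      4ℚ ^ ν * ∑ (upTo (suc ν)) (λ i → coefficient i * (D^ i (𝓗-series ∣V 1) · D^ (ν ∸ i) (θ 0 m 2)) n)
        ≡⟨ ∑-* (4ℚ ^ ν) (upTo (suc ν)) (λ i → coefficient i * (D^ i (𝓗-series ∣V 1) · D^ (ν ∸ i) (θ 0 m 2)) n) ⟨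
      ∑ (upTo (suc ν)) (λ i → 4ℚ ^ ν * (coefficient i * (D^ i (𝓗-series ∣V 1) · D^ (ν ∸ i) (θ 0 m 2)) n))
        ≡⟨ sum-cong-∈ (upTo (suc ν)) (λ {i} i∈ → each i (ℕ.≤-pred (∈-upTo⁻ i∈))) ⟩
      ∑ (upTo (suc ν)) (λ i → moment n (λ t → central ν * monomial i t))
        ≡⟨ moment-∑ n (upTo (suc ν)) (λ i t → central ν * monomial i t) ⟩
      moment n (λ t → ∑ (upTo (suc ν)) (λ i → central ν * monomial i t))
        ≡⟨ moment-cong n (λ t → trans (∑-* (central ν) (upTo (suc ν)) (λ i → monomial i t)) (cong (central ν *_) (G-∑ (- fromℤ (+ n ℤ.- t ℤ.* t)) (odd ν) ν (fromℤ (t ℤ.* t) ^_)))) ⟩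
      moment n (λ t → central ν * chebyshev n ν t)
        ≡⟨ moment-* n (central ν) (chebyshev n ν) ⟩
      central ν * moment n (chebyshev n ν) ∎
      where
      open ≡-Reasoning
      -- The Pascal coefficients are the same for all parameters; the zeros are placeholders.
      open Powers√ 0ℚ 0ℚ using (odd)
      coefficient : ℕ → ℚ
      coefficient i = (- 1ℚ) ^ i * binomial ((+ 3 / 2) + fromℕ ν - 1ℚ) (ν ∸ i) * binomial ((½ + fromℕ 0) + fromℕ ν - 1ℚ) i
      monomial : ℕ → ℤ → ℚ
      monomial i t = odd ν i * (- fromℤ (+ n ℤ.- t ℤ.* t)) ^ i * fromℤ (t ℤ.* t) ^ (ν ∸ i)
      each : ∀ i → i ℕ.≤ ν → 4ℚ ^ ν * (coefficient i * (D^ i (𝓗-series ∣V 1) · D^ (ν ∸ i) (θ 0 m 2)) n) ≡ moment n (λ t → central ν * monomial i t)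
      each i i≤ν = trans (cong (λ u → 4ℚ ^ ν * (coefficient i * u)) (convolution n i (ν ∸ i)))
        (trans (sym (ℚ.*-assoc (4ℚ ^ ν) (coefficient i) _)) (trans (sym (moment-* n (4ℚ ^ ν * coefficient i) _)) (moment-cong n pointwise)))
        where
        pointwise : ∀ t → 4ℚ ^ ν * coefficient i * (fromℤ (+ n ℤ.- t ℤ.* t) ^ i * fromℤ (t ℤ.* t) ^ (ν ∸ i)) ≡ central ν * monomial i t
        pointwise t = trans (cong₂ (λ a b → 4ℚ ^ ν * ((- 1ℚ) ^ i * binomial a (ν ∸ i) * binomial b i) * (N ^ i * X)) (r₁ (fromℕ ν)) (r₂ (fromℕ ν)))
          (trans (r₃ (4ℚ ^ ν) ((- 1ℚ) ^ i) (binomial (fromℕ ν + ½) (ν ∸ i)) (binomial (fromℕ ν - ½) i) (N ^ i) X)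
            (trans (cong₂ (λ a b → a * (b * X)) (bracket-coefficient ν i (ν ∸ i) (ℕ.m+[n∸m]≡n i≤ν)) (trans (sym (^-* (- 1ℚ) N i)) (cong (_^ i) (r₄ N))))
              (r₅ (central ν) (odd ν i) ((- N) ^ i) X)))
          where
          N = fromℤ (+ n ℤ.- t ℤ.* t)
          X = fromℤ (t ℤ.* t) ^ (ν ∸ i)
          r₁ : ∀ x → (+ 3 / 2) + x - 1ℚ ≡ x + ½
          r₁ = solve-∀ ℚ-ring
          r₂ : ∀ x → (½ + 0ℚ) + x - 1ℚ ≡ x - ½
          r₂ = solve-∀ ℚ-ring
          r₃ : ∀ q s a b N X → q * (s * a * b) * (N * X) ≡ q * (a * b) * (s * N * X)
          r₃ = solve-∀ ℚ-ring
          r₄ : ∀ x → - 1ℚ * x ≡ - x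
          r₄ = solve-∀ ℚ-ring
          r₅ : ∀ c o n X → c * o * (n * X) ≡ c * (o * n * X)
          r₅ = solve-∀ ℚ-ring

    half : ∀ ν → ⌊ ν ℕ.* 2 /2⌋ ≡ ν
    half zero    = refl
    half (suc ν) = cong suc (half ν)

    Λ-positive : ∀ ℓ n .{{_ : NonZero n}} → Λ ℓ m 2 1 n ≡ λ-coeff ℓ m 2 1 n
    Λ-positive ℓ (suc n) = refl

    f-even : ∀ ν n → f (ν ℕ.* 2) m 2 1 n ≡
      RankinCohen (+ 3 / 2) (½ + fromℕ 0) ν (𝓗-series ∣V 1) (θ 0 m 2) n + (+ 1 / 1) * ½ ^ suc (ν ℕ.* 2) * central ν * Λ (ν ℕ.* 2) m 2 1 n
    f-even ν n = cong₂ (λ j k → RankinCohen (+ 3 / 2) (½ + fromℕ j) k (𝓗-series ∣V 1) (θ j m 2) n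
        + (+ 1 / 1) * ½ ^ suc (ν ℕ.* 2) * fromℕ ((ν ℕ.* 2) C k) * Λ (ν ℕ.* 2) m 2 1 n) (ℕ.m*n%n≡0 ν 2) (half ν)

    quarter : ∀ ν → 4ℚ ^ ν * ½ ^ suc (ν ℕ.* 2) ≡ ½
    quarter ν = trans (r (4ℚ ^ ν) (½ ^ (ν ℕ.* 2))) (trans (cong (½ *_) (trans (cong (4ℚ ^ ν *_) (^-double ½ ν)) (trans (sym (^-* 4ℚ (½ * ½) ν)) (1^ ν)))) refl)
      where
      r : ∀ q x → q * (½ * x) ≡ ½ * (q * x)
      r = solve-∀ ℚ-ring

    -- The normalisation of `α` cancels the central binomial coefficient. The factor 4^ν clears the
    -- half-integer binomials and reduces 2^(- 1 - 2ν) in front of `Λ` to one half.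
    α-even : ∀ ν n .{{_ : NonZero n}} → 4ℚ ^ ν * α (ν ℕ.* 2) m 2 1 n ≡ moment n (chebyshev n ν) + ½ * λ-coeff (ν ℕ.* 2) m 2 1 n
    α-even ν n = begin
      4ℚ ^ ν * (u * f (ν ℕ.* 2) m 2 1 n)                ≡⟨ cong (λ x → 4ℚ ^ ν * (u * x)) (f-even ν n) ⟩
      4ℚ ^ ν * (u * (rc + 1ℚ * z * c * Λ (ν ℕ.* 2) m 2 1 n)) ≡⟨ cong (λ x → 4ℚ ^ ν * (u * (rc + 1ℚ * z * c * x))) (Λ-positive (ν ℕ.* 2) n) ⟩
      4ℚ ^ ν * (u * (rc + 1ℚ * z * c * L))              ≡⟨ r₁ (4ℚ ^ ν) u rc z c L ⟩
      u * (4ℚ ^ ν * rc) + u * c * (4ℚ ^ ν * z) * L      ≡⟨ cong₂ (λ x y → u * x + u * c * y * L) (bracket n ν) (quarter ν) ⟩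
      u * (c * M) + u * c * ½ * L                       ≡⟨ r₂ u c M L ⟩
      u * c * (M + ½ * L)                               ≡⟨ cong (_* (M + ½ * L)) uc ⟩
      1ℚ * (M + ½ * L)                                  ≡⟨ ℚ.*-identityˡ (M + ½ * L) ⟩
      M + ½ * L                                         ∎
      where
      open ≡-Reasoning
      ℓ = ν ℕ.* 2
      u : ℚ
      u = (+ 1 / (ℓ C ⌊ ℓ /2⌋)) {{C-nonZero (ℕ.⌊n/2⌋≤n ℓ)}}
      rc = RankinCohen (+ 3 / 2) (½ + fromℕ 0) ν (𝓗-series ∣V 1) (θ 0 m 2) n
      z = ½ ^ suc (ν ℕ.* 2)
      c = central ν
      L = λ-coeff (ν ℕ.* 2) m 2 1 n
      M = moment n (chebyshev n ν)
      unit : ∀ d .{{_ : NonZero d}} → (+ 1 / d) * fromℕ d ≡ 1ℚ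
      unit (suc d) = fraction (+ 1) d
      uc : u * c ≡ 1ℚ
      uc = trans (cong (λ k → u * fromℕ (ℓ C k)) (sym (half ν))) (unit (ℓ C ⌊ ℓ /2⌋) {{C-nonZero (ℕ.⌊n/2⌋≤n ℓ)}})
      r₁ : ∀ q u rc z c L → q * (u * (rc + 1ℚ * z * c * L)) ≡ u * (q * rc) + u * c * (q * z) * L
      r₁ = solve-∀ ℚ-ring
      r₂ : ∀ u c M L → u * (c * M) + u * c * ½ * L ≡ u * c * (M + ½ * L)
      r₂ = solve-∀ ℚ-ring

-- The sums λ at prime powers.

module Lambda where

  open import Defs using (fromℤ; fromℕ; _^_; ∑; _≋_[mod_]; _≋?_[mod_]; λ-weight; λ-coeff)
  open FinSum
  open Rational
  open Chebyshev using (∑-*; ∑-first)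
  open ClassNumber
  open Series using (only-cong)
  open ClassSum using (halve; module EichlerPower)
  open PrimePower using (module Powers)
  open import Data.Integer.Divisibility.Signed using (divides; ∣m∣n⇒∣m+n) renaming (_∣_ to infix 4 _∥_)
  open import Data.Rational.Base using (_+_; _*_; _-_; -_)
  open import Tactic.RingSolver using (solve-∀)

  open ℚΣ

  ^-swap : ∀ x i e → (x ^ i) ^ e ≡ (x ^ e) ^ i
  ^-swap x zero    e = 1^ e
  ^-swap x (suc i) e = trans (^-* x (x ^ i) e) (cong (x ^ e *_) (^-swap x i e))

  Solution : ℕ → ℕ × ℕ → Set
  Solution n (t , s) = + (t ℕ.^ 2) ℤ.- + (1 ℕ.* s ℕ.^ 2) ≡ + n

  solution? : ∀ n ts → Dec (Solution n ts)
  solution? n (t , s) = + (t ℕ.^ 2) ℤ.- + (1 ℕ.* s ℕ.^ 2) ℤ.≟ + n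

  difference-of-squares : ∀ t s → + (t ℕ.^ 2) ℤ.- + (1 ℕ.* s ℕ.^ 2) ≡ + t ℤ.* + t ℤ.- + s ℤ.* + s
  difference-of-squares t s = cong₂ ℤ._-_ (square t) (trans (cong +_ (ℕ.*-identityˡ (s ℕ.^ 2))) (square s))
    where
    square : ∀ t → + (t ℕ.^ 2) ≡ + t ℤ.* + t
    square t = trans (cong (λ u → + (t ℕ.* u)) (ℕ.*-identityʳ t)) (ℤ.pos-* t t)

  factored : ∀ d s → + (d ℕ.+ s) ℤ.* + (d ℕ.+ s) ℤ.- + s ℤ.* + s ≡ + (d ℕ.* (d ℕ.+ (s ℕ.+ s)))
  factored d s = trans (e (+ d) (+ s)) (sym (ℤ.pos-* d (d ℕ.+ (s ℕ.+ s))))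
    where
    e : ∀ d s → (d ℤ.+ s) ℤ.* (d ℤ.+ s) ℤ.- s ℤ.* s ≡ d ℤ.* (d ℤ.+ (s ℤ.+ s))
    e = ℤ.solve-∀

  solution : ∀ d s {n} → d ℕ.* (d ℕ.+ (s ℕ.+ s)) ≡ n → Solution n (d ℕ.+ s , s)
  solution d s eq = trans (difference-of-squares (d ℕ.+ s) s) (trans (factored d s) (cong +_ eq))

  factors : ∀ {n} t s → 0 ℕ.< n → Solution n (t , s) → ∃[ d ] t ≡ d ℕ.+ s × d ℕ.* (d ℕ.+ (s ℕ.+ s)) ≡ n
  factors {n} t s 0<n sol with ℕ.≤-total s t
  ... | inj₁ s≤t = t ∸ s , sym (ℕ.m∸n+n≡m s≤t) , ℤ.+-injective (trans (sym (factored (t ∸ s) s))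
          (trans (cong (λ u → + u ℤ.* + u ℤ.- + s ℤ.* + s) (ℕ.m∸n+n≡m s≤t)) (trans (sym (difference-of-squares t s)) sol)))
  ... | inj₂ t≤s = ⊥-elim (ℤ.<⇒≱ (ℤ.+<+ 0<n) (subst (ℤ._≤ 0ℤ) (trans (sym (difference-of-squares t s)) sol)
          (ℤ.i≤j⇒i-j≤0 (subst₂ ℤ._≤_ (ℤ.pos-* t t) (ℤ.pos-* s s) (ℤ.+≤+ (ℕ.*-mono-≤ t≤s t≤s))))))

  λ-sum : ℕ → ℕ → ℚ
  λ-sum ℓ n = ∑ (cartesianProduct (map suc (upTo n)) (upTo (suc n)))
    (λ ts → only (solution? n ts) (λ-weight (proj₂ ts) * fromℤ (+ proj₁ ts ℤ.- + (1 ℕ.* proj₂ ts)) ^ suc ℓ))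

  -- The congruence on t follows from t² - s² = n.
  λ-coeff-even : ∀ ν m n → + 4 ∥ + n ℤ.- (+ 2 ℤ.* m ℤ.- 1ℤ) → λ-coeff (ν ℕ.* 2) m 2 1 n ≡ (1ℚ + 1ℚ) * λ-sum (ν ℕ.* 2) n
  λ-coeff-even ν m n n≡ = trans (cong₂ (λ x y → x + (y + 0ℚ)) (each 1ℤ (λ t d → subst (+ 2 ∥_) (e₁ t m) d) one) (each -1ℤ (λ t d → subst (+ 2 ∥_) (e₂ t m) (∣m∣n⇒∣m+n d (divides m (ℤ.*-comm (+ 2) m)))) minus-one))
      (e (λ-sum (ν ℕ.* 2) n))
    where
    e : ∀ x → 1ℚ * x + (1ℚ * x + 0ℚ) ≡ (1ℚ + 1ℚ) * x
    e = solve-∀ ℚ-ring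
    e₁ : ∀ t m → t ℤ.- m ≡ t ℤ.- 1ℤ ℤ.* m
    e₁ = ℤ.solve-∀
    e₂ : ∀ t m → t ℤ.- m ℤ.+ + 2 ℤ.* m ≡ t ℤ.- -1ℤ ℤ.* m
    e₂ = ℤ.solve-∀
    one : fromℤ 1ℤ ^ (ν ℕ.* 2) ≡ 1ℚ
    one = 1^ (ν ℕ.* 2)
    minus-one : fromℤ -1ℤ ^ (ν ℕ.* 2) ≡ 1ℚ
    minus-one = trans (^-double (fromℤ -1ℤ) ν) (1^ ν)
    t≡m : ∀ t s → Solution n (t , s) → + 2 ∥ + t ℤ.- m
    t≡m t s sol = trace-parity m (+ n) (+ t) (+ s) n≡ (divides 0ℤ (trans (cong (λ u → + s ℤ.* + s ℤ.+ (u ℤ.- + t ℤ.* + t)) (trans (sym sol) (difference-of-squares t s))) (r (+ t) (+ s))))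
      where
      r : ∀ t s → s ℤ.* s ℤ.+ (t ℤ.* t ℤ.- s ℤ.* s ℤ.- t ℤ.* t) ≡ 0ℤ
      r = ℤ.solve-∀
    both? : ∀ ε (ts : ℕ × ℕ) → let t , s = ts in Dec (Solution n ts × + t ≋ ε ℤ.* m [mod 2 ])
    both? ε (t , s) = (+ (t ℕ.^ 2) ℤ.- + (1 ℕ.* s ℕ.^ 2) ℤ.≟ + n) ×-dec (+ t ≋? ε ℤ.* m [mod 2 ])
    w : ℕ × ℕ → ℚ
    w (t , s) = λ-weight s * fromℤ (+ t ℤ.- + (1 ℕ.* s)) ^ suc (ν ℕ.* 2)
    box : List (ℕ × ℕ)
    box = cartesianProduct (map suc (upTo n)) (upTo (suc n))
    each : ∀ ε → (∀ t → + 2 ∥ t ℤ.- m → + 2 ∥ t ℤ.- ε ℤ.* m) → fromℤ ε ^ (ν ℕ.* 2) ≡ 1ℚ →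
      fromℤ ε ^ (ν ℕ.* 2) * ∑ (filter (both? ε) box) w ≡ 1ℚ * λ-sum (ν ℕ.* 2) n
    each ε t≡εm ε≡1 = cong₂ _*_ ε≡1 (trans (∑-filter (both? ε) box w)
      (sum-cong box (λ (t , s) → trans
        (only-× (solution? n (t , s)) (+ t ≋? ε ℤ.* m [mod 2 ]) (w (t , s)))
        (only-cong (solution? n (t , s)) (λ sol → only-yes (+ t ≋? ε ℤ.* m [mod 2 ]) {w (t , s)} (t≡εm (+ t) (t≡m t s sol)))))))

  module Divisors (p : ℕ) (p-prime : Prime p) (2∤p : ¬ 2 ℕ.∣ p) where

    open Powers p p-prime using (divisors; 1<p)
    open EichlerPower p p-prime 2∤p using (2∤power)

    0<p^ : ∀ r → 0 ℕ.< p ℕ.^ r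
    0<p^ r = ℕ.m^n>0 p {{ℕ.>-nonZero (ℕ.<⇒≤ 1<p)}} r

    -- The value of s with t - s = pⁱ and t + s = p^(r - i): both powers are odd, so the difference
    -- of their halves is half of their difference.
    gap : ℕ → ℕ → ℕ
    gap r i = ⌊ p ℕ.^ (r ∸ i) /2⌋ ∸ ⌊ p ℕ.^ i /2⌋

    pair : ℕ → ℕ → ℕ × ℕ
    pair r i = p ℕ.^ i ℕ.+ gap r i , gap r i

    double≤ : ∀ {i} r → i ℕ.≤ ⌊ r /2⌋ → i ℕ.+ i ℕ.≤ r
    double≤ {zero}  r             _         = z≤n
    double≤ {suc i} (suc (suc r)) (s≤s i≤r) = s≤s (subst (ℕ._≤ suc r) (sym (ℕ.+-suc i i)) (s≤s (double≤ r i≤r)))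
    double≤ {suc i} zero          ()
    double≤ {suc i} (suc zero)    ()

    ≤half : ∀ {i} r → i ℕ.+ i ℕ.≤ r → i ℕ.≤ ⌊ r /2⌋
    ≤half {zero}  r             _       = z≤n
    ≤half {suc i} (suc zero)    (s≤s h) with () ← subst (ℕ._≤ 0) (ℕ.+-suc i i) h
    ≤half {suc i} (suc (suc r)) (s≤s h) = s≤s (≤half r (ℕ.≤-pred (subst (ℕ._≤ suc r) (ℕ.+-suc i i) h)))

    gap-sum : ∀ r i → i ℕ.+ i ℕ.≤ r → p ℕ.^ i ℕ.+ (gap r i ℕ.+ gap r i) ≡ p ℕ.^ (r ∸ i)
    gap-sum r i 2i≤r = begin
      p ℕ.^ i ℕ.+ (g ℕ.+ g)         ≡⟨ cong (ℕ._+ (g ℕ.+ g)) (halve (p ℕ.^ i) (2∤power i)) ⟩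
      suc (2 ℕ.* a) ℕ.+ (g ℕ.+ g)   ≡⟨ cong suc (trans (cong (λ u → 2 ℕ.* a ℕ.+ (g ℕ.+ u)) (sym (ℕ.+-identityʳ g))) (sym (ℕ.*-distribˡ-+ 2 a g))) ⟩
      suc (2 ℕ.* (a ℕ.+ g))         ≡⟨ cong (λ u → suc (2 ℕ.* u)) (ℕ.m+[n∸m]≡n a≤b) ⟩
      suc (2 ℕ.* b)                 ≡⟨ halve (p ℕ.^ (r ∸ i)) (2∤power (r ∸ i)) ⟨
      p ℕ.^ (r ∸ i)                 ∎
      where
      open ≡-Reasoning
      g = gap r i
      a = ⌊ p ℕ.^ i /2⌋
      b = ⌊ p ℕ.^ (r ∸ i) /2⌋
      a≤b : a ℕ.≤ b
      a≤b = ℕ.⌊n/2⌋-mono (ℕ.^-monoʳ-≤ p {{ℕ.>-nonZero (ℕ.<⇒≤ 1<p)}} (subst (ℕ._≤ r ∸ i) (ℕ.m+n∸n≡m i i) (ℕ.∸-monoˡ-≤ i 2i≤r)))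

    pair-solution : ∀ r i → i ℕ.+ i ℕ.≤ r → Solution (p ℕ.^ r) (pair r i)
    pair-solution r i 2i≤r = solution (p ℕ.^ i) (gap r i) (trans (cong (p ℕ.^ i ℕ.*_) (gap-sum r i 2i≤r))
      (trans (sym (ℕ.^-distribˡ-+-* p i (r ∸ i))) (cong (p ℕ.^_) (ℕ.m+[n∸m]≡n (ℕ.≤-trans (ℕ.m≤m+n i i) 2i≤r)))))

    ^-injective : ∀ i j → p ℕ.^ i ≡ p ℕ.^ j → i ≡ j
    ^-injective i j eq with ℕ.<-cmp i j
    ... | tri≈ _ i≡j _ = i≡j
    ... | tri< i<j _ _ = ⊥-elim (ℕ.<⇒≢ (ℕ.^-monoʳ-< p 1<p i<j) eq)
    ... | tri> _ _ j<i = ⊥-elim (ℕ.<⇒≢ (ℕ.^-monoʳ-< p 1<p j<i) (sym eq))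

    pair-injective : ∀ r {i j} → pair r i ≡ pair r j → i ≡ j
    pair-injective r {i} {j} eq = ^-injective i j (ℕ.+-cancelʳ-≡ (gap r j) _ _
      (trans (cong (λ u → p ℕ.^ i ℕ.+ u) (sym (cong proj₂ eq))) (cong proj₁ eq)))

    -- The factors t - s and t + s of p^r are powers of p; the smaller one is pⁱ with 2i at most r.
    pair-complete : ∀ r ts → Solution (p ℕ.^ r) ts → ts ∈ map (pair r) (upTo (suc ⌊ r /2⌋))
    pair-complete r (t , s) sol with factors t s (0<p^ r) sol
    ... | d , refl , eq with divisors r d (d ℕ.+ (s ℕ.+ s)) eq
    ...   | i , i≤r , refl , e≡ = subst (_∈ map (pair r) (upTo (suc ⌊ r /2⌋))) (cong (λ g → p ℕ.^ i ℕ.+ g , g) gap≡)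
              (∈-map⁺ (pair r) {i} (∈-upTo⁺ (s≤s (≤half {i} r 2i≤r))))
      where
      i≤r-i : i ℕ.≤ r ∸ i
      i≤r-i with ℕ.≤-<-connex i (r ∸ i)
      ... | inj₁ q = q
      ... | inj₂ q = ⊥-elim (ℕ.<⇒≱ (ℕ.^-monoʳ-< p 1<p q) (subst (p ℕ.^ i ℕ.≤_) e≡ (ℕ.m≤m+n (p ℕ.^ i) (s ℕ.+ s))))
      2i≤r : i ℕ.+ i ℕ.≤ r
      2i≤r = subst (i ℕ.+ i ℕ.≤_) (ℕ.m+[n∸m]≡n i≤r) (ℕ.+-monoʳ-≤ i i≤r-i)
      double-injective : ∀ x y → x ℕ.+ x ≡ y ℕ.+ y → x ≡ y
      double-injective x y eq = ℕ.*-cancelˡ-≡ x y 2 (trans (cong (λ u → x ℕ.+ u) (ℕ.+-identityʳ x)) (trans eq (cong (λ u → y ℕ.+ u) (sym (ℕ.+-identityʳ y)))))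
      gap≡ : gap r i ≡ s
      gap≡ = double-injective (gap r i) s (ℕ.+-cancelˡ-≡ (p ℕ.^ i) _ _ (trans (gap-sum r i 2i≤r) (sym e≡)))

    -- Twice the weight in λ: 1 for 2i = r, where s = 0, and 2 otherwise.
    W : ℕ → ℕ → ℚ
    W r i = only (i ℕ.+ i ℕ.≟ r) (- 1ℚ) + (1ℚ + 1ℚ)

    W-suc : ∀ r i → W (2 ℕ.+ r) (suc i) ≡ W r i
    W-suc r i = cong (_+ (1ℚ + 1ℚ)) (only-⇔ (suc i ℕ.+ suc i ℕ.≟ 2 ℕ.+ r) (i ℕ.+ i ℕ.≟ r)
      (λ eq → ℕ.suc-injective (trans (sym (ℕ.+-suc i i)) (ℕ.suc-injective eq)))
      (λ eq → cong suc (trans (ℕ.+-suc i i) (cong suc eq))))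

    W-gap : ∀ r i → i ℕ.+ i ℕ.≤ r → (1ℚ + 1ℚ) * λ-weight (gap r i) ≡ W r i
    W-gap r i 2i≤r = go (i ℕ.+ i ℕ.≟ r)
      where
      diagonal : ∀ r → i ℕ.+ i ≡ r → gap r i ≡ 0
      diagonal r refl = trans (cong (λ j → ⌊ p ℕ.^ j /2⌋ ∸ ⌊ p ℕ.^ i /2⌋) (ℕ.m+n∸n≡m i i)) (ℕ.n∸n≡0 ⌊ p ℕ.^ i /2⌋)
      off-diagonal : i ℕ.+ i ≢ r → ∀ g → gap r i ≡ g → (1ℚ + 1ℚ) * λ-weight g ≡ 0ℚ + (1ℚ + 1ℚ)
      off-diagonal _     (suc g) _  = refl
      off-diagonal 2i≢r zero    eq = ⊥-elim (2i≢r (trans (cong (λ u → i ℕ.+ u) i≡) (ℕ.m+[n∸m]≡n (ℕ.≤-trans (ℕ.m≤m+n i i) 2i≤r))))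
        where
        i≡ : i ≡ r ∸ i
        i≡ = ^-injective i (r ∸ i) (trans (sym (ℕ.+-identityʳ (p ℕ.^ i))) (trans (cong (λ g → p ℕ.^ i ℕ.+ (g ℕ.+ g)) (sym eq)) (gap-sum r i 2i≤r)))
      go : (d? : Dec (i ℕ.+ i ≡ r)) → (1ℚ + 1ℚ) * λ-weight (gap r i) ≡ only d? (- 1ℚ) + (1ℚ + 1ℚ)
      go (yes 2i≡r) = cong (λ g → (1ℚ + 1ℚ) * λ-weight g) (diagonal r 2i≡r)
      go (no 2i≢r)  = off-diagonal 2i≢r (gap r i) refl

    L : ℕ → ℕ → ℚ
    L ℓ r = ∑ (upTo (suc ⌊ r /2⌋)) (λ i → W r i * (fromℕ p ^ suc ℓ) ^ i)

    λ-sum-L : ∀ ℓ r → (1ℚ + 1ℚ) * λ-sum ℓ (p ℕ.^ r) ≡ L ℓ r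
    λ-sum-L ℓ r = trans (cong ((1ℚ + 1ℚ) *_) (trans
        (sum-cover (Unique.cartesianProduct⁺ (Unique.map⁺ ℕ.suc-injective (Unique.upTo⁺ n)) (Unique.upTo⁺ (suc n)))
          (Unique.map⁺ (λ {i} {j} → pair-injective r {i} {j}) (Unique.upTo⁺ (suc ⌊ r /2⌋))) box-covers pairs-cover)
        (sum-map (pair r) (upTo (suc ⌊ r /2⌋)) g)))
      (trans (sym (∑-* (1ℚ + 1ℚ) (upTo (suc ⌊ r /2⌋)) (λ i → g (pair r i))))
        (sum-cong-∈ (upTo (suc ⌊ r /2⌋)) (λ {i} i∈ → at i (double≤ {i} r (ℕ.≤-pred (∈-upTo⁻ i∈))))))
      where
      n = p ℕ.^ r
      g : ℕ × ℕ → ℚ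
      g ts = only (solution? n ts) (λ-weight (proj₂ ts) * fromℤ (+ proj₁ ts ℤ.- + (1 ℕ.* proj₂ ts)) ^ suc ℓ)
      pairs-cover : Covers (map (pair r) (upTo (suc ⌊ r /2⌋))) g
      pairs-cover ts = go (solution? n ts)
        where
        go : (s? : Dec (Solution n ts)) → ts ∈ map (pair r) (upTo (suc ⌊ r /2⌋)) ⊎ only s? (λ-weight (proj₂ ts) * fromℤ (+ proj₁ ts ℤ.- + (1 ℕ.* proj₂ ts)) ^ suc ℓ) ≡ 0ℚ
        go (yes sol) = inj₁ (pair-complete r ts sol)
        go (no _)    = inj₂ refl
      box-covers : Covers (cartesianProduct (map suc (upTo n)) (upTo (suc n))) g
      box-covers ts@(t , s) = go (solution? n ts)
        where
        go : (s? : Dec (Solution n ts)) → ts ∈ cartesianProduct (map suc (upTo n)) (upTo (suc n)) ⊎ only s? (λ-weight s * fromℤ (+ t ℤ.- + (1 ℕ.* s)) ^ suc ℓ) ≡ 0ℚ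
        go (no _)    = inj₂ refl
        go (yes sol) with factors t s (0<p^ r) sol
        ... | zero  , _ , eq = ⊥-elim (ℕ.<⇒≢ (0<p^ r) eq)
        ... | suc d , refl , eq = inj₁ (∈-cartesianProduct⁺ (∈-map⁺ suc (∈-upTo⁺ (ℕ.≤-trans (s≤s (ℕ.+-monoʳ-≤ d (ℕ.m≤m+n s s))) bound)))
                (∈-upTo⁺ (s≤s (ℕ.≤-trans (ℕ.m≤m+n s s) (ℕ.≤-trans (ℕ.m≤n+m (s ℕ.+ s) (suc d)) bound)))))
          where
          bound : suc d ℕ.+ (s ℕ.+ s) ℕ.≤ n
          bound = subst (suc d ℕ.+ (s ℕ.+ s) ℕ.≤_) eq (ℕ.m≤n*m (suc d ℕ.+ (s ℕ.+ s)) (suc d))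
      at : ∀ i → i ℕ.+ i ℕ.≤ r → (1ℚ + 1ℚ) * g (pair r i) ≡ W r i * (fromℕ p ^ suc ℓ) ^ i
      at i 2i≤r = trans (cong ((1ℚ + 1ℚ) *_) (only-yes (solution? n (pair r i)) (pair-solution r i 2i≤r)))
        (trans (sym (ℚ.*-assoc (1ℚ + 1ℚ) (λ-weight (gap r i)) _)) (cong₂ _*_ (W-gap r i 2i≤r)
          (trans (cong (_^ suc ℓ) (trans (cong fromℤ (trans (cong (λ u → + (p ℕ.^ i ℕ.+ gap r i) ℤ.- + u) (ℕ.*-identityˡ (gap r i))) (e (+ (p ℕ.^ i)) (+ gap r i)))) (fromℕ-^ p i)))
            (^-swap (fromℕ p) i (suc ℓ)))))
        where
        e : ∀ x y → x ℤ.+ y ℤ.- y ≡ x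
        e = ℤ.solve-∀

    -- The terms with i > 0 are those for r with one more factor p^(ℓ + 1). The term i = 0 has s > 0
    -- and contributes 2.
    L-step : ∀ ℓ r → L ℓ (2 ℕ.+ r) ≡ fromℕ p ^ suc ℓ * L ℓ r + (1ℚ + 1ℚ)
    L-step ℓ r = trans (∑-first (suc ⌊ r /2⌋) (λ i → W (2 ℕ.+ r) i * Q ^ i))
      (trans (cong (λ u → (0ℚ + (1ℚ + 1ℚ)) * 1ℚ + u) (trans (sum-cong (upTo (suc ⌊ r /2⌋)) (λ i → trans (cong (_* (Q * Q ^ i)) (W-suc r i)) (e₁ (W r i) Q (Q ^ i))))
        (∑-* Q (upTo (suc ⌊ r /2⌋)) (λ i → W r i * Q ^ i)))) (e₂ (Q * L ℓ r)))
      where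
      Q = fromℕ p ^ suc ℓ
      e₁ : ∀ w q x → w * (q * x) ≡ q * (w * x)
      e₁ = solve-∀ ℚ-ring
      e₂ : ∀ y → (0ℚ + (1ℚ + 1ℚ)) * 1ℚ + y ≡ y + (1ℚ + 1ℚ)
      e₂ = solve-∀ ℚ-ring

    L-1 : ∀ ℓ → L ℓ 1 ≡ 1ℚ + 1ℚ
    L-1 ℓ = refl

-- Removing the multiples of p and assembling the formula.

module Final where

  open import Defs using (fromℤ; fromℕ; _^_; ∑; δ; _≋_[mod_]; _≋?_[mod_]; 𝓗; H; α; α[_^_-2]; T; Catalan; interval; λ-coeff)
  open FinSum
  open Rational
  open Binomials
  open Chebyshev
  open ClassNumber
  open Series
  open Lambda
  open HeckeTrace using (6H⁺; module Trace)
  open PrimePower using (module Powers)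
  open import Data.Integer.Divisibility.Signed using (divides; ∣⇒∣ᵤ; ∣m∣n⇒∣m+n; ∣m∣n⇒∣m-n) renaming (_∣_ to infix 4 _∥_; _∣?_ to infix 4 _∥?_)
  open import Data.Rational.Base using (_+_; _*_; _-_; -_; _/_)
  open import Tactic.RingSolver using (solve-∀)

  open ℚΣ

  only-split : ∀ {P : Set} (P? : Dec P) x → x ≡ only (¬? P?) x + only P? x
  only-split (yes _) x = sym (ℚ.+-identityˡ x)
  only-split (no _)  x = sym (ℚ.+-identityʳ x)

  module AtPrime (K : ℕ) (m : ℤ) (p : ℕ) (p-prime : Prime p) (3≤p : 3 ℕ.≤ p) where

    k : ℕ
    k = K ℕ.* 2

    2∤p : ¬ 2 ℕ.∣ p
    2∤p d = [ (λ ()) , (λ { refl → ℕ.<⇒≱ 3≤p ℕ.≤-refl }) ]′ (prime⇒irreducible p-prime d)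

    P : ℤ
    P = + p

    P∤2 : ¬ P ∥ + 2
    P∤2 d = ℕ.<⇒≱ 3≤p (ℕ.∣⇒≤ (∣⇒∣ᵤ d))

    open Powers p p-prime using (1<p)
    open Trace p p-prime P∤2 using (trace-lift; N-step; large; 6H⁺-≤0)
    open Total p p-prime 2∤p
    open Divisors p p-prime 2∤p
    open Moment m
    open Coefficients m

    instance
      p≢0 : NonZero p
      p≢0 = ℕ.>-nonZero (ℕ.<⇒≤ 1<p)

      power≢0 : ∀ {r} → NonZero (p ℕ.^ r)
      power≢0 {r} = ℕ.>-nonZero (0<p^ r)

    P-odd : ∃[ e ] P ≡ 1ℤ ℤ.+ + 2 ℤ.* e
    P-odd with parity P
    ... | inj₂ odd = odd
    ... | inj₁ (e , eq) = ⊥-elim (2∤p (∣⇒∣ᵤ {+ 2} {P} (divides e (trans eq (ℤ.*-comm (+ 2) e)))))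

    q : ℚ
    q = fromℕ p

    n : ℕ → ℚ
    n r = fromℕ (p ℕ.^ r)

    Admissible : ℕ → Set
    Admissible r = + 4 ∥ + (p ℕ.^ r) ℤ.- (+ 2 ℤ.* m ℤ.- 1ℤ)

    -- An odd square is 1 modulo 4.
    admissible-2 : ∀ {s} → Admissible (2 ℕ.+ s) → Admissible s
    admissible-2 {s} (divides v eq) with P-odd
    ... | e , P≡ = divides (v ℤ.- (e ℤ.* e ℤ.+ e) ℤ.* x) (trans (e₁ x y) (trans (cong₂ ℤ._-_ eq′ (cong (λ u → (u ℤ.* u ℤ.- 1ℤ) ℤ.* x) P≡)) (e₂ v e x)))
      where
      x = + (p ℕ.^ s)
      y = + 2 ℤ.* m ℤ.- 1ℤ
      eq′ : P ℤ.* (P ℤ.* x) ℤ.- y ≡ v ℤ.* + 4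
      eq′ = trans (cong (ℤ._- y) (sym (trans (ℤ.pos-* p (p ℕ.* p ℕ.^ s)) (cong (P ℤ.*_) (ℤ.pos-* p (p ℕ.^ s)))))) eq
      e₁ : ∀ x y → x ℤ.- y ≡ P ℤ.* (P ℤ.* x) ℤ.- y ℤ.- (P ℤ.* P ℤ.- 1ℤ) ℤ.* x
      e₁ = ring P
        where
        ring : ∀ P x y → x ℤ.- y ≡ P ℤ.* (P ℤ.* x) ℤ.- y ℤ.- (P ℤ.* P ℤ.- 1ℤ) ℤ.* x
        ring = ℤ.solve-∀
      e₂ : ∀ v e x → v ℤ.* + 4 ℤ.- ((1ℤ ℤ.+ + 2 ℤ.* e) ℤ.* (1ℤ ℤ.+ + 2 ℤ.* e) ℤ.- 1ℤ) ℤ.* x ≡ (v ℤ.- (e ℤ.* e ℤ.+ e) ℤ.* x) ℤ.* + 4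
      e₂ = ℤ.solve-∀

    power : ℤ → ℚ
    power t = fromℤ t ^ k

    power-square : ∀ t → power t ≡ fromℤ (t ℤ.* t) ^ K
    power-square t = trans (^-double (fromℤ t) K) (cong (_^ K) (sym (fromℤ-* t t)))

    -- The congruence on t is automatic: by `trace-parity` the class number vanishes for every other
    -- t.
    moment-1 : ∀ r → Admissible r → moment (p ℕ.^ r) (λ _ → 1ℚ) ≡ total-h r
    moment-1 r n≡ = HasSum-unique (moment-hasSum (p ℕ.^ r) (λ _ → 1ℚ))
      (HasSum-cong (λ t → at t (t ≋? m [mod 2 ])) (class-number-sum r))
      where
      at : ∀ t (c? : Dec (t ≋ m [mod 2 ])) → h (+ (p ℕ.^ r) ℤ.- t ℤ.* t) ≡ only c? (h (+ (p ℕ.^ r) ℤ.- t ℤ.* t) * 1ℚ)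
      at t (yes _) = sym (ℚ.*-identityʳ (h (+ (p ℕ.^ r) ℤ.- t ℤ.* t)))
      at t (no t≢m) = h-vanish (+ (p ℕ.^ r) ℤ.- t ℤ.* t) (λ b d → t≢m (trace-parity m (+ (p ℕ.^ r)) t b n≡ d))

    E : ℕ → ℚ
    E r = ∑ (upTo K) (λ μ → ballot K μ * n r ^ μ * moment (p ℕ.^ r) (chebyshev (p ℕ.^ r) (K ∸ μ)))

    -- The expansion `ballot-expansion` holds at each t with the same n, so it can be summed against
    -- the class numbers. The term μ = K, where `V` is 1, is split off.
    E-moments : ∀ r → E r ≡ 4ℚ ^ K * moment (p ℕ.^ r) power - ballot K K * n r ^ K * moment (p ℕ.^ r) (λ _ → 1ℚ)
    E-moments r = trans (e₁ (E r) last) (cong₂ _-_ (trans (sym (∑-last K F)) (trans whole total≡)) last≡)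
      where
      a = p ℕ.^ r
      F : ℕ → ℚ
      F μ = ballot K μ * n r ^ μ * moment a (chebyshev a (K ∸ μ))
      last = F K
      e₁ : ∀ x y → x ≡ x + y - y
      e₁ = solve-∀ ℚ-ring
      last≡ : last ≡ ballot K K * n r ^ K * moment a (λ _ → 1ℚ)
      last≡ = cong (ballot K K * n r ^ K *_) (trans (cong (λ j → moment a (chebyshev a j)) (ℕ.n∸n≡0 K)) (moment-cong a {chebyshev a 0} {λ _ → 1ℚ} (λ t → refl)))
      whole : ∑ (upTo (suc K)) F ≡ moment a (λ t → G (n r) (ballot K) K (λ ν → chebyshev a ν t))
      whole = trans (sum-cong (upTo (suc K)) (λ μ → sym (moment-* a (ballot K μ * n r ^ μ) (chebyshev a (K ∸ μ)))))
        (trans (moment-∑ a (upTo (suc K)) (λ μ t → ballot K μ * n r ^ μ * chebyshev a (K ∸ μ) t))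
          (moment-cong a (λ t → G-∑ (n r) (ballot K) K (λ ν → chebyshev a ν t))))
      total≡ : moment a (λ t → G (n r) (ballot K) K (λ ν → chebyshev a ν t)) ≡ 4ℚ ^ K * moment a power
      total≡ = trans (moment-cong a (λ t → trans (cong (λ y → G y (ballot K) K (λ ν → chebyshev a ν t)) (n≡ t))
          (trans (ballot-expansion (fromℤ (+ a ℤ.- t ℤ.* t)) (fromℤ (t ℤ.* t)) K)
            (trans (^-* 4ℚ (fromℤ (t ℤ.* t)) K) (cong (4ℚ ^ K *_) (sym (power-square t)))))))
        (moment-* a (4ℚ ^ K) power)
        where
        n≡ : ∀ t → n r ≡ fromℤ (+ a ℤ.- t ℤ.* t) + fromℤ (t ℤ.* t)
        n≡ t = trans (cong fromℤ (e (+ a) (t ℤ.* t))) (fromℤ-+ (+ a ℤ.- t ℤ.* t) (t ℤ.* t))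
          where
          e : ∀ a s → a ≡ a ℤ.- s ℤ.+ s
          e = ℤ.solve-∀

    -- The factor p^(k - 2μ + 1) of the theorem, with ν = K - μ.
    Q : ℕ → ℚ
    Q ν = q ^ suc (ν ℕ.* 2)

    n-2 : ∀ s → n (2 ℕ.+ s) ≡ q * q * n s
    n-2 s = trans (fromℕ-* p (p ℕ.* p ℕ.^ s)) (trans (cong (q *_) (fromℕ-* p (p ℕ.^ s))) (sym (ℚ.*-assoc q q (n s))))

    n-2^ : ∀ s j → n (2 ℕ.+ s) ^ j ≡ q ^ (j ℕ.* 2) * n s ^ j
    n-2^ s j = trans (cong (_^ j) (n-2 s)) (trans (^-* (q * q) (n s) j) (cong (_* n s ^ j) (sym (^-double q j))))

    -- The extra factor p^(2μ) of the μ-th power combines with `Q (K ∸ μ)` to `Q K`, which no longer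
    -- depends on μ.
    previous-moments : ∀ s → ∑ (upTo K) (λ μ → ballot K μ * n (2 ℕ.+ s) ^ μ * (Q (K ∸ μ) * moment (p ℕ.^ s) (chebyshev (p ℕ.^ s) (K ∸ μ)))) ≡ Q K * E s
    previous-moments s = trans (sum-cong-∈ (upTo K) (λ {μ} μ∈ → each μ (ℕ.<⇒≤ (∈-upTo⁻ μ∈))))
      (∑-* (Q K) (upTo K) (λ μ → ballot K μ * n s ^ μ * moment (p ℕ.^ s) (chebyshev (p ℕ.^ s) (K ∸ μ))))
      where
      each : ∀ μ → μ ℕ.≤ K → ballot K μ * n (2 ℕ.+ s) ^ μ * (Q (K ∸ μ) * moment (p ℕ.^ s) (chebyshev (p ℕ.^ s) (K ∸ μ)))
        ≡ Q K * (ballot K μ * n s ^ μ * moment (p ℕ.^ s) (chebyshev (p ℕ.^ s) (K ∸ μ)))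
      each μ μ≤K = trans (cong (λ u → ballot K μ * u * (Q (K ∸ μ) * M)) (n-2^ s μ)) (trans (e (ballot K μ) (q ^ (μ ℕ.* 2)) (n s ^ μ) (Q (K ∸ μ)) M)
          (cong (_* (ballot K μ * n s ^ μ * M)) (trans (sym (^-+ q (μ ℕ.* 2) (suc ((K ∸ μ) ℕ.* 2)))) (cong (q ^_) exponent))))
        where
        M = moment (p ℕ.^ s) (chebyshev (p ℕ.^ s) (K ∸ μ))
        exponent : μ ℕ.* 2 ℕ.+ suc ((K ∸ μ) ℕ.* 2) ≡ suc (K ℕ.* 2)
        exponent = trans (ℕ.+-suc (μ ℕ.* 2) ((K ∸ μ) ℕ.* 2)) (cong suc (trans (sym (ℕ.*-distribʳ-+ 2 μ (K ∸ μ))) (cong (ℕ._* 2) (ℕ.m+[n∸m]≡n μ≤K))))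
        e : ∀ b x y z M → b * (x * y) * (z * M) ≡ x * z * (b * y * M)
        e = solve-∀ ℚ-ring

    λ-value : ∀ ν r → Admissible r → λ-coeff (ν ℕ.* 2) m 2 1 (p ℕ.^ r) ≡ L (ν ℕ.* 2) r
    λ-value ν r n≡ = trans (λ-coeff-even ν m (p ℕ.^ r) n≡) (λ-sum-L (ν ℕ.* 2) r)

    α-difference-1 : ∀ ν → Admissible 1 →
      4ℚ ^ ν * (α (ν ℕ.* 2) m 2 1 (p ℕ.^ 1) - Q ν * α[ p ^ 1 -2] (ν ℕ.* 2) m 2 1) ≡ moment (p ℕ.^ 1) (chebyshev (p ℕ.^ 1) ν) - Q ν * 0ℚ + 1ℚ
    α-difference-1 ν n≡ = trans (e₁ (4ℚ ^ ν) (α (ν ℕ.* 2) m 2 1 (p ℕ.^ 1)) (Q ν)) (trans (α-even ν (p ℕ.^ 1) {{power≢0 {1}}})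
      (trans (cong (λ u → moment (p ℕ.^ 1) (chebyshev (p ℕ.^ 1) ν) + ½ * u) (trans (λ-value ν 1 n≡) (L-1 (ν ℕ.* 2)))) (e₂ (moment (p ℕ.^ 1) (chebyshev (p ℕ.^ 1) ν)) (Q ν))))
      where
      e₁ : ∀ f a Q → f * (a - Q * 0ℚ) ≡ f * a
      e₁ = solve-∀ ℚ-ring
      e₂ : ∀ M Q → M + ½ * (1ℚ + 1ℚ) ≡ M - Q * 0ℚ + 1ℚ
      e₂ = solve-∀ ℚ-ring

    -- By `L-step` the contributions of Λ at the two levels leave exactly 2, halved to the final 1.
    α-difference : ∀ ν s → Admissible (2 ℕ.+ s) →
      4ℚ ^ ν * (α (ν ℕ.* 2) m 2 1 (p ℕ.^ (2 ℕ.+ s)) - Q ν * α[ p ^ (2 ℕ.+ s) -2] (ν ℕ.* 2) m 2 1)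
        ≡ moment (p ℕ.^ (2 ℕ.+ s)) (chebyshev (p ℕ.^ (2 ℕ.+ s)) ν) - Q ν * moment (p ℕ.^ s) (chebyshev (p ℕ.^ s) ν) + 1ℚ
    α-difference ν s n≡ = trans (e₁ (4ℚ ^ ν) (α (ν ℕ.* 2) m 2 1 (p ℕ.^ (2 ℕ.+ s))) (Q ν) (α (ν ℕ.* 2) m 2 1 (p ℕ.^ s)))
      (trans (cong₂ (λ u v → u - Q ν * v)
          (trans (α-even ν (p ℕ.^ (2 ℕ.+ s)) {{power≢0 {2 ℕ.+ s}}}) (cong (λ u → M₂ + ½ * u) (trans (λ-value ν (2 ℕ.+ s) n≡) (L-step (ν ℕ.* 2) s))))
          (trans (α-even ν (p ℕ.^ s) {{power≢0 {s}}}) (cong (λ u → M₀ + ½ * u) (λ-value ν s (admissible-2 {s} n≡)))))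
        (e₂ M₂ M₀ (Q ν) (L (ν ℕ.* 2) s)))
      where
      M₂ = moment (p ℕ.^ (2 ℕ.+ s)) (chebyshev (p ℕ.^ (2 ℕ.+ s)) ν)
      M₀ = moment (p ℕ.^ s) (chebyshev (p ℕ.^ s) ν)
      e₁ : ∀ f a Q b → f * (a - Q * b) ≡ f * a - Q * (f * b)
      e₁ = solve-∀ ℚ-ring
      e₂ : ∀ M M₀ Q L → M + ½ * (Q * L + (1ℚ + 1ℚ)) - Q * (M₀ + ½ * L) ≡ M - Q * M₀ + 1ℚ
      e₂ = solve-∀ ℚ-ring

    multiples : ℕ → ℚ
    multiples r = ∑ (interval (p ℕ.^ r)) (λ t → only (P ∥? t) (term (p ℕ.^ r) power t))

    𝓗-moment : ∀ r → moment (p ℕ.^ r) power ≡ 𝓗 k m 2 1 p r + multiples r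
    𝓗-moment r = trans (sum-cong (interval a) (λ t → only-split (P ∥? t) (term a power t)))
      (trans (sum-⊕ (interval a) (λ t → only (¬? (P ∥? t)) (term a power t)) (λ t → only (P ∥? t) (term a power t)))
        (cong (_+ multiples r) (sym (trans (∑-filter (λ t → ¬? (P ∥? t) ×-dec (t ≋? m [mod 2 ])) (interval a) (λ t → H (fromℤ (+ a ℤ.- t ℤ.* t)) * power t))
          (sum-cong (interval a) (λ t → trans (only-× (¬? (P ∥? t)) (t ≋? m [mod 2 ]) (H (fromℤ (+ a ℤ.- t ℤ.* t)) * power t))
            (cong (λ u → only (¬? (P ∥? t)) (only (t ≋? m [mod 2 ]) (u * power t))) (sym (h-def (+ a ℤ.- t ℤ.* t))))))))))
      where
      a = p ℕ.^ r

    multiples-hasSum : ∀ r {z} → HasSum (λ t → term (p ℕ.^ r) power (t ℤ.* P)) z → multiples r ≡ z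
    multiples-hasSum r {z} F = HasSum-unique {f = g} (hasSum (interval a) (interval-unique a) covered refl)
        (HasSum-bij {f = λ t → term a power (t ℤ.* P)} {g = g} (ℤ._* P) quotient (λ t → inj₁ (quotient-* t (P ∥? (t ℤ.* P)))) (λ t → inj₁ (only-yes (P ∥? (t ℤ.* P)) (divides t refl))) (λ t → back t (P ∥? t)) F)
      where
      a = p ℕ.^ r
      g : ℤ → ℚ
      g t = only (P ∥? t) (term a power t)
      covered : Covers (interval a) g
      covered t with covers (moment-hasSum a power) t
      ... | inj₁ t∈ = inj₁ t∈
      ... | inj₂ eq = inj₂ (trans (cong (only (P ∥? t)) eq) (only-zero (P ∥? t)))
      quotient′ : ∀ {t} → Dec (P ∥ t) → ℤ
      quotient′ (yes (divides u _)) = u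
      quotient′ (no _)              = 0ℤ
      quotient : ℤ → ℤ
      quotient t = quotient′ (P ∥? t)
      quotient-* : ∀ t (d? : Dec (P ∥ t ℤ.* P)) → quotient′ d? ≡ t
      quotient-* t (yes (divides u eq)) = ℤ.*-cancelʳ-≡ u t P (sym eq)
      quotient-* t (no P∤)              = ⊥-elim (P∤ (divides t refl))
      back : ∀ t (d? : Dec (P ∥ t)) → (quotient′ d? ℤ.* P ≡ t × term a power (quotient′ d? ℤ.* P) ≡ only d? (term a power t)) ⊎ only d? (term a power t) ≡ 0ℚ
      back t (no _)                 = inj₂ refl
      back t (yes (divides u refl)) = inj₁ (refl , refl)

    power-0 : 1 ℕ.≤ K → power 0ℤ ≡ 0ℚ
    power-0 1≤K = zero-power K 1≤K
      where
      zero-power : ∀ K → 1 ℕ.≤ K → fromℤ 0ℤ ^ (K ℕ.* 2) ≡ 0ℚ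
      zero-power (suc K) _ = 0^ (suc (K ℕ.* 2))

    -- For t ≠ 0 the argument p - p² t² is negative, and t = 0 contributes nothing because k is
    -- positive.
    multiples-1 : 1 ℕ.≤ K → multiples 1 ≡ 0ℚ
    multiples-1 1≤K = multiples-hasSum 1 (HasSum-ε (λ t → trans (cong (only (t ℤ.* P ≋? m [mod 2 ])) (at t (t ℤ.≟ 0ℤ))) (only-zero (t ℤ.* P ≋? m [mod 2 ]))))
      where
      at : ∀ t → Dec (t ≡ 0ℤ) → h (+ (p ℕ.^ 1) ℤ.- t ℤ.* P ℤ.* (t ℤ.* P)) * power (t ℤ.* P) ≡ 0ℚ
      at t (yes refl) = trans (cong (h (+ (p ℕ.^ 1) ℤ.- 0ℤ ℤ.* P ℤ.* (0ℤ ℤ.* P)) *_) (trans (cong power (ℤ.*-zeroˡ P)) (power-0 1≤K))) (ℚ.*-zeroʳ (h (+ (p ℕ.^ 1) ℤ.- 0ℤ ℤ.* P ℤ.* (0ℤ ℤ.* P))))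
      at t (no t≢0) = trans (cong (_* power (t ℤ.* P)) (trans (h-formula N)
          (cong₂ (λ x y → (+ 1 / 6) * fromℤ x - (+ 1 / 12) * y) (6H⁺-≤0 (large 1 t (s≤s z≤n) t≢0)) (zero#≢0 (λ eq → not-square 1 2∤1 (t ℤ.* P) (ℤ.i-j≡0⇒i≡j _ _ eq))))))
          (ℚ.*-zeroˡ (power (t ℤ.* P)))
        where
        N = + (p ℕ.^ 1) ℤ.- t ℤ.* P ℤ.* (t ℤ.* P)
        2∤1 : ¬ 2 ℕ.∣ 1
        2∤1 d with ℕ.∣1⇒≡1 d
        ... | ()

    odd-multiple : ∀ t → (t ≋ m [mod 2 ] → t ℤ.* P ≋ m [mod 2 ]) × (t ℤ.* P ≋ m [mod 2 ] → t ≋ m [mod 2 ])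
    odd-multiple t with P-odd
    ... | e , P≡ = (λ d → subst (+ 2 ∥_) (trans (e₁ t m e) (cong (λ u → t ℤ.* u ℤ.- m) (sym P≡))) (∣m∣n⇒∣m+n d (divides (t ℤ.* e) refl)))
                 , (λ d → subst (+ 2 ∥_) (trans (cong (λ u → t ℤ.* u ℤ.- m ℤ.- t ℤ.* e ℤ.* + 2) P≡) (e₂ t m e)) (∣m∣n⇒∣m-n d (divides (t ℤ.* e) refl)))
      where
      e₁ : ∀ t m e → t ℤ.- m ℤ.+ t ℤ.* e ℤ.* + 2 ≡ t ℤ.* (1ℤ ℤ.+ + 2 ℤ.* e) ℤ.- m
      e₁ = ℤ.solve-∀
      e₂ : ∀ t m e → t ℤ.* (1ℤ ℤ.+ + 2 ℤ.* e) ℤ.- m ℤ.- t ℤ.* e ℤ.* + 2 ≡ t ℤ.- m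
      e₂ = ℤ.solve-∀

    zero#-scale : ∀ x → zero# (P ℤ.* P ℤ.* x) ≡ zero# x
    zero#-scale x = go (x ℤ.≟ 0ℤ)
      where
      go : Dec (x ≡ 0ℤ) → zero# (P ℤ.* P ℤ.* x) ≡ zero# x
      go (yes refl) = cong zero# (ℤ.*-zeroʳ (P ℤ.* P))
      go (no x≢0)   = trans (zero#≢0 {P ℤ.* P ℤ.* x} (λ eq → [ (λ PP≡0 → [ P≢0 , P≢0 ]′ (ℤ.i*j≡0⇒i≡0∨j≡0 P PP≡0)) , x≢0 ]′ (ℤ.i*j≡0⇒i≡0∨j≡0 (P ℤ.* P) eq))) (sym (zero#≢0 x≢0))
        where
        P≢0 : P ≢ 0ℤ
        P≢0 eq = ℕ.<⇒≢ (ℕ.<⇒≤ 1<p) (sym (ℤ.+-injective eq))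

    -- Writing t p for the multiples of p, `trace-lift` gives p^(k + 1) times the moment at pˢ. The
    -- exception is H(0), which does not scale: it leaves (p - 1) / 12 at each of the two t with t²
    -- = pˢ.
    multiples-2 : 1 ℕ.≤ K → ∀ s → Admissible (2 ℕ.+ s) →
      multiples (2 ℕ.+ s) ≡ Q K * moment (p ℕ.^ s) power + (+ 1 / 6) * (q - 1ℚ) * n (2 ℕ.+ s) ^ K * δ (2 ℕ.∣? (2 ℕ.+ s))
    multiples-2 1≤K s n≡ = trans (multiples-hasSum (2 ℕ.+ s) (HasSum-cong (λ t → sym (pointwise t (t ℤ.≟ 0ℤ)))
        (HasSum-⊕ {f = λ t → Q K * term a power t} {g = λ t → c * zero# (y t)}
          (HasSum-hom ℚ.+-0-isCommutativeMonoid ℚ.+-0-isCommutativeMonoid (Q K *_) (ℚ.*-zeroʳ (Q K)) (ℚ.*-distribˡ-+ (Q K)) (moment-hasSum a power))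
          (HasSum-hom ℚ.+-0-isCommutativeMonoid ℚ.+-0-isCommutativeMonoid (c *_) (ℚ.*-zeroʳ c) (ℚ.*-distribˡ-+ c) (squares s (2 ℕ.∣? s))))))
      (trans (cong (λ d → Q K * moment a power + c * ((1ℚ + 1ℚ) * d)) (sym (δ-step s))) (e₀ (Q K * moment a power) (q - 1ℚ) (n (2 ℕ.+ s) ^ K) (δ (2 ℕ.∣? (2 ℕ.+ s)))))
      where
      a = p ℕ.^ s
      y : ℤ → ℤ
      y t = + a ℤ.- t ℤ.* t
      c = (+ 1 / 12) * (q - 1ℚ) * n (2 ℕ.+ s) ^ K
      e₀ : ∀ M d x δ → M + (+ 1 / 12) * d * x * ((1ℚ + 1ℚ) * δ) ≡ M + (+ 1 / 6) * d * x * δ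
      e₀ = solve-∀ ℚ-ring
      h-scale : ∀ t → t ≢ 0ℤ → h (P ℤ.* P ℤ.* y t) ≡ q * h (y t) + (+ 1 / 12) * (q - 1ℚ) * zero# (y t)
      h-scale t t≢0 = trans (h-formula (P ℤ.* P ℤ.* y t)) (trans (cong₂ (λ u v → (+ 1 / 6) * u - (+ 1 / 12) * v) (trans (cong fromℤ (trace-lift s t t≢0)) (fromℤ-* P (6H⁺ (y t)))) (zero#-scale (y t)))
        (trans (e q (fromℤ (6H⁺ (y t))) (zero# (y t))) (cong (λ u → q * u + (+ 1 / 12) * (q - 1ℚ) * zero# (y t)) (sym (h-formula (y t))))))
        where
        e : ∀ q x z → (+ 1 / 6) * (q * x) - (+ 1 / 12) * z ≡ q * ((+ 1 / 6) * x - (+ 1 / 12) * z) + (+ 1 / 12) * (q - 1ℚ) * z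
        e = solve-∀ ℚ-ring
      power-scale : ∀ t → power (t ℤ.* P) ≡ q ^ k * power t
      power-scale t = trans (cong (_^ k) (trans (fromℤ-* t P) (ℚ.*-comm (fromℤ t) q))) (^-* q (fromℤ t) k)
      -- Where pˢ = t² the congruence on t holds by `trace-parity` with b = 0, and p^k t^k is the
      -- K-th power of p^(s + 2).
      zero-term : ∀ t (z? : Dec (y t ≡ 0ℤ)) (c? : Dec (t ≋ m [mod 2 ])) → only c? (zero# (y t) * (q ^ k * power t)) ≡ zero# (y t) * n (2 ℕ.+ s) ^ K
      zero-term t (no y≢0) c? = trans (cong (only c?) (trans (cong (_* (q ^ k * power t)) (zero#≢0 y≢0)) (ℚ.*-zeroˡ (q ^ k * power t))))
        (trans (only-zero c?) (sym (trans (cong (_* n (2 ℕ.+ s) ^ K) (zero#≢0 y≢0)) (ℚ.*-zeroˡ (n (2 ℕ.+ s) ^ K)))))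
      zero-term t (yes y≡0) c? = trans (only-yes c? (trace-parity m (+ a) t 0ℤ (admissible-2 {s} n≡) (divides 0ℤ (trans (ℤ.+-identityˡ (y t)) y≡0))))
        (cong (zero# (y t) *_) (trans (cong (q ^ k *_) (trans (power-square t) (cong (λ u → fromℤ u ^ K) (sym (ℤ.i-j≡0⇒i≡j (+ a) (t ℤ.* t) y≡0))))) (sym (n-2^ s K))))
      pointwise : ∀ t → Dec (t ≡ 0ℤ) → term (p ℕ.^ (2 ℕ.+ s)) power (t ℤ.* P) ≡ Q K * term a power t + c * zero# (y t)
      -- The case t = 0 lies outside `trace-lift`; both sides vanish since k is positive and pˢ is
      -- not 0.
      pointwise t (yes refl) = trans (cong (only (0ℤ ℤ.* P ≋? m [mod 2 ])) (trans (cong (h (+ (p ℕ.^ (2 ℕ.+ s)) ℤ.- 0ℤ ℤ.* P ℤ.* (0ℤ ℤ.* P)) *_) (trans (cong power (ℤ.*-zeroˡ P)) (power-0 1≤K))) (ℚ.*-zeroʳ (h (+ (p ℕ.^ (2 ℕ.+ s)) ℤ.- 0ℤ ℤ.* P ℤ.* (0ℤ ℤ.* P))))))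
        (trans (only-zero (0ℤ ℤ.* P ≋? m [mod 2 ])) (sym (trans (cong₂ (λ u v → Q K * u + c * v)
          (trans (cong (only (0ℤ ≋? m [mod 2 ])) (trans (cong (h (y 0ℤ) *_) (power-0 1≤K)) (ℚ.*-zeroʳ (h (y 0ℤ))))) (only-zero (0ℤ ≋? m [mod 2 ])))
          (zero#≢0 {y 0ℤ} (λ eq → ℕ.<⇒≢ (0<p^ s) (sym (ℤ.+-injective (trans (sym (ℤ.+-identityʳ (+ a))) eq)))))) (e (Q K) c))))
        where
        e : ∀ Q c → Q * 0ℚ + c * 0ℚ ≡ 0ℚ
        e = solve-∀ ℚ-ring
      pointwise t (no t≢0) = trans (only-⇔ (t ℤ.* P ≋? m [mod 2 ]) (t ≋? m [mod 2 ]) (proj₂ (odd-multiple t)) (proj₁ (odd-multiple t)))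
        (trans (cong (only (t ≋? m [mod 2 ])) (trans (cong₂ _*_ (trans (cong h (N-step s t)) (h-scale t t≢0)) (power-scale t)) (e₁ q (h (y t)) (zero# (y t)) (q ^ k) (power t))))
          (trans (only-+ (t ≋? m [mod 2 ]) (Q K * (h (y t) * power t)) ((+ 1 / 12) * (q - 1ℚ) * (zero# (y t) * (q ^ k * power t))))
            (cong₂ _+_ (only-* (t ≋? m [mod 2 ]) (Q K) (h (y t) * power t))
              (trans (only-* (t ≋? m [mod 2 ]) ((+ 1 / 12) * (q - 1ℚ)) (zero# (y t) * (q ^ k * power t)))
                (trans (cong ((+ 1 / 12) * (q - 1ℚ) *_) (zero-term t (y t ℤ.≟ 0ℤ) (t ≋? m [mod 2 ]))) (e₂ q (zero# (y t)) (n (2 ℕ.+ s) ^ K)))))))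
        where
        e₁ : ∀ q h z x w → (q * h + (+ 1 / 12) * (q - 1ℚ) * z) * (x * w) ≡ q * x * (h * w) + (+ 1 / 12) * (q - 1ℚ) * (z * (x * w))
        e₁ = solve-∀ ℚ-ring
        e₂ : ∀ q z x → (+ 1 / 12) * (q - 1ℚ) * (z * x) ≡ (+ 1 / 12) * (q - 1ℚ) * x * z
        e₂ = solve-∀ ℚ-ring

    -- The algebra common to r = 1 and r ≥ 2. The parameters `M′`, `X′` and `τ′` stand for the
    -- Chebyshev moments, the k-th moment and the plain class number sum at p^(r - 2), all taken to
    -- be 0 for r = 1.
    module Assembly (r : ℕ) (n≡ : Admissible r) (M′ : ℕ → ℚ) (X′ τ′ : ℚ)
      (differences : ∀ ν → 4ℚ ^ ν * (α (ν ℕ.* 2) m 2 1 (p ℕ.^ r) - Q ν * α[ p ^ r -2] (ν ℕ.* 2) m 2 1) ≡ moment (p ℕ.^ r) (chebyshev (p ℕ.^ r) ν) - Q ν * M′ ν + 1ℚ)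
      (previous : ∑ (upTo K) (λ μ → ballot K μ * n r ^ μ * (Q (K ∸ μ) * M′ (K ∸ μ))) ≡ Q K * (4ℚ ^ K * X′) - ballot K K * n r ^ K * (q * τ′))
      (total≡ : total-h r ≡ q * τ′ + (+ 1 / 3) * (n r - (1ℚ + 1ℚ)))
      (sieved : moment (p ℕ.^ r) power ≡ 𝓗 k m 2 1 p r + (Q K * X′ + (+ 1 / 6) * (q - 1ℚ) * n r ^ K * δ (2 ℕ.∣? r))) where

      summand : ℕ → ℚ
      summand μ = ½ ^ (2 ℕ.* μ) * T k μ * (α (k ∸ 2 ℕ.* μ) m 2 1 (p ℕ.^ r) - fromℕ (p ℕ.^ (k ∸ 2 ℕ.* μ ℕ.+ 1)) * α[ p ^ r -2] (k ∸ 2 ℕ.* μ) m 2 1) * fromℕ (p ℕ.^ (r ℕ.* μ))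

      fromℕ-power : ∀ μ → fromℕ (p ℕ.^ (r ℕ.* μ)) ≡ n r ^ μ
      fromℕ-power μ = trans (cong fromℕ (sym (ℕ.^-*-assoc p r μ))) (fromℕ-^ (p ℕ.^ r) μ)

      unit : ∀ μ → 4ℚ ^ μ * ½ ^ (2 ℕ.* μ) ≡ 1ℚ
      unit μ = trans (cong (λ e → 4ℚ ^ μ * ½ ^ e) (ℕ.*-comm 2 μ)) (trans (cong (4ℚ ^ μ *_) (^-double ½ μ)) (trans (sym (^-* 4ℚ (½ * ½) μ)) (1^ μ)))

      each : ∀ μ → μ ℕ.≤ K → 4ℚ ^ K * summand μ ≡ ballot K μ * n r ^ μ * moment (p ℕ.^ r) (chebyshev (p ℕ.^ r) (K ∸ μ))
        + (- 1ℚ * (ballot K μ * n r ^ μ * (Q (K ∸ μ) * M′ (K ∸ μ))) + T k μ * fromℕ (p ℕ.^ (r ℕ.* μ)))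
      each μ μ≤K = begin
        4ℚ ^ K * summand μ
          ≡⟨ cong₂ (λ x j → x * (½ ^ (2 ℕ.* μ) * T k μ * (α j m 2 1 (p ℕ.^ r) - fromℕ (p ℕ.^ (j ℕ.+ 1)) * α[ p ^ r -2] j m 2 1) * fromℕ (p ℕ.^ (r ℕ.* μ)))) split level ⟩
        4ℚ ^ μ * 4ℚ ^ ν * (½ ^ (2 ℕ.* μ) * T k μ * (a - fromℕ (p ℕ.^ (ν ℕ.* 2 ℕ.+ 1)) * a′) * fromℕ (p ℕ.^ (r ℕ.* μ)))
          ≡⟨ cong (λ x → 4ℚ ^ μ * 4ℚ ^ ν * (½ ^ (2 ℕ.* μ) * T k μ * (a - x * a′) * fromℕ (p ℕ.^ (r ℕ.* μ)))) (trans (cong (λ e → fromℕ (p ℕ.^ e)) (ℕ.+-comm (ν ℕ.* 2) 1)) (fromℕ-^ p (suc (ν ℕ.* 2)))) ⟩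
        4ℚ ^ μ * 4ℚ ^ ν * (½ ^ (2 ℕ.* μ) * T k μ * (a - Q ν * a′) * fromℕ (p ℕ.^ (r ℕ.* μ)))
          ≡⟨ e₁ (4ℚ ^ μ) (4ℚ ^ ν) (½ ^ (2 ℕ.* μ)) (T k μ) (a - Q ν * a′) (fromℕ (p ℕ.^ (r ℕ.* μ))) ⟩
        4ℚ ^ μ * ½ ^ (2 ℕ.* μ) * (T k μ * fromℕ (p ℕ.^ (r ℕ.* μ))) * (4ℚ ^ ν * (a - Q ν * a′))
          ≡⟨ cong₂ (λ x y → x * (T k μ * fromℕ (p ℕ.^ (r ℕ.* μ))) * y) (unit μ) (differences ν) ⟩
        1ℚ * (T k μ * fromℕ (p ℕ.^ (r ℕ.* μ))) * (M - Q ν * M′ ν + 1ℚ)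
          ≡⟨ e₂ (T k μ * fromℕ (p ℕ.^ (r ℕ.* μ))) M (Q ν * M′ ν) ⟩
        T k μ * fromℕ (p ℕ.^ (r ℕ.* μ)) * M + (- 1ℚ * (T k μ * fromℕ (p ℕ.^ (r ℕ.* μ)) * (Q ν * M′ ν)) + T k μ * fromℕ (p ℕ.^ (r ℕ.* μ)))
          ≡⟨ cong (λ x → x * M + (- 1ℚ * (x * (Q ν * M′ ν)) + T k μ * fromℕ (p ℕ.^ (r ℕ.* μ)))) (cong₂ _*_ (T-ballot K μ μ≤K) (fromℕ-power μ)) ⟩
        ballot K μ * n r ^ μ * M + (- 1ℚ * (ballot K μ * n r ^ μ * (Q ν * M′ ν)) + T k μ * fromℕ (p ℕ.^ (r ℕ.* μ))) ∎
        where
        open ≡-Reasoning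
        ν = K ∸ μ
        a = α (ν ℕ.* 2) m 2 1 (p ℕ.^ r)
        a′ = α[ p ^ r -2] (ν ℕ.* 2) m 2 1
        M = moment (p ℕ.^ r) (chebyshev (p ℕ.^ r) ν)
        split : 4ℚ ^ K ≡ 4ℚ ^ μ * 4ℚ ^ ν
        split = trans (cong (4ℚ ^_) (sym (ℕ.m+[n∸m]≡n μ≤K))) (^-+ 4ℚ μ ν)
        level : k ∸ 2 ℕ.* μ ≡ ν ℕ.* 2
        level = trans (cong (k ∸_) (ℕ.*-comm 2 μ)) (sym (ℕ.*-distribʳ-∸ 2 K μ))
        e₁ : ∀ x y z t d u → x * y * (z * t * d * u) ≡ x * z * (t * u) * (y * d)
        e₁ = solve-∀ ℚ-ring
        e₂ : ∀ t M w → 1ℚ * t * (M - w + 1ℚ) ≡ t * M + (- 1ℚ * (t * w) + t)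
        e₂ = solve-∀ ℚ-ring

      ballots main : ℚ
      ballots = ∑ (upTo K) (λ μ → T k μ * fromℕ (p ℕ.^ (r ℕ.* μ)))
      main = ∑ (upTo K) summand

      main-value : 4ℚ ^ K * main ≡ E r + (- 1ℚ * (Q K * (4ℚ ^ K * X′) - ballot K K * n r ^ K * (q * τ′)) + ballots)
      main-value = trans (sym (∑-* (4ℚ ^ K) (upTo K) summand)) (trans (sum-cong-∈ (upTo K) (λ {μ} μ∈ → each μ (ℕ.<⇒≤ (∈-upTo⁻ μ∈))))
        (trans (sum-⊕ (upTo K) E′ (λ μ → - 1ℚ * Y μ + B μ)) (cong (λ u → E r + u) (trans (sum-⊕ (upTo K) (λ μ → - 1ℚ * Y μ) B)
          (cong (_+ ballots) (trans (∑-* (- 1ℚ) (upTo K) Y) (cong (- 1ℚ *_) previous)))))))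
        where
        E′ Y B : ℕ → ℚ
        E′ μ = ballot K μ * n r ^ μ * moment (p ℕ.^ r) (chebyshev (p ℕ.^ r) (K ∸ μ))
        Y μ = ballot K μ * n r ^ μ * (Q (K ∸ μ) * M′ (K ∸ μ))
        B μ = T k μ * fromℕ (p ℕ.^ (r ℕ.* μ))

      half-unit : 4ℚ ^ K * ½ ^ k ≡ 1ℚ
      half-unit = trans (cong (λ e → 4ℚ ^ K * ½ ^ e) (ℕ.*-comm K 2)) (unit K)

      formula : 𝓗 k m 2 1 p r ≡
        Catalan K * (+ 1 / 3) * ½ ^ k * (fromℕ (p ℕ.^ (r ℕ.* (K ℕ.+ 1))) - fromℕ (2 ℕ.* p ℕ.^ (r ℕ.* K)))
          - δ (2 ℕ.∣? r) * (+ 1 / 6) * fromℕ (p ℕ.^ (r ℕ.* K)) * fromℕ (p ∸ 1) - ½ ^ k * ballots + main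
      -- Multiplication by 4^K clears the powers of ½. In the last identity the quantities of level
      -- p^(r - 2) and the sum of ballot terms cancel, and the plain class number sum leaves the
      -- Catalan term.
      formula = *-cancel (4ℚ ^ K) (½ ^ k) (trans (ℚ.*-comm (½ ^ k) (4ℚ ^ K)) half-unit) (sym (begin
        4ℚ ^ K * (Catalan K * (+ 1 / 3) * ½ ^ k * (fromℕ (p ℕ.^ (r ℕ.* (K ℕ.+ 1))) - fromℕ (2 ℕ.* p ℕ.^ (r ℕ.* K)))
          - d * (+ 1 / 6) * fromℕ (p ℕ.^ (r ℕ.* K)) * fromℕ (p ∸ 1) - ½ ^ k * ballots + main)
          ≡⟨ cong₂ (λ c u → F c u (½ ^ k) (fromℕ (p ℕ.^ (r ℕ.* K))) (fromℕ (2 ℕ.* p ℕ.^ (r ℕ.* K))) (fromℕ (p ∸ 1)) main) (Catalan-ballot K) power-suc ⟩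
        F c (n r * n r ^ K) (½ ^ k) (fromℕ (p ℕ.^ (r ℕ.* K))) (fromℕ (2 ℕ.* p ℕ.^ (r ℕ.* K))) (fromℕ (p ∸ 1)) main
          ≡⟨ cong₂ (λ u v → F c (n r * n r ^ K) (½ ^ k) u v (fromℕ (p ∸ 1)) main) (fromℕ-power K) (trans (fromℕ-* 2 (p ℕ.^ (r ℕ.* K))) (cong ((1ℚ + 1ℚ) *_) (fromℕ-power K))) ⟩
        F c (n r * n r ^ K) (½ ^ k) (n r ^ K) ((1ℚ + 1ℚ) * n r ^ K) (fromℕ (p ∸ 1)) main
          ≡⟨ cong (λ u → F c (n r * n r ^ K) (½ ^ k) (n r ^ K) ((1ℚ + 1ℚ) * n r ^ K) u main) predecessor ⟩
        F c (n r * n r ^ K) (½ ^ k) (n r ^ K) ((1ℚ + 1ℚ) * n r ^ K) (q - 1ℚ) main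
          ≡⟨ e₁ (4ℚ ^ K) c (n r) (n r ^ K) (½ ^ k) d (q - 1ℚ) ballots main ⟩
        (4ℚ ^ K * ½ ^ k) * (c * (+ 1 / 3) * (n r - (1ℚ + 1ℚ)) * n r ^ K - ballots) - 4ℚ ^ K * ((+ 1 / 6) * (q - 1ℚ) * n r ^ K * d) + 4ℚ ^ K * main
          ≡⟨ cong₂ (λ x y → x * (c * (+ 1 / 3) * (n r - (1ℚ + 1ℚ)) * n r ^ K - ballots) - 4ℚ ^ K * ((+ 1 / 6) * (q - 1ℚ) * n r ^ K * d) + y) half-unit
               (trans main-value (cong (λ x → x + (- 1ℚ * (Q K * (4ℚ ^ K * X′) - c * n r ^ K * (q * τ′)) + ballots)) (trans (E-moments r)
                 (cong₂ (λ x y → 4ℚ ^ K * x - c * n r ^ K * y) sieved (trans (moment-1 r n≡) total≡))))) ⟩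
        1ℚ * (c * (+ 1 / 3) * (n r - (1ℚ + 1ℚ)) * n r ^ K - ballots) - 4ℚ ^ K * ((+ 1 / 6) * (q - 1ℚ) * n r ^ K * d)
          + (4ℚ ^ K * (𝓗 k m 2 1 p r + (Q K * X′ + (+ 1 / 6) * (q - 1ℚ) * n r ^ K * d)) - c * n r ^ K * (q * τ′ + (+ 1 / 3) * (n r - (1ℚ + 1ℚ)))
             + (- 1ℚ * (Q K * (4ℚ ^ K * X′) - c * n r ^ K * (q * τ′)) + ballots))
          ≡⟨ e₂ (4ℚ ^ K) c (n r) (n r ^ K) d q ballots (Q K) X′ τ′ (𝓗 k m 2 1 p r) ⟩
        4ℚ ^ K * 𝓗 k m 2 1 p r ∎))
        where
        open ≡-Reasoning
        c = ballot K K
        d = δ (2 ℕ.∣? r)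
        F : (c u z x v w main : ℚ) → ℚ
        F c u z x v w main = 4ℚ ^ K * (c * (+ 1 / 3) * z * (u - v) - d * (+ 1 / 6) * x * w - z * ballots + main)
        power-suc : fromℕ (p ℕ.^ (r ℕ.* (K ℕ.+ 1))) ≡ n r * n r ^ K
        power-suc = trans (fromℕ-power (K ℕ.+ 1)) (cong (n r ^_) (ℕ.+-comm K 1))
        predecessor : fromℕ (p ∸ 1) ≡ q - 1ℚ
        predecessor = trans (e (fromℕ (p ∸ 1))) (cong (_- 1ℚ) (trans (sym (fromℕ-+ (p ∸ 1) 1)) (cong fromℕ (ℕ.m∸n+n≡m (ℕ.<⇒≤ 1<p)))))
          where
          e : ∀ x → x ≡ x + 1ℚ - 1ℚ
          e = solve-∀ ℚ-ring
        e₁ : ∀ f c n x z d w b main → f * (c * (+ 1 / 3) * z * (n * x - (1ℚ + 1ℚ) * x) - d * (+ 1 / 6) * x * w - z * b + main)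
          ≡ (f * z) * (c * (+ 1 / 3) * (n - (1ℚ + 1ℚ)) * x - b) - f * ((+ 1 / 6) * w * x * d) + f * main
        e₁ = solve-∀ ℚ-ring
        e₂ : ∀ f c n x d q b Q X τ h → 1ℚ * (c * (+ 1 / 3) * (n - (1ℚ + 1ℚ)) * x - b) - f * ((+ 1 / 6) * (q - 1ℚ) * x * d)
          + (f * (h + (Q * X + (+ 1 / 6) * (q - 1ℚ) * x * d)) - c * x * (q * τ + (+ 1 / 3) * (n - (1ℚ + 1ℚ))) + (- 1ℚ * (Q * (f * X) - c * x * (q * τ)) + b))
          ≡ f * h
        e₂ = solve-∀ ℚ-ring

    -- The second argument stands for `⌊ k /2⌋`; kept apart from `K`, it can be rewritten by `half`.
    Formula : ℕ → ℕ → Set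
    Formula r κ = 𝓗 k m 2 1 p r ≡
      Catalan κ * (+ 1 / 3) * ½ ^ k * (fromℕ (p ℕ.^ (r ℕ.* (κ ℕ.+ 1))) - fromℕ (2 ℕ.* p ℕ.^ (r ℕ.* κ)))
        - δ (2 ℕ.∣? r) * (+ 1 / 6) * fromℕ (p ℕ.^ (r ℕ.* κ)) * fromℕ (p ∸ 1)
        - ½ ^ k * ∑ (upTo κ) (λ μ → T k μ * fromℕ (p ℕ.^ (r ℕ.* μ)))
        + ∑ (upTo κ) (λ μ → ½ ^ (2 ℕ.* μ) * T k μ
            * (α (k ∸ 2 ℕ.* μ) m 2 1 (p ℕ.^ r) - fromℕ (p ℕ.^ (k ∸ 2 ℕ.* μ ℕ.+ 1)) * α[ p ^ r -2] (k ∸ 2 ℕ.* μ) m 2 1)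
            * fromℕ (p ℕ.^ (r ℕ.* μ)))

    moment-formula : 1 ℕ.≤ K → ∀ r → 1 ℕ.≤ r → Admissible r → Formula r K
    moment-formula 1≤K (suc zero) _ n≡ = Assembly.formula 1 n≡ (λ _ → 0ℚ) 0ℚ 0ℚ (λ ν → α-difference-1 ν n≡)
      (trans (sum-ε (upTo K) (λ {μ} _ → e₁ (ballot K μ * n 1 ^ μ) (Q (K ∸ μ)))) (e₂ (Q K) (4ℚ ^ K) (ballot K K * n 1 ^ K) q))
      (trans total-1 (trans (cong (λ u → (+ 1 / 3) * (fromℕ u - (1ℚ + 1ℚ))) (sym (ℕ.*-identityʳ p))) (e₃ q ((+ 1 / 3) * (n 1 - (1ℚ + 1ℚ))))))
      (trans (𝓗-moment 1) (cong (λ u → 𝓗 k m 2 1 p 1 + u) (trans (multiples-1 1≤K) (e₄ (Q K) ((+ 1 / 6) * (q - 1ℚ) * n 1 ^ K)))))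
      where
      e₁ : ∀ x y → x * (y * 0ℚ) ≡ 0ℚ
      e₁ = solve-∀ ℚ-ring
      e₂ : ∀ Q f c q → 0ℚ ≡ Q * (f * 0ℚ) - c * (q * 0ℚ)
      e₂ = solve-∀ ℚ-ring
      e₃ : ∀ q x → x ≡ q * 0ℚ + x
      e₃ = solve-∀ ℚ-ring
      e₄ : ∀ Q x → 0ℚ ≡ Q * 0ℚ + x * 0ℚ
      e₄ = solve-∀ ℚ-ring
    moment-formula 1≤K (suc (suc s)) _ n≡ = Assembly.formula (2 ℕ.+ s) n≡ (λ ν → moment (p ℕ.^ s) (chebyshev (p ℕ.^ s) ν)) (moment (p ℕ.^ s) power) (total-h s)
      (λ ν → α-difference ν s n≡)
      (trans (previous-moments s) (trans (cong (Q K *_) (trans (E-moments s) (cong (λ u → 4ℚ ^ K * moment (p ℕ.^ s) power - ballot K K * n s ^ K * u) (moment-1 s (admissible-2 {s} n≡)))))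
        (trans (e₁ q (q ^ k) (4ℚ ^ K * moment (p ℕ.^ s) power) (ballot K K) (n s ^ K) (total-h s))
          (cong (λ u → Q K * (4ℚ ^ K * moment (p ℕ.^ s) power) - ballot K K * u * (q * total-h s)) (sym (n-2^ s K))))))
      (total-step s)
      (trans (𝓗-moment (2 ℕ.+ s)) (cong (λ u → 𝓗 k m 2 1 p (2 ℕ.+ s) + u) (multiples-2 1≤K s n≡)))
      where
      e₁ : ∀ q x X b y τ → q * x * (X - b * y * τ) ≡ q * x * X - b * (x * y) * (q * τ)
      e₁ = solve-∀ ℚ-ring

    -- Since 2m + 1 = 2 (m + 1) - 1, a non-zero class number forces t to have the parity of m + 1.
    vanishing : ∀ r → + 4 ∥ + (p ℕ.^ r) ℤ.- (+ 2 ℤ.* m ℤ.+ 1ℤ) → 𝓗 k m 2 1 p r ≡ 0ℚ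
    vanishing r n≡ = trans (∑-filter (λ t → ¬? (P ∥? t) ×-dec (t ≋? m [mod 2 ])) (interval a) (λ t → H (fromℤ (+ a ℤ.- t ℤ.* t)) * power t))
      (sum-ε (interval a) (λ {t} _ → at t (¬? (P ∥? t) ×-dec (t ≋? m [mod 2 ]))))
      where
      a = p ℕ.^ r
      e₁ : ∀ a m → a ℤ.- (+ 2 ℤ.* m ℤ.+ 1ℤ) ≡ a ℤ.- (+ 2 ℤ.* (m ℤ.+ 1ℤ) ℤ.- 1ℤ)
      e₁ = ℤ.solve-∀
      e₂ : ∀ t m → t ℤ.- m ℤ.- (t ℤ.- (m ℤ.+ 1ℤ)) ≡ 1ℤ
      e₂ = ℤ.solve-∀
      at : ∀ t {A : Set} (c? : Dec (A × t ≋ m [mod 2 ])) → only c? (H (fromℤ (+ a ℤ.- t ℤ.* t)) * power t) ≡ 0ℚ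
      at t (no _) = refl
      at t (yes (_ , t≡m)) = trans (cong (_* power t) (trans (sym (h-def (+ a ℤ.- t ℤ.* t))) (h-vanish (+ a ℤ.- t ℤ.* t) (λ b d →
          2∤1+2e 0ℤ (subst (+ 2 ∥_) (e₂ t m) (∣m∣n⇒∣m-n t≡m (trace-parity (m ℤ.+ 1ℤ) (+ a) t b (subst (+ 4 ∥_) (e₁ (+ a) m) n≡) d))))))) (ℚ.*-zeroˡ (power t))

open import Defs
open import Data.Integer.Base using (ℤ; +_; 0ℤ; 1ℤ) renaming (_+_ to _+ℤ_; _-_ to _-ℤ_; _*_ to _*ℤ_)
open import Data.List.Base using (upTo)
open import Data.Nat.Base using (ℕ; suc; _≤_; _∸_; ⌊_/2⌋) renaming (_+_ to _+ℕ_; _*_ to _*ℕ_; _^_ to _^ℕ_)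
open import Data.Nat.Divisibility using (_∣_; _∣?_)
open import Data.Nat.Primality using (Prime)
open import Data.Product.Base using (_×_)
open import Data.Rational.Base using (ℚ; 0ℚ; ½; _+_; _*_; _-_; _/_)
open import Data.Sum.Base using (_⊎_)
open import Relation.Binary.PropositionalEquality using (_≡_)
open import Data.Nat.Divisibility using (divides)

theorem5p7 : ∀ (k : ℕ) (m : ℤ) (p r : ℕ) → 1 ≤ k → 2 ∣ k → m ≡ 0ℤ ⊎ m ≡ 1ℤ → Prime p → 3 ≤ p → 1 ≤ r →
    (+ (p ^ℕ r) ≋ + 2 *ℤ m -ℤ 1ℤ [mod 4 ] →
    𝓗 k m 2 1 p r ≡
    Catalan ⌊ k /2⌋ * (+ 1 / 3) * ½ ^ k
    * (fromℕ (p ^ℕ (r *ℕ (⌊ k /2⌋ +ℕ 1))) - fromℕ (2 *ℕ p ^ℕ (r *ℕ ⌊ k /2⌋)))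
    - δ (2 ∣? r) * (+ 1 / 6) * fromℕ (p ^ℕ (r *ℕ ⌊ k /2⌋)) * fromℕ (p ∸ 1)
    - ½ ^ k * (∑[ μ ← upTo ⌊ k /2⌋ ] T k μ * fromℕ (p ^ℕ (r *ℕ μ)))
    + (∑[ μ ← upTo ⌊ k /2⌋ ]
    ½ ^ (2 *ℕ μ) * T k μ
    * (α (k ∸ 2 *ℕ μ) m 2 1 (p ^ℕ r)
    - fromℕ (p ^ℕ (k ∸ 2 *ℕ μ +ℕ 1)) * α[ p ^ r -2] (k ∸ 2 *ℕ μ) m 2 1)
    * fromℕ (p ^ℕ (r *ℕ μ))))
    × (+ (p ^ℕ r) ≋ + 2 *ℤ m +ℤ 1ℤ [mod 4 ] → 𝓗 k m 2 1 p r ≡ 0ℚ)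
theorem5p7 k m p r 1≤k (divides K refl) _ p-prime 3≤p 1≤r =
  (λ n≡ → subst (Formula r) (sym (half K)) (moment-formula (positive K 1≤k) r 1≤r n≡)) , vanishing r
  where
  open Final.AtPrime K m p p-prime 3≤p
  open Series.Coefficients m using (half)
  positive : ∀ K → 1 ≤ K *ℕ 2 → 1 ≤ K
  positive (suc K) _ = s≤s z≤n
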